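{- There is a deterministic algorithm that, given a dataset $X\subseteq\ell_\infty^d$ of size $|X|=n$, a diameter bound $\Delta>0$ and a parameter $0<\rho<1$, runs in time $O(n^{1+\rho}\cdot\rho^{ -1}d^2\log n)$ and outputs a collection $\mathcal{R}$ of axis-aligned rectangles in $\mathbb{R}^d$, with associated cluster collection $\mathcal{C}(\mathcal{R})=\{C(R):=X\cap R\}_{R\in\mathcal{R}}$, such that the following hold for $s=O(n^\rho\cdot\rho^{ -1}\log n)$ and $\beta=O(\rho^{ -1}\log\log d)$: - (Diameter) Each rectangle $R\in\mathcal{R}$ has width at most $\Delta$. - (Covering) For each $x\in X$ there is a rectangle $R\in\mathcal{R}$ such that $B_\infty(x,\frac{\Delta}{\beta})\subseteq R$. - (Sparsity) Each $x\in X$ is contained in at most $s$ rectangles from $\mathcal{R}$. In particular, the cluster collection $\mathcal{C}(\mathcal{R})$ forms a $(\beta,s,\Delta)$-neighborhood cover of $X$ (with the $\ell_\infty$ metric).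
   Context: $\ell_\infty^d$ is $\mathbb{R}^d$ with the norm $\|x\|_\infty=\max_i|x_i|$, and $B_\infty(x,r)=\{y\in\mathbb{R}^d:\|x-y\|_\infty\le r\}$ is the closed ball in the whole space $\mathbb{R}^d$. For a finite $X\subseteq\ell_\infty^d$, $B_X(x,r)=\{y\in X:\|x-y\|_\infty\le r\}$. An axis-aligned rectangle in $\mathbb{R}^d$ is a set $R=I_1\times\cdots\times I_d$ where each $I_i$ is an interval in $\mathbb{R}$ (of any of the forms $[a,b],(a,b],[a,b),(a,b)$). The width of $R$ is the length of the longest interval among $I_1,\dots,I_d$. A collection $\mathcal{C}$ of subsets of $X$ (called clusters) is a $(\beta,s,\Delta)$-neighborhood cover of $X$ if: (i) each $C\in\mathcal{C}$ has diameter at most $\Delta$; (ii) for each $x\in X$ there is $C\in\mathcal{C}$ with $B_X(x,\frac{\Delta}{\beta})\subseteq C$; (iii) each $x\in X$ is contained in at most $s$ clusters of $\mathcal{C}$. Constants in $O(\cdot)$ are universal. Running time counts unit-cost operations on real numbers. Logarithmic factors inside $O(\cdot)$ are read as at least $1$ (i.e. $n,d$ larger than a constant). -}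

module Defs where

open import Level using (0ℓ)
open import Algebra.Bundles using (CommutativeRing; Semiring)
open import Algebra.Core using (Op₁; Op₂)
open import Algebra.Structures using (IsCommutativeRing)
import Algebra.Definitions.RawSemiring as RawSemiringDefinitions
open import Data.Bool.Base using (Bool; true; false; if_then_else_)
open import Data.Fin.Base using (Fin; toℕ)
open import Data.Fin.Subset using (Subset; _∈_; _⊆_)
open import Data.Fin.Subset.Properties using (_∈?_)
import Data.Fin.Properties as Fin
open import Data.List.Base as List using (List; []; _∷_; length; filter; cartesianProductWith)
import Data.List.Extrema as Extrema
open import Data.List.Relation.Unary.All using (All)
open import Data.List.Relation.Unary.Any using (Any)
open import Data.Maybe.Base using (fromMaybe)
open import Data.Nat.Base as ℕ using (ℕ; suc; NonZero)
import Data.Nat.Properties as ℕ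
open import Data.Product.Base using (_×_; _,_; ∃-syntax)
import Data.Vec.Base as Vec
open import Data.Vec.Functional using (Vector; toList)
open import Function.Definitions using (Injective)
open import Relation.Binary.Bundles using (DecTotalOrder)
open import Relation.Binary.Core using (Rel)
open import Relation.Binary.PropositionalEquality
  using (_≡_; _≢_; _≗_; refl; cong₂)
open import Relation.Binary.Structures using (IsDecTotalOrder)
import Relation.Binary.Construct.NonStrictToStrict as ToStrict
open import Relation.Nullary using (¬_; Dec; does; contradiction; _×-dec_)
open import Relation.Unary using (Pred; Decidable)

------------------------------------------------------------------------
-- The real numbers, axiomatised as a Dedekind-complete ordered field.
-- Up to isomorphism ℝ is the only classical model.  The order is
-- decidable, as comparisons are primitive in the real RAM.  _⁻¹ and sup
-- are total functions, unspecified outside their usual domains.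

record RealNumbers : Set₁ where
  infix  8 -_ _⁻¹
  infixl 7 _*_
  infixl 6 _+_
  infix  4 _≤_
  field
    ℝ   : Set
    _+_ : Op₂ ℝ
    _*_ : Op₂ ℝ
    -_  : Op₁ ℝ
    _⁻¹ : Op₁ ℝ
    0ℝ  : ℝ
    1ℝ  : ℝ
    _≤_ : Rel ℝ 0ℓ

    isCommutativeRing : IsCommutativeRing _≡_ _+_ _*_ -_ 0ℝ 1ℝ
    0≢1               : 0ℝ ≢ 1ℝ
    ⁻¹-inverse        : ∀ x → x ≢ 0ℝ → x * x ⁻¹ ≡ 1ℝ

    isDecTotalOrder   : IsDecTotalOrder _≡_ _≤_
    +-monoˡ-≤         : ∀ z {x y} → x ≤ y → (x + z) ≤ (y + z)
    *-nonNegative     : ∀ {x y} → 0ℝ ≤ x → 0ℝ ≤ y → 0ℝ ≤ (x * y)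

  UpperBound : Pred ℝ 0ℓ → Pred ℝ 0ℓ
  UpperBound P u = ∀ x → P x → x ≤ u

  field
    sup       : Pred ℝ 0ℓ → ℝ
    sup-upper : ∀ P → ∃[ x ] P x → ∃[ u ] UpperBound P u → UpperBound P (sup P)
    sup-least : ∀ P → ∃[ x ] P x → ∀ u → UpperBound P u → sup P ≤ u

  commutativeRing : CommutativeRing 0ℓ 0ℓ
  commutativeRing = record { isCommutativeRing = isCommutativeRing }

  decTotalOrder : DecTotalOrder 0ℓ 0ℓ 0ℓ
  decTotalOrder = record { isDecTotalOrder = isDecTotalOrder }

  open DecTotalOrder decTotalOrder public using (_≤?_; _≟_; totalOrder)
  open ToStrict _≡_ _≤_ public using (_<_; <-decidable)
  open Extrema totalOrder public using (max)
  open RawSemiringDefinitions (Semiring.rawSemiring (CommutativeRing.semiring commutativeRing)) public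
    using (_^_) renaming (_×_ to _·_)

  infix 4 _<?_
  _<?_ : ∀ x y → Dec (x < y)
  _<?_ = <-decidable _≟_ _≤?_

  infixl 6 _-_
  _-_ : Op₂ ℝ
  x - y = x + - y

  infixl 7 _/_
  _/_ : Op₂ ℝ
  x / y = x * y ⁻¹

  fromℕ : ℕ → ℝ
  fromℕ n = n · 1ℝ

  ∣_∣ : ℝ → ℝ
  ∣ x ∣ = max x (- x ∷ [])

  -- For x ≥ 1 and ρ ≥ 0: x ^ ρ is the supremum of the x ^ (p / q) over the
  -- rationals 0 ≤ p / q ≤ ρ, where y ≤ x ^ (p / q) is written y ^ q ≤ x ^ p.
  pow : ℝ → ℝ → ℝ
  pow x ρ = sup λ y → (0ℝ ≤ y) ×
    (∃[ p ] ∃[ q ] NonZero q × (fromℕ p / fromℕ q ≤ ρ) × (y ^ q ≤ x ^ p))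

  -- For x ≥ 1: the supremum of the rationals p / q ≥ 0 with 2 ^ (p / q) ≤ x.
  log₂ : ℝ → ℝ
  log₂ x = sup λ y →
    ∃[ p ] ∃[ q ] NonZero q × (y ≡ fromℕ p / fromℕ q) × (fromℕ 2 ^ p ≤ x ^ q)

  -- A logarithmic factor, read as at least 1.
  lg : ℝ → ℝ
  lg x = max 1ℝ (log₂ x ∷ [])

------------------------------------------------------------------------
-- Programs of a real RAM.  The memory has a bank of natural numbers, also
-- used as addresses, and a bank of reals.  `at a` is the cell a, and
-- `ind a` the cell whose address is held in cell a of the natural bank.
-- There is no integer multiplication, no rounding of reals and no root,
-- exponential or logarithm among the instructions.

data Loc : Set where
  at ind : ℕ → Loc

data OpN : Set where
  add monus : OpN

data OpR : Set where
  add sub mul div : OpR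

data Instr : Set where
  setN setR : Loc → ℕ → Instr
  opN       : OpN → Loc → Loc → Loc → Instr
  opR       : OpR → Loc → Loc → Loc → Instr

data Test : Set where
  leN leR : Loc → Loc → Test

infixr 5 _⨾_
data Program : Set where
  ⟪_⟫   : Instr → Program
  _⨾_   : Program → Program → Program
  cond  : Test → Program → Program → Program
  while : Test → Program → Program

_[_≔_] : {A : Set} → (ℕ → A) → ℕ → A → (ℕ → A)
(f [ a ≔ v ]) b = if does (a ℕ.≟ b) then v else f b

module RealRAM (𝓡 : RealNumbers) where
  open RealNumbers 𝓡

  record Store : Set where
    field
      nat  : ℕ → ℕ
      real : ℕ → ℝ
  open Store public

  address : Store → Loc → ℕ
  address σ (at a)  = a
  address σ (ind a) = nat σ a

  getN : Store → Loc → ℕ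
  getN σ l = nat σ (address σ l)

  getR : Store → Loc → ℝ
  getR σ l = real σ (address σ l)

  putN : Store → Loc → ℕ → Store
  putN σ l k = record σ { nat = nat σ [ address σ l ≔ k ] }

  putR : Store → Loc → ℝ → Store
  putR σ l x = record σ { real = real σ [ address σ l ≔ x ] }

  evalN : OpN → Op₂ ℕ
  evalN add   = ℕ._+_
  evalN monus = ℕ._∸_

  evalR : OpR → Op₂ ℝ
  evalR add = _+_
  evalR sub = _-_
  evalR mul = _*_
  evalR div = _/_

  exec : Instr → Store → Store
  exec (setN l k)     σ = putN σ l k
  exec (setR l k)     σ = putR σ l (fromℕ k)
  exec (opN ∙ l a b)  σ = putN σ l (evalN ∙ (getN σ a) (getN σ b))
  exec (opR ∙ l a b)  σ = putR σ l (evalR ∙ (getR σ a) (getR σ b))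

  Holds : Test → Store → Set
  Holds (leN a b) σ = getN σ a ℕ.≤ getN σ b
  Holds (leR a b) σ = getR σ a ≤ getR σ b

  -- ⟨ P , σ ⟩⇓⟨ τ , t ⟩ : started in σ, P halts in τ after t unit-cost steps.
  -- Each execution of an instruction or of a test is one step.
  data ⟨_,_⟩⇓⟨_,_⟩ : Program → Store → Store → ℕ → Set where
    instr       : ∀ {i σ} → ⟨ ⟪ i ⟫ , σ ⟩⇓⟨ exec i σ , 1 ⟩
    seq         : ∀ {P Q σ τ υ t u} →
                  ⟨ P , σ ⟩⇓⟨ τ , t ⟩ → ⟨ Q , τ ⟩⇓⟨ υ , u ⟩ →
                  ⟨ P ⨾ Q , σ ⟩⇓⟨ υ , t ℕ.+ u ⟩
    cond-true   : ∀ {b P Q σ τ t} → Holds b σ → ⟨ P , σ ⟩⇓⟨ τ , t ⟩ →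
                  ⟨ cond b P Q , σ ⟩⇓⟨ τ , suc t ⟩
    cond-false  : ∀ {b P Q σ τ t} → ¬ Holds b σ → ⟨ Q , σ ⟩⇓⟨ τ , t ⟩ →
                  ⟨ cond b P Q , σ ⟩⇓⟨ τ , suc t ⟩
    while-true  : ∀ {b P σ τ υ t u} → Holds b σ →
                  ⟨ P , σ ⟩⇓⟨ τ , t ⟩ → ⟨ while b P , τ ⟩⇓⟨ υ , u ⟩ →
                  ⟨ while b P , σ ⟩⇓⟨ υ , suc (t ℕ.+ u) ⟩
    while-false : ∀ {b P σ} → ¬ Holds b σ → ⟨ while b P , σ ⟩⇓⟨ σ , 1 ⟩

  deterministic : ∀ {P σ τ τ′ t t′} →
    ⟨ P , σ ⟩⇓⟨ τ , t ⟩ → ⟨ P , σ ⟩⇓⟨ τ′ , t′ ⟩ → (τ ≡ τ′) × (t ≡ t′)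
  deterministic instr instr = refl , refl
  deterministic (seq p q) (seq p′ q′) with deterministic p p′
  ... | refl , refl with deterministic q q′
  ... | refl , refl = refl , refl
  deterministic (cond-true _ p) (cond-true _ p′) with deterministic p p′
  ... | refl , refl = refl , refl
  deterministic (cond-true h _) (cond-false ¬h _) = contradiction h ¬h
  deterministic (cond-false ¬h _) (cond-true h _) = contradiction h ¬h
  deterministic (cond-false _ p) (cond-false _ p′) with deterministic p p′
  ... | refl , refl = refl , refl
  deterministic (while-true _ p q) (while-true _ p′ q′) with deterministic p p′
  ... | refl , refl with deterministic q q′
  ... | refl , refl = refl , refl
  deterministic (while-true h _ _) (while-false ¬h) = contradiction h ¬h
  deterministic (while-false ¬h) (while-true h _ _) = contradiction h ¬h
  deterministic (while-false _) (while-false _) = refl , refl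

  -- The memory holding the lists ks and xs from address 0 on, and 0 elsewhere.
  load : List ℕ → List ℝ → Store
  load ks xs = record
    { nat  = λ a → fromMaybe 0 (List.head (List.drop a ks))
    ; real = λ a → fromMaybe 0ℝ (List.head (List.drop a xs))
    }

module ℓ∞ (𝓡 : RealNumbers) where
  open RealNumbers 𝓡
  open RealRAM 𝓡

  Point : ℕ → Set
  Point d = Vector ℝ d

  ‖_‖∞ : ∀ {d} → Point d → ℝ
  ‖ x ‖∞ = max 0ℝ (toList λ i → ∣ x i ∣)

  dist : ∀ {d} → Point d → Point d → ℝ
  dist x y = ‖ (λ i → x i - y i) ‖∞

  B∞ : ∀ {d} → Point d → ℝ → Pred (Point d) 0ℓ
  B∞ x r y = dist x y ≤ r

  record Interval : Set where
    field
      lower upper             : ℝ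
      lower≤upper             : lower ≤ upper
      lowerClosed upperClosed : Bool

    len : ℝ
    len = upper - lower
  open Interval public

  -- x ≤[ c ] y is x ≤ y if c is true and x < y otherwise.
  _≤[_]_ : ℝ → Bool → ℝ → Set
  x ≤[ true  ] y = x ≤ y
  x ≤[ false ] y = x < y

  _≤[_]?_ : ∀ x c y → Dec (x ≤[ c ] y)
  x ≤[ true  ]? y = x ≤? y
  x ≤[ false ]? y = x <? y

  _∈I_ : ℝ → Interval → Set
  x ∈I I = (lower I ≤[ lowerClosed I ] x) × (x ≤[ upperClosed I ] upper I)

  _∈I?_ : ∀ x I → Dec (x ∈I I)
  x ∈I? I = (lower I ≤[ lowerClosed I ]? x) ×-dec (x ≤[ upperClosed I ]? upper I)

  Rectangle : ℕ → Set
  Rectangle d = Vector Interval d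

  _∈R_ : ∀ {d} → Point d → Rectangle d → Set
  x ∈R R = ∀ i → x i ∈I R i

  _∈R?_ : ∀ {d} (x : Point d) (R : Rectangle d) → Dec (x ∈R R)
  x ∈R? R = Fin.all? λ i → x i ∈I? R i

  width : ∀ {d} → Rectangle d → ℝ
  width R = max 0ℝ (toList λ i → len (R i))

  -- A set of n distinct points, in some enumeration.  Its subsets are given
  -- as sets of indices.
  record Dataset (n d : ℕ) : Set where
    field
      point    : Fin n → Point d
      distinct : Injective _≡_ _≗_ point
  open Dataset public

  ⟦_⟧ : ∀ {n} {P : Pred (Fin n) 0ℓ} → Decidable P → Subset n
  ⟦ P? ⟧ = Vec.tabulate λ j → does (P? j)

  B : ∀ {n d} → Dataset n d → Fin n → ℝ → Subset n
  B X i r = ⟦ (λ j → dist (point X i) (point X j) ≤? r) ⟧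

  _∩_ : ∀ {n d} → Dataset n d → Rectangle d → Subset n
  X ∩ R = ⟦ (λ j → point X j ∈R? R) ⟧

  diameter : ∀ {n d} → Dataset n d → Subset n → ℝ
  diameter {n} X C = max 0ℝ (cartesianProductWith (λ i j → dist (point X i) (point X j)) is is)
    where
    is : List (Fin n)
    is = filter (_∈? C) (List.allFin n)

  record IsNeighborhoodCover {n d} (X : Dataset n d) (β s Δ : ℝ)
                             (𝒞 : List (Subset n)) : Set where
    field
      diameter≤Δ : All (λ C → diameter X C ≤ Δ) 𝒞
      covering   : ∀ i → Any (λ C → B X i (Δ / β) ⊆ C) 𝒞
      sparsity   : ∀ i → fromℕ (length (filter (i ∈?_) 𝒞)) ≤ s

  clusters : ∀ {n d} → Dataset n d → List (Rectangle d) → List (Subset n)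
  clusters X = List.map (X ∩_)

  -- n and d are in the natural bank; Δ, ρ and then the coordinates of the
  -- points, point after point, are in the real bank.
  input : ∀ {n d} → Dataset n d → (Δ ρ : ℝ) → Store
  input {n} {d} X Δ ρ =
    load (n ∷ d ∷ []) (Δ ∷ ρ ∷ List.concat (toList λ i → toList (point X i)))

  bit : Bool → ℕ
  bit c = if c then 1 else 0

  -- Cell 0 of the natural bank holds the number of rectangles, and cells 1
  -- and 2 the start addresses of two arrays: the endpoints (in the real
  -- bank) and their open/closed flags (in the natural bank), with two
  -- entries for each side of each rectangle.
  record Outputs {d} (σ : Store) (ℛ : List (Rectangle d)) : Set where
    offset : Fin (length ℛ) → Fin d → ℕ
    offset t i = 2 ℕ.* (toℕ t ℕ.* d ℕ.+ toℕ i)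

    field
      count   : nat σ 0 ≡ length ℛ
      lowers  : ∀ t i → real σ (nat σ 1 ℕ.+ offset t i) ≡ lower (List.lookup ℛ t i)
      uppers  : ∀ t i → real σ (nat σ 1 ℕ.+ suc (offset t i)) ≡ upper (List.lookup ℛ t i)
      lowerCs : ∀ t i → nat σ (nat σ 2 ℕ.+ offset t i) ≡ bit (lowerClosed (List.lookup ℛ t i))
      upperCs : ∀ t i → nat σ (nat σ 2 ℕ.+ suc (offset t i)) ≡ bit (upperClosed (List.lookup ℛ t i))

{-# OPTIONS --safe #-}

-- The points are separated by axis-parallel cuts. Let p + 1 be the least integer above 2 / ρ, or n + 2
-- if that is smaller. In a set of m points, consider for each coordinate and each sign the levels t, t
-- + w, t + 2 w, … from the median on, and let c₀, c₁, … be the numbers of points above them. The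
-- fractions θ₀ > θ₁ > … satisfy θⱼ ^ (p + 1) ≤ θⱼ₊₁ ^ p. At the first level with cⱼ₊₁ > θⱼ₊₁ m, the
-- set is cut into the points below level j, with which the search goes on, and those above level j +
-- 1, which become a node of their own; the points in between wait for a later round. As cⱼ ^ (p + 1) ≤
-- cⱼ₊₁ ^ p m, the new node pays for all cⱼ points lost, up to a (p + 1)-st root. If there is no such
-- level, the points above the last one are at most a fraction 1 / 6 d of all, and wait as well. What
-- is left after all coordinates is a core. The logarithm of θ doubles every p levels, so that O(p log
-- log d) levels suffice, and a core has diameter at most Δ - w. If m ≤ ℓ ^ (p + 1), a round puts at
-- least m / 2 ℓ of m points into cores, so that O(ℓ log n) rounds exhaust the data. The cores of a
-- round differ by more than w in some coordinate, so that their bounding boxes, enlarged by w / 2, are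
-- disjoint.
--
-- The algorithm is an expression of a total language, in which iteration is folding over lists.  It is
-- compiled to the RAM with a running time linear in the number of fold steps.

module Submission where

open import Defs
open import Data.List.Base using (List; length; filter; concat)
open import Data.List.Relation.Unary.All as All using (All)
open import Data.List.Relation.Unary.Any using (Any)
open import Data.Nat.Base as ℕ using (ℕ; NonZero; >-nonZero⁻¹)
open import Data.Nat.Properties using (+-identityʳ)
open import Data.Product.Base using (_×_; _,_; proj₁; ∃-syntax; Σ-syntax)
open import Relation.Binary.PropositionalEquality using (refl; trans)
open import Relation.Unary using (_⊆_)

-- The payment is shaped by the power x^(p/(p+1)): c^(p+1) ≤ c′^p m says that c / m^(1/(p+1)) ≤
-- c′^(p/(p+1)). Summed over the parts of a node of m points, the powers of the parts are at least
-- m^(p/(p+1)), and the induction yields half that many core points at any depth. Roots are replaced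
-- by fractions `a` / `b` that bound them. The exponent 2 / ρ instead of 1 / ρ pays for logarithms.
-- With q = p + 1, the root n^(1/q) uses up half of the exponent ρ; as log n = O(q n^(1/q)), the
-- other half absorbs a logarithm at the price of 1 / ρ, in the number of rounds and in the work.
-- The medians are those of the whole node, while the current set shrinks. So a pass cuts only while
-- the current set holds 3/4 of the node: half of the node is then at most 2/3 of that set, and the
-- first threshold is at least 2/3. Otherwise the remainder becomes a child itself, small enough to
-- keep the recursion shallow. The medians of a coordinate and of its negative add up to at most 0.
-- Hence k levels of width w on either side leave a core of extent at most 2 k w, and w = Δ / (2 k +
-- 1) leaves room for the enlargement.

module Construction where
  open import Algebra.Bundles using (CommutativeRing)
  import Algebra.Properties.Ring as RingProperties
  import Algebra.Properties.Semiring.Mult as Mult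
  import Algebra.Solver.CommutativeMonoid as MonoidSolver
  import Algebra.Solver.Ring.NaturalCoefficients.Default as Solver
  open import Data.Bool.Base using (Bool; true; false; if_then_else_; not)
  open import Data.Fin.Base as Fin using (Fin; toℕ)
  open import Data.Fin.Properties using (toℕ<n; toℕ-fromℕ<)
  open import Data.Fin.Subset using (Subset)
  import Data.Fin.Subset as Subset
  open import Data.Fin.Subset.Properties using (_∈?_)
  open import Data.List.Base as List using (List; []; _∷_; length; filter; _++_; _ʳ++_; map; concat; drop; take; reverse; merge; head; lookup; tabulate; allFin)
  import Data.List.Extrema as Extrema
  open import Data.List.Membership.Propositional using (_∈_; lose)
  import Data.List.Membership.Propositional.Properties as ∈ₚ
  open import Data.List.Properties using (length-++; length-map; ++-identityʳ; ʳ++-defn; ʳ++-ʳ++; length-ʳ++; length-take; take++drop≡id; drop-drop; map-∘; map-++; ++-assoc; ++-ʳ++; length-tabulate; filter-++; filter-none)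
  open import Data.List.Relation.Binary.Permutation.Propositional using (_↭_; ↭-refl; ↭-sym; ↭-trans; ↭-reflexive; prep; swap)
  import Data.List.Relation.Binary.Permutation.Propositional as Perm
  import Data.List.Relation.Binary.Permutation.Propositional.Properties as Permₚ
  open import Data.List.Relation.Unary.All as All using (All; []; _∷_)
  import Data.List.Relation.Unary.All.Properties as Allₚ
  open import Data.List.Relation.Unary.AllPairs as AllPairs using (AllPairs; []; _∷_)
  import Data.List.Relation.Unary.AllPairs.Properties as AllPairsₚ
  open import Data.List.Relation.Unary.Any as Any using (Any; here; there)
  import Data.List.Relation.Unary.Any.Properties as Anyₚ
  open import Data.List.Relation.Unary.Linked using ([]; [-]; _∷_)
  import Data.List.Relation.Unary.Linked.Properties as Linkedₚ
  open import Data.List.Relation.Unary.Sorted.TotalOrder using (Sorted)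
  import Data.List.Relation.Unary.Sorted.TotalOrder.Properties as Sortedₚ
  open import Data.Maybe.Base using (fromMaybe)
  open import Data.Nat.Base as ℕ using (ℕ; zero; suc; NonZero; _+_; _*_; _∸_; _⊔_; _≤_; _<_; z≤n; s≤s; ⌊_/2⌋)
  import Data.Nat.DivMod as ℕ
  open import Data.Nat.Properties as ℕ using (module ≤-Reasoning; m⊔n≤o⇒n≤o; m⊔n≤o⇒m≤o; m≤m⊔n; _≟_; *-distribʳ-+; *-distribˡ-+; *-monoʳ-≤; *-monoˡ-≤; *-suc; +-assoc; +-comm; +-identityʳ; +-mono-≤; +-monoʳ-≤; +-monoˡ-≤; +-suc; 1+n≢n; 1+n≰n; <-trans; <-≤-trans; <⇒≢; <⇒≤; <⇒≱; m<n⇒m<1+n; m≤m*n; m≤m+n; m≤n+m; m≤n⇒m≤1+n; n<1+n; n≤1+n; ≤-<-trans; ≤-refl; ≤-reflexive; ≤-trans)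
  open import Data.Nat.Tactic.RingSolver using (solve-∀)
  open import Data.Product.Base using (_×_; _,_; proj₁; proj₂; ∃-syntax; Σ-syntax)
  open import Data.Sum.Base using (_⊎_; inj₁; inj₂)
  open import Data.Unit.Base using (⊤; tt)
  open import Data.Vec.Functional using (toList)
  import Data.Vec.Properties as Vecₚ
  open import Level using (0ℓ)
  open import Relation.Binary.Bundles using (DecTotalOrder)
  import Relation.Binary.Construct.Flip.EqAndOrd as Flip
  open import Relation.Binary.PropositionalEquality hiding (J)
  open import Relation.Nullary using (¬_; does; yes; no; contradiction)
  open import Relation.Nullary.Decidable using (dec-true; dec-false)
  open import Relation.Unary using (Decidable; Pred)

  -- A total language of folds and its compilation to the RAM.

  module Language where

    -- A total first-order language of real numbers, pairs and lists, in which
    -- iteration is folding over a list.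

    data Ty : Set where
      num  : Ty
      list : Ty → Ty
      _⊗_  : Ty → Ty → Ty
    infixr 6 _⊗_

    Ctx : Set
    Ctx = List Ty

    private variable
      Γ : Ctx
      A B C : Ty

    data Exp (Γ : Ctx) : Ty → Set where
      var  : A ∈ Γ → Exp Γ A
      lit  : ℕ → Exp Γ num
      op   : OpR → Exp Γ num → Exp Γ num → Exp Γ num
      ifle : Exp Γ num → Exp Γ num → Exp Γ A → Exp Γ A → Exp Γ A
      pair : Exp Γ A → Exp Γ B → Exp Γ (A ⊗ B)
      fst  : Exp Γ (A ⊗ B) → Exp Γ A
      snd  : Exp Γ (A ⊗ B) → Exp Γ B
      nil  : Exp Γ (list A)
      cons : Exp Γ A → Exp Γ (list A) → Exp Γ (list A)
      case : Exp Γ (list A) → Exp Γ B → Exp (A ∷ list A ∷ Γ) B → Exp Γ B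
      -- The body sees the current element, the state and the remaining list.
      fold : Exp Γ (list A) → Exp Γ B → Exp (A ∷ B ∷ list A ∷ Γ) B → Exp Γ B
      -- The body is closed up to its argument, so that a code can be used in every context without
      -- weakening.
      app  : Exp (A ∷ []) B → Exp Γ A → Exp Γ B
      bind : Exp Γ A → Exp (A ∷ Γ) B → Exp Γ B

    -- Cells 2, 3, 4 of the natural bank are the heap pointer, 0 and 1.  A real is
    -- a pointer into the real bank, a pair or nonempty list a pointer to two
    -- cells of the natural bank, and the empty list is 0.

    -- Cell 3 holds 0, and adding it is the way to copy.
    move : ℕ → ℕ → Program
    move k r = ⟪ opN add (at k) (at r) (at 3) ⟫

    -- One pointer serves the heaps of both banks, so a single bound tells the allocated cells of
    -- either bank from the free ones.
    fresh : ℕ → Program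
    fresh k = ⟪ opN add (at k) (at 2) (at 3) ⟫ ⨾ ⟪ opN add (at 2) (at 2) (at 4) ⟫

    -- Register `k` is written after `r` and `s` have been read, since it may be one of them. By
    -- then the heap pointer has moved on by one, hence the `monus`.
    newpair : ℕ → ℕ → ℕ → Program
    newpair k r s = ⟪ opN add (ind 2) (at r) (at 3) ⟫ ⨾ ⟪ opN add (at 2) (at 2) (at 4) ⟫ ⨾
      ⟪ opN add (ind 2) (at s) (at 3) ⟫ ⨾ ⟪ opN monus (at k) (at 2) (at 4) ⟫ ⨾
      ⟪ opN add (at 2) (at 2) (at 4) ⟫

    deref : ℕ → ℕ → Program
    deref j k = ⟪ opN add (at j) (ind k) (at 3) ⟫

    second : ℕ → Program
    second k = ⟪ opN add (at k) (at k) (at 4) ⟫ ⨾ deref k k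

    Regs : Ctx → Set
    Regs = All (λ _ → ℕ)

    -- The value is left in register `k`. The variables lie below `k`, and everything from `k` up to
    -- the heap is scratch. The empty list is recognised by comparing the pointer with the constant
    -- 0 or 1.
    compile : Exp Γ A → Regs Γ → ℕ → Program
    compile (var x) ρ k = move k (All.lookup ρ x)
    compile (lit n) ρ k = ⟪ setR (ind 2) n ⟫ ⨾ fresh k
    compile (op o e f) ρ k = compile e ρ k ⨾ compile f ρ (suc k) ⨾
      ⟪ opR o (ind 2) (ind k) (ind (suc k)) ⟫ ⨾ fresh k
    compile (ifle e f g h) ρ k = compile e ρ k ⨾ compile f ρ (suc k) ⨾
      cond (leR (ind k) (ind (suc k))) (compile g ρ k) (compile h ρ k)
    compile (pair e f) ρ k = compile e ρ k ⨾ compile f ρ (suc k) ⨾ newpair k k (suc k)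
    compile (fst e) ρ k = compile e ρ k ⨾ deref k k
    compile (snd e) ρ k = compile e ρ k ⨾ second k
    compile nil ρ k = ⟪ setN (at k) 0 ⟫
    compile (cons e f) ρ k = compile e ρ k ⨾ compile f ρ (suc k) ⨾ newpair k k (suc k)
    compile (case e f g) ρ k = compile e ρ k ⨾ cond (leN (at k) (at 3)) (compile f ρ k)
      (deref (suc k) k ⨾ second k ⨾ compile g (suc k ∷ k ∷ ρ) (2 + k) ⨾ move k (2 + k))
    compile (fold e f g) ρ k = compile e ρ k ⨾ compile f ρ (suc k) ⨾
      while (leN (at 4) (at k)) (deref (2 + k) k ⨾ second k ⨾
        compile g (2 + k ∷ suc k ∷ k ∷ ρ) (3 + k) ⨾ move (suc k) (3 + k)) ⨾
      move k (suc k)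
    compile (app f e) ρ k = compile e ρ k ⨾ compile f (k ∷ []) (suc k) ⨾ move k (suc k)
    compile (bind e f) ρ k = compile e ρ k ⨾ compile f (k ∷ ρ) (suc k) ⨾ move k (suc k)

    -- One more than the largest register that the compiled code uses; the heap has to start there
    -- or later.
    top : Exp Γ A → ℕ → ℕ
    top (var x) k = suc k
    top (lit n) k = suc k
    top (op o e f) k = top e k ⊔ top f (suc k)
    top (ifle e f g h) k = (top e k ⊔ top f (suc k)) ⊔ (top g k ⊔ top h k)
    top (pair e f) k = top e k ⊔ top f (suc k)
    top (fst e) k = top e k
    top (snd e) k = top e k
    top nil k = suc k
    top (cons e f) k = top e k ⊔ top f (suc k)
    top (case e f g) k = top e k ⊔ top f k ⊔ top g (2 + k)
    top (fold e f g) k = top e k ⊔ top f (suc k) ⊔ top g (3 + k)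
    top (app f e) k = top e k ⊔ top f (suc k)
    top (bind e f) k = top e k ⊔ top f (suc k)

    -- Bounds the cost of one run through the code in which all branches and all loop bodies are
    -- taken once.
    weight : Exp Γ A → ℕ
    weight (var x) = 1
    weight (lit n) = 3
    weight (op o e f) = weight e + (weight f + 3)
    weight (ifle e f g h) = weight e + (weight f + (1 + (weight g + weight h)))
    weight (pair e f) = weight e + (weight f + 5)
    weight (fst e) = weight e + 1
    weight (snd e) = weight e + 2
    weight nil = 1
    weight (cons e f) = weight e + (weight f + 5)
    weight (case e f g) = weight e + (1 + (weight f + (weight g + 4)))
    weight (fold e f g) = weight e + (weight f + (weight g + 7))
    weight (app f e) = weight e + (weight f + 1)
    weight (bind e f) = weight e + (weight f + 1)

    module Semantics (𝓡 : RealNumbers) where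
      open RealNumbers 𝓡 using (ℝ; fromℕ)
      open RealRAM 𝓡

      ⟦_⟧ᵗ : Ty → Set
      ⟦ num ⟧ᵗ = ℝ
      ⟦ list A ⟧ᵗ = List ⟦ A ⟧ᵗ
      ⟦ A ⊗ B ⟧ᵗ = ⟦ A ⟧ᵗ × ⟦ B ⟧ᵗ

      Env : Ctx → Set
      Env = All ⟦_⟧ᵗ

      iter : {X Y : Set} → (X → Y → List X → Y) → List X → Y → Y
      iter f [] s = s
      iter f (x ∷ xs) s = iter f xs (f x s xs)

      iterCost : {X Y : Set} → (X → Y → List X → ℕ) → (X → Y → List X → Y) → List X → Y → ℕ
      iterCost c f [] s = 0
      iterCost c f (x ∷ xs) s = suc (c x s xs) + iterCost c f xs (f x s xs)

      if≤ : {X : Set} → ℝ → ℝ → X → X → X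
      if≤ x y a b = if does (RealNumbers._≤?_ 𝓡 x y) then a else b

      cases : {X Y : Set} → List X → Y → (X → List X → Y) → Y
      cases [] n c = n
      cases (x ∷ xs) n c = c x xs

      ⟦_⟧ : Exp Γ A → Env Γ → ⟦ A ⟧ᵗ
      ⟦ var x ⟧ γ = All.lookup γ x
      ⟦ lit n ⟧ γ = fromℕ n
      ⟦ op o e f ⟧ γ = evalR o (⟦ e ⟧ γ) (⟦ f ⟧ γ)
      ⟦ ifle e f g h ⟧ γ = if≤ (⟦ e ⟧ γ) (⟦ f ⟧ γ) (⟦ g ⟧ γ) (⟦ h ⟧ γ)
      ⟦ pair e f ⟧ γ = ⟦ e ⟧ γ , ⟦ f ⟧ γ
      ⟦ fst e ⟧ γ = proj₁ (⟦ e ⟧ γ)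
      ⟦ snd e ⟧ γ = proj₂ (⟦ e ⟧ γ)
      ⟦ nil ⟧ γ = []
      ⟦ cons e f ⟧ γ = ⟦ e ⟧ γ ∷ ⟦ f ⟧ γ
      ⟦ case e f g ⟧ γ = cases (⟦ e ⟧ γ) (⟦ f ⟧ γ) λ x xs → ⟦ g ⟧ (x ∷ xs ∷ γ)
      ⟦ fold e f g ⟧ γ = iter (λ x s xs → ⟦ g ⟧ (x ∷ s ∷ xs ∷ γ)) (⟦ e ⟧ γ) (⟦ f ⟧ γ)
      ⟦ app f e ⟧ γ = ⟦ f ⟧ (⟦ e ⟧ γ ∷ [])
      ⟦ bind e f ⟧ γ = ⟦ f ⟧ (⟦ e ⟧ γ ∷ γ)

      -- Only fold steps are counted, and only those of the branch taken. What happens between two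
      -- of them is bounded by `weight`, so this is the whole cost model.
      iters : Exp Γ A → Env Γ → ℕ
      iters (var x) γ = 0
      iters (lit n) γ = 0
      iters (op o e f) γ = iters e γ + iters f γ
      iters (ifle e f g h) γ = iters e γ + (iters f γ + if≤ (⟦ e ⟧ γ) (⟦ f ⟧ γ) (iters g γ) (iters h γ))
      iters (pair e f) γ = iters e γ + iters f γ
      iters (fst e) γ = iters e γ
      iters (snd e) γ = iters e γ
      iters nil γ = 0
      iters (cons e f) γ = iters e γ + iters f γ
      iters (case e f g) γ = iters e γ + cases (⟦ e ⟧ γ) (iters f γ) λ x xs → iters g (x ∷ xs ∷ γ)
      iters (fold e f g) γ = iters e γ + (iters f γ +
        iterCost (λ x s xs → iters g (x ∷ s ∷ xs ∷ γ)) (λ x s xs → ⟦ g ⟧ (x ∷ s ∷ xs ∷ γ)) (⟦ e ⟧ γ) (⟦ f ⟧ γ))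
      iters (app f e) γ = iters e γ + iters f (⟦ e ⟧ γ ∷ [])
      iters (bind e f) γ = iters e γ + iters f (⟦ e ⟧ γ ∷ γ)

      upd-same : {X : Set} (f : ℕ → X) (a : ℕ) {v : X} → (f [ a ≔ v ]) a ≡ v
      upd-same f a rewrite dec-true (a ≟ a) refl = refl

      upd-other : {X : Set} (f : ℕ → X) {a b : ℕ} {v : X} → b ≢ a → (f [ a ≔ v ]) b ≡ f b
      upd-other f {a} {b} ne rewrite dec-false (a ≟ b) (λ e → ne (sym e)) = refl

      private
        add≤ : ∀ {t u w v i j} → t ≤ w * suc i → u ≤ v * suc j → t + u ≤ (w + v) * suc (i + j)
        add≤ {t} {u} {w} {v} {i} {j} p q = begin
          t + u                                 ≤⟨ +-mono-≤ p q ⟩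
          w * suc i + v * suc j                 ≤⟨ +-mono-≤ (*-monoʳ-≤ w (s≤s (m≤m+n i j))) (*-monoʳ-≤ v (s≤s (m≤n+m j i))) ⟩
          w * suc (i + j) + v * suc (i + j)     ≡⟨ *-distribʳ-+ (suc (i + j)) w v ⟨
          (w + v) * suc (i + j)                 ∎
          where open ≤-Reasoning

        const≤ : ∀ {c i} → c ≤ c * suc i
        const≤ {c} {i} = m≤m*n c (suc i)

        addc≤ : ∀ {t w i} c → t ≤ w * suc i → t + c ≤ (w + c) * suc i
        addc≤ {t} {w} {i} c p = ≤-trans (+-mono-≤ p const≤) (≤-reflexive (sym (*-distribʳ-+ (suc i) w c)))

        op≤ : ∀ {t u x w v i j} c → t ≤ w * suc i → u ≤ v * suc j → x ≤ c → t + (u + x) ≤ (w + (v + c)) * suc (i + j)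
        op≤ {u = u} {w = w} {v} {i} c p q r = add≤ {w = w} {i = i} p (≤-trans (+-monoʳ-≤ u r) (addc≤ {w = v} c q))

        suc≤ : ∀ {t w v} i → t ≤ w * suc i → w ≤ v → suc t ≤ suc v * suc i
        suc≤ {v = v} i p q = s≤s (≤-trans p (≤-trans (*-monoˡ-≤ (suc i) q) (m≤n+m (v * suc i) i)))

        loop≤ : ∀ {t w i u J} → t ≤ w * suc i → u ≤ (w + 6) * J + 1 →
          suc ((1 + (2 + (t + 1))) + u) ≤ (w + 6) * (suc i + J) + 1
        loop≤ {t} {w} {i} {u} {J} p q = begin
          suc ((1 + (2 + (t + 1))) + u)                ≡⟨ arith t u ⟩
          (t + 5) + u                                  ≤⟨ +-mono-≤ (≤-trans (addc≤ {w = w} 5 p) (*-monoˡ-≤ (suc i) (+-monoʳ-≤ w (n≤1+n 5)))) q ⟩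
          (w + 6) * suc i + ((w + 6) * J + 1)          ≡⟨ +-assoc ((w + 6) * suc i) _ 1 ⟨
          (w + 6) * suc i + (w + 6) * J + 1            ≡⟨ cong (_+ 1) (*-distribˡ-+ (w + 6) (suc i) J) ⟨
          (w + 6) * (suc i + J) + 1                    ∎
          where
          open ≤-Reasoning
          arith : ∀ t u → suc ((1 + (2 + (t + 1))) + u) ≡ (t + 5) + u
          arith t u rewrite +-comm t 1 | +-comm t 5 = refl

      -- H bounds the addresses of registers.
      module Simulation (H : ℕ) where

        -- A real may lie anywhere below the heap pointer, even below `H`, because the input is used
        -- in place; pairs lie on the heap proper. As `H` is positive in all uses, a nonempty list
        -- is told from the empty one by a nonzero address.
        rep : Store → ∀ A → ⟦ A ⟧ᵗ → ℕ → Set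
        repList : Store → ∀ A → List ⟦ A ⟧ᵗ → ℕ → Set

        rep σ num x p = p < nat σ 2 × real σ p ≡ x
        rep σ (list A) xs p = repList σ A xs p
        rep σ (A ⊗ B) (a , b) p = H ≤ p × suc p < nat σ 2 × rep σ A a (nat σ p) × rep σ B b (nat σ (suc p))
        repList σ A [] p = p ≡ 0
        repList σ A (x ∷ xs) p = H ≤ p × suc p < nat σ 2 × rep σ A x (nat σ p) × repList σ A xs (nat σ (suc p))

        record Good (σ : Store) : Set where
          field
            zero≡ : nat σ 3 ≡ 0
            one≡  : nat σ 4 ≡ 1
            H≤hp  : H ≤ nat σ 2
        open Good public

        -- The heap is only ever extended. Values are immutable, so whatever was represented stays
        -- so (`rep-ext`). Of the registers, those below `k` are kept, except for the heap pointer.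
        record Ext (k : ℕ) (σ τ : Store) : Set where
          field
            low   : ∀ a → a < k → a ≢ 2 → nat τ a ≡ nat σ a
            heapN : ∀ a → H ≤ a → a < nat σ 2 → nat τ a ≡ nat σ a
            heapR : ∀ a → a < nat σ 2 → real τ a ≡ real σ a
            hp≤   : nat σ 2 ≤ nat τ 2
        open Ext public

        Ext-refl : ∀ {k σ} → Ext k σ σ
        Ext-refl = record { low = λ _ _ _ → refl ; heapN = λ _ _ _ → refl ; heapR = λ _ _ → refl ; hp≤ = ≤-refl }

        Ext-trans : ∀ {k σ τ υ} → Ext k σ τ → Ext k τ υ → Ext k σ υ
        Ext-trans E F = record
          { low   = λ a p q → trans (low F a p q) (low E a p q)
          ; heapN = λ a p q → trans (heapN F a p (<-≤-trans q (hp≤ E))) (heapN E a p q)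
          ; heapR = λ a q → trans (heapR F a (<-≤-trans q (hp≤ E))) (heapR E a q)
          ; hp≤   = ≤-trans (hp≤ E) (hp≤ F) }

        Ext-wk : ∀ {k k′ σ τ} → k ≤ k′ → Ext k′ σ τ → Ext k σ τ
        Ext-wk le E = record { low = λ a p q → low E a (<-≤-trans p le) q ; heapN = heapN E ; heapR = heapR E ; hp≤ = hp≤ E }

        Ext-good : ∀ {k σ τ} → 5 ≤ k → Ext k σ τ → Good σ → Good τ
        Ext-good k≥5 E g = record
          { zero≡ = trans (low E 3 (≤-trans (s≤s (s≤s (s≤s (s≤s z≤n)))) k≥5) λ ()) (zero≡ g)
          ; one≡  = trans (low E 4 k≥5 λ ()) (one≡ g)
          ; H≤hp  = ≤-trans (H≤hp g) (hp≤ E) }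

        rep-ext : ∀ {k σ τ} → Ext k σ τ → ∀ A {v p} → rep σ A v p → rep τ A v p
        repList-ext : ∀ {k σ τ} → Ext k σ τ → ∀ A v {p} → repList σ A v p → repList τ A v p
        rep-ext E num {p = p} (p< , eq) = <-≤-trans p< (hp≤ E) , trans (heapR E p p<) eq
        rep-ext E (list A) {v} r = repList-ext E A v r
        rep-ext E (A ⊗ B) {p = p} (H≤ , p< , r , s)
          rewrite sym (heapN E p H≤ (<-trans (n<1+n p) p<)) | sym (heapN E (suc p) (m≤n⇒m≤1+n H≤) p<)
          = H≤ , <-≤-trans p< (hp≤ E) , rep-ext E A r , rep-ext E B s
        repList-ext E A [] r = r
        repList-ext E A (x ∷ xs) {p} (H≤ , p< , r , s)
          rewrite sym (heapN E p H≤ (<-trans (n<1+n p) p<)) | sym (heapN E (suc p) (m≤n⇒m≤1+n H≤) p<)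
          = H≤ , <-≤-trans p< (hp≤ E) , rep-ext E A r , repList-ext E A xs s

        RepEnv : Store → ℕ → Regs Γ → Env Γ → Set
        RepEnv σ k [] [] = ⊤
        RepEnv {A ∷ Γ} σ k (r ∷ ρ) (v ∷ γ) = (5 ≤ r × r < k × rep σ A v (nat σ r)) × RepEnv σ k ρ γ

        n≢2 : ∀ {r} → 5 ≤ r → r ≢ 2
        n≢2 (s≤s (s≤s (s≤s _))) ()

        rep-low : ∀ {k σ τ r} A {v} → 5 ≤ r → r < k → Ext k σ τ → rep σ A v (nat σ r) → rep τ A v (nat τ r)
        rep-low {r = r} A {v} r≥ r< E x = subst (rep _ A v) (sym (low E r r< (n≢2 r≥))) (rep-ext E A x)

        env-ext : ∀ {k k′ j σ τ} (ρ : Regs Γ) {γ} → k ≤ k′ → k ≤ j → Ext j σ τ → RepEnv σ k ρ γ → RepEnv τ k′ ρ γ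
        env-ext [] {[]} _ _ E _ = tt
        env-ext {A ∷ Γ} (r ∷ ρ) {v ∷ γ} le le′ E ((r≥ , r< , x) , e) =
          (r≥ , <-≤-trans r< le , rep-low A r≥ (<-≤-trans r< le′) E x) , env-ext ρ le le′ E e

        env-lookup : ∀ {k σ} (ρ : Regs Γ) {γ} → RepEnv σ k ρ γ → (x : A ∈ Γ) →
          5 ≤ All.lookup ρ x × All.lookup ρ x < k × rep σ A (All.lookup γ x) (nat σ (All.lookup ρ x))
        env-lookup (r ∷ ρ) {v ∷ γ} (x , e) (here refl) = x
        env-lookup (r ∷ ρ) {v ∷ γ} (x , e) (there i) = env-lookup ρ e i

        record Gives (k : ℕ) (σ : Store) (P : Program) (A : Ty) (v : ⟦ A ⟧ᵗ) (t : ℕ) : Set where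
          constructor gives
          field
            {after} : Store
            {time}  : ℕ
            run     : ⟨ P , σ ⟩⇓⟨ after , time ⟩
            ext     : Ext k σ after
            result  : rep after A v (nat after k)
            time≤   : time ≤ t
        open Gives public

        module _ {k : ℕ} (k≥5 : 5 ≤ k) (k<H : k < H) where

          -- The final store is spelled out rather than quantified, since the loop of a `fold` and
          -- the branch of a `case` run exactly these three instructions. The head is fetched into
          -- `j` before the address in `k` is lost.
          uncons-gives : ∀ {j σ x xs} → k < j → j < H → Good σ → repList σ A (x ∷ xs) (nat σ k) →
            let τ = exec (opN add (at k) (ind k) (at 3)) (exec (opN add (at k) (at k) (at 4)) (exec (opN add (at j) (ind k) (at 3)) σ)) in
            Ext k σ τ × rep τ A x (nat τ j) × repList τ A xs (nat τ k) × (∀ a → a < H → a ≢ k → a ≢ j → nat τ a ≡ nat σ a)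
          uncons-gives {A} {j} {σ} {x} {xs} k<j j<H g (H≤ , _ , rx , rxs) =
            E , subst (rep τ A x) (sym j≡) (rep-ext E A rx) , subst (repList τ A xs) (sym k≡) (repList-ext E A xs rxs) , other
            where
            p = nat σ k
            n₁ = nat σ [ j ≔ nat σ p + nat σ 3 ]
            n₂ = n₁ [ k ≔ n₁ k + n₁ 4 ]
            n₃ = n₂ [ k ≔ n₂ (n₂ k) + n₂ 3 ]
            τ = exec (opN add (at k) (ind k) (at 3)) (exec (opN add (at k) (at k) (at 4)) (exec (opN add (at j) (ind k) (at 3)) σ))
            low-reg : ∀ {a} → a < 5 → a ≢ j × a ≢ k
            low-reg a<5 = <⇒≢ (<-≤-trans a<5 (≤-trans k≥5 (<⇒≤ k<j))) , <⇒≢ (<-≤-trans a<5 k≥5)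
            other : ∀ a → a < H → a ≢ k → a ≢ j → n₃ a ≡ nat σ a
            other a _ ≢k ≢j = trans (upd-other n₂ ≢k) (trans (upd-other n₁ ≢k) (upd-other (nat σ) ≢j))
            heap : ∀ {a} → H ≤ a → n₂ a ≡ nat σ a
            heap H≤a = trans (upd-other n₁ (λ e → <⇒≢ (<-≤-trans k<H H≤a) (sym e))) (upd-other (nat σ) (λ e → <⇒≢ (<-≤-trans j<H H≤a) (sym e)))
            n₂3 : n₂ 3 ≡ 0
            n₂3 = trans (upd-other n₁ (proj₂ (low-reg (s≤s (s≤s (s≤s (s≤s z≤n))))))) (trans (upd-other (nat σ) (proj₁ (low-reg (s≤s (s≤s (s≤s (s≤s z≤n))))))) (zero≡ g))
            n₂k : n₂ k ≡ suc p
            n₂k = trans (upd-same n₁ k) (trans (cong₂ _+_ (upd-other (nat σ) (<⇒≢ k<j)) (trans (upd-other (nat σ) (proj₁ (low-reg ≤-refl))) (one≡ g))) (+-comm p 1))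
            k≡ : n₃ k ≡ nat σ (suc p)
            k≡ = trans (upd-same n₂ k) (trans (cong₂ _+_ (trans (cong n₂ n₂k) (heap (m≤n⇒m≤1+n H≤))) n₂3) (+-identityʳ _))
            j≡ : n₃ j ≡ nat σ p
            j≡ = trans (upd-other n₂ (λ e → <⇒≢ k<j (sym e))) (trans (upd-other n₁ (λ e → <⇒≢ k<j (sym e)))
              (trans (upd-same (nat σ) j) (trans (cong (nat σ p +_) (zero≡ g)) (+-identityʳ _))))
            E : Ext k σ τ
            E = record
              { low   = λ a a<k _ → other a (<-trans a<k k<H) (<⇒≢ a<k) (<⇒≢ (<-trans a<k k<j))
              ; heapN = λ a H≤a _ → trans (upd-other n₂ (λ e → <⇒≢ (<-≤-trans k<H H≤a) (sym e))) (heap H≤a)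
              ; heapR = λ _ _ → refl
              ; hp≤   = ≤-reflexive (sym (other 2 (<-trans (≤-trans (s≤s (s≤s (s≤s z≤n))) k≥5) k<H)
                  (λ e → n≢2 k≥5 (sym e)) (λ e → n≢2 (≤-trans k≥5 (<⇒≤ k<j)) (sym e)))) }

          ext-put : ∀ {σ v} → Good σ → Ext k σ (putN σ (at k) v)
          ext-put {σ} g = record
            { low   = λ a a<k _ → upd-other (nat σ) (<⇒≢ a<k)
            ; heapN = λ a H≤a _ → upd-other (nat σ) (λ e → <⇒≢ (<-≤-trans k<H H≤a) (sym e))
            ; heapR = λ _ _ → refl
            ; hp≤   = ≤-reflexive (sym (upd-other (nat σ) (λ e → n≢2 k≥5 (sym e)))) }

          move-gives : ∀ {σ r v} → Good σ → rep σ A v (nat σ r) → Gives k σ (move k r) A v 1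
          move-gives {A} {σ} {r} {v} g x = gives instr (ext-put g)
            (subst (rep _ A v) (sym (trans (upd-same (nat σ) k) (trans (cong (nat σ r +_) (zero≡ g)) (+-identityʳ _))))
              (rep-ext (ext-put g) A x)) ≤-refl

          load-gives : ∀ {σ j v} → Good σ → rep σ A v (nat σ (nat σ j)) → Gives k σ (deref k j) A v 1
          load-gives {A} {σ} {j} {v} g x = gives instr (ext-put g)
            (subst (rep _ A v) (sym (trans (upd-same (nat σ) k) (trans (cong (nat σ (nat σ j) +_) (zero≡ g)) (+-identityʳ _))))
              (rep-ext (ext-put g) A x)) ≤-refl

          second-gives : ∀ {σ v} → Good σ → H ≤ nat σ k → rep σ A v (nat σ (suc (nat σ k))) → Gives k σ (second k) A v 2
          second-gives {A} {σ} {v} g H≤ x = gives (seq instr (run G)) (Ext-trans E (ext G)) (result G) (s≤s (time≤ G))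
            where
            E = ext-put {v = nat σ k + nat σ 4} g
            eq : nat (putN σ (at k) (nat σ k + nat σ 4)) k ≡ suc (nat σ k)
            eq = trans (upd-same (nat σ) k) (trans (cong (nat σ k +_) (one≡ g)) (+-comm (nat σ k) 1))
            other : nat (putN σ (at k) (nat σ k + nat σ 4)) (suc (nat σ k)) ≡ nat σ (suc (nat σ k))
            other = upd-other (nat σ) (λ e → <⇒≢ (<-≤-trans k<H (m≤n⇒m≤1+n H≤)) (sym e))
            G = load-gives {A = A} {j = k} (Ext-good k≥5 E g)
              (subst (rep _ A v) (sym (trans (cong (nat (putN σ (at k) (nat σ k + nat σ 4))) eq) other)) (rep-ext E A x))

          -- Stated for any instruction that writes to the free cell, so that it covers literals as
          -- well as arithmetic.
          real-gives : ∀ {σ i} {x : ℝ} → Good σ → exec i σ ≡ putR σ (ind 2) x → Gives k σ (⟪ i ⟫ ⨾ fresh k) num x 3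
          real-gives {σ} {i} {x} g eq = gives (seq (subst (λ τ → ⟨ ⟪ i ⟫ , σ ⟩⇓⟨ τ , 1 ⟩) eq instr) (seq instr instr))
            (record
              { low   = λ a a<k a≢2 → trans (upd-other n₁ a≢2) (upd-other (nat σ) (<⇒≢ a<k))
              ; heapN = λ a H≤a a<hp → trans (upd-other n₁ {2} (λ { refl → contradiction H≤a (<⇒≱ (≤-<-trans (≤-trans (s≤s (s≤s z≤n)) k≥5) k<H)) }))
                  (upd-other (nat σ) (λ e → <⇒≢ (<-≤-trans k<H H≤a) (sym e)))
              ; heapR = λ a a<hp → upd-other (real σ) (<⇒≢ a<hp)
              ; hp≤   = ≤-trans (n≤1+n _) (≤-reflexive (sym hp′)) })
            (subst (_< nat₂ 2) (sym k≡) (≤-reflexive (sym hp′)) , trans (cong (real (putR σ (ind 2) x)) k≡) (upd-same (real σ) (nat σ 2)))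
            ≤-refl
            where
            n₁ = nat σ [ k ≔ nat σ 2 + nat σ 3 ]
            nat₂ = n₁ [ 2 ≔ n₁ 2 + n₁ 4 ]
            2≢k : 2 ≢ k
            2≢k e = n≢2 k≥5 (sym e)
            4≢k : 4 ≢ k
            4≢k e = <⇒≢ k≥5 e
            hp′ : nat₂ 2 ≡ suc (nat σ 2)
            hp′ = trans (upd-same n₁ 2) (trans (cong₂ _+_ (upd-other (nat σ) 2≢k) (trans (upd-other (nat σ) 4≢k) (one≡ g))) (+-comm (nat σ 2) 1))
            k≡ : nat₂ k ≡ nat σ 2
            k≡ = trans (upd-other n₁ (n≢2 k≥5)) (trans (upd-same (nat σ) k) (trans (cong (nat σ 2 +_) (zero≡ g)) (+-identityʳ _)))

          newpair-gives : ∀ {σ r s} {a : ⟦ A ⟧ᵗ} {b : ⟦ B ⟧ᵗ} → Good σ → 5 ≤ r → r < H → 5 ≤ s → s < H →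
            rep σ A a (nat σ r) → rep σ B b (nat σ s) →
            Gives k σ (newpair k r s) (A ⊗ B) (a , b) 5
          newpair-gives {A} {B} {σ} {r} {s} {a} {b} g r≥ r< s≥ s< ra rb =
            gives (seq instr (seq instr (seq instr (seq instr instr)))) E
              (subst (rep τ (A ⊗ B) (a , b)) (sym n₅k)
                (H≤h , ≤-reflexive (sym n₅2)
                , subst (rep τ A a) (sym n₅h) (rep-ext E A ra)
                , subst (rep τ B b) (sym n₅h′) (rep-ext E B rb)))
              ≤-refl
            where
            h = nat σ 2
            H≤h = H≤hp g
            n₀ = nat σ
            n₁ = n₀ [ h ≔ n₀ r + n₀ 3 ]
            n₂ = n₁ [ 2 ≔ n₁ 2 + n₁ 4 ]
            n₃ = n₂ [ n₂ 2 ≔ n₂ s + n₂ 3 ]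
            n₄ = n₃ [ k ≔ n₃ 2 ∸ n₃ 4 ]
            n₅ = n₄ [ 2 ≔ n₄ 2 + n₄ 4 ]
            τ = exec (opN add (at 2) (at 2) (at 4)) (exec (opN monus (at k) (at 2) (at 4))
              (exec (opN add (ind 2) (at s) (at 3)) (exec (opN add (at 2) (at 2) (at 4))
              (exec (opN add (ind 2) (at r) (at 3)) σ))))
            5<H : 5 < H
            5<H = ≤-<-trans k≥5 k<H
            below : ∀ {x} → x < H → x ≢ h
            below x<H = <⇒≢ (<-≤-trans x<H H≤h)
            below′ : ∀ {x} → x < H → x ≢ suc h
            below′ x<H = <⇒≢ (<-≤-trans x<H (m≤n⇒m≤1+n H≤h))
            3<H : 3 < H
            3<H = <-trans (s≤s (s≤s (s≤s (s≤s z≤n)))) 5<H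
            4<H : 4 < H
            4<H = <-trans (s≤s (s≤s (s≤s (s≤s (s≤s z≤n))))) 5<H
            2<H : 2 < H
            2<H = <-trans (s≤s (s≤s (s≤s z≤n))) 5<H
            n₂-reg : ∀ {x} → x ≢ h → x ≢ 2 → n₂ x ≡ n₀ x
            n₂-reg p q = trans (upd-other n₁ q) (upd-other n₀ p)
            n₂2 : n₂ 2 ≡ suc h
            n₂2 = trans (upd-same n₁ 2) (trans (cong₂ _+_ (upd-other n₀ (below 2<H)) (trans (upd-other n₀ (below 4<H)) (one≡ g))) (+-comm h 1))
            n₃-reg : ∀ {x} → x ≢ suc h → n₃ x ≡ n₂ x
            n₃-reg p = upd-other n₂ (λ e → p (trans e n₂2))
            n₃2 : n₃ 2 ≡ suc h
            n₃2 = trans (n₃-reg (below′ 2<H)) n₂2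
            n₃4 : n₃ 4 ≡ 1
            n₃4 = trans (n₃-reg (below′ 4<H)) (trans (n₂-reg (below 4<H) (λ ())) (one≡ g))
            2≢k : 2 ≢ k
            2≢k e = n≢2 k≥5 (sym e)
            4≢k : 4 ≢ k
            4≢k e = <⇒≢ k≥5 e
            n₅2 : n₅ 2 ≡ suc (suc h)
            n₅2 = trans (upd-same n₄ 2) (trans (cong₂ _+_ (trans (upd-other n₃ 2≢k) n₃2) (trans (upd-other n₃ 4≢k) n₃4)) (+-comm (suc h) 1))
            n₅k : n₅ k ≡ h
            n₅k = trans (upd-other n₄ (n≢2 k≥5)) (trans (upd-same n₃ k) (cong₂ _∸_ n₃2 n₃4))
            n₅-heap : ∀ {x} → H ≤ x → x ≢ suc h → n₅ x ≡ n₁ x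
            n₅-heap {x} H≤x ne = trans (upd-other n₄ 2≢) (trans (upd-other n₃ (λ e → <⇒≢ (<-≤-trans k<H H≤x) (sym e)))
              (trans (n₃-reg ne) (upd-other n₁ 2≢)))
              where
              2≢ : x ≢ 2
              2≢ e = <⇒≢ (<-≤-trans 2<H H≤x) (sym e)
            plus0 : ∀ {x y} → y ≡ 0 → x + y ≡ x
            plus0 {x} refl = +-identityʳ x
            n₅h : n₅ h ≡ n₀ r
            n₅h = trans (n₅-heap H≤h (<⇒≢ (n<1+n h))) (trans (upd-same n₀ h) (plus0 (zero≡ g)))
            n₅h′ : n₅ (suc h) ≡ n₀ s
            n₅h′ = trans (upd-other n₄ (λ e → below′ 2<H (sym e))) (trans (upd-other n₃ (λ e → below′ k<H (sym e)))
              (trans (cong n₃ (sym n₂2)) (trans (upd-same n₂ (n₂ 2))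
                (trans (plus0 (trans (n₂-reg (below 3<H) (λ ())) (zero≡ g))) (n₂-reg (below s<) (n≢2 s≥))))))
            E : Ext k σ τ
            E = record
              { low   = λ x x<k x≢2 → trans (upd-other n₄ x≢2) (trans (upd-other n₃ (<⇒≢ x<k))
                  (trans (n₃-reg (below′ (<-trans x<k k<H))) (n₂-reg (below (<-trans x<k k<H)) x≢2)))
              ; heapN = λ x H≤x x<h → trans (n₅-heap H≤x (<⇒≢ (m<n⇒m<1+n x<h))) (upd-other n₀ (<⇒≢ x<h))
              ; heapR = λ _ _ → refl
              ; hp≤   = ≤-trans (≤-trans (n≤1+n h) (n≤1+n _)) (≤-reflexive (sym n₅2)) }

        k<top : (e : Exp Γ A) → ∀ k → k < top e k
        k<top (var x) k = n<1+n k
        k<top (lit n) k = n<1+n k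
        k<top (op o e f) k = ≤-trans (k<top e k) (m≤m⊔n _ _)
        k<top (ifle e f g h) k = ≤-trans (k<top e k) (≤-trans (m≤m⊔n _ _) (m≤m⊔n _ _))
        k<top (pair e f) k = ≤-trans (k<top e k) (m≤m⊔n _ _)
        k<top (fst e) k = k<top e k
        k<top (snd e) k = k<top e k
        k<top nil k = n<1+n k
        k<top (cons e f) k = ≤-trans (k<top e k) (m≤m⊔n _ _)
        k<top (case e f g) k = ≤-trans (k<top e k) (≤-trans (m≤m⊔n _ _) (m≤m⊔n _ _))
        k<top (fold e f g) k = ≤-trans (k<top e k) (≤-trans (m≤m⊔n _ _) (m≤m⊔n _ _))
        k<top (app f e) k = ≤-trans (k<top e k) (m≤m⊔n _ _)
        k<top (bind e f) k = ≤-trans (k<top e k) (m≤m⊔n _ _)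

        private
          ⊔l : ∀ {m n o} → m ⊔ n ≤ o → m ≤ o
          ⊔l {m} {n} p = m⊔n≤o⇒m≤o m n p
          ⊔r : ∀ {m n o} → m ⊔ n ≤ o → n ≤ o
          ⊔r {m} {n} p = m⊔n≤o⇒n≤o m n p

          -- A cons cell is laid out as a pair.
          cons-gives : ∀ {k σ P t} {x : ⟦ A ⟧ᵗ} {xs} → Gives k σ P (A ⊗ list A) (x , xs) t → Gives k σ P (list A) (x ∷ xs) t
          cons-gives (gives r e x t) = gives r e x t

        -- Correctness of the compiler, by induction on the expression. Evaluating the second
        -- operand from register `suc k` on protects the first one in `k`. The bound is a product
        -- because each step of a fold runs the body once, within the weight of the body times one
        -- plus its own steps.
        simulation : (e : Exp Γ A) (ρ : Regs Γ) {γ : Env Γ} {k : ℕ} {σ : Store} → 5 ≤ k → top e k ≤ H → Good σ →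
          RepEnv σ k ρ γ → Gives k σ (compile e ρ k) A (⟦ e ⟧ γ) (weight e * suc (iters e γ))

        private
          record Operands (k : ℕ) (σ : Store) (P Q : Program) (A B : Ty) (a : ⟦ A ⟧ᵗ) (b : ⟦ B ⟧ᵗ) (w i v j : ℕ) : Set where
            field
              {mid end} : Store
              {t₁ t₂}   : ℕ
              run₁  : ⟨ P , σ ⟩⇓⟨ mid , t₁ ⟩
              run₂  : ⟨ Q , mid ⟩⇓⟨ end , t₂ ⟩
              extₒ  : Ext k σ end
              left  : rep end A a (nat end k)
              right : rep end B b (nat end (suc k))
              t≤    : t₁ ≤ w * suc i
              u≤    : t₂ ≤ v * suc j

          operands : (e : Exp Γ A) (f : Exp Γ B) (ρ : Regs Γ) {γ : Env Γ} {k : ℕ} {σ : Store} → 5 ≤ k →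
            top e k ≤ H → top f (suc k) ≤ H → Good σ → RepEnv σ k ρ γ →
            Operands k σ (compile e ρ k) (compile f ρ (suc k)) A B (⟦ e ⟧ γ) (⟦ f ⟧ γ) (weight e) (iters e γ) (weight f) (iters f γ)
          operands {A = A} e f ρ {k = k} k≥ te tf g env = record
            { run₁ = run G₁ ; run₂ = run G₂ ; extₒ = Ext-trans (ext G₁) (Ext-wk (n≤1+n k) (ext G₂))
            ; left = rep-low A k≥ (n<1+n k) (ext G₂) (result G₁) ; right = result G₂ ; t≤ = time≤ G₁ ; u≤ = time≤ G₂ }
            where
            G₁ = simulation e ρ k≥ te g env
            G₂ = simulation f ρ (m≤n⇒m≤1+n k≥) tf (Ext-good k≥ (ext G₁) g) (env-ext ρ (n≤1+n k) ≤-refl (ext G₁) env)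

        simulation (var x) ρ {k = k} {σ} k≥ t g env with env-lookup {σ = σ} ρ env x
        ... | _ , _ , r = move-gives k≥ t g r
        simulation (lit n) ρ k≥ t g env = gives (run G) (ext G) (result G) (≤-trans (time≤ G) (const≤ {3} {0}))
          where G = real-gives k≥ t {i = setR (ind 2) n} g refl
        simulation (op o e f) ρ {γ} {k} k≥ t g env = gives (seq run₁ (seq run₂ (run G))) (Ext-trans extₒ (ext G)) (result G)
          (op≤ {w = weight e} {weight f} {iters e γ} 3 t≤ u≤ (time≤ G))
          where
          O = operands e f ρ k≥ (⊔l t) (⊔r {top e k} t) g env
          open Operands O
          eq = cong₂ (evalR o) (proj₂ left) (proj₂ right)
          G = real-gives k≥ (<-≤-trans (k<top e k) (⊔l t)) {i = opR o (ind 2) (ind k) (ind (suc k))} (Ext-good k≥ extₒ g)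
            (cong (putR end (ind 2)) eq)
        simulation (ifle e f g h) ρ {γ} {k} k≥ t gd env with RealNumbers._≤?_ 𝓡 (⟦ e ⟧ γ) (⟦ f ⟧ γ)
        ... | yes p = gives (seq run₁ (seq run₂ (cond-true holds (run G)))) (Ext-trans extₒ (ext G)) (result G)
          (add≤ {w = weight e} {i = iters e γ} t≤ (add≤ {w = weight f} {i = iters f γ} u≤
            (suc≤ (iters g γ) (time≤ G) (m≤m+n (weight g) (weight h)))))
          where
          O = operands e f ρ k≥ (⊔l (⊔l t)) (⊔r {top e k} (⊔l t)) gd env
          open Operands O
          holds = subst₂ (RealNumbers._≤_ 𝓡) (sym (proj₂ left)) (sym (proj₂ right)) p
          G = simulation g ρ k≥ (⊔l (⊔r {top e k ⊔ top f (suc k)} t)) (Ext-good k≥ extₒ gd) (env-ext ρ ≤-refl ≤-refl extₒ env)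
        ... | no ¬p = gives (seq run₁ (seq run₂ (cond-false ¬holds (run G)))) (Ext-trans extₒ (ext G)) (result G)
          (add≤ {w = weight e} {i = iters e γ} t≤ (add≤ {w = weight f} {i = iters f γ} u≤
            (suc≤ (iters h γ) (time≤ G) (m≤n+m (weight h) (weight g)))))
          where
          O = operands e f ρ k≥ (⊔l (⊔l t)) (⊔r {top e k} (⊔l t)) gd env
          open Operands O
          ¬holds = λ q → ¬p (subst₂ (RealNumbers._≤_ 𝓡) (proj₂ left) (proj₂ right) q)
          G = simulation h ρ k≥ (⊔r {top g k} (⊔r {top e k ⊔ top f (suc k)} t)) (Ext-good k≥ extₒ gd) (env-ext ρ ≤-refl ≤-refl extₒ env)
        simulation (pair {A = A} {B} e f) ρ {γ} {k} k≥ t g env = gives (seq run₁ (seq run₂ (run G))) (Ext-trans extₒ (ext G)) (result G)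
          (op≤ {w = weight e} {weight f} {iters e γ} 5 t≤ u≤ (time≤ G))
          where
          O = operands e f ρ k≥ (⊔l t) (⊔r {top e k} t) g env
          open Operands O
          G = newpair-gives k≥ (<-≤-trans (k<top e k) (⊔l t)) {A = A} {B} (Ext-good k≥ extₒ g) k≥ (<-≤-trans (k<top e k) (⊔l t)) (m≤n⇒m≤1+n k≥)
            (<-≤-trans (k<top f (suc k)) (⊔r {top e k} t)) left right
        simulation (fst {A = A} e) ρ {γ} {k} k≥ t g env = gives (seq (run G₁) (run G)) (Ext-trans (ext G₁) (ext G)) (result G)
          (≤-trans (+-mono-≤ (time≤ G₁) (time≤ G)) (addc≤ {w = weight e} 1 ≤-refl))
          where
          G₁ = simulation e ρ k≥ t g env
          G = load-gives k≥ (<-≤-trans (k<top e k) t) {A = A} {j = k} (Ext-good k≥ (ext G₁) g) (proj₁ (proj₂ (proj₂ (result G₁))))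
        simulation (snd {B = B} e) ρ {γ} {k} k≥ t g env = gives (seq (run G₁) (run G)) (Ext-trans (ext G₁) (ext G)) (result G)
          (≤-trans (+-mono-≤ (time≤ G₁) (time≤ G)) (addc≤ {w = weight e} 2 ≤-refl))
          where
          G₁ = simulation e ρ k≥ t g env
          G = second-gives k≥ (<-≤-trans (k<top e k) t) {A = B} (Ext-good k≥ (ext G₁) g) (proj₁ (result G₁)) (proj₂ (proj₂ (proj₂ (result G₁))))
        simulation nil ρ {k = k} {σ} k≥ t g env = gives instr (ext-put k≥ t g) (upd-same (nat σ) k) const≤
        simulation (cons {A = A} e f) ρ {γ} {k} k≥ t g env = gives (seq run₁ (seq run₂ (run G))) (Ext-trans extₒ (ext G)) (result G)
          (op≤ {w = weight e} {weight f} {iters e γ} 5 t≤ u≤ (time≤ G))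
          where
          O = operands e f ρ k≥ (⊔l t) (⊔r {top e k} t) g env
          open Operands O
          G = cons-gives (newpair-gives k≥ (<-≤-trans (k<top e k) (⊔l t)) {A = A} {list A} (Ext-good k≥ extₒ g) k≥ (<-≤-trans (k<top e k) (⊔l t)) (m≤n⇒m≤1+n k≥)
            (<-≤-trans (k<top f (suc k)) (⊔r {top e k} t)) left right)
        simulation (app {A = A} {B} f e) ρ {γ} {k} k≥ t g env = gives (seq (run G₁) (seq (run G₂) (run G)))
          (Ext-trans (ext G₁) (Ext-trans (Ext-wk (n≤1+n k) (ext G₂)) (ext G))) (result G)
          (op≤ {w = weight e} {weight f} {iters e γ} 1 (time≤ G₁) (time≤ G₂) (time≤ G))
          where
          k<H = <-≤-trans (k<top e k) (⊔l t)
          G₁ = simulation e ρ k≥ (⊔l t) g env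
          g₁ = Ext-good k≥ (ext G₁) g
          G₂ = simulation f (k ∷ []) (m≤n⇒m≤1+n k≥) (⊔r {top e k} t) g₁ ((k≥ , n<1+n k , result G₁) , tt)
          G = move-gives k≥ k<H {A = B} {r = suc k} (Ext-good (m≤n⇒m≤1+n k≥) (ext G₂) g₁) (result G₂)
        simulation (bind {A = A} {B} e f) ρ {γ} {k} k≥ t g env = gives (seq (run G₁) (seq (run G₂) (run G)))
          (Ext-trans (ext G₁) (Ext-trans (Ext-wk (n≤1+n k) (ext G₂)) (ext G))) (result G)
          (op≤ {w = weight e} {weight f} {iters e γ} 1 (time≤ G₁) (time≤ G₂) (time≤ G))
          where
          k<H = <-≤-trans (k<top e k) (⊔l t)
          G₁ = simulation e ρ k≥ (⊔l t) g env
          g₁ = Ext-good k≥ (ext G₁) g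
          G₂ = simulation f (k ∷ ρ) (m≤n⇒m≤1+n k≥) (⊔r {top e k} t) g₁ ((k≥ , n<1+n k , result G₁) , env-ext ρ (n≤1+n k) ≤-refl (ext G₁) env)
          G = move-gives k≥ k<H {A = B} {r = suc k} (Ext-good (m≤n⇒m≤1+n k≥) (ext G₂) g₁) (result G₂)
        simulation (case {A = A} {B} e f g) ρ {γ} {k} k≥ t gd env with ⟦ e ⟧ γ | simulation e ρ k≥ (⊔l (⊔l t)) gd env
        ... | [] | G₁ = gives (seq (run G₁) (cond-true holds (run G))) (Ext-trans (ext G₁) (ext G)) (result G)
          (add≤ {w = weight e} {i = iters e γ} (time≤ G₁) (suc≤ (iters f γ) (time≤ G) (m≤m+n (weight f) (weight g + 4))))
          where
          g₁ = Ext-good k≥ (ext G₁) gd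
          holds = ≤-reflexive (trans (result G₁) (sym (zero≡ g₁)))
          G = simulation f ρ k≥ (⊔r {top e k} (⊔l t)) g₁ (env-ext ρ ≤-refl ≤-refl (ext G₁) env)
        ... | x ∷ xs | G₁ = gives (seq (run G₁) (cond-false ¬holds (seq instr (seq (seq instr instr) (seq (run G₂) (run G))))))
          (Ext-trans (ext G₁) (Ext-trans E (Ext-trans (Ext-wk (≤-trans (n≤1+n k) (n≤1+n _)) (ext G₂)) (ext G)))) (result G)
          (add≤ {w = weight e} {i = iters e γ} (time≤ G₁) bound)
          where
          k<H = <-≤-trans (k<top e k) (⊔l (⊔l t))
          2+k<H = <-≤-trans (k<top g (2 + k)) (⊔r {top e k ⊔ top f k} t)
          g₁ = Ext-good k≥ (ext G₁) gd
          ¬holds : ¬ (nat (after G₁) k ≤ nat (after G₁) 3)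
          ¬holds p = <⇒≱ (≤-trans (<-≤-trans (≤-<-trans z≤n k<H) (proj₁ (result G₁))) p) (≤-reflexive (zero≡ g₁))
          U = uncons-gives k≥ k<H {A = A} {x = x} {xs} (n<1+n k) (<-trans (n<1+n _) 2+k<H) g₁ (result G₁)
          E = proj₁ U
          g₂ = Ext-good k≥ E g₁
          G₂ = simulation g (suc k ∷ k ∷ ρ) (m≤n⇒m≤1+n (m≤n⇒m≤1+n k≥)) (⊔r {top e k ⊔ top f k} t) g₂
            ((m≤n⇒m≤1+n k≥ , ≤-refl , proj₁ (proj₂ U)) , (k≥ , n≤1+n _ , proj₁ (proj₂ (proj₂ U))) ,
              env-ext ρ (≤-trans (n≤1+n k) (n≤1+n _)) ≤-refl (Ext-trans (ext G₁) E) env)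
          G = move-gives k≥ k<H {A = B} {r = 2 + k} (Ext-good (m≤n⇒m≤1+n (m≤n⇒m≤1+n k≥)) (ext G₂) g₂) (result G₂)
          i = iters g (x ∷ xs ∷ γ)
          bound : suc (1 + (2 + (time G₂ + 1))) ≤ (1 + (weight f + (weight g + 4))) * suc i
          bound = ≤-trans (≤-reflexive (arith (time G₂))) (≤-trans (addc≤ {w = weight g} 5 (time≤ G₂))
            (*-monoˡ-≤ (suc i) (≤-trans (≤-reflexive (+-suc (weight g) 4)) (s≤s (m≤n+m _ (weight f))))))
            where
            arith : ∀ t → suc (1 + (2 + (t + 1))) ≡ t + 5
            arith t rewrite +-comm t 1 | +-comm t 5 = refl
        simulation (fold {A = A} {B} e f g) ρ {γ} {k} k≥ t gd env = gives (seq run₁ (seq run₂ (seq (L.run₀) (run G))))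
          (Ext-trans extₒ (Ext-trans L.ext₀ (ext G))) (result G)
          (add≤ {w = weight e} {i = iters e γ} t≤ (add≤ {w = weight f} {i = iters f γ} u≤
            (≤-trans (+-mono-≤ L.time₀ (time≤ G)) finish)))
          where
          O = operands e f ρ k≥ (⊔l (⊔l t)) (⊔r {top e k} (⊔l t)) gd env
          open Operands O
          k<H = <-≤-trans (k<top e k) (⊔l (⊔l t))
          3+k<H = <-≤-trans (k<top g (3 + k)) (⊔r {top e k ⊔ top f (suc k)} t)
          k+≥ : ∀ m → 5 ≤ m + k
          k+≥ m = ≤-trans k≥ (m≤n+m k m)
          step = λ x s xs → ⟦ g ⟧ (x ∷ s ∷ xs ∷ γ)
          cost = λ x s xs → iters g (x ∷ s ∷ xs ∷ γ)
          body = deref (2 + k) k ⨾ second k ⨾ compile g (2 + k ∷ suc k ∷ k ∷ ρ) (3 + k) ⨾ move (suc k) (3 + k)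
          record Loop (σ : Store) (xs : List ⟦ A ⟧ᵗ) (s : ⟦ B ⟧ᵗ) : Set where
            field
              {after₀} : Store
              {t₀}     : ℕ
              run₀  : ⟨ while (leN (at 4) (at k)) body , σ ⟩⇓⟨ after₀ , t₀ ⟩
              ext₀  : Ext k σ after₀
              res₀  : rep after₀ B (iter step xs s) (nat after₀ (suc k))
              time₀ : t₀ ≤ (weight g + 6) * iterCost cost step xs s + 1
          -- The remaining list and the state survive the body, whose scratch registers begin at
          -- `3 + k`.
          loop : ∀ {σ} xs s → Good σ → RepEnv σ k ρ γ → repList σ A xs (nat σ k) → rep σ B s (nat σ (suc k)) → Loop σ xs s
          loop {σ} [] s gσ _ nil≡ rs = record
            { run₀ = while-false λ p → <⇒≱ (s≤s z≤n) (≤-trans (subst (_≤ nat σ k) (one≡ gσ) p) (≤-reflexive nil≡))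
            ; ext₀ = Ext-refl ; res₀ = rs ; time₀ = m≤n+m 1 _ }
          loop {σ} (x ∷ xs) s gσ env rl rs = record
            { run₀ = while-true holds (seq instr (seq (seq instr instr) (seq (run G₂) (run G₃)))) R.run₀
            ; ext₀ = Ext-trans E′ R.ext₀ ; res₀ = R.res₀
            ; time₀ = ≤-trans (s≤s (+-monoˡ-≤ _ (s≤s (s≤s (s≤s (+-monoʳ-≤ (time G₂) (time≤ G₃)))))))
                (loop≤ {w = weight g} {i = cost x s xs} (time≤ G₂) R.time₀) }
            where
            holds = subst (_≤ nat σ k) (sym (one≡ gσ)) (<-≤-trans (≤-<-trans z≤n k<H) (proj₁ rl))
            U = uncons-gives k≥ k<H {A = A} {x = x} {xs} (≤-trans (n<1+n k) (n≤1+n _)) (<-trans (n<1+n _) 3+k<H) gσ rl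
            E = proj₁ U
            g₂ = Ext-good k≥ E gσ
            rs₂ = subst (rep _ B s) (sym (proj₂ (proj₂ (proj₂ U)) (suc k) (<-trans (n<1+n _) (<-trans (n<1+n _) 3+k<H)) (1+n≢n) (<⇒≢ (n<1+n _))))
              (rep-ext E B rs)
            G₂ = simulation g (2 + k ∷ suc k ∷ k ∷ ρ) (k+≥ 3) (⊔r {top e k ⊔ top f (suc k)} t) g₂
              ((k+≥ 2 , ≤-refl , proj₁ (proj₂ U)) , (k+≥ 1 , n≤1+n _ , rs₂) , (k≥ , ≤-trans (n≤1+n _) (n≤1+n _) , proj₁ (proj₂ (proj₂ U))) ,
                env-ext ρ (m≤n+m k 3) ≤-refl E env)
            G₃ = move-gives (k+≥ 1) (<-trans (n<1+n _) (<-trans (n<1+n _) 3+k<H)) {A = B} {r = 3 + k} (Ext-good (k+≥ 3) (ext G₂) g₂) (result G₂)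
            E″ = Ext-trans (Ext-wk (m≤n+m (suc k) 2) (ext G₂)) (ext G₃)
            E′ = Ext-trans E (Ext-wk (n≤1+n k) E″)
            module R = Loop (loop xs (step x s xs) (Ext-good k≥ E′ gσ) (env-ext ρ ≤-refl ≤-refl E′ env)
              (rep-low (list A) k≥ (n<1+n k) E″ (proj₁ (proj₂ (proj₂ U)))) (result G₃))
          gₒ = Ext-good k≥ extₒ gd
          module L = Loop (loop (⟦ e ⟧ γ) (⟦ f ⟧ γ) gₒ (env-ext ρ ≤-refl ≤-refl extₒ env) left right)
          G = move-gives k≥ k<H {A = B} {r = suc k} (Ext-good k≥ L.ext₀ gₒ) L.res₀
          J = iterCost cost step (⟦ e ⟧ γ) (⟦ f ⟧ γ)
          -- The failing last test and the closing move are paid by the 1 in `suc J`.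
          finish : (weight g + 6) * J + 1 + 1 ≤ (weight g + 7) * suc J
          finish = begin
            (weight g + 6) * J + 1 + 1         ≡⟨ +-assoc _ 1 1 ⟩
            (weight g + 6) * J + 2             ≤⟨ +-mono-≤ (*-monoˡ-≤ J (+-monoʳ-≤ (weight g) (n≤1+n 6))) (≤-trans (s≤s (s≤s z≤n)) (m≤n+m 7 (weight g))) ⟩
            (weight g + 7) * J + (weight g + 7) ≡⟨ +-comm _ (weight g + 7) ⟩
            (weight g + 7) + (weight g + 7) * J ≡⟨ *-suc (weight g + 7) J ⟨
            (weight g + 7) * suc J             ∎
            where open ≤-Reasoning

  open Language public

  -- The clustering algorithm in the fold language.

  module Codes where

    private variable
      Γ : Ctx
      A B : Ty

    pattern v0 = var (here refl)
    pattern v1 = var (there (here refl))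
    pattern v2 = var (there (there (here refl)))
    pattern v3 = var (there (there (there (here refl))))
    pattern v4 = var (there (there (there (there (here refl)))))
    pattern v5 = var (there (there (there (there (there (here refl))))))
    pattern v6 = var (there (there (there (there (there (there (here refl)))))))
    pattern v7 = var (there (there (there (there (there (there (there (here refl))))))))
    pattern v8 = var (there (there (there (there (there (there (there (there (here refl)))))))))

    -- A point x is the list -x₀, x₀, -x₁, x₁, … so that all cuts remove the points
    -- above some threshold.  During a pass over the coordinates a point is kept
    -- together with its coordinates still to come and a list that is nonempty if
    -- the point lies outside the box.
    P El Nodes Param State Out : Ty
    P     = list num
    El    = P ⊗ (P ⊗ list num)
    Nodes = list (list P)
    Param = list (num ⊗ num) ⊗ num
    -- The points of the node, the current points, the children and the dropped points.
    State = list El ⊗ (list El ⊗ (Nodes ⊗ list P))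
    -- The nodes to be split, the cores and the dropped points.
    Out   = Nodes ⊗ (Nodes ⊗ list P)

    infixl 7 _*ᵉ_
    infixl 6 _+ᵉ_ _-ᵉ_
    _+ᵉ_ _*ᵉ_ _-ᵉ_ : Exp Γ num → Exp Γ num → Exp Γ num
    _+ᵉ_ = op add
    _*ᵉ_ = op mul
    _-ᵉ_ = op sub

    -- Opaque, so that apart from the lemmas that unfold it a code is known only through its value
    -- and its bound on `iters`.
    opaque
      hdE : Exp (list num ∷ []) num
      hdE = case v0 (lit 0) v0

    opaque
      tlE : Exp (list A ∷ []) (list A)
      tlE = case v0 nil v1

    opaque
      revAppE : Exp (list A ⊗ list A ∷ []) (list A)
      revAppE = fold (fst v0) (snd v0) (cons v0 v1)

    opaque
      lenE : Exp (list A ∷ []) num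
      lenE = fold v0 (lit 0) (v1 +ᵉ lit 1)

    opaque
      initE : Exp (list P ∷ []) (list El)
      initE = fold v0 nil (cons (pair v0 (pair v0 nil)) v1)

    opaque
      keysE : Exp (list El ∷ []) (list num)
      keysE = fold v0 nil (cons (app hdE (fst v0)) v1)

    opaque
      advanceE : Exp (list El ∷ []) (list El)
      advanceE = fold v0 nil (cons (pair (app tlE (fst v0)) (snd v0)) v1)

    opaque
      fullE : Exp (list El ∷ []) (list P)
      fullE = fold v0 nil (cons (fst (snd v0)) v1)

    opaque
      countE : Exp (num ⊗ list num ∷ []) num
      countE = fold (snd v0) (lit 0) (ifle v0 (fst v3) v1 (v1 +ᵉ lit 1))

    opaque
      -- Merging recurses on two lists, which a fold cannot do. The concatenation of both serves as
      -- a clock, and every tick moves one element to the output.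
      mergeE : Exp (list num ⊗ list num ∷ []) (list num)
      mergeE = bind (fold (app revAppE v0) (pair (fst v0) (pair (snd v0) nil))
          (case (fst v1)
            (case (fst (snd v1)) v1 (pair nil (pair v1 (cons v0 (snd (snd v3))))))
            (case (fst (snd v3)) (pair v1 (pair nil (cons v0 (snd (snd v3)))))
              (ifle v0 v2 (pair v3 (pair (cons v0 v1) (cons v2 (snd (snd v5)))))
                          (pair (cons v2 v3) (pair v1 (cons v0 (snd (snd v5)))))))))
        (app revAppE (pair (snd (snd v0)) nil))

    opaque
      -- The first component holds the run, at most one, that waits for a partner.
      mergePairsE : Exp (list (list num) ∷ []) (list (list num))
      mergePairsE = bind (fold v0 (pair nil nil)
          (case (fst v1) (pair (cons v0 nil) (snd v1))
            (pair nil (cons (app mergeE (pair v0 v2)) (snd v3)))))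
        (app revAppE v0)

    opaque
      -- Bottom-up merge sort with as many passes as there are elements; the passes are idle once a
      -- single run is left.
      sortE : Exp (list num ∷ []) (list num)
      sortE = bind (fold v0 (fold v0 nil (cons (cons v0 nil) v1))
          (case v1 v1 (case v1 v3 (app mergePairsE v5))))
        (case v0 nil v0)

    opaque
      -- The second list advances by one for every two steps of the fold.
      halfE : Exp (list num ∷ []) (list num)
      halfE = fst (fold v0 (pair v0 nil)
        (case (snd v1) (pair (fst v1) (cons v0 nil)) (pair (app tlE (fst v3)) nil)))

    opaque
      medianE : Exp (list num ∷ []) num
      medianE = app hdE (app halfE (app sortE v0))

    opaque
      -- Looks for the first level at which the points above do not thin out fast enough.
      scanE : Exp (list (num ⊗ num) ⊗ (num ⊗ (num ⊗ (num ⊗ list num))) ∷ []) (list num ⊗ num)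
      scanE = fold (fst v0) (pair nil (fst (snd (snd (snd v0)))))
        (case (fst v1)
          (bind (snd v1 +ᵉ fst (snd (snd v3)))
            (ifle (app countE (pair v0 (snd (snd (snd (snd v4))))) *ᵉ snd v1) (fst v1 *ᵉ fst (snd v4))
              (pair nil v0) (pair (cons (snd v2) nil) (snd v2))))
          v3)

    opaque
      -- The three lists are the points up to the lower level, which stay current, those above the
      -- upper level, and those in between, which are dropped. Only the first keep their unread
      -- coordinates.
      cutE : Exp (num ⊗ (num ⊗ list El) ∷ []) (list El ⊗ (list P ⊗ list P))
      cutE = fold (snd (snd v0)) (pair nil (pair nil nil))
        (ifle (app hdE (fst v0)) (fst v3)
          (pair (cons (pair (app tlE (fst v0)) (snd v0)) (fst v1)) (snd v1))
          (ifle (app hdE (fst v0)) (fst (snd v3))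
            (pair (fst v1) (pair (fst (snd v1)) (cons (fst (snd v0)) (snd (snd v1)))))
            (pair (fst v1) (pair (cons (fst (snd v0)) (fst (snd v1))) (snd (snd v1))))))

    opaque
      markE : Exp (num ⊗ list El ∷ []) (list El)
      markE = fold (snd v0) nil
        (cons (pair (app tlE (fst v0)) (pair (fst (snd v0))
          (ifle (app hdE (fst v0)) (fst v3) (snd (snd v0)) (cons (fst v3) (snd (snd v0)))))) v1)

    opaque
      -- The median is taken in the node, the counts in the current set. Once the current set has
      -- less than 3/4 of the node, coordinates are still consumed but nothing is cut or marked.
      stepE : Exp (Param ⊗ State ∷ []) State
      stepE = bind (snd v0) (bind (app lenE (fst (snd v0)))
        (ifle (lit 3 *ᵉ app lenE (fst v1)) (lit 4 *ᵉ v0)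
          (bind (app scanE (pair (fst (fst v2)) (pair v0 (pair (snd (fst v2))
              (pair (app medianE (app keysE (fst v1))) (app keysE (fst (snd v1))))))))
            (case (fst v0)
              (pair (app advanceE (fst v2)) (pair (app markE (pair (snd v0) (fst (snd v2)))) (snd (snd v2))))
              (bind (app cutE (pair v0 (pair (v0 +ᵉ snd (fst v5)) (fst (snd v4)))))
                (pair (app advanceE (fst v5)) (pair (fst v0)
                  (pair (cons (fst (snd v0)) (fst (snd (snd v5))))
                        (app revAppE (pair (snd (snd v0)) (snd (snd (snd v5)))))))))))
          (pair (app advanceE (fst v1)) (pair (app advanceE (fst (snd v1))) (snd (snd v1))))))

    opaque
      -- The first point of the node provides a list of the right length to fold over.
      passE : Exp (Param ⊗ list P ∷ []) State
      passE = bind (app initE (snd v0)) (fold (case (snd v1) nil v0) (pair v0 (pair v0 (pair nil nil)))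
        (app stepE (pair (fst v4) v1)))

    opaque
      unmarkE : Exp (list El ⊗ list P ∷ []) (list P ⊗ list P)
      unmarkE = fold (fst v0) (pair nil (snd v0))
        (case (snd (snd v0)) (pair (cons (fst (snd v0)) (fst v1)) (snd v1))
          (pair (fst v3) (cons (fst (snd v2)) (snd v3))))

    opaque
      -- A pass that keeps 3/4 of the node ends in a core; the marked points are taken out of it and
      -- wait. Otherwise the current set is a further child, unless it is empty.
      nodeE : Exp (Param ⊗ list P ∷ []) Out
      nodeE = bind (app passE v0)
        (ifle (lit 3 *ᵉ app lenE (snd v1)) (lit 4 *ᵉ app lenE (fst (snd v0)))
          (bind (app unmarkE (pair (fst (snd v0)) (snd (snd (snd v0)))))
            (pair (fst (snd (snd v1))) (pair (cons (fst v0) nil) (snd v0))))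
          (pair (case (fst (snd v0)) (fst (snd (snd v0)))
              (cons (app fullE (fst (snd v2))) (fst (snd (snd v2)))))
            (pair nil (snd (snd (snd v0))))))

    opaque
      levelE : Exp (Param ⊗ Out ∷ []) Out
      levelE = fold (fst (snd v0)) (pair nil (snd (snd v0)))
        (bind (app nodeE (pair (fst v3) v0))
          (pair (app revAppE (pair (fst v0) (fst v2)))
            (pair (app revAppE (pair (fst (snd v0)) (fst (snd v2))))
              (app revAppE (pair (snd (snd v0)) (snd (snd v2)))))))

    opaque
      -- A child has fewer points than its parent, so the list of points is a long enough clock for
      -- the levels.
      roundE : Exp (Param ⊗ list P ∷ []) Out
      roundE = fold (snd v0) (pair (cons (snd v0) nil) (pair nil nil))
        (case (fst v1) v1 (app levelE (pair (fst v5) v3)))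

    opaque
      maxE : Exp (list num ∷ []) num
      maxE = case v0 (lit 0) (fold v1 v0 (ifle v0 v1 v1 v0))

    opaque
      boxE : Exp (list P ∷ []) (list num)
      boxE = snd (fold (case v0 nil v0) (pair (app initE v0) nil)
        (pair (app advanceE (fst v1)) (cons (app maxE (app keysE (fst v1))) (snd v1))))

    opaque
      -- The coordinates of the box come in reverse order, beginning with an upper
      -- endpoint; the sign turns every other one into a lower endpoint.
      emitE : Exp (num ⊗ (list P ⊗ list num) ∷ []) (list num)
      emitE = snd (fold (app boxE (fst (snd v0))) (pair (lit 1) (snd (snd v0)))
        (pair (lit 0 -ᵉ fst v1) (cons (fst v1 *ᵉ (v0 +ᵉ fst v3)) (snd v1))))

    opaque
      -- The first list counts the rectangles in unary.
      emitsE : Exp (num ⊗ (Nodes ⊗ (list num ⊗ list num)) ∷ []) (list num ⊗ list num)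
      emitsE = fold (fst (snd v0)) (snd (snd v0))
        (pair (cons (fst v3) (fst v1)) (app emitE (pair (fst v3) (pair v0 (snd v1)))))

    opaque
      roundsE : Exp (Param ⊗ (num ⊗ (list num ⊗ list P)) ∷ []) (list num ⊗ list num)
      roundsE = snd (fold (fst (snd (snd v0))) (pair (snd (snd (snd v0))) (pair nil nil))
        (case (fst v1) v1
          (bind (app roundE (pair (fst v5) (fst v3)))
            (pair (snd (snd v0)) (app emitsE (pair (fst (snd v6)) (pair (fst (snd v0)) (snd v4))))))))

    opaque
      -- The fold steps after which 6 d is exceeded by squaring 2 again and again, plus 2.
      blocksE : Exp (list num ∷ []) (list num)
      blocksE = bind (lit 6 *ᵉ app lenE v0) (bind
        (fold (cons (lit 0) (cons (lit 0) (cons (lit 0) v1))) (pair (lit 2) nil)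
          (ifle v3 (fst v1) v1 (pair (fst v1 *ᵉ fst v1) (cons v0 (snd v1)))))
        (cons (lit 0) (cons (lit 0) (snd v0))))

    opaque
      -- Numbers that control loops are kept as lists of that length. The list has q elements, and
      -- the clock of n + 2 steps is the cap on q.
      qsE : Exp (num ⊗ list num ∷ []) (list num)
      qsE = snd (fold (cons (lit 0) (cons (lit 0) (snd v0))) (pair (lit 0) nil)
        (ifle (fst v1) (lit 2) (pair (fst v1 +ᵉ fst v3) (cons v0 (snd v1))) v1))

    opaque
      -- The inner fold runs through a block of p equal steps, each a multiplication by a fixed
      -- fraction; the outer fold squares that fraction from block to block.
      ladderE : Exp (list num ⊗ list num ∷ []) (list (num ⊗ num))
      ladderE = bind (lit 3 *ᵉ app lenE (snd v0)) (bind (v0 -ᵉ lit 1)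
        (bind (fold (snd v2) (pair (lit 1) (lit 1)) (pair (v3 *ᵉ fst v1) (v4 *ᵉ snd v1)))
        (bind (fold (fst v3) (pair v0 (pair (pair v1 v2) nil))
          (bind (fold (snd v6) (pair (fst v1) (snd (snd v1)))
            (bind (pair (fst (fst v1) *ᵉ fst (fst (snd v4))) (snd (fst v1) *ᵉ snd (fst (snd v4))))
              (pair v0 (cons v0 (snd v2)))))
            (pair (fst v0) (pair (pair (fst (fst (snd v2)) *ᵉ fst (fst (snd v2))) (snd (fst (snd v2)) *ᵉ snd (fst (snd v2))))
              (snd v0)))))
        (app revAppE (pair (snd (snd v0)) nil)))))

    opaque
      pointE : Exp (list num ⊗ list num ∷ []) (list num ⊗ P)
      pointE = bind (fold (fst v0) (pair (snd v0) nil)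
          (case (fst v1) v1 (pair v1 (cons v0 (cons (lit 0 -ᵉ v0) (snd v3))))))
        (pair (fst v0) (app revAppE (pair (snd v0) nil)))

    opaque
      pointsE : Exp (list num ⊗ (list num ⊗ list num) ∷ []) (list P)
      pointsE = snd (fold (fst (snd v0)) (pair (snd (snd v0)) nil)
        (bind (app pointE (pair (fst v3) (fst v1))) (pair (fst v0) (cons (snd v0) (snd v2)))))

    opaque
      -- The variables are d and n in unary, the coordinates, ρ and Δ.
      mainE : Exp (list num ∷ list num ∷ list num ∷ num ∷ num ∷ []) (list num ⊗ list num)
      mainE = bind (app ladderE (pair (app blocksE v0) (app tlE (app qsE (pair v3 v1)))))
        -- The side Δ of a box consists of 2 k w for the core and w / 2 at either end, hence w = Δ /
        -- (2 k + 1).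
        (bind (op div v5 (lit 2 *ᵉ app lenE v0 +ᵉ lit 1))
          (app roundsE (pair (pair v1 v0) (pair (op div v0 (lit 2)) (pair v3
            (app pointsE (pair v2 (pair v3 v4))))))))

  open Codes public

  -- Arithmetic of the ordered field.

  module OrderedField (𝓡 : RealNumbers) where
    open RealNumbers 𝓡 public
      using (ℝ; 0ℝ; 1ℝ; _⁻¹; fromℕ; 0≢1; ⁻¹-inverse; *-nonNegative; commutativeRing; decTotalOrder)
      renaming (_+_ to infixl 6 _+ᵣ_; _*_ to infixl 7 _*ᵣ_; -_ to infix 8 -ᵣ_; _-_ to infixl 6 _⊖_; _/_ to infixl 7 _/ᵣ_;
        _≤_ to infix 4 _≤ᵣ_; _<_ to infix 4 _<ᵣ_; _≤?_ to infix 4 _≤ᵣ?_; _<?_ to infix 4 _<ᵣ?_; _^_ to infixr 8 _^ᵣ_; +-monoˡ-≤ to +ᵣ-monoˡ-≤;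
        max to maxᵣ; ∣_∣ to abs)
    open CommutativeRing commutativeRing public
      using () renaming (+-comm to +ᵣ-comm; +-assoc to +ᵣ-assoc; +-identityˡ to +ᵣ-identityˡ; +-identityʳ to +ᵣ-identityʳ;
        -‿inverseˡ to -ᵣ-inverseˡ; -‿inverseʳ to -ᵣ-inverseʳ;
        *-comm to *ᵣ-comm; *-assoc to *ᵣ-assoc; *-identityˡ to *ᵣ-identityˡ; *-identityʳ to *ᵣ-identityʳ; distribˡ to *ᵣ-distribˡ; distribʳ to *ᵣ-distribʳ;
        zeroˡ to *ᵣ-zeroˡ; zeroʳ to *ᵣ-zeroʳ)
    open DecTotalOrder decTotalOrder public
      using () renaming (refl to ≤ᵣ-refl; reflexive to ≤ᵣ-reflexive; trans to ≤ᵣ-trans; antisym to ≤ᵣ-antisym; total to ≤ᵣ-total)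
    open RingProperties (CommutativeRing.ring commutativeRing) public
      using () renaming (-‿involutive to -ᵣ-involutive; -‿distribˡ-* to -ᵣ-distribˡ; -‿+-comm to -ᵣ-+-comm)

    module RealSolver = Solver (CommutativeRing.commutativeSemiring commutativeRing)

    add-sub : ∀ y z → (y +ᵣ z) ⊖ y ≡ z
    add-sub y z = trans (cong (_+ᵣ -ᵣ y) (+ᵣ-comm y z)) (trans (+ᵣ-assoc z y _) (trans (cong (z +ᵣ_) (-ᵣ-inverseʳ y)) (+ᵣ-identityʳ z)))

    sub-add : ∀ x y → (x ⊖ y) +ᵣ y ≡ x
    sub-add x y = trans (+ᵣ-assoc x _ y) (trans (cong (x +ᵣ_) (-ᵣ-inverseˡ y)) (+ᵣ-identityʳ x))

    ≰⇒>ᵣ : ∀ {x y} → ¬ (x ≤ᵣ y) → y <ᵣ x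
    ≰⇒>ᵣ {x} {y} n with ≤ᵣ-total x y
    ... | inj₁ p = contradiction p n
    ... | inj₂ p = p , λ { refl → n p }

    <⇒≱ᵣ : ∀ {x y} → x <ᵣ y → ¬ (y ≤ᵣ x)
    <⇒≱ᵣ (p , ne) q = ne (≤ᵣ-antisym p q)

    ≤ᵣ-<ᵣ-trans : ∀ {x y z} → x ≤ᵣ y → y <ᵣ z → x <ᵣ z
    ≤ᵣ-<ᵣ-trans p (q , ne) = ≤ᵣ-trans p q , λ { refl → ne (≤ᵣ-antisym q p) }

    <ᵣ-≤ᵣ-trans : ∀ {x y z} → x <ᵣ y → y ≤ᵣ z → x <ᵣ z
    <ᵣ-≤ᵣ-trans (p , ne) q = ≤ᵣ-trans p q , λ { refl → ne (≤ᵣ-antisym p q) }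

    +ᵣ-mono : ∀ {x y u v} → x ≤ᵣ y → u ≤ᵣ v → x +ᵣ u ≤ᵣ y +ᵣ v
    +ᵣ-mono {x} {y} {u} {v} p q = ≤ᵣ-trans (+ᵣ-monoˡ-≤ u p) (subst₂ _≤ᵣ_ (+ᵣ-comm u y) (+ᵣ-comm v y) (+ᵣ-monoˡ-≤ y q))

    +ᵣ-cancelʳ : ∀ z {x y} → x +ᵣ z ≤ᵣ y +ᵣ z → x ≤ᵣ y
    +ᵣ-cancelʳ z {x} {y} p = subst₂ _≤ᵣ_ (eq x) (eq y) (+ᵣ-monoˡ-≤ (-ᵣ z) p)
      where
      eq : ∀ x → (x +ᵣ z) +ᵣ (-ᵣ z) ≡ x
      eq x = trans (+ᵣ-assoc x z (-ᵣ z)) (trans (cong (x +ᵣ_) (-ᵣ-inverseʳ z)) (+ᵣ-identityʳ x))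

    neg-mono : ∀ {x y} → x ≤ᵣ y → -ᵣ y ≤ᵣ -ᵣ x
    neg-mono {x} {y} p = subst₂ _≤ᵣ_ (eq₁ x y) (eq₂ x y) (+ᵣ-monoˡ-≤ (-ᵣ x +ᵣ -ᵣ y) p)
      where
      eq₁ : ∀ x y → x +ᵣ (-ᵣ x +ᵣ -ᵣ y) ≡ -ᵣ y
      eq₁ x y = trans (sym (+ᵣ-assoc x _ _)) (trans (cong (_+ᵣ -ᵣ y) (-ᵣ-inverseʳ x)) (+ᵣ-identityˡ _))
      eq₂ : ∀ x y → y +ᵣ (-ᵣ x +ᵣ -ᵣ y) ≡ -ᵣ x
      eq₂ x y = trans (cong (y +ᵣ_) (+ᵣ-comm _ _)) (eq₁ y x)

    x-y≤z : ∀ {x y z} → x ≤ᵣ y +ᵣ z → x ⊖ y ≤ᵣ z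
    x-y≤z {x} {y} {z} p = subst (x ⊖ y ≤ᵣ_) (add-sub y z) (+ᵣ-monoˡ-≤ (-ᵣ y) p)

    x≤y+z : ∀ {x y z} → x ⊖ y ≤ᵣ z → x ≤ᵣ y +ᵣ z
    x≤y+z {x} {y} {z} p = subst₂ _≤ᵣ_ (sub-add x y) (+ᵣ-comm z y) (+ᵣ-monoˡ-≤ y p)

    *ᵣ-monoˡ : ∀ {z x y} → 0ℝ ≤ᵣ z → x ≤ᵣ y → x *ᵣ z ≤ᵣ y *ᵣ z
    *ᵣ-monoˡ {z} {x} {y} z≥0 p = +ᵣ-cancelʳ (-ᵣ (x *ᵣ z)) (subst₂ _≤ᵣ_ (sym (-ᵣ-inverseʳ (x *ᵣ z))) (eq x y z)
      (*-nonNegative (subst (_≤ᵣ y +ᵣ -ᵣ x) (-ᵣ-inverseʳ x) (+ᵣ-monoˡ-≤ (-ᵣ x) p)) z≥0))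
      where
      eq : ∀ x y z → (y +ᵣ -ᵣ x) *ᵣ z ≡ y *ᵣ z +ᵣ -ᵣ (x *ᵣ z)
      eq x y z = trans (*ᵣ-distribʳ z y (-ᵣ x)) (cong (y *ᵣ z +ᵣ_) (sym (-ᵣ-distribˡ x z)))

    *ᵣ-mono : ∀ {x y u v} → 0ℝ ≤ᵣ u → 0ℝ ≤ᵣ y → x ≤ᵣ y → u ≤ᵣ v → x *ᵣ u ≤ᵣ y *ᵣ v
    *ᵣ-mono {x} {y} {u} {v} u≥0 y≥0 p q = ≤ᵣ-trans (*ᵣ-monoˡ u≥0 p) (subst₂ _≤ᵣ_ (*ᵣ-comm u y) (*ᵣ-comm v y) (*ᵣ-monoˡ y≥0 q))

    0≤1 : 0ℝ ≤ᵣ 1ℝ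
    0≤1 with ≤ᵣ-total 0ℝ 1ℝ
    ... | inj₁ p = p
    ... | inj₂ p = subst (0ℝ ≤ᵣ_) (eq 1ℝ) (*-nonNegative q q)
      where
      q : 0ℝ ≤ᵣ -ᵣ 1ℝ
      q = subst (_≤ᵣ -ᵣ 1ℝ) (trans (sym (+ᵣ-identityˡ _)) (-ᵣ-inverseʳ 0ℝ)) (neg-mono p)
      eq : ∀ x → -ᵣ 1ℝ *ᵣ -ᵣ 1ℝ ≡ 1ℝ
      eq _ = trans (sym (-ᵣ-distribˡ 1ℝ (-ᵣ 1ℝ))) (trans (cong -ᵣ_ (*ᵣ-identityˡ _)) (-ᵣ-involutive 1ℝ))

    0<1 : 0ℝ <ᵣ 1ℝ
    0<1 = 0≤1 , 0≢1

    private
      semiring = CommutativeRing.semiring commutativeRing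

    fromℕ-+ : ∀ m n → fromℕ (m + n) ≡ fromℕ m +ᵣ fromℕ n
    fromℕ-+ m n = Mult.×-homo-+ semiring 1ℝ m n

    fromℕ-1 : fromℕ 1 ≡ 1ℝ
    fromℕ-1 = +ᵣ-identityʳ 1ℝ

    fromℕ-* : ∀ m n → fromℕ (m * n) ≡ fromℕ m *ᵣ fromℕ n
    fromℕ-* zero n = sym (*ᵣ-zeroˡ _)
    fromℕ-* (suc m) n = trans (fromℕ-+ n (m * n)) (trans (cong₂ _+ᵣ_ (sym (*ᵣ-identityˡ _)) (fromℕ-* m n)) (sym (*ᵣ-distribʳ (fromℕ n) 1ℝ (fromℕ m))))

    fromℕ-^ : ∀ m k → fromℕ (m ℕ.^ k) ≡ fromℕ m ^ᵣ k
    fromℕ-^ m zero = fromℕ-1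
    fromℕ-^ m (suc k) = trans (fromℕ-* m (m ℕ.^ k)) (cong (fromℕ m *ᵣ_) (fromℕ-^ m k))

    0≤fromℕ : ∀ n → 0ℝ ≤ᵣ fromℕ n
    0≤fromℕ zero = ≤ᵣ-refl
    0≤fromℕ (suc n) = subst (_≤ᵣ fromℕ (suc n)) (+ᵣ-identityʳ 0ℝ) (+ᵣ-mono 0≤1 (0≤fromℕ n))

    fromℕ-mono : ∀ {m n} → m ≤ n → fromℕ m ≤ᵣ fromℕ n
    fromℕ-mono {n = n} z≤n = 0≤fromℕ n
    fromℕ-mono {suc m} {suc n} (s≤s p) = +ᵣ-mono ≤ᵣ-refl (fromℕ-mono {m} {n} p)

    0<fromℕ : ∀ n → 0ℝ <ᵣ fromℕ (suc n)
    0<fromℕ n = <ᵣ-≤ᵣ-trans 0<1 (subst (_≤ᵣ fromℕ (suc n)) fromℕ-1 (fromℕ-mono {1} {suc n} (s≤s z≤n)))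

    fromℕ-cancel : ∀ {m n} → fromℕ m ≤ᵣ fromℕ n → m ≤ n
    fromℕ-cancel {zero} p = z≤n
    fromℕ-cancel {suc m} {zero} p = contradiction p (<⇒≱ᵣ (0<fromℕ m))
    fromℕ-cancel {suc m} {suc n} p = s≤s (fromℕ-cancel (+ᵣ-cancelʳ 1ℝ (subst₂ _≤ᵣ_ (+ᵣ-comm 1ℝ _) (+ᵣ-comm 1ℝ _) p)))

    fromℕ-pred : ∀ n → fromℕ (suc n) ⊖ fromℕ 1 ≡ fromℕ n
    fromℕ-pred n = trans (cong (fromℕ (suc n) ⊖_) fromℕ-1) (add-sub 1ℝ (fromℕ n))

    *-cancel-pos : ∀ {z x y} → 0ℝ <ᵣ z → x *ᵣ z ≤ᵣ y *ᵣ z → x ≤ᵣ y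
    *-cancel-pos {z} {x} {y} (z≥0 , z≢0) p with ≤ᵣ-total x y
    ... | inj₁ q = q
    ... | inj₂ q = ≤ᵣ-reflexive (trans (sym (inv x)) (trans (cong (_*ᵣ z ⁻¹) (≤ᵣ-antisym p (*ᵣ-monoˡ z≥0 q))) (inv y)))
      where
      inv : ∀ x → (x *ᵣ z) *ᵣ z ⁻¹ ≡ x
      inv x = trans (*ᵣ-assoc x z _) (trans (cong (x *ᵣ_) (⁻¹-inverse z λ e → z≢0 (sym e))) (*ᵣ-identityʳ x))

    *-pos : ∀ {x y} → 0ℝ <ᵣ x → 0ℝ <ᵣ y → 0ℝ <ᵣ x *ᵣ y
    *-pos {x} {y} (x≥0 , x≢0) y>0@(y≥0 , y≢0) = *-nonNegative x≥0 y≥0 , λ e →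
      x≢0 (≤ᵣ-antisym x≥0 (*-cancel-pos y>0 (≤ᵣ-reflexive (trans (sym e) (sym (*ᵣ-zeroˡ y))))))

    ⁻¹-inverseˡ : ∀ {x} → 0ℝ <ᵣ x → x ⁻¹ *ᵣ x ≡ 1ℝ
    ⁻¹-inverseˡ {x} (_ , ne) = trans (*ᵣ-comm _ _) (⁻¹-inverse x λ e → ne (sym e))

    ⁻¹-pos : ∀ {x} → 0ℝ <ᵣ x → 0ℝ <ᵣ x ⁻¹
    ⁻¹-pos {x} x>0 = *-cancel-pos x>0 (≤ᵣ-trans (≤ᵣ-reflexive (*ᵣ-zeroˡ x)) (≤ᵣ-trans 0≤1 (≤ᵣ-reflexive (sym (⁻¹-inverseˡ x>0))))) ,
      λ e → 0≢1 (trans (sym (*ᵣ-zeroˡ x)) (trans (cong (_*ᵣ x) e) (⁻¹-inverseˡ x>0)))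

    /≤ : ∀ {x y z} → 0ℝ <ᵣ y → x ≤ᵣ z *ᵣ y → x /ᵣ y ≤ᵣ z
    /≤ {x} {y} {z} y>0 p = *-cancel-pos y>0 (subst (_≤ᵣ z *ᵣ y) (sym (trans (*ᵣ-assoc x _ y) (trans (cong (x *ᵣ_) (⁻¹-inverseˡ y>0)) (*ᵣ-identityʳ x)))) p)

    /-* : ∀ {x y} → 0ℝ <ᵣ y → x /ᵣ y *ᵣ y ≡ x
    /-* {x} {y} y>0 = trans (*ᵣ-assoc x _ y) (trans (cong (x *ᵣ_) (⁻¹-inverseˡ y>0)) (*ᵣ-identityʳ x))

  -- Counting the elements of a list.

  toℕᵇ : Bool → ℕ
  toℕᵇ b = if b then 1 else 0

  module _ {X : Set} where

    -- Medians, cuts and marks are all about the number of points beyond a level, and such counts do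
    -- not depend on the order of a list, which the folds keep reversing.
    # : (X → Bool) → List X → ℕ
    # p [] = 0
    # p (x ∷ xs) = toℕᵇ (p x) + # p xs

    #-++ : ∀ p xs {ys} → # p (xs ++ ys) ≡ # p xs + # p ys
    #-++ p [] = refl
    #-++ p (x ∷ xs) = trans (cong (toℕᵇ (p x) +_) (#-++ p xs)) (sym (ℕ.+-assoc (toℕᵇ (p x)) _ _))

    #-↭ : ∀ p {xs ys} → xs ↭ ys → # p xs ≡ # p ys
    #-↭ p Perm.refl = refl
    #-↭ p (prep x e) = cong (toℕᵇ (p x) +_) (#-↭ p e)
    #-↭ p (swap x y e) = trans (cong (λ n → toℕᵇ (p x) + (toℕᵇ (p y) + n)) (#-↭ p e))
      (ℕ-swap (toℕᵇ (p x)) (toℕᵇ (p y)) _)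
      where
      ℕ-swap : ∀ a b c → a + (b + c) ≡ b + (a + c)
      ℕ-swap = solve-∀
    #-↭ p (Perm.trans e f) = trans (#-↭ p e) (#-↭ p f)

    #-mono : ∀ p q → (∀ x → p x ≡ true → q x ≡ true) → ∀ xs → # p xs ≤ # q xs
    #-mono p q imp [] = z≤n
    #-mono p q imp (x ∷ xs) with p x in eq
    ... | false = ℕ.m≤n⇒m≤o+n (toℕᵇ (q x)) (#-mono p q imp xs)
    ... | true rewrite imp x eq = s≤s (#-mono p q imp xs)

    #≤length : ∀ p xs → # p xs ≤ length xs
    #≤length p [] = z≤n
    #≤length p (x ∷ xs) with p x
    ... | true = s≤s (#≤length p xs)
    ... | false = ℕ.m≤n⇒m≤1+n (#≤length p xs)

    #-none : ∀ p {xs} → All (λ x → p x ≡ false) xs → # p xs ≡ 0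
    #-none p [] = refl
    #-none p (e ∷ es) rewrite e = #-none p es

    #-all : ∀ p {xs} → All (λ x → p x ≡ true) xs → # p xs ≡ length xs
    #-all p [] = refl
    #-all p (e ∷ es) rewrite e = cong suc (#-all p es)

    ʳ++-↭ : ∀ (xs : List X) {ys} → xs ʳ++ ys ↭ xs ++ ys
    ʳ++-↭ xs {ys} = ↭-trans (↭-reflexive (ʳ++-defn xs)) (Permₚ.++⁺ʳ ys (Permₚ.↭-reverse xs))

  #-map : {X Y : Set} (f : X → Y) (p : Y → Bool) (xs : List X) → # p (map f xs) ≡ # (λ x → p (f x)) xs
  #-map f p [] = refl
  #-map f p (x ∷ xs) = cong (toℕᵇ (p (f x)) +_) (#-map f p xs)

  -- Values and step counts of the basic codes, up to merging.

  module Basics (𝓡 : RealNumbers) where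
    open OrderedField 𝓡 public
    open Semantics 𝓡 public

    if≤-le : ∀ x y {a b n} → a ≤ n → b ≤ n → if≤ x y a b ≤ n
    if≤-le x y p q with x ≤ᵣ? y
    ... | yes _ = p
    ... | no _ = q

    cases-le : {X : Set} (xs : List X) {a n : ℕ} {f : X → List X → ℕ} → a ≤ n → (∀ x xs → f x xs ≤ n) → cases xs a f ≤ n
    cases-le [] p q = p
    cases-le (x ∷ xs) p q = q x xs

    iter-map : {X Y : Set} (f : X → Y) (xs : List X) {s : List Y} → iter (λ x s _ → f x ∷ s) xs s ≡ map f xs ʳ++ s
    iter-map f [] = refl
    iter-map f (x ∷ xs) = iter-map f xs

    iterCost-const : {X Y : Set} (b : ℕ) {c : X → Y → List X → ℕ} {f : X → Y → List X → Y} →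
      (∀ x s xs → c x s xs ≤ b) → ∀ xs s → iterCost c f xs s ≤ length xs * suc b
    iterCost-const b le [] s = z≤n
    iterCost-const b le (x ∷ xs) s = ℕ.+-mono-≤ (s≤s (le x s xs)) (iterCost-const b le xs _)

    iterCost-unit : {X Y : Set} {c : X → Y → List X → ℕ} {f : X → Y → List X → Y} →
      (∀ x s xs → c x s xs ≤ 0) → ∀ xs s → iterCost c f xs s ≤ length xs
    iterCost-unit le xs s = ℕ.≤-trans (iterCost-const 0 le xs s) (ℕ.≤-reflexive (ℕ.*-identityʳ _))

    hd : List ℝ → ℝ
    hd xs = cases xs 0ℝ λ x _ → x

    above : ℝ → ℝ → Bool
    above t x = not (does (x ≤ᵣ? t))

    Pt Elem : Set
    Pt = List ℝ
    Elem = Pt × Pt × List ℝ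

    opaque
      unfolding hdE
      ⟦hd⟧ : ∀ xs → ⟦ hdE ⟧ (xs ∷ []) ≡ hd xs
      ⟦hd⟧ xs = refl
      iters-hd : ∀ xs → iters hdE (xs ∷ []) ≤ 0
      iters-hd xs = cases-le xs z≤n λ _ _ → z≤n

    opaque
      unfolding tlE
      ⟦tl⟧ : ∀ {A} xs → ⟦ tlE {A} ⟧ (xs ∷ []) ≡ drop 1 xs
      ⟦tl⟧ [] = refl
      ⟦tl⟧ (x ∷ xs) = refl
      iters-tl : ∀ {A} xs → iters (tlE {A}) (xs ∷ []) ≤ 0
      iters-tl xs = cases-le xs z≤n λ _ _ → z≤n

    opaque
      unfolding revAppE
      ⟦revApp⟧ : ∀ {A} xs ys → ⟦ revAppE {A} ⟧ ((xs , ys) ∷ []) ≡ xs ʳ++ ys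
      ⟦revApp⟧ [] ys = refl
      ⟦revApp⟧ {A} (x ∷ xs) ys = ⟦revApp⟧ {A} xs (x ∷ ys)
      iters-revApp : ∀ {A} xs ys → iters (revAppE {A}) ((xs , ys) ∷ []) ≤ length xs
      iters-revApp xs ys = iterCost-unit (λ _ _ _ → z≤n) xs _

    opaque
      unfolding lenE
      ⟦len⟧ : ∀ {A} xs → ⟦ lenE {A} ⟧ (xs ∷ []) ≡ fromℕ (length xs)
      ⟦len⟧ xs = trans (go xs 0) (cong fromℕ (ℕ.+-identityʳ (length xs)))
        where
        go : ∀ {X : Set} (xs : List X) n → iter (λ _ s _ → s +ᵣ fromℕ 1) xs (fromℕ n) ≡ fromℕ (length xs + n)
        go [] n = refl
        go (x ∷ xs) n rewrite trans (+ᵣ-comm (fromℕ n) (fromℕ 1)) (sym (fromℕ-+ 1 n)) = trans (go xs (suc n)) (cong (λ k → fromℕ k) (ℕ.+-suc (length xs) n))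
      iters-len : ∀ {A} xs → iters (lenE {A}) (xs ∷ []) ≤ length xs
      iters-len xs = iterCost-unit (λ _ _ _ → z≤n) xs _

    opaque
      unfolding initE
      ⟦init⟧ : ∀ xs → ⟦ initE ⟧ (xs ∷ []) ≡ map (λ p → p , p , []) xs ʳ++ []
      ⟦init⟧ xs = iter-map _ xs
      iters-init : ∀ xs → iters initE (xs ∷ []) ≤ length xs
      iters-init xs = iterCost-unit (λ _ _ _ → z≤n) xs _

    opaque
      unfolding keysE
      ⟦keys⟧ : ∀ (xs : List Elem) → ⟦ keysE ⟧ (xs ∷ []) ≡ map (λ x → ⟦ hdE ⟧ (proj₁ x ∷ [])) xs ʳ++ []
      ⟦keys⟧ xs = iter-map _ xs
      iters-keys : ∀ (xs : List Elem) → iters keysE (xs ∷ []) ≤ length xs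
      iters-keys xs = iterCost-unit (λ x _ _ → ℕ.+-mono-≤ (iters-hd (proj₁ x)) z≤n) xs _

    opaque
      unfolding advanceE
      ⟦advance⟧ : ∀ (xs : List Elem) → ⟦ advanceE ⟧ (xs ∷ []) ≡ map (λ x → ⟦ tlE ⟧ (proj₁ x ∷ []) , proj₂ x) xs ʳ++ []
      ⟦advance⟧ xs = iter-map _ xs
      iters-advance : ∀ (xs : List Elem) → iters advanceE (xs ∷ []) ≤ length xs
      iters-advance xs = iterCost-unit (λ x _ _ → ℕ.+-mono-≤ {v = 0} (ℕ.+-mono-≤ {v = 0} (iters-tl {num} (proj₁ x)) z≤n) z≤n) xs _

    opaque
      unfolding fullE
      ⟦full⟧ : ∀ (xs : List Elem) → ⟦ fullE ⟧ (xs ∷ []) ≡ map (λ x → proj₁ (proj₂ x)) xs ʳ++ []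
      ⟦full⟧ xs = iter-map _ xs
      iters-full : ∀ (xs : List Elem) → iters fullE (xs ∷ []) ≤ length xs
      iters-full xs = iterCost-unit (λ x _ _ → z≤n) xs _

    opaque
      unfolding countE
      ⟦count⟧ : ∀ t xs → ⟦ countE ⟧ ((t , xs) ∷ []) ≡ fromℕ (# (above t) xs)
      ⟦count⟧ t xs = trans (go xs 0) (cong fromℕ (ℕ.+-identityʳ (# (above t) xs)))
        where
        go : ∀ xs n → iter (λ x s _ → if≤ x t s (s +ᵣ fromℕ 1)) xs (fromℕ n) ≡ fromℕ (# (above t) xs + n)
        go [] n = refl
        go (x ∷ xs) n with x ≤ᵣ? t
        ... | yes _ = go xs n
        ... | no _ rewrite trans (+ᵣ-comm (fromℕ n) (fromℕ 1)) (sym (fromℕ-+ 1 n)) = trans (go xs (suc n)) (cong (λ k → fromℕ k) (ℕ.+-suc (# (above t) xs) n))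
      iters-count : ∀ t xs → iters countE ((t , xs) ∷ []) ≤ length xs
      iters-count t xs = iterCost-unit (λ x s _ → if≤-le x t z≤n z≤n) xs _

    -- The order is reversed, so that sorting is decreasing and the points above a level form a
    -- prefix.
    DO : DecTotalOrder _ _ _
    DO = Flip.decTotalOrder decTotalOrder

    Decreasing : List ℝ → Set
    Decreasing = Sorted (DecTotalOrder.totalOrder DO)

    mergeR : List ℝ → List ℝ → List ℝ
    mergeR = merge (DecTotalOrder._≤?_ DO)

    mergeR-[] : ∀ xs → mergeR xs [] ≡ xs
    mergeR-[] [] = refl
    mergeR-[] (x ∷ xs) = refl

    #-merge : ∀ q xs ys → # q (mergeR xs ys) ≡ # q xs + # q ys
    #-merge q xs ys = trans (#-↭ q (Permₚ.merge-↭ (DecTotalOrder._≤?_ DO) xs ys)) (#-++ q xs)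

    always : {X : Set} → X → Bool
    always _ = true

    #-always : {X : Set} (xs : List X) → # always xs ≡ length xs
    #-always xs = #-all always (All.universal (λ _ → refl) xs)

    private
      mstep : ℝ → List ℝ × List ℝ × List ℝ → List ℝ → List ℝ × List ℝ × List ℝ
      mstep _ s@(xs , ys , acc) _ = cases xs (cases ys s λ y ys → [] , ys , y ∷ acc) λ x xs →
        cases ys (xs , [] , x ∷ acc) λ y ys → if≤ y x (xs , y ∷ ys , x ∷ acc) (x ∷ xs , ys , y ∷ acc)

      merge-go : ∀ fuel xs ys acc → length xs + length ys ≤ length fuel →
        iter mstep fuel (xs , ys , acc) ≡ ([] , [] , mergeR xs ys ʳ++ acc)
      merge-go [] [] [] acc le = refl
      merge-go (f ∷ fuel) [] [] acc le = merge-go fuel [] [] acc z≤n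
      merge-go (f ∷ fuel) [] (y ∷ ys) acc (s≤s le) = merge-go fuel [] ys (y ∷ acc) le
      merge-go (f ∷ fuel) (x ∷ xs) [] acc (s≤s le) rewrite merge-go fuel xs [] (x ∷ acc) le | mergeR-[] xs = refl
      merge-go (f ∷ fuel) (x ∷ xs) (y ∷ ys) acc (s≤s le) with y ≤ᵣ? x
      ... | yes _ = merge-go fuel xs (y ∷ ys) (x ∷ acc) le
      ... | no _ = merge-go fuel (x ∷ xs) ys (y ∷ acc) (ℕ.≤-trans (ℕ.≤-reflexive (sym (ℕ.+-suc (length xs) (length ys)))) le)

      merge-loop : ∀ xs ys → iter mstep (⟦ revAppE {num} ⟧ ((xs , ys) ∷ [])) (xs , ys , []) ≡ ([] , [] , mergeR xs ys ʳ++ [])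
      merge-loop xs ys = merge-go (⟦ revAppE {num} ⟧ ((xs , ys) ∷ [])) xs ys [] (ℕ.≤-reflexive (sym (trans (cong length (⟦revApp⟧ {num} xs ys)) (length-ʳ++ xs))))

      length-merge : ∀ xs ys → length (mergeR xs ys) ≡ length xs + length ys
      length-merge xs ys = trans (sym (#-always (mergeR xs ys))) (trans (#-merge always xs ys) (cong₂ _+_ (#-always xs) (#-always ys)))

    opaque
      unfolding mergeE
      ⟦merge⟧ : ∀ xs ys → ⟦ mergeE ⟧ ((xs , ys) ∷ []) ≡ mergeR xs ys
      ⟦merge⟧ xs ys = trans (⟦revApp⟧ {num} (proj₂ (proj₂ (iter mstep (⟦ revAppE {num} ⟧ ((xs , ys) ∷ [])) (xs , ys , [])))) [])
        (trans (cong (λ s → proj₂ (proj₂ s) ʳ++ []) (merge-loop xs ys))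
          (trans (ʳ++-ʳ++ (mergeR xs ys)) (++-identityʳ _)))

      iters-merge : ∀ xs ys → iters mergeE ((xs , ys) ∷ []) ≤ 3 * (length xs + length ys)
      iters-merge xs ys = begin
        _ ≤⟨ ℕ.+-mono-≤ (ℕ.+-mono-≤ (iters-revApp {num} xs ys) (iterCost-unit {f = mstep} (λ _ s _ → cases-le (proj₁ s) (cases-le (proj₁ (proj₂ s)) z≤n λ _ _ → z≤n) λ x _ →
                 cases-le (proj₁ (proj₂ s)) z≤n λ y _ → if≤-le y x z≤n z≤n) (⟦ revAppE {num} ⟧ ((xs , ys) ∷ [])) _))
               (iters-revApp {num} (proj₂ (proj₂ (iter mstep (⟦ revAppE {num} ⟧ ((xs , ys) ∷ [])) (xs , ys , [])))) []) ⟩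
        _ ≡⟨ cong₂ (λ a b → length xs + a + b) (trans (cong length (⟦revApp⟧ {num} xs ys)) (length-ʳ++ xs))
               (trans (cong (λ s → length (proj₂ (proj₂ s))) (merge-loop xs ys)) (trans (length-ʳ++ (mergeR xs ys)) (trans (ℕ.+-identityʳ _) (length-merge xs ys)))) ⟩
        length xs + n + n ≤⟨ ℕ.+-monoˡ-≤ n (ℕ.+-monoˡ-≤ n (ℕ.m≤m+n (length xs) (length ys))) ⟩
        n + n + n ≡⟨ arith n ⟩
        3 * n ∎
        where
        open ℕ.≤-Reasoning
        n : ℕ
        n = length xs + length ys
        arith : ∀ n → n + n + n ≡ 3 * n
        arith = solve-∀

    size : List (List ℝ) → ℕ
    size xss = length (concat xss)

    private
      pstep : List ℝ → List (List ℝ) × List (List ℝ) → List (List ℝ) → List (List ℝ) × List (List ℝ)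
      pstep r (pend , done) _ = cases pend (r ∷ [] , done) λ p _ → [] , ⟦ mergeE ⟧ ((p , r) ∷ []) ∷ done

      pcost : List ℝ → List (List ℝ) × List (List ℝ) → List (List ℝ) → ℕ
      pcost r (pend , done) _ = cases pend 0 λ p _ → iters mergeE ((p , r) ∷ []) + 0

      -- That merging preserves the multiset is stated by counts for all predicates. `lengths`
      -- expresses that two runs become one, with weight 2 for a merged run and 1 for a waiting one.
      record Paired (runs pend done : List (List ℝ)) : Set where
        field
          sorted₁ : All Decreasing (proj₁ (iter pstep runs (pend , done)))
          sorted₂ : All Decreasing (proj₂ (iter pstep runs (pend , done)))
          counts  : ∀ q → # q (concat (proj₁ (iter pstep runs (pend , done)))) + # q (concat (proj₂ (iter pstep runs (pend , done))))
                      ≡ # q (concat runs) + (# q (concat pend) + # q (concat done))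
          pend≤1  : length (proj₁ (iter pstep runs (pend , done))) ≤ 1
          lengths : length (proj₁ (iter pstep runs (pend , done))) + 2 * length (proj₂ (iter pstep runs (pend , done)))
                      ≡ length runs + (length pend + 2 * length done)
          cost≤   : iterCost pcost pstep runs (pend , done) ≤ length runs + 3 * (size runs + size pend)

      paired : ∀ runs pend done → length pend ≤ 1 → All Decreasing runs → All Decreasing pend → All Decreasing done → Paired runs pend done
      paired [] pend done le sr sp sd = record { sorted₁ = sp ; sorted₂ = sd ; counts = λ q → refl ; pend≤1 = le ; lengths = refl ; cost≤ = z≤n }
      paired (r ∷ runs) [] done le (s ∷ sr) sp sd = record
        { sorted₁ = R.sorted₁ ; sorted₂ = R.sorted₂ ; pend≤1 = R.pend≤1
        ; counts = λ q → trans (R.counts q) (trans (cong (λ n → # q (concat runs) + (n + # q (concat done))) (#-++ q r))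
            (trans (arith (# q (concat runs)) (# q r) (# q (concat done))) (cong (_+ # q (concat done)) (sym (#-++ q r)))))
        ; lengths = trans R.lengths (ℕ.+-suc (length runs) _)
        ; cost≤ = s≤s (ℕ.≤-trans R.cost≤ (ℕ.≤-reflexive (cong (λ n → length runs + 3 * n)
            (trans (cong (size runs +_) (trans (length-++ r) (ℕ.+-identityʳ _)))
            (trans (ℕ.+-comm (size runs) (length r)) (trans (sym (length-++ r)) (sym (ℕ.+-identityʳ _)))))))) }
        where
        module R = Paired (paired runs (r ∷ []) done (s≤s z≤n) sr (s ∷ []) sd)
        arith : ∀ a b c → a + (b + 0 + c) ≡ b + a + c
        arith = solve-∀
      paired (r ∷ runs) (p ∷ []) done le (s ∷ sr) (s′ ∷ []) sd = record
        { sorted₁ = R.sorted₁ ; sorted₂ = R.sorted₂ ; pend≤1 = R.pend≤1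
        ; counts = λ q → trans (R.counts q) (trans (cong (# q (concat runs) +_) (trans (#-++ q m) (cong (_+ # q (concat done)) (trans (cong (# q) (⟦merge⟧ p r)) (#-merge q p r)))))
            (trans (arith (# q (concat runs)) (# q p) (# q r) (# q (concat done)))
              (cong₂ _+_ (sym (#-++ q r)) (cong (_+ # q (concat done)) (sym (#-++ q p))))))
        ; lengths = trans R.lengths (arith′ (length runs) (length done))
        ; cost≤ = s≤s (begin
            iters mergeE ((p , r) ∷ []) + 0 + _ ≤⟨ ℕ.+-mono-≤ (ℕ.≤-trans (ℕ.≤-reflexive (ℕ.+-identityʳ _)) (iters-merge p r)) R.cost≤ ⟩
            3 * (length p + length r) + (length runs + 3 * (size runs + 0)) ≡⟨ arith″ (length p) (length r) (length runs) (size runs) ⟩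
            length runs + 3 * (length r + size runs + (length p + 0)) ≡⟨ cong₂ (λ a b → length runs + 3 * (a + b)) (sym (length-++ r)) (sym (length-++ p)) ⟩
            length runs + 3 * (size (r ∷ runs) + size (p ∷ [])) ∎) }
        where
        m : List ℝ
        m = ⟦ mergeE ⟧ ((p , r) ∷ [])
        module R = Paired (paired runs [] (m ∷ done) z≤n sr [] (subst Decreasing (sym (⟦merge⟧ p r)) (Sortedₚ.merge⁺ DO s′ s) ∷ sd))
        open ℕ.≤-Reasoning
        arith : ∀ a b c d → a + ((b + c) + d) ≡ (c + a) + ((b + 0) + d)
        arith = solve-∀
        arith′ : ∀ a d → a + (0 + 2 * suc d) ≡ suc a + (1 + 2 * d)
        arith′ = solve-∀
        arith″ : ∀ p r l s → 3 * (p + r) + (l + 3 * (s + 0)) ≡ l + 3 * (r + s + (p + 0))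
        arith″ = solve-∀
      paired (r ∷ runs) (p ∷ _ ∷ _) done (s≤s ()) sr sp sd

    private
      opaque
        unfolding mergePairsE
        mergePairs-unfold : ∀ runs → ⟦ mergePairsE ⟧ (runs ∷ []) ≡
          ⟦ revAppE {list num} ⟧ (iter pstep runs ([] , []) ∷ [])
        mergePairs-unfold runs = refl
        mergePairs-cost : ∀ runs → iters mergePairsE (runs ∷ []) ≡
          iterCost pcost pstep runs ([] , []) + iters (revAppE {list num}) (iter pstep runs ([] , []) ∷ [])
        mergePairs-cost runs = refl

    module MergePairs {runs : List (List ℝ)} (sr : All Decreasing runs) where
      private
        module R = Paired (paired runs [] [] z≤n sr [] [])
        s₁ = proj₁ (iter pstep runs ([] , []))
        s₂ = proj₂ (iter pstep runs ([] , []))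
        eq : ⟦ mergePairsE ⟧ (runs ∷ []) ≡ s₁ ʳ++ s₂
        eq = trans (mergePairs-unfold runs) (⟦revApp⟧ {list num} s₁ s₂)
      mp-sorted : All Decreasing (⟦ mergePairsE ⟧ (runs ∷ []))
      mp-sorted = subst (All Decreasing) (sym eq) (Permₚ.All-resp-↭ (↭-sym (ʳ++-↭ s₁)) (Allₚ.++⁺ R.sorted₁ R.sorted₂))
      mp-counts : ∀ q → # q (concat (⟦ mergePairsE ⟧ (runs ∷ []))) ≡ # q (concat runs)
      mp-counts q = begin
        # q (concat (⟦ mergePairsE ⟧ (runs ∷ []))) ≡⟨ cong (λ xs → # q (concat xs)) eq ⟩
        # q (concat (s₁ ʳ++ s₂))                   ≡⟨ short s₁ R.pend≤1 ⟩
        # q (concat s₁) + # q (concat s₂)          ≡⟨ R.counts q ⟩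
        # q (concat runs) + 0                      ≡⟨ ℕ.+-identityʳ _ ⟩
        # q (concat runs)                          ∎
        where
        open ≡-Reasoning
        short : ∀ xs {ys} → length xs ≤ 1 → # q (concat (xs ʳ++ ys)) ≡ # q (concat xs) + # q (concat ys)
        short [] _ = refl
        short (x ∷ []) _ = trans (#-++ q x) (cong (_+ _) (cong (# q) (sym (++-identityʳ x))))
        short (_ ∷ _ ∷ _) (s≤s ())
      mp-length : 2 * length (⟦ mergePairsE ⟧ (runs ∷ [])) ≤ suc (length runs)
      mp-length = begin
        2 * length (⟦ mergePairsE ⟧ (runs ∷ []))  ≡⟨ cong (2 *_) (trans (cong length eq) (length-ʳ++ s₁)) ⟩
        2 * (length s₁ + length s₂)               ≡⟨ arith (length s₁) (length s₂) ⟩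
        length s₁ + (length s₁ + 2 * length s₂)   ≤⟨ ℕ.+-mono-≤ R.pend≤1 (ℕ.≤-reflexive R.lengths) ⟩
        suc (length runs + 0)                     ≡⟨ cong suc (ℕ.+-identityʳ _) ⟩
        suc (length runs)                         ∎
        where
        open ℕ.≤-Reasoning
        arith : ∀ a b → 2 * (a + b) ≡ a + (a + 2 * b)
        arith = solve-∀
      mp-iters : iters mergePairsE (runs ∷ []) ≤ length runs + 3 * size runs + 1
      mp-iters = ℕ.≤-trans (ℕ.≤-reflexive (mergePairs-cost runs)) (ℕ.+-mono-≤ (ℕ.≤-trans R.cost≤ (ℕ.≤-reflexive (cong (λ n → length runs + 3 * n) (ℕ.+-identityʳ (size runs)))))
        (ℕ.≤-trans (iters-revApp {list num} s₁ s₂) R.pend≤1))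

  n<2^n : ∀ n → n < 2 ℕ.^ n
  n<2^n zero = s≤s z≤n
  n<2^n (suc n) = ℕ.+-mono-≤ (ℕ.≤-trans (s≤s z≤n) (n<2^n n)) (ℕ.≤-trans (n<2^n n) (ℕ.≤-reflexive (sym (ℕ.+-identityʳ _))))

  n≤2^n : ∀ n → n ≤ 2 ℕ.^ n
  n≤2^n n = ℕ.<⇒≤ (n<2^n n)

  -- Merge sort and the median.

  module Median (𝓡 : RealNumbers) where
    open Basics 𝓡

    private
      sstep : ℝ → List (List ℝ) → List ℝ → List (List ℝ)
      sstep _ s _ = cases s s λ _ s′ → cases s′ s λ _ _ → ⟦ mergePairsE ⟧ (s ∷ [])

      scost : ℝ → List (List ℝ) → List ℝ → ℕ
      scost _ s _ = cases s 0 λ _ s′ → cases s′ 0 λ _ _ → iters mergePairsE (s ∷ [])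

      -- `L` bounds the logarithm of the number of runs, `M` their number and the number of
      -- elements. A pass halves the number of runs, so at most `L` passes do work; the others cost
      -- one step each.
      record Merged (fuel : List ℝ) (runs : List (List ℝ)) (M L : ℕ) : Set where
        field
          sorted : All Decreasing (iter sstep fuel runs)
          counts : ∀ q → # q (concat (iter sstep fuel runs)) ≡ # q (concat runs)
          single : length (iter sstep fuel runs) ≤ 1
          cost≤  : iterCost scost sstep fuel runs ≤ length fuel + L * (4 * M + 1)

      few-runs : ∀ fuel runs {M L} → All Decreasing runs → length runs ≤ 1 → Merged fuel runs M L
      few-runs [] runs sr le = record { sorted = sr ; counts = λ _ → refl ; single = le ; cost≤ = z≤n }
      few-runs (f ∷ fuel) [] {M} {L} sr le = record { sorted = R.sorted ; counts = R.counts ; single = R.single ; cost≤ = s≤s R.cost≤ }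
        where module R = Merged (few-runs fuel [] {M} {L} sr le)
      few-runs (f ∷ fuel) (r ∷ []) {M} {L} sr le = record { sorted = R.sorted ; counts = R.counts ; single = R.single ; cost≤ = s≤s R.cost≤ }
        where module R = Merged (few-runs fuel (r ∷ []) {M} {L} sr le)
      few-runs (f ∷ fuel) (r ∷ _ ∷ _) sr (s≤s ())

      halve : ∀ {a b} → 2 * a ≤ suc (2 * b) → a ≤ b
      halve {a} {b} le = ℕ.≮⇒≥ λ b<a → ℕ.<⇒≱ (ℕ.≤-trans (ℕ.≤-reflexive (sym (arith b))) (ℕ.*-monoʳ-≤ 2 b<a)) le
        where
        arith : ∀ b → 2 * suc b ≡ suc (suc (2 * b))
        arith = solve-∀

      merged : ∀ fuel runs M L → All Decreasing runs → length runs ≤ suc (length fuel) → length runs ≤ 2 ℕ.^ L →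
        length runs ≤ M → size runs ≤ M → Merged fuel runs M L
      merged fuel [] M L sr _ _ _ _ = few-runs fuel [] sr z≤n
      merged fuel (r ∷ []) M L sr _ _ _ _ = few-runs fuel (r ∷ []) sr (s≤s z≤n)
      merged [] (r ∷ r′ ∷ runs) M L sr (s≤s ()) _ _ _
      merged (f ∷ fuel) (r ∷ r′ ∷ runs) M zero sr _ (s≤s ()) _ _
      merged (f ∷ fuel) rs@(r ∷ r′ ∷ runs) M (suc L) sr (s≤s le) le2 leM size≤ = record
        { sorted = R.sorted ; counts = λ q → trans (R.counts q) (mp-counts q) ; single = R.single
        ; cost≤ = s≤s (begin
            iters mergePairsE (rs ∷ []) + iterCost scost sstep fuel rs′ ≤⟨ ℕ.+-mono-≤ (ℕ.≤-trans mp-iters (ℕ.+-monoˡ-≤ 1 (ℕ.+-mono-≤ leM (ℕ.*-monoʳ-≤ 3 size≤)))) R.cost≤ ⟩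
            M + 3 * M + 1 + (length fuel + L * (4 * M + 1))             ≡⟨ arith M (length fuel) L ⟩
            length fuel + suc L * (4 * M + 1)                           ∎) }
        where
        open MergePairs {rs} sr
        open ℕ.≤-Reasoning
        arith : ∀ M f L → M + 3 * M + 1 + (f + L * (4 * M + 1)) ≡ f + (suc L) * (4 * M + 1)
        arith = solve-∀
        rs′ : List (List ℝ)
        rs′ = ⟦ mergePairsE ⟧ (rs ∷ [])
        shorter : length rs′ ≤ suc (length runs)
        shorter = halve (ℕ.≤-trans mp-length (ℕ.≤-trans (s≤s (ℕ.m≤m+n (length rs) (length runs))) (ℕ.≤-reflexive (arith′ (length runs)))))
          where
          arith′ : ∀ a → suc (suc (suc a) + a) ≡ suc (2 * suc a)
          arith′ = solve-∀
        module R = Merged (merged fuel rs′ M L mp-sorted (ℕ.≤-trans shorter le)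
          (halve (ℕ.≤-trans mp-length (s≤s le2))) (ℕ.≤-trans shorter (ℕ.≤-trans (ℕ.n≤1+n _) leM))
          (subst (_≤ M) (trans (sym (#-always (concat rs))) (trans (sym (mp-counts always)) (#-always (concat rs′)))) size≤))

      start : List ℝ → List (List ℝ)
      start xs = iter (λ x s _ → (x ∷ []) ∷ s) xs []

      start≡ : ∀ (xs : List ℝ) (s : List (List ℝ)) → iter (λ x s _ → (x ∷ []) ∷ s) xs s ≡ map (_∷ []) xs ʳ++ s
      start≡ xs s = iter-map _ xs

      start-↭ : ∀ xs → start xs ↭ map (_∷ []) xs
      start-↭ xs = ↭-trans (↭-reflexive (start≡ xs [])) (↭-trans (ʳ++-↭ (map (_∷ []) xs)) (↭-reflexive (++-identityʳ _)))

      start-length : ∀ xs → length (start xs) ≡ length xs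
      start-length xs = trans (Permₚ.↭-length (start-↭ xs)) (length-map _ xs)

      start-counts : ∀ q xs → # q (concat (start xs)) ≡ # q xs
      start-counts q xs = trans (go xs []) (ℕ.+-identityʳ (# q xs))
        where
        arith : ∀ a b c → a + (b + c) ≡ b + a + c
        arith = solve-∀
        go : ∀ xs s → # q (concat (iter {ℝ} {List (List ℝ)} (λ x s _ → (x ∷ []) ∷ s) xs s)) ≡ # q xs + # q (concat s)
        go [] s = refl
        go (x ∷ xs) s = trans (go xs ((x ∷ []) ∷ s)) (arith (# q xs) (toℕᵇ (q x)) (# q (concat s)))

      start-sorted : ∀ xs → All Decreasing (start xs)
      start-sorted xs = Permₚ.All-resp-↭ (↭-sym (start-↭ xs)) (Allₚ.map⁺ (All.universal (λ _ → [-]) xs))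

      sorting : ∀ xs M L → length xs ≤ M → length xs ≤ 2 ℕ.^ L → Merged xs (start xs) M L
      sorting xs M L leM le2 = merged xs (start xs) M L (start-sorted xs) (subst (_≤ suc (length xs)) (sym len) (ℕ.n≤1+n _))
        (subst (_≤ 2 ℕ.^ L) (sym len) le2) (subst (_≤ M) (sym len) leM)
        (subst (_≤ M) (sym (trans (sym (#-always (concat (start xs)))) (trans (start-counts always xs) (#-always xs)))) leM)
        where
        len : length (start xs) ≡ length xs
        len = start-length xs

    private
      opaque
        unfolding sortE
        sort-unfold : ∀ xs → ⟦ sortE ⟧ (xs ∷ []) ≡ cases (iter sstep xs (start xs)) [] λ r _ → r
        sort-unfold xs = refl
        sort-cost : ∀ xs → iters sortE (xs ∷ []) ≤ (length xs + iterCost scost sstep xs (start xs)) + 0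
        sort-cost xs = ℕ.+-mono-≤ (ℕ.+-monoˡ-≤ _ (iterCost-unit {f = λ x s _ → (x ∷ []) ∷ s} (λ _ _ _ → z≤n) xs []))
          (cases-le (iter sstep xs (start xs)) z≤n λ _ _ → z≤n)

    sort-decreasing : ∀ xs → Decreasing (⟦ sortE ⟧ (xs ∷ []))
    sort-decreasing xs rewrite sort-unfold xs with iter sstep xs (start xs) | Merged.sorted (sorting xs (length xs) (length xs) ℕ.≤-refl (n≤2^n (length xs)))
    ... | [] | _ = []
    ... | r ∷ _ | s ∷ _ = s

    #-sort : ∀ q xs → # q (⟦ sortE ⟧ (xs ∷ [])) ≡ # q xs
    #-sort q xs = trans (cong (# q) (sort-unfold xs)) (trans (single (iter sstep xs (start xs)) R.single) (trans (R.counts q) (start-counts q xs)))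
      where
      module R = Merged (sorting xs (length xs) (length xs) ℕ.≤-refl (n≤2^n (length xs)))
      single : ∀ rs → length rs ≤ 1 → # q (cases rs [] λ r _ → r) ≡ # q (concat rs)
      single [] _ = refl
      single (r ∷ []) _ = cong (# q) (sym (++-identityʳ r))
      single (_ ∷ _ ∷ _) (s≤s ())

    iters-sort : ∀ xs L → length xs ≤ 2 ℕ.^ L → iters sortE (xs ∷ []) ≤ length xs + (length xs + L * (4 * length xs + 1))
    iters-sort xs L le = ℕ.≤-trans (sort-cost xs) (ℕ.≤-trans (ℕ.≤-reflexive (ℕ.+-identityʳ _))
      (ℕ.+-monoʳ-≤ (length xs) (Merged.cost≤ (sorting xs (length xs) L ℕ.≤-refl le))))

    private
      hstep : ℝ → List ℝ × List ℝ → List ℝ → List ℝ × List ℝ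
      hstep x s _ = cases (proj₂ s) (proj₁ s , x ∷ []) λ _ _ → ⟦ tlE ⟧ (proj₁ s ∷ []) , []

      half-go : ∀ fuel s → proj₁ (iter hstep fuel (s , [])) ≡ drop ⌊ length fuel /2⌋ s
      half-go [] s = refl
      half-go (x ∷ []) s = refl
      half-go (x ∷ y ∷ fuel) s = trans (half-go fuel _) (trans (cong (drop ⌊ length fuel /2⌋) (⟦tl⟧ s))
        (drop-drop 1 ⌊ length fuel /2⌋ s))

    opaque
      unfolding halfE
      ⟦half⟧ : ∀ xs → ⟦ halfE ⟧ (xs ∷ []) ≡ drop ⌊ length xs /2⌋ xs
      ⟦half⟧ xs = half-go xs xs

      iters-half : ∀ xs → iters halfE (xs ∷ []) ≤ length xs
      iters-half xs = iterCost-unit (λ _ s _ → cases-le (proj₂ s) z≤n λ _ _ → ℕ.+-mono-≤ (iters-tl (proj₁ s)) z≤n) xs _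

    atLeast : ℝ → ℝ → Bool
    atLeast t x = does (t ≤ᵣ? x)

    private
      drop-split : ∀ {X : Set} n (xs : List X) → n < length xs → ∃[ y ] ∃[ ys ] drop n xs ≡ y ∷ ys
      drop-split zero (x ∷ xs) _ = x , xs , refl
      drop-split (suc n) (x ∷ xs) (s≤s p) = drop-split n xs p

      AllPairs-take : ∀ {R : ℝ → ℝ → Set} xs {y ys} → AllPairs R (xs ++ y ∷ ys) → All (λ x → R x y) xs
      AllPairs-take [] _ = []
      AllPairs-take (x ∷ xs) (a ∷ as) = All.head (Allₚ.++⁻ʳ xs a) ∷ AllPairs-take xs as

      AllPairs-drop : ∀ {R : ℝ → ℝ → Set} xs {ys} → AllPairs R (xs ++ ys) → AllPairs R ys
      AllPairs-drop [] a = a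
      AllPairs-drop (x ∷ xs) (_ ∷ as) = AllPairs-drop xs as

    above-false : ∀ {t x} → x ≤ᵣ t → above t x ≡ false
    above-false {t} {x} p rewrite dec-true (x ≤ᵣ? t) p = refl

    private
      length-sort : ∀ xs → length (⟦ sortE ⟧ (xs ∷ [])) ≡ length xs
      length-sort xs = trans (sym (#-always (⟦ sortE ⟧ (xs ∷ [])))) (trans (#-sort always xs) (#-always xs))

    private
      opaque
        unfolding medianE
        median-unfold : ∀ xs → ⟦ medianE ⟧ (xs ∷ []) ≡ ⟦ hdE ⟧ (⟦ halfE ⟧ (⟦ sortE ⟧ (xs ∷ []) ∷ []) ∷ [])
        median-unfold xs = refl
        median-cost : ∀ xs → iters medianE (xs ∷ []) ≡ iters sortE (xs ∷ []) + iters halfE (⟦ sortE ⟧ (xs ∷ []) ∷ [])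
          + iters hdE (⟦ halfE ⟧ (⟦ sortE ⟧ (xs ∷ []) ∷ []) ∷ [])
        median-cost xs = refl

    iters-median : ∀ xs L → length xs ≤ 2 ℕ.^ L → iters medianE (xs ∷ []) ≤ 3 * length xs + L * (4 * length xs + 1)
    iters-median xs L le = begin
      _ ≡⟨ median-cost xs ⟩
      _ ≤⟨ ℕ.+-mono-≤ (ℕ.+-mono-≤ (iters-sort xs L le) (ℕ.≤-trans (iters-half (⟦ sortE ⟧ (xs ∷ []))) (ℕ.≤-reflexive (length-sort xs))))
             (iters-hd (⟦ halfE ⟧ (⟦ sortE ⟧ (xs ∷ []) ∷ []))) ⟩
      _ ≡⟨ arith (length xs) (L * (4 * length xs + 1)) ⟩
      3 * length xs + L * (4 * length xs + 1) ∎
      where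
      open ℕ.≤-Reasoning
      arith : ∀ a b → a + (a + b) + a + 0 ≡ 3 * a + b
      arith = solve-∀

    -- The median is the entry at position ⌊n / 2⌋ of the decreasing list: at most that many are
    -- above it, and one more is at least as large. That the second count exceeds one half is what
    -- later provides a point reaching both the median of a coordinate and that of its negative.
    median-spec : ∀ xs → 0 < length xs → let μ = ⟦ medianE ⟧ (xs ∷ []) in
      2 * # (above μ) xs ≤ length xs × length xs < 2 * # (atLeast μ) xs
    median-spec xs pos = subst (λ μ → 2 * # (above μ) xs ≤ length xs × length xs < 2 * # (atLeast μ) xs) (sym μ≡) (few , many)
      where
      S = ⟦ sortE ⟧ (xs ∷ [])
      n = length xs
      h = ⌊ n /2⌋
      h<n : h < n
      h<n = below n pos
        where
        below : ∀ n → 0 < n → ⌊ n /2⌋ < n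
        below (suc n) _ = ℕ.⌊n/2⌋<n n
      sp = drop-split h S (subst (h <_) (sym (length-sort xs)) h<n)
      μ = proj₁ sp
      ys = proj₁ (proj₂ sp)
      S≡ : take h S ++ μ ∷ ys ≡ S
      S≡ = trans (cong (take h S ++_) (sym (proj₂ (proj₂ sp)))) (take++drop≡id h S)
      μ≡ : ⟦ medianE ⟧ (xs ∷ []) ≡ μ
      μ≡ = trans (median-unfold xs) (trans (⟦hd⟧ _) (cong hd (trans (⟦half⟧ S) (trans (cong (λ k → drop ⌊ k /2⌋ S) (length-sort xs)) (proj₂ (proj₂ sp))))))
      pairs : AllPairs (λ x y → y ≤ᵣ x) (take h S ++ μ ∷ ys)
      pairs = subst (AllPairs _) (sym S≡) (Linkedₚ.Linked⇒AllPairs (λ p q → ≤ᵣ-trans q p) (sort-decreasing xs))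
      length-take-S : length (take h S) ≡ h
      length-take-S = trans (length-take h S) (ℕ.m≤n⇒m⊓n≡m (ℕ.≤-trans (ℕ.<⇒≤ h<n) (ℕ.≤-reflexive (sym (length-sort xs)))))
      split : ∀ q → # q xs ≡ # q (take h S) + # q (μ ∷ ys)
      split q = trans (sym (#-sort q xs)) (trans (cong (# q) (sym S≡)) (#-++ q (take h S)))
      2h≤n : 2 * h ≤ n
      2h≤n = ℕ.≤-trans (ℕ.≤-reflexive (cong (h +_) (ℕ.+-identityʳ h))) (ℕ.≤-trans (ℕ.+-monoʳ-≤ h (ℕ.⌊n/2⌋≤⌈n/2⌉ n)) (ℕ.≤-reflexive (ℕ.⌊n/2⌋+⌈n/2⌉≡n n)))
      few : 2 * # (above μ) xs ≤ n
      few = ℕ.≤-trans (ℕ.*-monoʳ-≤ 2 (begin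
        # (above μ) xs ≡⟨ split (above μ) ⟩
        # (above μ) (take h S) + # (above μ) (μ ∷ ys) ≡⟨ cong (# (above μ) (take h S) +_) (#-none (above μ) (above-false ≤ᵣ-refl ∷ All.map above-false (AllPairs.head (AllPairs-drop (take h S) pairs)))) ⟩
        # (above μ) (take h S) + 0 ≡⟨ ℕ.+-identityʳ _ ⟩
        # (above μ) (take h S) ≤⟨ #≤length (above μ) (take h S) ⟩
        length (take h S) ≡⟨ length-take-S ⟩
        h ∎)) 2h≤n
        where open ℕ.≤-Reasoning
      many : n < 2 * # (atLeast μ) xs
      many = ℕ.<-≤-trans n<2h+2 (ℕ.*-monoʳ-≤ 2 (begin
        suc h ≡⟨ ℕ.+-comm 1 h ⟩
        h + 1 ≡⟨ cong (_+ 1) (trans (#-all (atLeast μ) (All.map (λ {x} p → dec-true (μ ≤ᵣ? x) p) (AllPairs-take (take h S) pairs))) length-take-S) ⟨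
        # (atLeast μ) (take h S) + 1 ≤⟨ ℕ.+-monoʳ-≤ (# (atLeast μ) (take h S)) one ⟩
        # (atLeast μ) (take h S) + # (atLeast μ) (μ ∷ ys) ≡⟨ split (atLeast μ) ⟨
        # (atLeast μ) xs ∎))
        where
        open ℕ.≤-Reasoning
        one : 1 ≤ # (atLeast μ) (μ ∷ ys)
        one rewrite dec-true (μ ≤ᵣ? μ) ≤ᵣ-refl = s≤s z≤n
        n<2h+2 : n < 2 * suc h
        n<2h+2 = ℕ.≤-trans (s≤s (ℕ.≤-reflexive (sym (ℕ.⌊n/2⌋+⌈n/2⌉≡n n)))) (ℕ.≤-trans (s≤s (ℕ.+-monoʳ-≤ h (ℕ.⌊n/2⌋-mono (ℕ.n≤1+n (suc n)))))
          (ℕ.≤-reflexive (cong suc (cong (h +_) (sym (ℕ.+-identityʳ (suc h)))))))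

  -- Ladders of thresholds and the payment for a cut.

  ^-distribʳ-* : ∀ k m n → (m * n) ℕ.^ k ≡ m ℕ.^ k * n ℕ.^ k
  ^-distribʳ-* zero m n = refl
  ^-distribʳ-* (suc k) m n = trans (cong (m * n *_) (^-distribʳ-* k m n)) (arith m n (m ℕ.^ k) (n ℕ.^ k))
    where
    arith : ∀ a b c d → a * b * (c * d) ≡ a * c * (b * d)
    arith = solve-∀

  -- A threshold is a fraction (N , D).

  Fraction : Set
  Fraction = ℕ × ℕ

  -- (N / D) ^ (p + 1) ≤ (N′ / D′) ^ p
  record Link (p : ℕ) (x y : Fraction) : Set where
    field
      D>0  : 0 < proj₂ x
      D′>0 : 0 < proj₂ y
      slow : proj₁ x ℕ.^ suc p * proj₂ y ℕ.^ p ≤ proj₁ y ℕ.^ p * proj₂ x ℕ.^ suc p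

  data Ladder (p : ℕ) : Fraction → List Fraction → Fraction → Set where
    stop : ∀ {x} → 0 < proj₂ x → Ladder p x [] x
    _∷_  : ∀ {x y z θ} → Link p x y → Ladder p y θ z → Ladder p x (y ∷ θ) z

  Ladder-end : ∀ {p x θ z} → Ladder p x θ z → 0 < proj₂ z
  Ladder-end (stop pos) = pos
  Ladder-end (_ ∷ l) = Ladder-end l

  -- If c / m is at most a threshold and c′ / m at least the next one, the part
  -- of size c′ pays for all c points above the cut.
  credit : ∀ {p x y c c′ m} → Link p x y → c * proj₂ x ≤ proj₁ x * m → proj₁ y * m < c′ * proj₂ y →
    c ℕ.^ suc p ≤ c′ ℕ.^ p * m
  credit {p} {N , D} {N′ , D′} {c} {c′} {m} link lo hi = ℕ.*-cancelʳ-≤ _ _ (D ℕ.^ suc p * D′ ℕ.^ p) {{nz}} (begin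
    c ℕ.^ suc p * (D ℕ.^ suc p * D′ ℕ.^ p)           ≡⟨ ℕ.*-assoc (c ℕ.^ suc p) _ _ ⟨
    c ℕ.^ suc p * D ℕ.^ suc p * D′ ℕ.^ p             ≡⟨ cong (_* D′ ℕ.^ p) (^-distribʳ-* (suc p) c D) ⟨
    (c * D) ℕ.^ suc p * D′ ℕ.^ p                     ≤⟨ ℕ.*-monoˡ-≤ (D′ ℕ.^ p) (ℕ.^-monoˡ-≤ (suc p) lo) ⟩
    (N * m) ℕ.^ suc p * D′ ℕ.^ p                     ≡⟨ cong (_* D′ ℕ.^ p) (^-distribʳ-* (suc p) N m) ⟩
    N ℕ.^ suc p * m ℕ.^ suc p * D′ ℕ.^ p             ≡⟨ arith₁ (N ℕ.^ suc p) (m ℕ.^ suc p) (D′ ℕ.^ p) ⟩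
    N ℕ.^ suc p * D′ ℕ.^ p * m ℕ.^ suc p             ≤⟨ ℕ.*-monoˡ-≤ (m ℕ.^ suc p) (Link.slow link) ⟩
    N′ ℕ.^ p * D ℕ.^ suc p * (m * m ℕ.^ p)           ≡⟨ arith₂ (N′ ℕ.^ p) (D ℕ.^ suc p) m (m ℕ.^ p) ⟩
    N′ ℕ.^ p * m ℕ.^ p * (m * D ℕ.^ suc p)           ≡⟨ cong (_* (m * D ℕ.^ suc p)) (^-distribʳ-* p N′ m) ⟨
    (N′ * m) ℕ.^ p * (m * D ℕ.^ suc p)               ≤⟨ ℕ.*-monoˡ-≤ (m * D ℕ.^ suc p) (ℕ.^-monoˡ-≤ p (ℕ.<⇒≤ hi)) ⟩
    (c′ * D′) ℕ.^ p * (m * D ℕ.^ suc p)              ≡⟨ cong (_* (m * D ℕ.^ suc p)) (^-distribʳ-* p c′ D′) ⟩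
    c′ ℕ.^ p * D′ ℕ.^ p * (m * D ℕ.^ suc p)          ≡⟨ arith₃ (c′ ℕ.^ p) (D′ ℕ.^ p) m (D ℕ.^ suc p) ⟩
    c′ ℕ.^ p * m * (D ℕ.^ suc p * D′ ℕ.^ p)          ∎)
    where
    open ℕ.≤-Reasoning
    arith₁ : ∀ a b c → a * b * c ≡ a * c * b
    arith₁ = solve-∀
    arith₂ : ∀ a b c d → a * b * (c * d) ≡ a * d * (c * b)
    arith₂ = solve-∀
    arith₃ : ∀ a b c d → a * b * (c * d) ≡ a * c * (d * b)
    arith₃ = solve-∀
    nz : NonZero (D ℕ.^ suc p * D′ ℕ.^ p)
    nz = ℕ.m*n≢0 (D ℕ.^ suc p) (D′ ℕ.^ p) {{ℕ.m^n≢0 D (suc p) {{ℕ.>-nonZero (Link.D>0 link)}}}} {{ℕ.m^n≢0 D′ p {{ℕ.>-nonZero (Link.D′>0 link)}}}}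

  -- Signed coordinates and the search for a level to cut at.

  module Cuts (𝓡 : RealNumbers) where
    open Basics 𝓡
    open Median 𝓡 using (above-false)

    above-true : ∀ {t x} → ¬ (x ≤ᵣ t) → above t x ≡ true
    above-true {t} {x} n rewrite dec-false (x ≤ᵣ? t) n = refl

    above-antitone : ∀ {s t x} → s ≤ᵣ t → above t x ≡ true → above s x ≡ true
    above-antitone {s} {t} {x} le eq with x ≤ᵣ? s | x ≤ᵣ? t
    ... | no _ | _ = refl
    ... | yes p | yes _ = eq
    ... | yes p | no n = contradiction (≤ᵣ-trans p le) n

    -- The value is 0 beyond the length of the point. Such indices are not excluded in `Sep` and are
    -- dealt with by `coord-beyond`.
    coord : ℕ → Pt → ℝ
    coord e p = hd (drop e p)

    full : Elem → Pt
    full x = proj₁ (proj₂ x)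

    flagged : Elem → Bool
    flagged x = cases (proj₂ (proj₂ x)) false λ _ _ → true

    -- The first component holds the coordinates from the e-th on.
    Synced : ℕ → List Elem → Set
    Synced e = All (λ x → proj₁ x ≡ drop e (full x))

    drop-suc : ∀ e (p : Pt) → drop 1 (drop e p) ≡ drop (suc e) p
    drop-suc e p = trans (drop-drop e 1 p) (cong (λ n → drop n p) (ℕ.+-comm e 1))

    Synced-init : ∀ S → Synced 0 (⟦ initE ⟧ (S ∷ []))
    Synced-init S = subst (Synced 0) (sym (⟦init⟧ S)) (Permₚ.All-resp-↭ (↭-sym (ʳ++-↭ (map (λ p → p , p , []) S)))
      (Allₚ.++⁺ (Allₚ.map⁺ (All.universal (λ _ → refl) S)) []))

    full-init : ∀ S → map full (⟦ initE ⟧ (S ∷ [])) ↭ S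
    full-init S = ↭-trans (↭-reflexive (cong (map full) (⟦init⟧ S))) (↭-trans (Permₚ.map⁺ full (↭-trans (ʳ++-↭ (map (λ p → p , p , []) S)) (↭-reflexive (++-identityʳ _))))
      (↭-reflexive (trans (sym (map-∘ S)) (map-id S))))
      where
      map-id : ∀ (S : List Pt) → map (λ p → full (p , p , [])) S ≡ S
      map-id [] = refl
      map-id (p ∷ S) = cong (p ∷_) (map-id S)

    unflagged-init : ∀ S → # flagged (⟦ initE ⟧ (S ∷ [])) ≡ 0
    unflagged-init S = #-none flagged (subst (All (λ x → flagged x ≡ false)) (sym (⟦init⟧ S)) (Permₚ.All-resp-↭ (↭-sym (ʳ++-↭ (map (λ p → p , p , []) S)))
      (Allₚ.++⁺ (Allₚ.map⁺ (All.universal (λ _ → refl) S)) [])))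

    adv : Elem → Elem
    adv x = ⟦ tlE {num} ⟧ (proj₁ x ∷ []) , proj₂ x

    advance-↭ : ∀ els → ⟦ advanceE ⟧ (els ∷ []) ↭ map adv els
    advance-↭ els = ↭-trans (↭-reflexive (⟦advance⟧ els)) (↭-trans (ʳ++-↭ (map adv els)) (↭-reflexive (++-identityʳ _)))

    sync-step : ∀ {e x} → proj₁ x ≡ drop e (full x) → proj₁ (adv x) ≡ drop (suc e) (full x)
    sync-step {e} {x} eq = trans (⟦tl⟧ {num} (proj₁ x)) (trans (cong (drop 1) eq) (drop-suc e (full x)))

    Synced-advance : ∀ {e els} → Synced e els → Synced (suc e) (⟦ advanceE ⟧ (els ∷ []))
    Synced-advance {e} {els} s = Permₚ.All-resp-↭ (↭-sym (advance-↭ els)) (Allₚ.map⁺ (All.map (λ {x} q → sync-step {e} {x} q) s))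

    full-advance : ∀ els → map full (⟦ advanceE ⟧ (els ∷ [])) ↭ map full els
    full-advance els = ↭-trans (Permₚ.map⁺ full (advance-↭ els)) (↭-reflexive (sym (map-∘ els)))

    length-advance : ∀ els → length (⟦ advanceE ⟧ (els ∷ [])) ≡ length els
    length-advance els = trans (Permₚ.↭-length (advance-↭ els)) (length-map adv els)

    flagged-advance : ∀ els → # flagged (⟦ advanceE ⟧ (els ∷ [])) ≡ # flagged els
    flagged-advance els = trans (#-↭ flagged (advance-↭ els)) (#-map adv flagged els)

    #-keys : ∀ {e els} → Synced e els → ∀ q → # q (⟦ keysE ⟧ (els ∷ [])) ≡ # (λ p → q (coord e p)) (map full els)
    #-keys {e} {els} s q = begin
      # q (⟦ keysE ⟧ (els ∷ []))            ≡⟨ cong (# q) (⟦keys⟧ els) ⟩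
      # q (map h els ʳ++ [])                ≡⟨ #-↭ q (↭-trans (ʳ++-↭ (map h els)) (↭-reflexive (++-identityʳ _))) ⟩
      # q (map h els)                       ≡⟨ #-map h q els ⟩
      # (λ x → q (h x)) els                 ≡⟨ go s ⟩
      # (λ x → q (coord e (full x))) els    ≡⟨ #-map full (λ p → q (coord e p)) els ⟨
      # (λ p → q (coord e p)) (map full els) ∎
      where
      open ≡-Reasoning
      h : Elem → ℝ
      h x = ⟦ hdE ⟧ (proj₁ x ∷ [])
      go : ∀ {els} → Synced e els → # (λ x → q (h x)) els ≡ # (λ x → q (coord e (full x))) els
      go [] = refl
      go {x ∷ els} (eq ∷ s) = cong₂ (λ b n → toℕᵇ b + n) (cong q (trans (⟦hd⟧ (proj₁ x)) (cong hd eq))) (go s)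

    length-keys : ∀ (els : List Elem) → length (⟦ keysE ⟧ (els ∷ [])) ≡ length els
    length-keys els = trans (cong length (⟦keys⟧ els)) (trans (length-ʳ++ (map _ els)) (trans (ℕ.+-identityʳ _) (length-map _ els)))

    module _ (w : ℝ) where

      up : ℕ → ℝ → ℝ
      up zero t = t
      up (suc k) t = up k (t +ᵣ w)

      up-≡ : ∀ k t → up k t ≡ t +ᵣ fromℕ k *ᵣ w
      up-≡ zero t = sym (trans (cong (t +ᵣ_) (*ᵣ-zeroˡ w)) (+ᵣ-identityʳ t))
      up-≡ (suc k) t = trans (up-≡ k (t +ᵣ w)) (trans (+ᵣ-assoc t w _) (cong (t +ᵣ_)
        (trans (cong (_+ᵣ fromℕ k *ᵣ w) (sym (*ᵣ-identityˡ w))) (sym (*ᵣ-distribʳ w 1ℝ (fromℕ k))))))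

      module _ (w≥0 : 0ℝ ≤ᵣ w) where

        t≤t+w : ∀ t → t ≤ᵣ t +ᵣ w
        t≤t+w t = subst (_≤ᵣ t +ᵣ w) (+ᵣ-identityʳ t) (+ᵣ-mono ≤ᵣ-refl w≥0)

        t≤up : ∀ k t → t ≤ᵣ up k t
        t≤up zero t = ≤ᵣ-refl
        t≤up (suc k) t = ≤ᵣ-trans (t≤t+w t) (t≤up k (t +ᵣ w))

      toΘ : List Fraction → List (ℝ × ℝ)
      toΘ = map (λ x → fromℕ (proj₁ x) , fromℕ (proj₂ x))

      module _ (m : ℕ) (ks : List ℝ) where
        private
          c : ℝ → ℕ
          c t = # (above t) ks

        -- The trace of a scan. It stops with `thick` when the next level has too many points above
        -- it, and returns the level before that one.
        data Scan : List Fraction → ℝ → List ℝ × ℝ → Set where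
          done  : ∀ {t} → Scan [] t ([] , t)
          thin  : ∀ {x θ t r} → c (t +ᵣ w) * proj₂ x ≤ proj₁ x * m → Scan θ (t +ᵣ w) r → Scan (x ∷ θ) t r
          thick : ∀ {x θ t} → proj₁ x * m < c (t +ᵣ w) * proj₂ x → Scan (x ∷ θ) t (t ∷ [] , t)

        private
          step : ℝ × ℝ → List ℝ × ℝ → List (ℝ × ℝ) → List ℝ × ℝ
          step x s _ = cases (proj₁ s) (if≤ (⟦ countE ⟧ ((proj₂ s +ᵣ w , ks) ∷ []) *ᵣ proj₂ x) (proj₁ x *ᵣ fromℕ m)
            ([] , proj₂ s +ᵣ w) (proj₂ s ∷ [] , proj₂ s)) λ _ _ → s

          found : ∀ Θ t u → iter step Θ (t ∷ [] , u) ≡ (t ∷ [] , u)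
          found [] t u = refl
          found (_ ∷ Θ) t u = found Θ t u

          scanning : ∀ θ t → Scan θ t (iter step (toΘ θ) ([] , t))
          scanning [] t = done
          scanning (x ∷ θ) t with ⟦ countE ⟧ ((t +ᵣ w , ks) ∷ []) *ᵣ fromℕ (proj₂ x) ≤ᵣ? fromℕ (proj₁ x) *ᵣ fromℕ m
          ... | yes p = thin (fromℕ-cancel {c (t +ᵣ w) * proj₂ x} {proj₁ x * m} (subst₂ _≤ᵣ_ (trans (cong (_*ᵣ fromℕ (proj₂ x)) (⟦count⟧ (t +ᵣ w) ks)) (sym (fromℕ-* (c (t +ᵣ w)) (proj₂ x)))) (sym (fromℕ-* (proj₁ x) m)) p)) (scanning θ (t +ᵣ w))
          ... | no np = subst (Scan (x ∷ θ) t) (sym (found (toΘ θ) t t))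
            (thick (ℕ.≰⇒> λ q → np (subst₂ _≤ᵣ_ (trans (fromℕ-* (c (t +ᵣ w)) (proj₂ x)) (sym (cong (_*ᵣ fromℕ (proj₂ x)) (⟦count⟧ (t +ᵣ w) ks)))) (fromℕ-* (proj₁ x) m) (fromℕ-mono {c (t +ᵣ w) * proj₂ x} {proj₁ x * m} q))))

        opaque
          unfolding scanE
          ⟦scan⟧ : ∀ θ μ → Scan θ μ (⟦ scanE ⟧ ((toΘ θ , fromℕ m , w , μ , ks) ∷ []))
          ⟦scan⟧ θ μ = scanning θ μ

          iters-scan : ∀ θ μ → iters scanE ((toΘ θ , fromℕ m , w , μ , ks) ∷ []) ≤ length θ * suc (length ks)
          iters-scan θ μ = ℕ.≤-trans (iterCost-const (length ks) (λ x s _ → cases-le (proj₁ s)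
            (ℕ.≤-trans (ℕ.+-mono-≤ (ℕ.≤-reflexive (trans (ℕ.+-identityʳ _) refl)) (if≤-le (⟦ countE ⟧ ((proj₂ s +ᵣ w , ks) ∷ []) *ᵣ proj₂ x) (proj₁ x *ᵣ fromℕ m) z≤n z≤n))
              (ℕ.≤-trans (ℕ.≤-reflexive (ℕ.+-identityʳ _)) (iters-count (proj₂ s +ᵣ w) ks))) λ _ _ → z≤n) (toΘ θ) _)
            (ℕ.≤-reflexive (cong (_* suc (length ks)) (length-map _ θ)))

        -- Cutting at `s` loses the points above `s` and makes a node of those above `s` + w; the
        -- last inequality is the payment. In the other case the points above the topmost level are
        -- bounded by the last threshold.
        data Found (p : ℕ) (x : Fraction) (θ : List Fraction) (z : Fraction) (t : ℝ) : List ℝ × ℝ → Set where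
          concentrated : c (up (length θ) t) * proj₂ z ≤ proj₁ z * m → Found p x θ z t ([] , up (length θ) t)
          separated : ∀ {s u} → t ≤ᵣ s → s ≤ᵣ up (length θ) t → 0 < c (s +ᵣ w) → c s ℕ.^ suc p ≤ c (s +ᵣ w) ℕ.^ p * m →
            Found p x θ z t (s ∷ [] , u)

        -- The invariant is that the points above the current level are at most the fraction `x` of
        -- `m`. A violation at the next level, together with this invariant, is what `credit` needs.
        scan-found : 0ℝ ≤ᵣ w → ∀ {p x θ z t r} → Ladder p x θ z → c t * proj₂ x ≤ proj₁ x * m → Scan θ t r → Found p x θ z t r
        scan-found w≥0 (stop _) lo done = concentrated lo
        scan-found w≥0 {θ = _ ∷ θ} {t = t} (l ∷ ls) lo (thin lo′ sc) with scan-found w≥0 ls lo′ sc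
        ... | concentrated q = concentrated q
        ... | separated a b d e = separated (≤ᵣ-trans (t≤t+w w≥0 t) a) b d e
        scan-found w≥0 {θ = y ∷ θ} {t = t} (l ∷ ls) lo (thick hi) =
          separated ≤ᵣ-refl (t≤up w≥0 (suc (length θ)) t) (positive (c (t +ᵣ w)) hi) (credit {c = c t} l lo hi)
          where
          positive : ∀ c → proj₁ y * m < c * proj₂ y → 0 < c
          positive (suc c) _ = s≤s z≤n

  -- Cutting a set and marking its outliers.

  module CutMark (𝓡 : RealNumbers) where
    open Basics 𝓡
    open Median 𝓡 using (above-false)
    open Cuts 𝓡

    private
      h : Elem → ℝ
      h x = ⟦ hdE ⟧ (proj₁ x ∷ [])

      h≡ : ∀ {e x} → proj₁ x ≡ drop e (full x) → h x ≡ coord e (full x)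
      h≡ {e} {x} eq = trans (⟦hd⟧ (proj₁ x)) (cong hd eq)

      Sides : Set
      Sides = List Elem × List Pt × List Pt

      cstep : ℝ → ℝ → Elem → Sides → List Elem → Sides
      cstep t t′ x s _ = if≤ (h x) t (adv x ∷ proj₁ s , proj₂ s)
        (if≤ (h x) t′ (proj₁ s , proj₁ (proj₂ s) , full x ∷ proj₂ (proj₂ s)) (proj₁ s , full x ∷ proj₁ (proj₂ s) , proj₂ (proj₂ s)))

    record IsCut (e : ℕ) (t t′ : ℝ) (s : Sides) : Set where
      field
        sync : Synced (suc e) (proj₁ s)
        low  : All (λ x → coord e (full x) ≤ᵣ t) (proj₁ s)
        high : All (λ p → ¬ (coord e p ≤ᵣ t′)) (proj₁ (proj₂ s))
        mid  : All (λ p → ¬ (coord e p ≤ᵣ t) × coord e p ≤ᵣ t′) (proj₂ (proj₂ s))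

    points : Sides → List Pt
    points s = map full (proj₁ s) ++ (proj₁ (proj₂ s) ++ proj₂ (proj₂ s))

    private
      record Result (e : ℕ) (t t′ : ℝ) (els : List Elem) (s s₁ : Sides) : Set₁ where
        field
          isCut : IsCut e t t′ s → IsCut e t t′ s₁
          perm  : points s₁ ↭ map full els ++ points s
          marks : # flagged (proj₁ s₁) ≤ # flagged els + # flagged (proj₁ s)
          keep  : ∀ (Q : Pt × List ℝ → Set) → All (λ x → Q (proj₂ x)) els → All (λ x → Q (proj₂ x)) (proj₁ s) → All (λ x → Q (proj₂ x)) (proj₁ s₁)

      shift-↭ : ∀ {X : Set} (p : X) as bs → as ++ (p ∷ bs) ↭ p ∷ (as ++ bs)
      shift-↭ p as bs = Permₚ.shift p as bs

      cutting : ∀ e t t′ els s → Synced e els → Result e t t′ els s (iter (cstep t t′) els s)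
      cutting e t t′ [] s _ = record { isCut = λ c → c ; perm = ↭-refl ; marks = ℕ.≤-refl ; keep = λ _ _ a → a }
      cutting e t t′ (x ∷ els) s@(L , R , M) (eq ∷ sync) with h x ≤ᵣ? t | h x ≤ᵣ? t′
      ... | yes p | _ = record
        { isCut = λ c → R′.isCut record { sync = sync-step {e} {x} eq ∷ IsCut.sync c ; low = subst (_≤ᵣ t) (h≡ {e} {x} eq) p ∷ IsCut.low c ; high = IsCut.high c ; mid = IsCut.mid c }
        ; perm  = ↭-trans R′.perm (shift-↭ (full x) (map full els) _)
        ; marks = ℕ.≤-trans R′.marks (ℕ.≤-reflexive (arith (# flagged els) (toℕᵇ (flagged x)) (# flagged L)))
        ; keep  = λ { Q (q ∷ qs) a → R′.keep Q qs (q ∷ a) } }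
        where
        module R′ = Result (cutting e t t′ els (adv x ∷ L , R , M) sync)
        arith : ∀ a b c → a + (b + c) ≡ b + a + c
        arith = solve-∀
      ... | no n | yes p = record
        { isCut = λ c → R′.isCut record { sync = IsCut.sync c ; low = IsCut.low c ; high = IsCut.high c
            ; mid = ((λ q → n (subst (_≤ᵣ t) (sym (h≡ {e} {x} eq)) q)) , subst (_≤ᵣ t′) (h≡ {e} {x} eq) p) ∷ IsCut.mid c }
        ; perm  = ↭-trans R′.perm (↭-trans (Permₚ.++⁺ˡ (map full els) (↭-trans (Permₚ.++⁺ˡ (map full L) (shift-↭ (full x) R M)) (shift-↭ (full x) (map full L) (R ++ M))))
            (shift-↭ (full x) (map full els) _))
        ; marks = ℕ.≤-trans R′.marks (ℕ.+-monoˡ-≤ _ (ℕ.m≤n+m (# flagged els) (toℕᵇ (flagged x))))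
        ; keep  = λ { Q (q ∷ qs) a → R′.keep Q qs a } }
        where module R′ = Result (cutting e t t′ els (L , R , full x ∷ M) sync)
      ... | no n | no n′ = record
        { isCut = λ c → R′.isCut record { sync = IsCut.sync c ; low = IsCut.low c
            ; high = (λ q → n′ (subst (_≤ᵣ t′) (sym (h≡ {e} {x} eq)) q)) ∷ IsCut.high c ; mid = IsCut.mid c }
        ; perm  = ↭-trans R′.perm (↭-trans (Permₚ.++⁺ˡ (map full els) (shift-↭ (full x) (map full L) (R ++ M))) (shift-↭ (full x) (map full els) _))
        ; marks = ℕ.≤-trans R′.marks (ℕ.+-monoˡ-≤ _ (ℕ.m≤n+m (# flagged els) (toℕᵇ (flagged x))))
        ; keep  = λ { Q (q ∷ qs) a → R′.keep Q qs a } }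
        where module R′ = Result (cutting e t t′ els (L , full x ∷ R , M) sync)

      opaque
        unfolding cutE
        cut-unfold : ∀ t t′ els → ⟦ cutE ⟧ ((t , t′ , els) ∷ []) ≡ iter (cstep t t′) els ([] , [] , [])
        cut-unfold t t′ els = refl

    opaque
      unfolding cutE
      iters-cut : ∀ t t′ els → iters cutE ((t , t′ , els) ∷ []) ≤ length els
      iters-cut t t′ els = iterCost-unit (λ x _ _ → ℕ.+-mono-≤ {v = 0} (iters-hd (proj₁ x)) (if≤-le (h x) t
        (ℕ.≤-trans (ℕ.≤-reflexive (trans (ℕ.+-identityʳ _) (trans (ℕ.+-identityʳ _) (ℕ.+-identityʳ _)))) (iters-tl {num} (proj₁ x)))
        (ℕ.+-mono-≤ {v = 0} (iters-hd (proj₁ x)) (if≤-le (h x) t′ z≤n z≤n)))) els _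

    module Cut {e : ℕ} {els : List Elem} (s : Synced e els) (t t′ : ℝ) where
      private
        module C = Result (cutting e t t′ els ([] , [] , []) s)
        sides : Sides
        sides = ⟦ cutE ⟧ ((t , t′ , els) ∷ [])
        eq = cut-unfold t t′ els

      cut-is : IsCut e t t′ sides
      cut-is = subst (IsCut e t t′) (sym eq) (C.isCut record { sync = [] ; low = [] ; high = [] ; mid = [] })

      cut-perm : points sides ↭ map full els
      cut-perm = ↭-trans (↭-reflexive (cong points eq)) (↭-trans C.perm (↭-reflexive (++-identityʳ _)))

      cut-marks : # flagged (proj₁ sides) ≤ # flagged els
      cut-marks = subst (λ s → # flagged (proj₁ s) ≤ # flagged els) (sym eq) (ℕ.≤-trans C.marks (ℕ.≤-reflexive (ℕ.+-identityʳ _)))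

      cut-keep : ∀ (Q : Pt × List ℝ → Set) → All (λ x → Q (proj₂ x)) els → All (λ x → Q (proj₂ x)) (proj₁ sides)
      cut-keep Q a = subst (λ s → All (λ x → Q (proj₂ x)) (proj₁ s)) (sym eq) (C.keep Q a [])

      private
        coordAbove : ℝ → Pt → Bool
        coordAbove u p = above u (coord e p)

        split : ∀ q → # q (map full els) ≡ # q (map full (proj₁ sides)) + (# q (proj₁ (proj₂ sides)) + # q (proj₂ (proj₂ sides)))
        split q = trans (sym (#-↭ q cut-perm)) (trans (#-++ q (map full (proj₁ sides))) (cong (# q (map full (proj₁ sides)) +_) (#-++ q (proj₁ (proj₂ sides)))))

      cut-high : t ≤ᵣ t′ → length (proj₁ (proj₂ sides)) ≡ # (coordAbove t′) (map full els)
      cut-high le = sym (trans (split (coordAbove t′)) (cong₂ _+_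
        (#-none (coordAbove t′) (Allₚ.map⁺ (All.map (λ p → above-false (≤ᵣ-trans p le)) (IsCut.low cut-is))))
        (trans (cong₂ _+_ (#-all (coordAbove t′) (All.map above-true (IsCut.high cut-is))) (#-none (coordAbove t′) (All.map (λ p → above-false (proj₂ p)) (IsCut.mid cut-is)))) (ℕ.+-identityʳ _))))

      -- The points lost are all those above `t`, the dropped ones included; this is the count that
      -- the payment covers.
      cut-low : t ≤ᵣ t′ → length (proj₁ sides) + # (coordAbove t) (map full els) ≡ length els
      cut-low le = begin
        length L + # (coordAbove t) (map full els) ≡⟨ cong (length L +_) (trans (split (coordAbove t)) (cong₂ _+_
            (#-none (coordAbove t) (Allₚ.map⁺ (All.map above-false (IsCut.low cut-is))))
            (cong₂ _+_ (#-all (coordAbove t) (All.map (λ n → above-true (λ q → n (≤ᵣ-trans q le))) (IsCut.high cut-is)))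
              (#-all (coordAbove t) (All.map (λ p → above-true (proj₁ p)) (IsCut.mid cut-is)))))) ⟩
        length L + (length R + length M)           ≡⟨ cong (_+ (length R + length M)) (length-map full L) ⟨
        length (map full L) + (length R + length M) ≡⟨ cong (length (map full L) +_) (length-++ R) ⟨
        length (map full L) + length (R ++ M)      ≡⟨ length-++ (map full L) ⟨
        length (points sides)                      ≡⟨ Permₚ.↭-length cut-perm ⟩
        length (map full els)                      ≡⟨ length-map full els ⟩
        length els                                 ∎
        where
        open ≡-Reasoning
        L = proj₁ sides
        R = proj₁ (proj₂ sides)
        M = proj₂ (proj₂ sides)

    mark : ℝ → Elem → Elem
    mark U x = ⟦ tlE {num} ⟧ (proj₁ x ∷ []) , full x , if≤ (h x) U (proj₂ (proj₂ x)) (U ∷ proj₂ (proj₂ x))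

    opaque
      unfolding markE
      mark-↭ : ∀ U els → ⟦ markE ⟧ ((U , els) ∷ []) ↭ map (mark U) els
      mark-↭ U els = ↭-trans (↭-reflexive (iter-map (mark U) els)) (↭-trans (ʳ++-↭ (map (mark U) els)) (↭-reflexive (++-identityʳ _)))

      iters-mark : ∀ U els → iters markE ((U , els) ∷ []) ≤ length els
      iters-mark U els = iterCost-unit (λ x _ _ → ℕ.≤-trans (ℕ.≤-reflexive (ℕ.+-identityʳ _))
        (ℕ.+-mono-≤ {v = 0} (iters-tl {num} (proj₁ x)) (ℕ.+-mono-≤ {v = 0} (iters-hd (proj₁ x)) (if≤-le (h x) U z≤n z≤n)))) els _

    module Mark {e : ℕ} {els : List Elem} (s : Synced e els) (U : ℝ) where

      mark-sync : Synced (suc e) (⟦ markE ⟧ ((U , els) ∷ []))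
      mark-sync = Permₚ.All-resp-↭ (↭-sym (mark-↭ U els)) (Allₚ.map⁺ (All.map (λ {x} q → sync-step {e} {x} q) s))

      mark-perm : map full (⟦ markE ⟧ ((U , els) ∷ [])) ↭ map full els
      mark-perm = ↭-trans (Permₚ.map⁺ full (mark-↭ U els)) (↭-reflexive (sym (map-∘ els)))

      mark-length : length (⟦ markE ⟧ ((U , els) ∷ [])) ≡ length els
      mark-length = trans (Permₚ.↭-length (mark-↭ U els)) (length-map (mark U) els)

      mark-marks : # flagged (⟦ markE ⟧ ((U , els) ∷ [])) ≤ # flagged els + # (λ p → above U (coord e p)) (map full els)
      mark-marks = ℕ.≤-trans (ℕ.≤-reflexive (trans (#-↭ flagged (mark-↭ U els)) (#-map (mark U) flagged els))) (go s)
        where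
        go : ∀ {els} → Synced e els → # (λ x → flagged (mark U x)) els ≤ # flagged els + # (λ p → above U (coord e p)) (map full els)
        go [] = z≤n
        go {x ∷ els} (eq ∷ s) = begin
          toℕᵇ (flagged (mark U x)) + # (λ x → flagged (mark U x)) els ≤⟨ ℕ.+-mono-≤ one (go s) ⟩
          (toℕᵇ (flagged x) + toℕᵇ (above U (coord e (full x)))) + (# flagged els + # (λ p → above U (coord e p)) (map full els)) ≡⟨ arith (toℕᵇ (flagged x)) _ (# flagged els) _ ⟩
          _ ∎
          where
          open ℕ.≤-Reasoning
          arith : ∀ a b c d → (a + b) + (c + d) ≡ (a + c) + (b + d)
          arith = solve-∀
          one : toℕᵇ (flagged (mark U x)) ≤ toℕᵇ (flagged x) + toℕᵇ (above U (coord e (full x)))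
          one with h x ≤ᵣ? U
          ... | yes _ = ℕ.m≤m+n _ _
          ... | no n rewrite above-true (subst (λ y → ¬ (y ≤ᵣ U)) (h≡ {e} {x} eq) n) = ℕ.m≤n+m 1 (toℕᵇ (flagged x))

      mark-keep : ∀ (Q : Pt → Set) → All (λ x → flagged x ≡ false → Q (full x)) els →
        All (λ x → flagged x ≡ false → Q (full x) × coord e (full x) ≤ᵣ U) (⟦ markE ⟧ ((U , els) ∷ []))
      mark-keep Q a = Permₚ.All-resp-↭ (↭-sym (mark-↭ U els)) (Allₚ.map⁺ (go s a))
        where
        go : ∀ {els} → Synced e els → All (λ x → flagged x ≡ false → Q (full x)) els → All (λ x → flagged (mark U x) ≡ false → Q (full x) × coord e (full x) ≤ᵣ U) els
        go [] [] = []
        go {x ∷ els} (eq ∷ s) (q ∷ a) = one ∷ go s a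
          where
          one : flagged (mark U x) ≡ false → Q (full x) × coord e (full x) ≤ᵣ U
          one f with h x ≤ᵣ? U
          ... | yes p = q f , subst (_≤ᵣ U) (h≡ {e} {x} eq) p

  -- The first and last thresholds are at least 2 / 3 and at most 1 / (3 E).
  record Thresholds (p E : ℕ) (θ : List Fraction) : Set where
    field
      {first last} : Fraction
      E>0    : 0 < E
      ladder : Ladder p first θ last
      large  : 2 * proj₂ first ≤ 3 * proj₁ first
      small  : proj₁ last * (3 * E) ≤ proj₂ last

  -- Each part of size c′ pays for c points of a set of m points.
  data Charged {X : Set} (p m : ℕ) : List (List X) → ℕ → Set where
    []  : Charged p m [] 0
    _∷_ : ∀ {R c Rs u} → c ℕ.^ suc p ≤ length R ℕ.^ p * m → Charged p m Rs u → Charged p m (R ∷ Rs) (c + u)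

  -- The pigeonhole principle, carrying along a property of all elements.
  common : {X : Set} (f g : X → Bool) {Q : X → Set} (xs : List X) → All Q xs → length xs < # f xs + # g xs →
    ∃[ x ] Q x × f x ≡ true × g x ≡ true
  common f g [] [] ()
  common f g (x ∷ xs) (q ∷ qs) lt with f x in ef | g x in eg
  ... | true | true = x , q , ef , eg
  ... | true | false = common f g xs qs (ℕ.≤-pred lt)
  ... | false | true = common f g xs qs (ℕ.≤-pred (ℕ.≤-trans lt (ℕ.≤-reflexive (ℕ.+-suc (# f xs) (# g xs)))))
  ... | false | false = common f g xs qs (ℕ.<-trans (ℕ.n<1+n _) lt)

  AllPairs-↭ : {X : Set} {R : X → X → Set} → (∀ {x y} → R x y → R y x) → ∀ {xs ys} → xs ↭ ys → AllPairs R xs → AllPairs R ys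
  AllPairs-↭ sy Perm.refl a = a
  AllPairs-↭ sy (prep x e) (px ∷ a) = Permₚ.All-resp-↭ e px ∷ AllPairs-↭ sy e a
  AllPairs-↭ sy (swap x y e) ((xy ∷ px) ∷ py ∷ a) = (sy xy ∷ Permₚ.All-resp-↭ e py) ∷ Permₚ.All-resp-↭ e px ∷ AllPairs-↭ sy e a
  AllPairs-↭ sy (Perm.trans e f) a = AllPairs-↭ sy f (AllPairs-↭ sy e a)

  concat-ʳ++ : {X : Set} (xs : List (List X)) {ys : List (List X)} → concat (xs ʳ++ ys) ↭ concat xs ++ concat ys
  concat-ʳ++ [] = ↭-refl
  concat-ʳ++ (x ∷ xs) {ys} = ↭-trans (concat-ʳ++ xs) (↭-trans (Permₚ.shifts (concat xs) x) (↭-reflexive (sym (++-assoc x (concat xs) (concat ys)))))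

  module _ {X : Set} where
    open MonoidSolver (Permₚ.++-commutativeMonoid {A = X})

    reorder₅ : ∀ (co ch t n c : List X) → (co ++ ch) ++ (t ++ (n ++ c)) ↭ t ++ ((ch ++ n) ++ (co ++ c))
    reorder₅ = solve 5 (λ co ch t n c → (co ⊕ ch) ⊕ (t ⊕ (n ⊕ c)) ⊜ t ⊕ ((ch ⊕ n) ⊕ (co ⊕ c))) ↭-refl

    reorder₇ : ∀ (t ch n co c re r : List X) → t ++ ((ch ++ n) ++ ((co ++ c) ++ (re ++ r))) ↭ ((ch ++ (co ++ re)) ++ t) ++ (n ++ (c ++ r))
    reorder₇ = solve 7 (λ t ch n co c re r → t ⊕ ((ch ⊕ n) ⊕ ((co ⊕ c) ⊕ (re ⊕ r))) ⊜ ((ch ⊕ (co ⊕ re)) ⊕ t) ⊕ (n ⊕ (c ⊕ r))) ↭-refl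

  length≤concat : {X : Set} (xs : List (List X)) → All (λ c → 0 < length c) xs → length xs ≤ length (concat xs)
  length≤concat [] [] = z≤n
  length≤concat (x ∷ xs) (px ∷ a) = ℕ.≤-trans (ℕ.+-mono-≤ px (length≤concat xs a)) (ℕ.≤-reflexive (sym (length-++ x)))

  power-≤ : ∀ q {a b} → b ℕ.^ suc q ≤ a ℕ.^ suc q → b ≤ a
  power-≤ q {a} {b} le = ℕ.≮⇒≥ λ lt → ℕ.<⇒≱ (ℕ.^-monoˡ-< (suc q) lt) le

  -- One pass over the coordinates of a node.

  module Clustering (𝓡 : RealNumbers) where
    open Basics 𝓡

    module Pass (w : ℝ) (w≥0 : 0ℝ ≤ᵣ w) {p E : ℕ} {θ : List Fraction} (thresholds : Thresholds p E θ) where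
      open Median 𝓡
      open Cuts 𝓡
      open CutMark 𝓡
      open Thresholds thresholds

      k : ℕ
      k = length θ

      param : List (ℝ × ℝ) × ℝ
      param = toΘ w θ , w

      Low High : ℕ → ℝ → List Pt → Set
      Low e t = All (λ x → coord e x ≤ᵣ t)
      High e t = All (λ x → ¬ (coord e x ≤ᵣ t +ᵣ w))

      -- As every axis occurs with both signs, a gap of more than w along an axis has this form for
      -- either of them; the disjunction makes the relation symmetric.
      Sep : List Pt → List Pt → Set
      Sep A B = ∃[ e ] ∃[ t ] ((Low e t A × High e t B) ⊎ (Low e t B × High e t A))

      infix 4 _⊑_
      -- Inclusion of the underlying sets, in the form that hands on properties of all points of a
      -- node.
      _⊑_ : List Pt → List Pt → Set₁
      A ⊑ B = ∀ (Q : Pt → Set) → All Q B → All Q A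

      sep-⊑ : ∀ {A A′ B B′} → A′ ⊑ A → B′ ⊑ B → Sep A B → Sep A′ B′
      sep-⊑ f g (e , t , inj₁ (lo , hi)) = e , t , inj₁ (f _ lo , g _ hi)
      sep-⊑ f g (e , t , inj₂ (lo , hi)) = e , t , inj₂ (g _ lo , f _ hi)

      sep-sym : ∀ {A B} → Sep A B → Sep B A
      sep-sym (e , t , inj₁ s) = e , t , inj₂ s
      sep-sym (e , t , inj₂ s) = e , t , inj₁ s

      ⊑-refl : ∀ {A} → A ⊑ A
      ⊑-refl Q a = a

      ↭⇒⊑ : ∀ {A B} → A ↭ B → A ⊑ B
      ↭⇒⊑ perm Q a = Permₚ.All-resp-↭ (↭-sym perm) a

      module _ (S : List Pt) where
        m₀ : ℕ
        m₀ = length S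

        advs : ℕ → List Elem
        advs zero = ⟦ initE ⟧ (S ∷ [])
        advs (suc e) = ⟦ advanceE ⟧ (advs e ∷ [])

        advs-sync : ∀ e → Synced e (advs e)
        advs-sync zero = Synced-init S
        advs-sync (suc e) = Synced-advance {e} {advs e} (advs-sync e)

        advs-full : ∀ e → map full (advs e) ↭ S
        advs-full zero = full-init S
        advs-full (suc e) = ↭-trans (full-advance (advs e)) (advs-full e)

        length-advs : ∀ e → length (advs e) ≡ m₀
        length-advs e = trans (sym (length-map full (advs e))) (Permₚ.↭-length (advs-full e))

        med : ℕ → ℝ
        med e = ⟦ medianE ⟧ (⟦ keysE ⟧ (advs e ∷ []) ∷ [])

        -- The topmost level of the scan; a core lies below it in every signed coordinate.
        bound : ℕ → ℝ
        bound e = up w k (med e)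

        private
          counts : ∀ e q → # q (⟦ keysE ⟧ (advs e ∷ [])) ≡ # (λ x → q (coord e x)) S
          counts e q = trans (#-keys {e} {advs e} (advs-sync e) q) (#-↭ _ (advs-full e))

          key-length : ∀ e → length (⟦ keysE ⟧ (advs e ∷ [])) ≡ m₀
          key-length e = trans (length-keys (advs e)) (length-advs e)

        med-above : 0 < m₀ → ∀ e → 2 * # (λ x → above (med e) (coord e x)) S ≤ m₀
        med-above pos e = subst₂ _≤_ (cong (2 *_) (counts e (above (med e)))) (key-length e)
          (proj₁ (median-spec (⟦ keysE ⟧ (advs e ∷ [])) (subst (0 <_) (sym (key-length e)) pos)))

        med-atLeast : 0 < m₀ → ∀ e → m₀ < 2 * # (λ x → atLeast (med e) (coord e x)) S
        med-atLeast pos e = subst₂ _<_ (key-length e) (cong (2 *_) (counts e (atLeast (med e))))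
          (proj₂ (median-spec (⟦ keysE ⟧ (advs e ∷ [])) (subst (0 <_) (sym (key-length e)) pos)))

        St : Set
        St = List Elem × List Elem × List (List Pt) × List Pt

        -- `paid` counts all points that have left the current set, dropped ones included. `bounded`
        -- is claimed only while 3/4 of the node are left, since later coordinates are skipped. In
        -- `marks`, each of the `e` coordinates may mark a fraction 1 / 3 E of the node.
        record Inv (e : ℕ) (st : St) : Set where
          els = proj₁ (proj₂ st)
          children = proj₁ (proj₂ (proj₂ st))
          rest = proj₂ (proj₂ (proj₂ st))
          field
            start    : proj₁ st ≡ advs e
            sync     : Synced e els
            perm     : map full els ++ (concat children ++ rest) ↭ S
            bounded  : 3 * m₀ ≤ 4 * length els →
              All (λ x → flagged x ≡ false → ∀ e′ → e′ < e → coord e′ (full x) ≤ᵣ bound e′) els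
            marks    : 3 * E * # flagged els ≤ e * m₀
            nonempty : All (λ c → 0 < length c) children
            light    : All (λ c → 4 * length c ≤ 3 * m₀) children
            sep      : AllPairs Sep (map full els ∷ children)
            {paid}   : ℕ
            charged  : Charged p m₀ children paid
            total    : paid + length els ≡ m₀

          length-els : length els ≤ m₀
          length-els = subst (length els ≤_) total (ℕ.m≤n+m _ paid)

          count≤ : ∀ q → # q (map full els) ≤ # q S
          count≤ q = subst (# q (map full els) ≤_) (trans (sym (#-++ q (map full els))) (#-↭ q perm)) (ℕ.m≤m+n _ _)

        scanned : St → List ℝ × ℝ
        scanned (S₀ , els , _) = ⟦ scanE ⟧ ((toΘ w θ , ⟦ lenE {El} ⟧ (els ∷ []) , w , ⟦ medianE ⟧ (⟦ keysE ⟧ (S₀ ∷ []) ∷ []) , ⟦ keysE ⟧ (els ∷ [])) ∷ [])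

        next : St → St
        next st@(S₀ , els , children , rest) = if≤ (fromℕ 3 *ᵣ ⟦ lenE {El} ⟧ (S₀ ∷ [])) (fromℕ 4 *ᵣ ⟦ lenE {El} ⟧ (els ∷ []))
          (cases (proj₁ (scanned st))
            (⟦ advanceE ⟧ (S₀ ∷ []) , ⟦ markE ⟧ ((proj₂ (scanned st) , els) ∷ []) , children , rest)
            λ t _ → let c = ⟦ cutE ⟧ ((t , t +ᵣ w , els) ∷ []) in
              ⟦ advanceE ⟧ (S₀ ∷ []) , proj₁ c , proj₁ (proj₂ c) ∷ children , ⟦ revAppE {P} ⟧ ((proj₂ (proj₂ c) , rest) ∷ []))
          (⟦ advanceE ⟧ (S₀ ∷ []) , ⟦ advanceE ⟧ (els ∷ []) , children , rest)

        opaque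
          unfolding stepE
          ⟦step⟧ : ∀ st → ⟦ stepE ⟧ ((param , st) ∷ []) ≡ next st
          ⟦step⟧ st = refl

        private
          heavy? : ∀ (S₀ els : List Elem) → fromℕ 3 *ᵣ ⟦ lenE {El} ⟧ (S₀ ∷ []) ≡ fromℕ (3 * length S₀) × fromℕ 4 *ᵣ ⟦ lenE {El} ⟧ (els ∷ []) ≡ fromℕ (4 * length els)
          heavy? S₀ els = trans (cong (fromℕ 3 *ᵣ_) (⟦len⟧ {El} S₀)) (sym (fromℕ-* 3 (length S₀))) ,
            trans (cong (fromℕ 4 *ᵣ_) (⟦len⟧ {El} els)) (sym (fromℕ-* 4 (length els)))

        module _ (pos : 0 < m₀) where

          skip : ∀ {e els children rest} → Inv e (advs e , els , children , rest) → ¬ (3 * m₀ ≤ 4 * length els) →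
            Inv (suc e) (advs (suc e) , ⟦ advanceE ⟧ (els ∷ []) , children , rest)
          skip {e} {els} {children} I light′ = record
            { start = refl ; sync = Synced-advance {e} {els} I.sync
            ; perm = ↭-trans (Permₚ.++⁺ʳ _ (full-advance els)) I.perm
            ; bounded = λ h → contradiction (subst (λ n → 3 * m₀ ≤ 4 * n) (length-advance els) h) light′
            ; marks = ℕ.≤-trans (subst (λ n → 3 * E * n ≤ e * m₀) (sym (flagged-advance els)) I.marks) (ℕ.m≤n+m _ m₀)
            ; nonempty = I.nonempty ; light = I.light
            ; sep = All.map (sep-⊑ (↭⇒⊑ (full-advance els)) ⊑-refl) (AllPairs.head I.sep) ∷ AllPairs.tail I.sep
            ; charged = I.charged ; total = trans (cong (I.paid +_) (length-advance els)) I.total }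
            where module I = Inv I

          module _ {e : ℕ} {els : List Elem} {children : List (List Pt)} {rest : List Pt} (I : Inv e (advs e , els , children , rest)) (heavy : 3 * m₀ ≤ 4 * length els) where
            private
              module I = Inv I
              ks = ⟦ keysE ⟧ (els ∷ [])

              c : ℝ → ℕ
              c t = # (λ x → above t (coord e x)) (map full els)

              count-ks : ∀ t → # (above t) ks ≡ c t
              count-ks t = #-keys {e} {els} I.sync (above t)

              -- At most half of the node is above its median, and half of the node is at most 2/3
              -- of a heavy current set, hence within the first threshold.
              start-ok : # (above (med e)) ks * proj₂ first ≤ proj₁ first * length els
              start-ok = ℕ.*-cancelˡ-≤ 6 (begin
                6 * (# (above (med e)) ks * D)    ≡⟨ cong (λ n → 6 * (n * D)) (count-ks (med e)) ⟩
                6 * (c (med e) * D)               ≡⟨ arith₁ (c (med e)) D ⟩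
                3 * (2 * c (med e)) * D           ≤⟨ ℕ.*-monoˡ-≤ D (ℕ.*-monoʳ-≤ 3 (ℕ.≤-trans (ℕ.*-monoʳ-≤ 2 (I.count≤ _)) (med-above pos e))) ⟩
                3 * m₀ * D                        ≤⟨ ℕ.*-monoˡ-≤ D heavy ⟩
                4 * length els * D                ≡⟨ arith₂ (length els) D ⟩
                2 * length els * (2 * D)          ≤⟨ ℕ.*-monoʳ-≤ (2 * length els) large ⟩
                2 * length els * (3 * N)          ≡⟨ arith₃ (length els) N ⟩
                6 * (N * length els)              ∎)
                where
                open ℕ.≤-Reasoning
                N = proj₁ first
                D = proj₂ first
                arith₁ : ∀ c D → 6 * (c * D) ≡ 3 * (2 * c) * D
                arith₁ = solve-∀
                arith₂ : ∀ l D → 4 * l * D ≡ 2 * l * (2 * D)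
                arith₂ = solve-∀
                arith₃ : ∀ l N → 2 * l * (3 * N) ≡ 6 * (N * l)
                arith₃ = solve-∀

            found : Found w (length els) ks p first θ last (med e) (scanned (advs e , els , children , rest))
            found = scan-found w (length els) ks w≥0 ladder start-ok
              (subst (λ m → Scan w (length els) ks θ (med e) (⟦ scanE ⟧ ((toΘ w θ , m , w , med e , ks) ∷ []))) (sym (⟦len⟧ {El} els)) (⟦scan⟧ w (length els) ks θ (med e)))

            marked : # (above (bound e)) ks * proj₂ last ≤ proj₁ last * length els →
              Inv (suc e) (advs (suc e) , ⟦ markE ⟧ ((bound e , els) ∷ []) , children , rest)
            marked few = record
              { start = refl ; sync = mark-sync
              ; perm = ↭-trans (Permₚ.++⁺ʳ _ mark-perm) I.perm
              ; bounded = λ _ → All.map (λ f u → combine (f u)) (mark-keep (λ q → ∀ e′ → e′ < e → coord e′ q ≤ᵣ bound e′) (I.bounded heavy))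
              ; marks = begin
                  3 * E * # flagged (⟦ markE ⟧ ((bound e , els) ∷ [])) ≤⟨ ℕ.*-monoʳ-≤ (3 * E) mark-marks ⟩
                  3 * E * (# flagged els + c (bound e))                ≡⟨ ℕ.*-distribˡ-+ (3 * E) (# flagged els) _ ⟩
                  3 * E * # flagged els + 3 * E * c (bound e)          ≤⟨ ℕ.+-mono-≤ I.marks (ℕ.≤-trans rare I.length-els) ⟩
                  e * m₀ + m₀                                          ≡⟨ ℕ.+-comm (e * m₀) m₀ ⟩
                  suc e * m₀                                           ∎
              ; nonempty = I.nonempty ; light = I.light
              ; sep = All.map (sep-⊑ (↭⇒⊑ mark-perm) ⊑-refl) (AllPairs.head I.sep) ∷ AllPairs.tail I.sep
              ; charged = I.charged ; total = trans (cong (I.paid +_) mark-length) I.total }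
              where
              open Mark {e} {els} I.sync (bound e)
              open ℕ.≤-Reasoning
              combine : ∀ {q} → (∀ e′ → e′ < e → coord e′ q ≤ᵣ bound e′) × coord e q ≤ᵣ bound e → ∀ e′ → e′ < suc e → coord e′ q ≤ᵣ bound e′
              combine (f , g) e′ (s≤s le) with ℕ.m≤n⇒m<n∨m≡n le
              ... | inj₁ lt = f e′ lt
              ... | inj₂ refl = g
              -- The last threshold is at most 1 / 3 E, so that all `E` coordinates together mark at
              -- most a third of the node.
              rare : 3 * E * c (bound e) ≤ length els
              rare = ℕ.*-cancelʳ-≤ _ _ D {{ℕ.>-nonZero (Ladder-end ladder)}} (begin
                3 * E * c (bound e) * D    ≡⟨ arith (3 * E) (c (bound e)) D ⟩
                c (bound e) * D * (3 * E)  ≤⟨ ℕ.*-monoˡ-≤ (3 * E) (subst (λ n → n * D ≤ N * length els) (count-ks (bound e)) few) ⟩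
                N * length els * (3 * E)   ≡⟨ arith′ N (length els) (3 * E) ⟩
                N * (3 * E) * length els   ≤⟨ ℕ.*-monoˡ-≤ (length els) small ⟩
                D * length els             ≡⟨ ℕ.*-comm D _ ⟩
                length els * D             ∎)
                where
                N = proj₁ last
                D = proj₂ last
                arith : ∀ a b c → a * b * c ≡ b * c * a
                arith = solve-∀
                arith′ : ∀ a b c → a * b * c ≡ a * c * b
                arith′ = solve-∀

            cutted : ∀ {t} → med e ≤ᵣ t → t ≤ᵣ bound e → 0 < # (above (t +ᵣ w)) ks →
              # (above t) ks ℕ.^ suc p ≤ # (above (t +ᵣ w)) ks ℕ.^ p * length els →
              let c = ⟦ cutE ⟧ ((t , t +ᵣ w , els) ∷ []) in
              Inv (suc e) (advs (suc e) , proj₁ c , proj₁ (proj₂ c) ∷ children , ⟦ revAppE {P} ⟧ ((proj₂ (proj₂ c) , rest) ∷ []))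
            cutted {t} ≥med ≤bound some pays = record
              { start = refl ; sync = IsCut.sync cut-is
              ; perm = ↭-trans (Permₚ.++⁺ˡ (map full L) (rearrange (proj₂ (proj₂ sides)) (concat children) rest))
                  (↭-trans (↭-reflexive (sym (++-assoc (map full L) _ _))) (↭-trans (Permₚ.++⁺ʳ _ cut-perm) I.perm))
              ; bounded = λ _ → All.zipWith (λ { (f , g) u e′ lt → combine (f u) g e′ lt })
                  (cut-keep (λ q → cases (proj₂ q) false (λ _ _ → true) ≡ false → ∀ e′ → e′ < e → coord e′ (proj₁ q) ≤ᵣ bound e′) (I.bounded heavy) , IsCut.low cut-is)
              ; marks = ℕ.≤-trans (ℕ.*-monoʳ-≤ (3 * E) cut-marks) (ℕ.≤-trans I.marks (ℕ.m≤n+m _ m₀))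
              ; nonempty = subst (0 <_) (trans (count-ks _) (sym (cut-high t≤t′))) some ∷ I.nonempty
              ; light = half ∷ I.light
              ; sep = ((e , t , inj₁ (Allₚ.map⁺ (IsCut.low cut-is) , IsCut.high cut-is)) ∷ All.map (sep-⊑ L⊑ ⊑-refl) (AllPairs.head I.sep))
                  ∷ (All.map (sep-⊑ R⊑ ⊑-refl) (AllPairs.head I.sep) ∷ AllPairs.tail I.sep)
              ; charged = subst₂ (λ a b → a ℕ.^ suc p ≤ b ℕ.^ p * m₀) (count-ks t) (trans (count-ks _) (sym (cut-high t≤t′)))
                  (ℕ.≤-trans pays (ℕ.*-monoʳ-≤ (# (above (t +ᵣ w)) ks ℕ.^ p) I.length-els)) ∷ I.charged
              ; total = trans (arith (c t) I.paid (length L)) (trans (cong (I.paid +_) (cut-low t≤t′)) I.total) }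
              where
              open Cut {e} {els} I.sync t (t +ᵣ w)
              sides = ⟦ cutE ⟧ ((t , t +ᵣ w , els) ∷ [])
              L = proj₁ sides
              R = proj₁ (proj₂ sides)
              t≤t′ = t≤t+w w w≥0 t
              arith : ∀ a b c → (a + b) + c ≡ b + (c + a)
              arith = solve-∀
              L⊑ : map full L ⊑ map full els
              L⊑ Q a = proj₁ (Allₚ.++⁻ (map full L) (Permₚ.All-resp-↭ (↭-sym cut-perm) a))
              R⊑ : R ⊑ map full els
              R⊑ Q a = proj₁ (Allₚ.++⁻ R (proj₂ (Allₚ.++⁻ (map full L) (Permₚ.All-resp-↭ (↭-sym cut-perm) a))))
              combine : ∀ {q} → (∀ e′ → e′ < e → coord e′ q ≤ᵣ bound e′) → coord e q ≤ᵣ t → ∀ e′ → e′ < suc e → coord e′ q ≤ᵣ bound e′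
              combine f g e′ (s≤s le) with ℕ.m≤n⇒m<n∨m≡n le
              ... | inj₁ lt = f e′ lt
              ... | inj₂ refl = ≤ᵣ-trans g ≤bound
              rearrange : ∀ (M C rest : List Pt) → (R ++ C) ++ ⟦ revAppE {P} ⟧ ((M , rest) ∷ []) ↭ (R ++ M) ++ (C ++ rest)
              rearrange M C rest = ↭-trans (Permₚ.++⁺ˡ (R ++ C) (↭-trans (↭-reflexive (⟦revApp⟧ {P} M rest)) (ʳ++-↭ M)))
                (↭-trans (↭-reflexive (++-assoc R C (M ++ rest))) (↭-trans (Permₚ.++⁺ˡ R (Permₚ.shifts C M)) (↭-reflexive (sym (++-assoc R M (C ++ rest))))))
              -- The level is at or above the median of the node, so at most half of its points are
              -- cut off. The weaker bound 3/4 is the one shared with the remainder of a light pass.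
              half : 4 * length R ≤ 3 * m₀
              half = begin
                4 * length R                 ≡⟨ cong (4 *_) (cut-high t≤t′) ⟩
                4 * c (t +ᵣ w)               ≤⟨ ℕ.*-monoʳ-≤ 4 (ℕ.≤-trans (#-mono _ _ (λ x → above-antitone (≤ᵣ-trans ≥med t≤t′)) (map full els)) (I.count≤ _)) ⟩
                4 * # (λ x → above (med e) (coord e x)) S ≡⟨ ℕ.*-assoc 2 2 (# (λ x → above (med e) (coord e x)) S) ⟩
                2 * (2 * # (λ x → above (med e) (coord e x)) S) ≤⟨ ℕ.*-monoʳ-≤ 2 (med-above pos e) ⟩
                2 * m₀                       ≤⟨ ℕ.*-monoˡ-≤ m₀ (ℕ.n≤1+n 2) ⟩
                3 * m₀                       ∎
                where open ℕ.≤-Reasoning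

          inv-next : ∀ {e st} → Inv e st → Inv (suc e) (next st)
          inv-next {e} {S₀ , els , children , rest} I with Inv.start I
          ... | refl with fromℕ 3 *ᵣ ⟦ lenE {El} ⟧ (advs e ∷ []) ≤ᵣ? fromℕ 4 *ᵣ ⟦ lenE {El} ⟧ (els ∷ [])
          ... | no n = skip I λ h → n (subst₂ _≤ᵣ_ (trans (cong (λ m → fromℕ (3 * m)) (sym (length-advs e))) (sym (proj₁ (heavy? (advs e) els)))) (sym (proj₂ (heavy? (advs e) els)))
            (fromℕ-mono {3 * m₀} {4 * length els} h))
          ... | yes q = go _ (found I heavy)
            where
            heavy : 3 * m₀ ≤ 4 * length els
            heavy = fromℕ-cancel {3 * m₀} {4 * length els} (subst₂ _≤ᵣ_ (trans (proj₁ (heavy? (advs e) els)) (cong (λ m → fromℕ (3 * m)) (length-advs e))) (proj₂ (heavy? (advs e) els)) q)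
            go : ∀ r → Found w (length els) (⟦ keysE ⟧ (els ∷ [])) p first θ last (med e) r → Inv (suc e) (cases (proj₁ r)
              (⟦ advanceE ⟧ (advs e ∷ []) , ⟦ markE ⟧ ((proj₂ r , els) ∷ []) , children , rest)
              λ t _ → let c = ⟦ cutE ⟧ ((t , t +ᵣ w , els) ∷ []) in
                ⟦ advanceE ⟧ (advs e ∷ []) , proj₁ c , proj₁ (proj₂ c) ∷ children , ⟦ revAppE {P} ⟧ ((proj₂ (proj₂ c) , rest) ∷ []))
            go _ (concentrated few) = marked I heavy few
            go _ (separated a b d pays) = cutted I heavy a b d pays

    -- From a pass to the core and the children of a node.

    module Nodes (w : ℝ) (w≥0 : 0ℝ ≤ᵣ w) {p E : ℕ} {θ : List Fraction} (thresholds : Thresholds p E θ) where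
      open Median 𝓡
      open Cuts 𝓡
      open CutMark 𝓡
      open Pass w w≥0 thresholds public

      private
        +-≤0 : ∀ {a n} → a ≤ n → a + 0 ≤ n
        +-≤0 le = ℕ.≤-trans (ℕ.≤-reflexive (ℕ.+-identityʳ _)) le

      -- Sorting the keys takes O(n L) steps, and counting at each of the k levels O(n k).
      stepBound : ℕ → ℕ → ℕ
      stepBound n L = n * (11 + 5 * L + 2 * k)

      opaque
        unfolding stepE
        iters-step : ∀ {n L} S₀ els (children : List (List Pt)) (rest : List Pt) → 0 < n → length S₀ ≡ n → length els ≤ n → n ≤ 2 ℕ.^ L →
          (∀ t → length (proj₂ (proj₂ (⟦ cutE ⟧ ((t , t +ᵣ w , els) ∷ [])))) ≤ n) →
          iters stepE ((param , S₀ , els , children , rest) ∷ []) ≤ stepBound n L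
        iters-step {n} {L} S₀ els children rest pos refl le le2 mid = begin
          _ ≤⟨ ℕ.+-mono-≤ (ℕ.≤-trans (iters-len {El} els) le) (ℕ.+-mono-≤ (iters-len {El} S₀)
                (if≤-le (fromℕ 3 *ᵣ ⟦ lenE {El} ⟧ (S₀ ∷ [])) (fromℕ 4 *ᵣ ⟦ lenE {El} ⟧ (els ∷ []))
                  (ℕ.+-mono-≤ (ℕ.+-mono-≤ (ℕ.+-mono-≤ (ℕ.+-mono-≤ (iters-keys S₀) medianCost) (ℕ.≤-trans (iters-keys els) le)) scanCost)
                    (cases-le (proj₁ sc) (ℕ.+-mono-≤ {u = _} (ℕ.≤-trans (iters-advance S₀) ℕ.≤-refl) (+-≤0 (ℕ.≤-trans (iters-mark (proj₂ sc) els) (ℕ.≤-trans le (ℕ.m≤n+m n n)))))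
                      λ t _ → ℕ.≤-trans (ℕ.+-mono-≤ (ℕ.≤-trans (iters-cut t (t +ᵣ w) els) le) (ℕ.+-mono-≤ (iters-advance S₀)
                        (ℕ.≤-trans (iters-revApp {P} (proj₂ (proj₂ (⟦ cutE ⟧ ((t , t +ᵣ w , els) ∷ [])))) rest) (mid t)))) ℕ.≤-refl))
                  (ℕ.≤-trans (ℕ.+-mono-≤ (iters-advance S₀) (+-≤0 (ℕ.≤-trans (iters-advance els) le))) simple))) ⟩
          n + (n + (((n + (3 * n + L * (4 * n + 1))) + n) + k * suc n + (n + (n + n)))) ≤⟨ ℕ.+-monoʳ-≤ n (ℕ.+-monoʳ-≤ n (ℕ.+-monoˡ-≤ (n + (n + n)) (ℕ.+-mono-≤
               (ℕ.+-monoˡ-≤ n (ℕ.+-monoʳ-≤ n (ℕ.+-monoʳ-≤ (3 * n) (ℕ.*-monoʳ-≤ L (ℕ.+-monoʳ-≤ (4 * n) pos))))) (ℕ.*-monoʳ-≤ k (ℕ.+-monoˡ-≤ n pos))))) ⟩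
          n + (n + (((n + (3 * n + L * (4 * n + n))) + n) + k * (n + n) + (n + (n + n)))) ≤⟨ ℕ.m≤m+n _ n ⟩
          n + (n + (((n + (3 * n + L * (4 * n + n))) + n) + k * (n + n) + (n + (n + n)))) + n ≡⟨ arith n L k ⟩
          n * (11 + 5 * L + 2 * k) ∎
          where
          open ℕ.≤-Reasoning
          sc : List ℝ × ℝ
          sc = ⟦ scanE ⟧ ((toΘ w θ , ⟦ lenE {El} ⟧ (els ∷ []) , w , ⟦ medianE ⟧ (⟦ keysE ⟧ (S₀ ∷ []) ∷ []) , ⟦ keysE ⟧ (els ∷ [])) ∷ [])
          medianCost : iters medianE (⟦ keysE ⟧ (S₀ ∷ []) ∷ []) ≤ 3 * n + L * (4 * n + 1)
          medianCost = subst (λ m → iters medianE (⟦ keysE ⟧ (S₀ ∷ []) ∷ []) ≤ 3 * m + L * (4 * m + 1)) (length-keys S₀)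
            (iters-median (⟦ keysE ⟧ (S₀ ∷ [])) L (subst (_≤ 2 ℕ.^ L) (sym (length-keys S₀)) le2))
          scanCost : iters scanE ((toΘ w θ , ⟦ lenE {El} ⟧ (els ∷ []) , w , ⟦ medianE ⟧ (⟦ keysE ⟧ (S₀ ∷ []) ∷ []) , ⟦ keysE ⟧ (els ∷ [])) ∷ []) ≤ k * suc n
          scanCost = ℕ.≤-trans (subst (λ m → iters scanE ((toΘ w θ , m , w , ⟦ medianE ⟧ (⟦ keysE ⟧ (S₀ ∷ []) ∷ []) , ⟦ keysE ⟧ (els ∷ [])) ∷ []) ≤ k * suc (length (⟦ keysE ⟧ (els ∷ []))))
            (sym (⟦len⟧ {El} els)) (iters-scan w (length els) (⟦ keysE ⟧ (els ∷ [])) θ _))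
            (ℕ.*-monoʳ-≤ k (s≤s (ℕ.≤-trans (ℕ.≤-reflexive (length-keys els)) le)))
          simple : n + n ≤ ((n + (3 * n + L * (4 * n + 1))) + n) + k * suc n + (n + (n + n))
          simple = ℕ.≤-trans (ℕ.m≤n+m (n + n) n) (ℕ.m≤n+m _ (((n + (3 * n + L * (4 * n + 1))) + n) + k * suc n))
          arith : ∀ n L k → n + (n + (((n + (3 * n + L * (4 * n + n))) + n) + k * (n + n) + (n + (n + n)))) + n ≡ n * (11 + 5 * L + 2 * k)
          arith = solve-∀

      module _ (S : List Pt) (pos : 0 < length S) where
        private
          pstep : ℝ → St S → List ℝ → St S
          pstep _ s _ = ⟦ stepE ⟧ ((param , s) ∷ [])

        inv-pass : ∀ fuel {e st} → Inv S e st → Inv S (length fuel + e) (iter pstep fuel st)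
        inv-pass [] I = I
        inv-pass (f ∷ fuel) {e} {st} I = subst (λ e → Inv S e (iter pstep (f ∷ fuel) st)) (ℕ.+-suc (length fuel) e)
          (inv-pass fuel (subst (Inv S (suc e)) (sym (⟦step⟧ S st)) (inv-next S pos I)))

        inv-start : Inv S 0 (⟦ initE ⟧ (S ∷ []) , ⟦ initE ⟧ (S ∷ []) , [] , [])
        inv-start = record
          { start = refl ; sync = Synced-init S ; perm = ↭-trans (↭-reflexive (++-identityʳ _)) (full-init S)
          ; bounded = λ _ → All.universal (λ _ _ _ ()) _
          ; marks = ℕ.≤-reflexive (trans (cong (3 * E *_) (unflagged-init S)) (ℕ.*-zeroʳ (3 * E)))
          ; nonempty = [] ; light = [] ; sep = [] ∷ [] ; charged = []
          ; total = trans (sym (length-map full (⟦ initE ⟧ (S ∷ [])))) (Permₚ.↭-length (full-init S)) }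

        pass-cost : ∀ {L} → length S ≤ 2 ℕ.^ L → ∀ fuel {e st} → Inv S e st →
          iterCost (λ _ s _ → iters stepE ((param , s) ∷ [])) pstep fuel st ≤ length fuel * suc (stepBound (length S) L)
        pass-cost le [] I = z≤n
        pass-cost {L} le (f ∷ fuel) {e} {st@(S₀ , els , children , rest)} I = ℕ.+-mono-≤
          (s≤s (iters-step {length S} {L} S₀ els children rest pos (trans (cong length (Inv.start I)) (length-advs S e)) (Inv.length-els I) le mid))
          (pass-cost {L} le fuel (subst (Inv S (suc e)) (sym (⟦step⟧ S st)) (inv-next S pos I)))
          where
          mid : ∀ t → length (proj₂ (proj₂ (⟦ cutE ⟧ ((t , t +ᵣ w , els) ∷ [])))) ≤ length S
          mid t = ℕ.≤-trans (ℕ.≤-trans (ℕ.m≤n+m _ (length (proj₁ (proj₂ sides)))) (ℕ.≤-trans (ℕ.m≤n+m _ (length (map full (proj₁ sides)))) (ℕ.≤-reflexive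
            (trans (cong (length (map full (proj₁ sides)) +_) (sym (length-++ (proj₁ (proj₂ sides))))) (trans (sym (length-++ (map full (proj₁ sides)))) (trans (Permₚ.↭-length cut-perm) (length-map full els)))))))
            (Inv.length-els I)
            where
            open Cut {e} {els} (Inv.sync I) t (t +ᵣ w)
            sides = ⟦ cutE ⟧ ((t , t +ᵣ w , els) ∷ [])

        pass : St S
        pass = ⟦ passE ⟧ ((param , S) ∷ [])

        private
          dims : List ℝ
          dims = cases S [] λ x _ → x

          dims-length : All (λ x → length x ≡ E) S → length dims ≡ E
          dims-length al = go S pos al
            where
            go : ∀ S → 0 < length S → All (λ x → length x ≡ E) S → length (cases S [] λ x _ → x) ≡ E
            go (x ∷ S) _ (eq ∷ _) = eq

          opaque
            unfolding passE
            pass-unfold : pass ≡ iter pstep dims (⟦ initE ⟧ (S ∷ []) , ⟦ initE ⟧ (S ∷ []) , [] , [])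
            pass-unfold = refl
            pass-iters : iters passE ((param , S) ∷ []) ≤ length S + (0 + iterCost (λ _ s _ → iters stepE ((param , s) ∷ [])) pstep dims (⟦ initE ⟧ (S ∷ []) , ⟦ initE ⟧ (S ∷ []) , [] , []))
            pass-iters = ℕ.+-mono-≤ (iters-init S) (ℕ.+-mono-≤ (cases-le S z≤n λ _ _ → z≤n) ℕ.≤-refl)

        inv-passed : All (λ x → length x ≡ E) S → Inv S E pass
        inv-passed al = subst₂ (Inv S) (trans (ℕ.+-identityʳ _) (dims-length al)) (sym pass-unfold) (inv-pass dims inv-start)

        iters-pass : All (λ x → length x ≡ E) S → ∀ {L} → length S ≤ 2 ℕ.^ L →
          iters passE ((param , S) ∷ []) ≤ length S + E * suc (stepBound (length S) L)
        iters-pass al {L} le = ℕ.≤-trans pass-iters (ℕ.+-monoʳ-≤ (length S) (ℕ.≤-trans (pass-cost {L} le dims inv-start) (ℕ.≤-reflexive (cong (_* suc (stepBound (length S) L)) (dims-length al)))))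

      private
        ustep : Elem → List Pt × List Pt → List Elem → List Pt × List Pt
        ustep x s _ = cases (proj₂ (proj₂ x)) (full x ∷ proj₁ s , proj₂ s) λ _ _ → proj₁ s , full x ∷ proj₂ s

        record Unmarked (els : List Elem) (s s₁ : List Pt × List Pt) : Set₁ where
          field
            u-perm   : proj₁ s₁ ++ proj₂ s₁ ↭ map full els ++ (proj₁ s ++ proj₂ s)
            u-keep   : ∀ (Q : Pt → Set) → All (λ x → flagged x ≡ false → Q (full x)) els → All Q (proj₁ s) → All Q (proj₁ s₁)
            u-length : length (proj₁ s₁) + # flagged els ≡ length els + length (proj₁ s)

        unmarking : ∀ els s → Unmarked els s (iter ustep els s)
        unmarking [] s = record { u-perm = ↭-refl ; u-keep = λ _ _ a → a ; u-length = ℕ.+-identityʳ _ }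
        unmarking ((r , q , []) ∷ els) s = record
          { u-perm = ↭-trans R.u-perm (Permₚ.shift q (map full els) _)
          ; u-keep = λ { Q (f ∷ fs) a → R.u-keep Q fs (f refl ∷ a) }
          ; u-length = trans R.u-length (ℕ.+-suc (length els) _) }
          where module R = Unmarked (unmarking els (q ∷ proj₁ s , proj₂ s))
        unmarking ((r , q , _ ∷ _) ∷ els) s = record
          { u-perm = ↭-trans R.u-perm (↭-trans (Permₚ.++⁺ˡ (map full els) (Permₚ.shift q (proj₁ s) (proj₂ s))) (Permₚ.shift q (map full els) _))
          ; u-keep = λ { Q (f ∷ fs) a → R.u-keep Q fs a }
          ; u-length = trans (ℕ.+-suc _ _) (cong suc R.u-length) }
          where module R = Unmarked (unmarking els (proj₁ s , q ∷ proj₂ s))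

        opaque
          unfolding unmarkE
          unmark : ∀ els rest → Unmarked els ([] , rest) (⟦ unmarkE ⟧ ((els , rest) ∷ []))
          unmark els rest = unmarking els ([] , rest)
          iters-unmark : ∀ els rest → iters unmarkE ((els , rest) ∷ []) ≤ length els
          iters-unmark els rest = iterCost-unit {f = ustep} (λ x _ _ → cases-le (proj₂ (proj₂ x)) z≤n λ _ _ → z≤n) els ([] , rest)

      Result : Set
      Result = List (List Pt) × List (List Pt) × List Pt

      -- Coordinate 2 i + 1 is the original coordinate i, and coordinate 2 i its negative.
      Doubled : Pt → Set
      Doubled x = length x ≡ E × (∀ i → suc (2 * i) < E → coord (suc (2 * i)) x ≡ -ᵣ coord (2 * i) x)

      W : ℝ
      W = fromℕ (2 * k) *ᵣ w

      -- Since coordinate 2 i is negated, the sum is the difference of `x` and `y` in one original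
      -- coordinate.
      Tight : List Pt → Set
      Tight C = ∀ i → suc (2 * i) < E → All (λ x → All (λ y → coord (suc (2 * i)) x +ᵣ coord (2 * i) y ≤ᵣ W) C) C

      node : List Pt → Result
      node S = ⟦ nodeE ⟧ ((param , S) ∷ [])

      -- `paying` are the children made by cuts; they pay for `paid` points. The `left` points are
      -- the final current set: either at least half of them are in the core, or they form a child
      -- `L` for which nothing is paid.
      record IsNode (S : List Pt) (r : Result) : Set where
        children = proj₁ r
        cores = proj₁ (proj₂ r)
        rest = proj₂ (proj₂ r)
        field
          perm     : concat children ++ (concat cores ++ rest) ↭ S
          nonempty : All (λ c → 0 < length c) children × All (λ c → 0 < length c) cores
          light    : All (λ c → 4 * length c ≤ 3 * length S) children
          sep      : AllPairs Sep (cores ++ children)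
          tight    : All Tight cores
          {paying} : List (List Pt)
          {paid}   : ℕ
          {left}   : ℕ
          charged  : Charged p (length S) paying paid
          total    : paid + left ≡ length S
          credits  : (children ≡ paying × left ≤ 2 * length (concat cores)) ⊎
                     (∃[ L ] children ≡ L ∷ paying × length L ≡ left)

      -- The cost of a node per point.
      rate : ℕ → ℕ
      rate L = 4 + E * (12 + 5 * L + 2 * k)

      module _ (S : List Pt) (pos : 0 < length S) (doubled : All Doubled S) where
        private
          st : St S
          st = pass S pos
          I : Inv S E st
          I = inv-passed S pos (All.map proj₁ doubled)
          module I = Inv I
          els = I.els
          ch = I.children
          u : List Pt × List Pt
          u = ⟦ unmarkE ⟧ ((els , I.rest) ∷ [])
          module U = Unmarked (unmark els I.rest)

          finish : Result
          finish = if≤ (fromℕ 3 *ᵣ ⟦ lenE {P} ⟧ (S ∷ [])) (fromℕ 4 *ᵣ ⟦ lenE {El} ⟧ (els ∷ []))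
            (ch , proj₁ u ∷ [] , proj₂ u) (cases els ch (λ _ _ → ⟦ fullE ⟧ (els ∷ []) ∷ ch) , [] , I.rest)

          opaque
            unfolding nodeE
            node-unfold : node S ≡ finish
            node-unfold = refl
            node-iters : iters nodeE ((param , S) ∷ []) ≤ iters passE ((param , S) ∷ []) + (length S + (length els + length els))
            node-iters = ℕ.+-monoʳ-≤ (iters passE ((param , S) ∷ [])) (ℕ.+-mono-≤ (iters-len {P} S) (ℕ.+-mono-≤ (iters-len {El} els)
              (if≤-le (fromℕ 3 *ᵣ ⟦ lenE {P} ⟧ (S ∷ [])) (fromℕ 4 *ᵣ ⟦ lenE {El} ⟧ (els ∷ []))
                (ℕ.≤-trans (ℕ.≤-reflexive (ℕ.+-identityʳ _)) (iters-unmark els I.rest))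
                (ℕ.≤-trans (ℕ.≤-reflexive (ℕ.+-identityʳ _)) (cases-le els z≤n λ _ _ → ℕ.≤-trans (ℕ.≤-reflexive (ℕ.+-identityʳ _)) (iters-full els))))))

          reach : ∀ {a b} → atLeast a b ≡ true → a ≤ᵣ b
          reach {a} {b} eq with a ≤ᵣ? b
          ... | yes q = q

          half-half : ∀ {m a b} → m < 2 * a → m < 2 * b → m < a + b
          half-half {m} {a} {b} p q = ℕ.*-cancelˡ-< 2 m (a + b) (ℕ.<-≤-trans (ℕ.<-≤-trans (ℕ.+-monoˡ-< (m + 0) p)
            (ℕ.+-monoʳ-≤ (2 * a) (ℕ.≤-trans (ℕ.≤-reflexive (ℕ.+-identityʳ m)) (ℕ.<⇒≤ q)))) (ℕ.≤-reflexive (sym (ℕ.*-distribˡ-+ 2 a b))))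

          -- More than half of the points reach each of the two medians, so some point reaches both,
          -- and its two signed coordinates cancel.
          medians : ∀ i → suc (2 * i) < E → med S (suc (2 * i)) +ᵣ med S (2 * i) ≤ᵣ 0ℝ
          medians i lt = conclude (common reach₁ reach₀ S doubled (half-half {m₀ S} {# reach₁ S} {# reach₀ S} (med-atLeast S pos (suc (2 * i))) (med-atLeast S pos (2 * i))))
            where
            μ₁ μ₀ : ℝ
            μ₁ = med S (suc (2 * i))
            μ₀ = med S (2 * i)
            reach₁ reach₀ : Pt → Bool
            reach₁ x = atLeast μ₁ (coord (suc (2 * i)) x)
            reach₀ x = atLeast μ₀ (coord (2 * i) x)
            conclude : (∃[ x ] Doubled x × reach₁ x ≡ true × reach₀ x ≡ true) → μ₁ +ᵣ μ₀ ≤ᵣ 0ℝ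
            conclude (x , (_ , dbl) , f , g) = ≤ᵣ-trans (+ᵣ-mono (reach f) (reach g))
              (≤ᵣ-reflexive (trans (cong (_+ᵣ coord (2 * i) x) (dbl i lt)) (-ᵣ-inverseˡ _)))

          few-marks : 3 * # flagged els ≤ length S
          few-marks = ℕ.*-cancelˡ-≤ E {{ℕ.>-nonZero (Thresholds.E>0 thresholds)}} (ℕ.≤-trans (ℕ.≤-reflexive (arith E (# flagged els))) I.marks)
            where
            arith : ∀ a b → a * (3 * b) ≡ 3 * a * b
            arith = solve-∀

          -- Each of the two bounds is k levels above its median, and the two medians add up to at
          -- most 0.
          close : ∀ i → suc (2 * i) < E → ∀ {x y} → (∀ e → e < E → coord e x ≤ᵣ bound S e) → (∀ e → e < E → coord e y ≤ᵣ bound S e) →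
            coord (suc (2 * i)) x +ᵣ coord (2 * i) y ≤ᵣ W
          close i lt {x} {y} f g = ≤ᵣ-trans (+ᵣ-mono (f (suc (2 * i)) lt) (g (2 * i) (ℕ.<-trans (ℕ.n<1+n _) lt)))
            (subst₂ _≤ᵣ_ (trans (sym (arith (med S (suc (2 * i))) (med S (2 * i)) (fromℕ k *ᵣ w))) (sym (cong₂ _+ᵣ_ (up-≡ w k (med S (suc (2 * i)))) (up-≡ w k (med S (2 * i))))))
              (trans (+ᵣ-identityˡ _) (trans (sym (*ᵣ-distribʳ w (fromℕ k) (fromℕ k))) (cong (_*ᵣ w) (trans (sym (fromℕ-+ k k)) (cong (λ n → fromℕ (k + n)) (sym (ℕ.+-identityʳ k)))))))
              (+ᵣ-mono (medians i lt) ≤ᵣ-refl))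
            where
            arith : ∀ a b c → (a +ᵣ c) +ᵣ (b +ᵣ c) ≡ (a +ᵣ b) +ᵣ (c +ᵣ c)
            arith = RealSolver.solve 3 (λ a b c → (a :+ c) :+ (b :+ c) := (a :+ b) :+ (c :+ c)) refl
              where open RealSolver using (_:+_; _:=_)

          heavy-node : 3 * length S ≤ 4 * length els → IsNode S (ch , proj₁ u ∷ [] , proj₂ u)
          heavy-node heavy = record
            { perm = ↭-trans (Permₚ.++⁺ˡ (concat ch) (↭-trans (↭-reflexive (cong (_++ proj₂ u) (++-identityʳ (proj₁ u)))) U.u-perm))
                (↭-trans (Permₚ.shifts (concat ch) (map full els)) I.perm)
            ; nonempty = I.nonempty , positive ∷ []
            ; light = I.light
            ; sep = All.map (sep-⊑ (λ Q a → U.u-keep Q (All.map (λ q _ → q) (Allₚ.map⁻ a)) []) ⊑-refl) (AllPairs.head I.sep) ∷ AllPairs.tail I.sep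
            ; tight = (λ i lt → All.map (λ {x} f → All.map (λ {y} g → close i lt {x} {y} f g) inBox) inBox) ∷ []
            ; charged = I.charged ; total = I.total
            ; credits = inj₁ (refl , subst (λ n → length els ≤ 2 * n) (cong length (sym (++-identityʳ (proj₁ u)))) most) }
            where
            inBox : All (λ x → ∀ e → e < E → coord e x ≤ᵣ bound S e) (proj₁ u)
            inBox = U.u-keep _ (I.bounded heavy) []
            f = # flagged els
            v = length els
            -- At most a third of the node is marked and at least 3/4 of it is current, so the
            -- marked points are at most 4/9 of the current set.
            2f≤v : 2 * f ≤ v
            2f≤v = ℕ.*-cancelˡ-≤ 9 (begin
              9 * (2 * f)   ≡⟨ arith₁ f ⟩
              6 * (3 * f)   ≤⟨ ℕ.*-monoʳ-≤ 6 few-marks ⟩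
              6 * length S  ≡⟨ ℕ.*-assoc 2 3 (length S) ⟩
              2 * (3 * length S) ≤⟨ ℕ.*-monoʳ-≤ 2 heavy ⟩
              2 * (4 * v)   ≤⟨ ℕ.m≤m+n _ v ⟩
              2 * (4 * v) + v ≡⟨ arith₂ v ⟩
              9 * v         ∎)
              where
              open ℕ.≤-Reasoning
              arith₁ : ∀ f → 9 * (2 * f) ≡ 6 * (3 * f)
              arith₁ = solve-∀
              arith₂ : ∀ v → 2 * (4 * v) + v ≡ 9 * v
              arith₂ = solve-∀
            most : v ≤ 2 * length (proj₁ u)
            most = ℕ.+-cancelʳ-≤ (2 * f) v _ (begin
              v + 2 * f                   ≤⟨ ℕ.+-monoʳ-≤ v 2f≤v ⟩
              v + v                       ≡⟨ cong (v +_) (ℕ.+-identityʳ v) ⟨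
              2 * v                       ≡⟨ cong (2 *_) (trans U.u-length (ℕ.+-identityʳ v)) ⟨
              2 * (length (proj₁ u) + f)  ≡⟨ ℕ.*-distribˡ-+ 2 (length (proj₁ u)) f ⟩
              2 * length (proj₁ u) + 2 * f ∎)
              where open ℕ.≤-Reasoning
            positive : 0 < length (proj₁ u)
            positive = go (length (proj₁ u)) v pos heavy most
              where
              go : ∀ a v {m} → 0 < m → 3 * m ≤ 4 * v → v ≤ 2 * a → 0 < a
              go (suc a) v _ _ _ = s≤s z≤n
              go zero zero {suc m} _ () _

          light-node : ¬ (3 * length S ≤ 4 * length els) → IsNode S (cases els ch (λ _ _ → ⟦ fullE ⟧ (els ∷ []) ∷ ch) , [] , I.rest)
          light-node light′ = go els refl
            where
            full↭ : ⟦ fullE ⟧ (els ∷ []) ↭ map full els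
            full↭ = ↭-trans (↭-reflexive (⟦full⟧ els)) (↭-trans (ʳ++-↭ (map full els)) (↭-reflexive (++-identityʳ _)))
            len : length (⟦ fullE ⟧ (els ∷ [])) ≡ length els
            len = trans (Permₚ.↭-length full↭) (length-map full els)
            go : ∀ xs → xs ≡ els → IsNode S (cases xs ch (λ _ _ → ⟦ fullE ⟧ (els ∷ []) ∷ ch) , [] , I.rest)
            go [] eq = record
              { perm = ↭-trans (↭-reflexive (cong (λ xs → map full xs ++ (concat ch ++ I.rest)) eq)) I.perm
              ; nonempty = I.nonempty , [] ; light = I.light ; sep = AllPairs.tail I.sep ; tight = []
              ; charged = I.charged ; total = I.total ; credits = inj₁ (refl , ℕ.≤-reflexive (sym (cong length eq))) }
            go (x ∷ xs) eq = record
              { perm = ↭-trans (↭-reflexive (++-assoc (⟦ fullE ⟧ (els ∷ [])) (concat ch) I.rest)) (↭-trans (Permₚ.++⁺ʳ _ full↭) I.perm)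
              ; nonempty = subst (0 <_) (trans (cong length eq) (sym len)) (s≤s z≤n) ∷ I.nonempty , []
              ; light = subst (λ n → 4 * n ≤ 3 * length S) (sym len) (ℕ.<⇒≤ (ℕ.≰⇒> light′)) ∷ I.light
              ; sep = All.map (sep-⊑ (↭⇒⊑ full↭) ⊑-refl) (AllPairs.head I.sep) ∷ AllPairs.tail I.sep
              ; tight = [] ; charged = I.charged ; total = I.total
              ; credits = inj₂ (_ , refl , len) }

        is-node : IsNode S (node S)
        is-node = subst (IsNode S) (sym node-unfold) go
          where
          eq₁ : fromℕ 3 *ᵣ ⟦ lenE {P} ⟧ (S ∷ []) ≡ fromℕ (3 * length S)
          eq₁ = trans (cong (fromℕ 3 *ᵣ_) (⟦len⟧ {P} S)) (sym (fromℕ-* 3 (length S)))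
          eq₂ : fromℕ 4 *ᵣ ⟦ lenE {El} ⟧ (els ∷ []) ≡ fromℕ (4 * length els)
          eq₂ = trans (cong (fromℕ 4 *ᵣ_) (⟦len⟧ {El} els)) (sym (fromℕ-* 4 (length els)))
          go : IsNode S finish
          go with fromℕ 3 *ᵣ ⟦ lenE {P} ⟧ (S ∷ []) ≤ᵣ? fromℕ 4 *ᵣ ⟦ lenE {El} ⟧ (els ∷ [])
          ... | yes q = heavy-node (fromℕ-cancel {3 * length S} {4 * length els} (subst₂ _≤ᵣ_ eq₁ eq₂ q))
          ... | no n = light-node λ h → n (subst₂ _≤ᵣ_ (sym eq₁) (sym eq₂) (fromℕ-mono {3 * length S} {4 * length els} h))

        iters-node : ∀ {L} → length S ≤ 2 ℕ.^ L → iters nodeE ((param , S) ∷ []) ≤ length S * rate L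
        iters-node {L} le = begin
          _ ≤⟨ node-iters ⟩
          _ ≤⟨ ℕ.+-mono-≤ (iters-pass S pos (All.map proj₁ doubled) {L} le) (ℕ.+-monoʳ-≤ n (ℕ.+-mono-≤ I.length-els I.length-els)) ⟩
          n + E * suc (n * (11 + 5 * L + 2 * k)) + (n + (n + n)) ≤⟨ ℕ.+-monoˡ-≤ (n + (n + n)) (ℕ.+-monoʳ-≤ n (ℕ.*-monoʳ-≤ E (ℕ.+-monoˡ-≤ (n * (11 + 5 * L + 2 * k)) pos))) ⟩
          n + E * (n + n * (11 + 5 * L + 2 * k)) + (n + (n + n)) ≡⟨ arith n E L k ⟩
          n * (4 + E * (12 + 5 * L + 2 * k)) ∎
          where
          open ℕ.≤-Reasoning
          n = length S
          arith : ∀ n E L k → n + E * (n + n * (11 + 5 * L + 2 * k)) + (n + (n + n)) ≡ n * (4 + E * (12 + 5 * L + 2 * k))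
          arith = solve-∀

    -- How many points of a node get into cores.

    module Round (w : ℝ) (w≥0 : 0ℝ ≤ᵣ w) {p E : ℕ} {θ : List Fraction} (thresholds : Thresholds p E θ) where
      open Cuts 𝓡
      open Nodes w w≥0 thresholds public

      all-⊑ : ∀ {S} {xss : List (List Pt)} → (∀ (Q : Pt → Set) → All Q S → All Q (concat xss)) → All (λ c → c ⊑ S) xss
      all-⊑ f = All.tabulate λ c∈ Q a → All.lookup (Allₚ.concat⁻ (f Q a)) c∈

      -- The number of points in the cores that arise from a node in f levels.
      pad : ℕ → List Pt → ℕ
      pads : ℕ → List (List Pt) → ℕ
      pad zero S = 0
      pad (suc f) S = length (concat (proj₁ (proj₂ (node S)))) + pads f (proj₁ (node S))
      pads f [] = 0
      pads f (S ∷ Ss) = pad f S + pads f Ss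

      pads-ʳ++ : ∀ f xs {ys} → pads f (xs ʳ++ ys) ≡ pads f xs + pads f ys
      pads-ʳ++ f [] = refl
      pads-ʳ++ f (x ∷ xs) {ys} = trans (pads-ʳ++ f xs) (arith (pads f xs) (pad f x) (pads f ys))
        where
        arith : ∀ a b c → a + (b + c) ≡ b + a + c
        arith = solve-∀

      module _ {S : List Pt} (N : IsNode S (node S)) where
        private module N = IsNode N

        children-⊑ : All (λ c → c ⊑ S) N.children
        children-⊑ = all-⊑ λ Q a → proj₁ (Allₚ.++⁻ (concat N.children) (Permₚ.All-resp-↭ (↭-sym N.perm) a))

        cores-⊑ : All (λ c → c ⊑ S) N.cores
        cores-⊑ = all-⊑ λ Q a → proj₁ (Allₚ.++⁻ (concat N.cores) (proj₂ (Allₚ.++⁻ (concat N.children) (Permₚ.All-resp-↭ (↭-sym N.perm) a))))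

      -- If the (p + 1)-st root of the size of S is at most a / b, at least |S| b / 2 a
      -- points get into cores.  A part of size c′ that pays for c points uses the
      -- fraction a c′ / b c.
      pad-large : ∀ f S → 0 < length S → All Doubled S → length S ≤ f → ∀ a b → length S * b ℕ.^ suc p ≤ a ℕ.^ suc p →
        length S * b ≤ 2 * pad f S * a
      pad-large zero S pos _ le = contradiction (ℕ.≤-trans pos le) λ ()
      pad-large (suc f) S pos dbl le a b root = finish N.credits
        where
        N = is-node S pos dbl
        module N = IsNode N
        m = length S
        q = suc p
        cores# = length (concat N.cores)

        -- Children have at most 3/4 of the points of `S`, so they are strictly smaller and the
        -- induction on `f` reaches them.
        IH : ∀ {c} → c ⊑ S → 0 < length c → 4 * length c ≤ 3 * m → ∀ a b → length c * b ℕ.^ q ≤ a ℕ.^ q → length c * b ≤ 2 * pad f c * a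
        IH {c} inc pos′ light = pad-large f c pos′ (inc Doubled dbl) (ℕ.≤-pred (ℕ.≤-trans (smaller (length c) m pos light) le))
          where
          smaller : ∀ c m → 0 < m → 4 * c ≤ 3 * m → c < m
          smaller c m@(suc _) _ h = ℕ.*-cancelˡ-< 4 c m (ℕ.≤-<-trans h (ℕ.*-monoˡ-< m {3} {4} ℕ.≤-refl))

        payment : ∀ {Rs u} → Charged p m Rs u → All (λ c → c ⊑ S) Rs → All (λ c → 0 < length c) Rs → All (λ c → 4 * length c ≤ 3 * m) Rs →
          u * b ≤ 2 * pads f Rs * a
        payment [] _ _ _ = z≤n
        payment {R ∷ Rs} (_∷_ {c = c} {u = u} pays cs) (s ∷ ss) (p₀ ∷ ps) (l ∷ ls) = begin
          (c + u) * b                                 ≡⟨ ℕ.*-distribʳ-+ b c u ⟩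
          c * b + u * b                               ≤⟨ ℕ.+-mono-≤ single (payment cs ss ps ls) ⟩
          2 * pad f R * a + 2 * pads f Rs * a         ≡⟨ arith (pad f R) (pads f Rs) a ⟩
          2 * (pad f R + pads f Rs) * a               ∎
          where
          open ℕ.≤-Reasoning
          arith : ∀ x y a → 2 * x * a + 2 * y * a ≡ 2 * (x + y) * a
          arith = solve-∀
          R# = length R
          scaled : R# * (b * c) ℕ.^ q ≤ (a * R#) ℕ.^ q
          scaled = begin
            R# * (b * c) ℕ.^ q                ≡⟨ cong (R# *_) (^-distribʳ-* q b c) ⟩
            R# * (b ℕ.^ q * c ℕ.^ q)          ≤⟨ ℕ.*-monoʳ-≤ R# (ℕ.*-monoʳ-≤ (b ℕ.^ q) pays) ⟩
            R# * (b ℕ.^ q * (R# ℕ.^ p * m))   ≡⟨ arith′ R# (b ℕ.^ q) (R# ℕ.^ p) m ⟩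
            (m * b ℕ.^ q) * (R# * R# ℕ.^ p)   ≤⟨ ℕ.*-monoˡ-≤ (R# ℕ.^ q) root ⟩
            a ℕ.^ q * R# ℕ.^ q                ≡⟨ ^-distribʳ-* q a R# ⟨
            (a * R#) ℕ.^ q                    ∎
            where
            arith′ : ∀ r x y m → r * (x * (y * m)) ≡ (m * x) * (r * y)
            arith′ = solve-∀
          single : c * b ≤ 2 * pad f R * a
          single = ℕ.*-cancelˡ-≤ R# {{ℕ.>-nonZero p₀}} (begin
            R# * (c * b)            ≡⟨ cong (R# *_) (ℕ.*-comm c b) ⟩
            R# * (b * c)            ≤⟨ IH s p₀ l (a * R#) (b * c) scaled ⟩
            2 * pad f R * (a * R#)  ≡⟨ arith″ (pad f R) a R# ⟩
            R# * (2 * pad f R * a)  ∎)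
            where
            arith″ : ∀ x a r → 2 * x * (a * r) ≡ r * (2 * x * a)
            arith″ = solve-∀

        -- As `S` is nonempty, the fraction `a` / `b` is at least 1, so the core points may be
        -- multiplied by it.
        b≤a : b ≤ a
        b≤a = power-≤ p (ℕ.≤-trans (ℕ.≤-trans (ℕ.≤-reflexive (sym (ℕ.*-identityˡ _))) (ℕ.*-monoˡ-≤ (b ℕ.^ q) pos)) root)

        finish : (N.children ≡ N.paying × N.left ≤ 2 * cores#) ⊎ (∃[ L ] N.children ≡ L ∷ N.paying × length L ≡ N.left) →
          m * b ≤ 2 * (cores# + pads f N.children) * a
        finish (inj₁ (eq , left≤)) = begin
          m * b                                        ≡⟨ cong (_* b) N.total ⟨
          (N.paid + N.left) * b                        ≡⟨ ℕ.*-distribʳ-+ b N.paid N.left ⟩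
          N.paid * b + N.left * b                      ≤⟨ ℕ.+-mono-≤ (payment (subst (λ c → Charged p m c N.paid) (sym eq) N.charged) (children-⊑ N) (proj₁ N.nonempty) N.light) (ℕ.*-mono-≤ left≤ b≤a) ⟩
          2 * pads f N.children * a + 2 * cores# * a   ≡⟨ arith (pads f N.children) cores# a ⟩
          2 * (cores# + pads f N.children) * a         ∎
          where
          open ℕ.≤-Reasoning
          arith : ∀ x y a → 2 * x * a + 2 * y * a ≡ 2 * (y + x) * a
          arith = solve-∀
        finish (inj₂ (L , eq , len)) = subst (λ ch → m * b ≤ 2 * (cores# + pads f ch) * a) (sym eq)
          (go (subst (All (λ c → c ⊑ S)) eq (children-⊑ N)) (subst (All _) eq (proj₁ N.nonempty)) (subst (All _) eq N.light))
          where
          open ℕ.≤-Reasoning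
          arith : ∀ x y z a → 2 * x * a + 2 * y * a ≤ 2 * (z + (y + x)) * a
          arith x y z a = ℕ.≤-trans (ℕ.≤-reflexive (arith₁ x y a)) (ℕ.*-monoˡ-≤ a (ℕ.*-monoʳ-≤ 2 (ℕ.m≤n+m (y + x) z)))
            where
            arith₁ : ∀ x y a → 2 * x * a + 2 * y * a ≡ 2 * (y + x) * a
            arith₁ = solve-∀
          -- The unpaid child has no more points than the node, so the fraction `a` / `b` still
          -- bounds the root of its size.
          go : All (λ c → c ⊑ S) (L ∷ N.paying) → All (λ c → 0 < length c) (L ∷ N.paying) → All (λ c → 4 * length c ≤ 3 * m) (L ∷ N.paying) →
            m * b ≤ 2 * (cores# + (pad f L + pads f N.paying)) * a
          go (s ∷ ss) (p₀ ∷ ps) (l ∷ ls) = begin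
            m * b                                        ≡⟨ cong (_* b) N.total ⟨
            (N.paid + N.left) * b                        ≡⟨ ℕ.*-distribʳ-+ b N.paid N.left ⟩
            N.paid * b + N.left * b                      ≤⟨ ℕ.+-mono-≤ (payment N.charged ss ps ls) (subst (λ n → n * b ≤ 2 * pad f L * a) len
                (IH s p₀ l a b (ℕ.≤-trans (ℕ.*-monoˡ-≤ (b ℕ.^ q) (ℕ.≤-trans (ℕ.≤-reflexive len) (subst (N.left ≤_) N.total (ℕ.m≤n+m N.left N.paid)))) root))) ⟩
            2 * pads f N.paying * a + 2 * pad f L * a    ≤⟨ arith (pads f N.paying) (pad f L) cores# a ⟩
            2 * (cores# + (pad f L + pads f N.paying)) * a ∎

      Level : Set
      Level = List (List Pt) × List (List Pt) × List Pt

      lstep : List Pt → Level → List (List Pt) → Level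
      lstep S s _ = ⟦ revAppE {list P} ⟧ ((proj₁ (node S) , proj₁ s) ∷ []) ,
        ⟦ revAppE {list P} ⟧ ((proj₁ (proj₂ (node S)) , proj₁ (proj₂ s)) ∷ []) ,
        ⟦ revAppE {P} ⟧ ((proj₂ (proj₂ (node S)) , proj₂ (proj₂ s)) ∷ [])

      lstep≡ : ∀ S s todo → lstep S s todo ≡ (proj₁ (node S) ʳ++ proj₁ s , proj₁ (proj₂ (node S)) ʳ++ proj₁ (proj₂ s) , proj₂ (proj₂ (node S)) ʳ++ proj₂ (proj₂ s))
      lstep≡ S s todo = cong₂ _,_ (⟦revApp⟧ {list P} _ _) (cong₂ _,_ (⟦revApp⟧ {list P} _ _) (⟦revApp⟧ {P} _ _))

      lcost : List Pt → Level → List (List Pt) → ℕ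
      lcost S s _ = iters nodeE ((param , S) ∷ []) + (iters (revAppE {list P}) ((proj₁ (node S) , proj₁ s) ∷ []) +
        (iters (revAppE {list P}) ((proj₁ (proj₂ (node S)) , proj₁ (proj₂ s)) ∷ []) + iters (revAppE {P}) ((proj₂ (proj₂ (node S)) , proj₂ (proj₂ s)) ∷ [])))

      opaque
        unfolding levelE
        level-unfold : ∀ nodes s → ⟦ levelE ⟧ ((param , nodes , s) ∷ []) ≡ iter lstep nodes ([] , s)
        level-unfold nodes s = refl
        level-cost : ∀ nodes s → iters levelE ((param , nodes , s) ∷ []) ≡ iterCost lcost lstep nodes ([] , s)
        level-cost nodes s = refl

      module _ (S₀ : List Pt) (doubled : All Doubled S₀) where

        -- The first bound makes the depth logarithmic, which matters for the work. The second shows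
        -- that a clock with one tick for each point of `S₀` suffices.
        Small : ℕ → List Pt → Set
        Small t c = length c * 4 ℕ.^ t ≤ 3 ℕ.^ t * length S₀ × length c + t ≤ length S₀

        record LInv (t : ℕ) (todo : List (List Pt)) (s : Level) : Set where
          field
            perm  : concat todo ++ (concat (proj₁ s) ++ (concat (proj₁ (proj₂ s)) ++ proj₂ (proj₂ s))) ↭ S₀
            ne₁   : All (λ c → 0 < length c) todo
            ne₂   : All (λ c → 0 < length c) (proj₁ s)
            ne₃   : All (λ c → 0 < length c) (proj₁ (proj₂ s))
            sep   : AllPairs Sep (todo ++ (proj₁ s ++ proj₁ (proj₂ s)))
            tight : All Tight (proj₁ (proj₂ s))
            size₁ : All (Small t) todo
            size₂ : All (Small (suc t)) (proj₁ s)

          todo-⊑ : All (λ c → c ⊑ S₀) todo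
          todo-⊑ = all-⊑ λ Q a → proj₁ (Allₚ.++⁻ (concat todo) (Permₚ.All-resp-↭ (↭-sym perm) a))

        small-child : ∀ {t S c} → Small t S → 0 < length S → 4 * length c ≤ 3 * length S → Small (suc t) c
        small-child {t} {S} {c} (le , le′) pos l = (begin
            length c * (4 * 4 ℕ.^ t)     ≡⟨ arith (length c) 4 (4 ℕ.^ t) ⟩
            4 * length c * 4 ℕ.^ t       ≤⟨ ℕ.*-monoˡ-≤ (4 ℕ.^ t) l ⟩
            3 * length S * 4 ℕ.^ t       ≡⟨ ℕ.*-assoc 3 (length S) _ ⟩
            3 * (length S * 4 ℕ.^ t)     ≤⟨ ℕ.*-monoʳ-≤ 3 le ⟩
            3 * (3 ℕ.^ t * length S₀)    ≡⟨ ℕ.*-assoc 3 (3 ℕ.^ t) _ ⟨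
            3 ℕ.^ suc t * length S₀      ∎) ,
          ℕ.≤-trans (ℕ.≤-reflexive (ℕ.+-suc (length c) t)) (ℕ.≤-trans (ℕ.+-monoˡ-≤ t (smaller (length c) (length S) pos l)) le′)
          where
          open ℕ.≤-Reasoning
          arith : ∀ a b c → a * (b * c) ≡ b * a * c
          arith = solve-∀
          smaller : ∀ c m → 0 < m → 4 * c ≤ 3 * m → c < m
          smaller c m@(suc _) _ h = ℕ.*-cancelˡ-< 4 c m (ℕ.≤-<-trans h (ℕ.*-monoˡ-< m {3} {4} ℕ.≤-refl))

        linv-step : ∀ {t S todo s} → LInv t (S ∷ todo) s → LInv t todo (lstep S s todo)
        linv-step {t} {S} {todo} {s@(next , cores , rest)} I with I.ne₁ | I.size₁ | I.todo-⊑ | I.sep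
          where module I = LInv I
        ... | pos ∷ ne₁ | sz ∷ size₁ | inc ∷ _ | sepS ∷ sep = subst (LInv t todo) (sym (lstep≡ S s todo)) record
          { perm = ↭-trans (Permₚ.++⁺ˡ (concat todo) (Permₚ.++⁺ (concat-ʳ++ N.children) (Permₚ.++⁺ (concat-ʳ++ N.cores) (ʳ++-↭ N.rest))))
              (↭-trans (reorder₇ (concat todo) (concat N.children) (concat next) (concat N.cores) (concat cores) N.rest rest)
              (↭-trans (Permₚ.++⁺ʳ _ (Permₚ.++⁺ʳ (concat todo) N.perm)) I.perm))
          ; ne₁ = ne₁
          ; ne₂ = All-ʳ++ (proj₁ N.nonempty) I.ne₂
          ; ne₃ = All-ʳ++ (proj₂ N.nonempty) I.ne₃
          ; sep = AllPairs-↭ sep-sym (↭-trans (reorder₅ N.cores N.children todo next cores)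
              (Permₚ.++⁺ˡ todo (Permₚ.++⁺ (↭-sym (ʳ++-↭ N.children)) (↭-sym (ʳ++-↭ N.cores)))))
              (AllPairsₚ.++⁺ N.sep sep (All.map (λ o → All.map (sep-⊑ o ⊑-refl) sepS) (Allₚ.++⁺ (cores-⊑ N) (children-⊑ N))))
          ; tight = All-ʳ++ N.tight I.tight
          ; size₁ = size₁
          ; size₂ = All-ʳ++ (All.map (λ {c} → small-child {t} {S} {c} sz pos) N.light) I.size₂ }
          where
          module I = LInv I
          N = is-node S pos (inc Doubled doubled)
          module N = IsNode N
          All-ʳ++ : ∀ {X : Set} {Q : X → Set} {xs ys} → All Q xs → All Q ys → All Q (xs ʳ++ ys)
          All-ʳ++ {xs = xs} a b = Permₚ.All-resp-↭ (↭-sym (ʳ++-↭ xs)) (Allₚ.++⁺ a b)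

    -- Correctness and cost of a round.

    module RoundSpec (w : ℝ) (w≥0 : 0ℝ ≤ᵣ w) {p E : ℕ} {θ : List Fraction} (thresholds : Thresholds p E θ) where
      open Cuts 𝓡
      open Round w w≥0 thresholds public

      levelRate : ℕ → ℕ
      levelRate L = rate L + 2

      -- A set of at most 2 ^ L points is exhausted after 3 (L + 1) levels, as a child
      -- has at most 3 / 4 of the points of its parent and (3 / 4) ^ 3 < 1 / 2.
      shallow : ∀ L {t c m} → 0 < c → m ≤ 2 ℕ.^ L → c * 4 ℕ.^ t ≤ 3 ℕ.^ t * m → t < 3 * suc L
      shallow L {t} {c} {m} pos le small = ℕ.≰⇒> λ h → ℕ.<⇒≱ (deep (t ∸ 3 * suc L) (ℕ.m+[n∸m]≡n h)) (begin
          4 ℕ.^ t            ≤⟨ ℕ.m≤n*m (4 ℕ.^ t) c {{ℕ.>-nonZero pos}} ⟩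
          c * 4 ℕ.^ t        ≤⟨ small ⟩
          3 ℕ.^ t * m        ≤⟨ ℕ.*-monoʳ-≤ (3 ℕ.^ t) le ⟩
          3 ℕ.^ t * 2 ℕ.^ L  ∎)
        where
        open ℕ.≤-Reasoning
        deep : ∀ i → 3 * suc L + i ≡ t → 3 ℕ.^ t * 2 ℕ.^ L < 4 ℕ.^ t
        deep i refl = begin-strict
          3 ℕ.^ (3 * suc L + i) * 2 ℕ.^ L           ≡⟨ cong (_* 2 ℕ.^ L) (trans (ℕ.^-distribˡ-+-* 3 (3 * suc L) i) (cong (_* 3 ℕ.^ i) (sym (ℕ.^-*-assoc 3 3 (suc L))))) ⟩
          27 ℕ.^ suc L * 3 ℕ.^ i * 2 ℕ.^ L          ≤⟨ ℕ.*-monoˡ-≤ (2 ℕ.^ L) (ℕ.*-monoʳ-≤ (27 ℕ.^ suc L) (ℕ.^-monoˡ-≤ i {3} {4} (ℕ.n≤1+n 3))) ⟩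
          27 ℕ.^ suc L * 4 ℕ.^ i * 2 ℕ.^ L          <⟨ ℕ.*-monoʳ-< (27 ℕ.^ suc L * 4 ℕ.^ i) {{ℕ.m*n≢0 (27 ℕ.^ suc L) (4 ℕ.^ i) {{ℕ.m^n≢0 27 (suc L)}} {{ℕ.m^n≢0 4 i}}}} (ℕ.^-monoʳ-< 2 ℕ.≤-refl (ℕ.n<1+n L)) ⟩
          27 ℕ.^ suc L * 4 ℕ.^ i * 2 ℕ.^ suc L      ≡⟨ arith (27 ℕ.^ suc L) (4 ℕ.^ i) (2 ℕ.^ suc L) ⟩
          27 ℕ.^ suc L * 2 ℕ.^ suc L * 4 ℕ.^ i      ≡⟨ cong (_* 4 ℕ.^ i) (^-distribʳ-* (suc L) 27 2) ⟨
          54 ℕ.^ suc L * 4 ℕ.^ i                    ≤⟨ ℕ.*-monoˡ-≤ (4 ℕ.^ i) (ℕ.^-monoˡ-≤ (suc L) {54} {64} (ℕ.m≤m+n 54 10)) ⟩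
          64 ℕ.^ suc L * 4 ℕ.^ i                    ≡⟨ cong (_* 4 ℕ.^ i) (ℕ.^-*-assoc 4 3 (suc L)) ⟩
          4 ℕ.^ (3 * suc L) * 4 ℕ.^ i               ≡⟨ ℕ.^-distribˡ-+-* 4 (3 * suc L) i ⟨
          4 ℕ.^ (3 * suc L + i)                     ∎
          where
          arith : ∀ a b c → a * b * c ≡ a * c * b
          arith = solve-∀

      module _ (S₀ : List Pt) (doubled : All Doubled S₀) {L : ℕ} (S₀≤ : length S₀ ≤ 2 ℕ.^ L) where
        private
          Inv′ : ℕ → List (List Pt) → Level → Set
          Inv′ = LInv S₀ doubled

          -- A potential: the core points found so far plus those still to come. No step changes it,
          -- so the final cores have as many points as `pad` predicts.
          count : ℕ → List (List Pt) → Level → ℕ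
          count f todo s = pads (suc f) todo + (pads f (proj₁ s) + length (concat (proj₁ (proj₂ s))))

          count-step : ∀ f S todo s → count f (S ∷ todo) s ≡ count f todo (lstep S s todo)
          count-step f S todo s@(next , cores , rest) = sym (trans (cong (count f todo) (lstep≡ S s todo)) (trans
              (cong₂ (λ a b → pads (suc f) todo + (a + b)) (pads-ʳ++ f (proj₁ (node S))) (trans (Permₚ.↭-length (concat-ʳ++ (proj₁ (proj₂ (node S))))) (length-++ (concat (proj₁ (proj₂ (node S)))))))
              (arith (pads (suc f) todo) (pads f (proj₁ (node S))) (pads f next) (length (concat (proj₁ (proj₂ (node S))))) (length (concat cores)))))
            where
            arith : ∀ t ch n co c → t + ((ch + n) + (co + c)) ≡ ((co + ch) + t) + (n + c)
            arith = solve-∀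

          lcost≤ : ∀ {t S todo s} → Inv′ t (S ∷ todo) s → suc (lcost S s todo) ≤ length S * levelRate L
          lcost≤ {t} {S} {todo} {s} I with LInv.ne₁ I | LInv.size₁ I | LInv.todo-⊑ I
          ... | pos ∷ _ | (_ , sz) ∷ _ | inc ∷ _ = begin
            suc (lcost S s todo)              ≤⟨ s≤s (ℕ.+-mono-≤ (iters-node S pos (inc Doubled doubled) {L} (ℕ.≤-trans (ℕ.m≤m+n (length S) t) (ℕ.≤-trans sz S₀≤)))
                (ℕ.≤-trans (ℕ.+-mono-≤ (iters-revApp {list P} N.children _) (ℕ.+-mono-≤ (iters-revApp {list P} N.cores _) (iters-revApp {P} N.rest _))) outputs)) ⟩
            1 + (length S * rate L + length S) ≤⟨ ℕ.+-monoˡ-≤ _ pos ⟩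
            length S + (length S * rate L + length S) ≡⟨ arith (length S) (rate L) ⟩
            length S * levelRate L            ∎
            where
            open ℕ.≤-Reasoning
            module N = IsNode (is-node S pos (inc Doubled doubled))
            arith : ∀ n r → n + (n * r + n) ≡ n * (r + 2)
            arith = solve-∀
            outputs : length N.children + (length N.cores + length N.rest) ≤ length S
            outputs = ℕ.≤-trans (ℕ.+-mono-≤ (length≤concat N.children (proj₁ N.nonempty)) (ℕ.+-monoˡ-≤ _ (length≤concat N.cores (proj₂ N.nonempty))))
              (ℕ.≤-reflexive (trans (cong (length (concat N.children) +_) (sym (length-++ (concat N.cores)))) (trans (sym (length-++ (concat N.children))) (Permₚ.↭-length N.perm))))

          record Levelled (t f : ℕ) (todo : List (List Pt)) (s : Level) : Set where
            field
              inv   : Inv′ t [] (iter lstep todo s)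
              same  : count f todo s ≡ count f [] (iter lstep todo s)
              cost≤ : iterCost lcost lstep todo s ≤ length (concat todo) * levelRate L

          levelled : ∀ {t f} todo s → Inv′ t todo s → Levelled t f todo s
          levelled [] s I = record { inv = I ; same = refl ; cost≤ = z≤n }
          levelled {t} {f} (S ∷ todo) s I = record
            { inv = R.inv ; same = trans (count-step f S todo s) R.same
            ; cost≤ = ℕ.≤-trans (ℕ.+-mono-≤ (lcost≤ I) R.cost≤) (ℕ.≤-reflexive (trans (sym (ℕ.*-distribʳ-+ (levelRate L) (length S) _)) (cong (_* levelRate L) (sym (length-++ S))))) }
            where module R = Levelled (levelled {t} {f} todo (lstep S s todo) (linv-step S₀ doubled I))

          next-level : ∀ {t s} → Inv′ t [] s → Inv′ (suc t) (proj₁ s) ([] , proj₂ s)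
          next-level I = record { perm = I.perm ; ne₁ = I.ne₂ ; ne₂ = [] ; ne₃ = I.ne₃ ; sep = I.sep ; tight = I.tight ; size₁ = I.size₂ ; size₂ = [] }
            where module I = LInv I

          idle : ∀ {t s} → Inv′ t [] ([] , s) → Inv′ (suc t) [] ([] , s)
          idle I = record { perm = I.perm ; ne₁ = [] ; ne₂ = [] ; ne₃ = I.ne₃ ; sep = I.sep ; tight = I.tight ; size₁ = [] ; size₂ = [] }
            where module I = LInv I

          rstep : Pt → Level → List Pt → Level
          rstep _ s _ = cases (proj₁ s) s λ _ _ → ⟦ levelE ⟧ ((param , s) ∷ [])

          rcost : Pt → Level → List Pt → ℕ
          rcost _ s _ = cases (proj₁ s) 0 λ _ _ → iters levelE ((param , s) ∷ [])

          B : ℕ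
          B = length S₀ * levelRate L

          -- Only the first 3 (L + 1) levels do work, each within `B`; the remaining ticks of the
          -- clock cost one step each.
          record Rounded (t : ℕ) (fuel : List Pt) (s : Level) : Set where
            field
              inv   : Inv′ (length fuel + t) (proj₁ (iter rstep fuel s)) ([] , proj₂ (iter rstep fuel s))
              same  : pads (length fuel) (proj₁ s) + length (concat (proj₁ (proj₂ s))) ≡ pads 0 (proj₁ (iter rstep fuel s)) + length (concat (proj₁ (proj₂ (iter rstep fuel s))))
              cost≤ : iterCost rcost rstep fuel s ≤ length fuel + (3 * suc L ∸ t) * B

          rounded : ∀ {t} fuel s → Inv′ t (proj₁ s) ([] , proj₂ s) → Rounded t fuel s
          rounded [] s I = record { inv = I ; same = refl ; cost≤ = z≤n }
          rounded {t} (x ∷ fuel) s@([] , cr) I = record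
            { inv = subst (λ t → Inv′ t (proj₁ (iter rstep (x ∷ fuel) s)) ([] , proj₂ (iter rstep (x ∷ fuel) s))) (ℕ.+-suc (length fuel) t) R.inv
            ; same = R.same
            ; cost≤ = s≤s (ℕ.≤-trans R.cost≤ (ℕ.+-monoʳ-≤ (length fuel) (ℕ.*-monoˡ-≤ B (ℕ.∸-monoʳ-≤ (3 * suc L) (ℕ.n≤1+n t))))) }
            where
            module R = Rounded (rounded {suc t} fuel s (idle I))
          rounded {t} (x ∷ fuel) s@(S ∷ todo , cr) I = record
            { inv = subst (λ t → Inv′ t (proj₁ (iter rstep (x ∷ fuel) s)) ([] , proj₂ (iter rstep (x ∷ fuel) s))) (ℕ.+-suc (length fuel) t) R.inv
            ; same = trans V.same (trans (cong (λ s′ → pads (length fuel) (proj₁ s′) + length (concat (proj₁ (proj₂ s′)))) (sym (level-unfold (S ∷ todo) cr))) R.same)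
            ; cost≤ = s≤s (begin
                iters levelE ((param , s) ∷ []) + iterCost rcost rstep fuel s′  ≤⟨ ℕ.+-mono-≤ (ℕ.≤-trans (ℕ.≤-reflexive (level-cost (S ∷ todo) cr)) (ℕ.≤-trans V.cost≤ (ℕ.*-monoˡ-≤ (levelRate L) fits))) R.cost≤ ⟩
                B + (length fuel + (3 * suc L ∸ suc t) * B)    ≡⟨ arith B (length fuel) ((3 * suc L ∸ suc t) * B) ⟩
                length fuel + (B + (3 * suc L ∸ suc t) * B)    ≡⟨ cong (λ n → length fuel + n * B) (sym (ℕ.+-∸-assoc 1 t<)) ⟩
                length fuel + (3 * suc L ∸ t) * B              ∎) }
            where
            open ℕ.≤-Reasoning
            s′ : Level
            s′ = ⟦ levelE ⟧ ((param , s) ∷ [])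
            module V = Levelled (levelled {t} {length fuel} (S ∷ todo) ([] , cr) I)
            module R = Rounded (rounded {suc t} fuel s′ (subst (λ s → Inv′ (suc t) (proj₁ s) ([] , proj₂ s)) (sym (level-unfold (S ∷ todo) cr)) (next-level V.inv)))
            arith : ∀ a b c → a + (b + c) ≡ b + (a + c)
            arith = solve-∀
            fits : length (concat (S ∷ todo)) ≤ length S₀
            fits = ℕ.≤-trans (ℕ.m≤m+n _ _) (ℕ.≤-reflexive (trans (sym (length-++ (concat (S ∷ todo)))) (Permₚ.↭-length (LInv.perm I))))
            t< : suc t ≤ 3 * suc L
            t< = shallow L {t} {length S} {length S₀} (All.head (LInv.ne₁ I)) S₀≤ (proj₁ (All.head (LInv.size₁ I)))

          initial : 0 < length S₀ → Inv′ 0 (S₀ ∷ []) ([] , [] , [])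
          initial pos = record
            { perm = ↭-reflexive (trans (++-identityʳ _) (++-identityʳ _)) ; ne₁ = pos ∷ [] ; ne₂ = [] ; ne₃ = [] ; sep = [] ∷ [] ; tight = []
            ; size₁ = (ℕ.≤-reflexive (trans (ℕ.*-identityʳ _) (sym (ℕ.+-identityʳ _))) , ℕ.≤-reflexive (ℕ.+-identityʳ _)) ∷ [] ; size₂ = [] }

          opaque
            unfolding roundE
            round-unfold : ⟦ roundE ⟧ ((param , S₀) ∷ []) ≡ iter rstep S₀ (S₀ ∷ [] , [] , [])
            round-unfold = refl
            round-cost : iters roundE ((param , S₀) ∷ []) ≡ iterCost rcost rstep S₀ (S₀ ∷ [] , [] , [])
            round-cost = refl

        record IsRound (cores : List (List Pt)) (rest : List Pt) : Set where
          field
            perm     : concat cores ++ rest ↭ S₀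
            nonempty : All (λ c → 0 < length c) cores
            sep      : AllPairs Sep cores
            tight    : All Tight cores
            progress : ∀ ℓ → length S₀ ≤ ℓ ℕ.^ suc p → length S₀ ≤ 2 * length (concat cores) * ℓ

        module _ (pos : 0 < length S₀) where
          private
            module R = Rounded (rounded {0} S₀ (S₀ ∷ [] , [] , []) (initial pos))
            final : Level
            final = iter rstep S₀ (S₀ ∷ [] , [] , [])
            module I = LInv R.inv

            -- When the clock has run out, the second bound of `Small` leaves no room for a nonempty
            -- node.
            no-nodes : proj₁ final ≡ []
            no-nodes = go (proj₁ final) I.ne₁ I.size₁
              where
              go : ∀ todo → All (λ c → 0 < length c) todo → All (Small S₀ doubled (length S₀ + 0)) todo → todo ≡ []
              go [] _ _ = refl
              go (c ∷ _) (p ∷ _) ((_ , le) ∷ _) = contradiction (ℕ.≤-trans (ℕ.+-monoˡ-≤ (length S₀ + 0) p) le)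
                (ℕ.<⇒≱ (s≤s (ℕ.≤-reflexive (sym (ℕ.+-identityʳ (length S₀))))))

          is-round : IsRound (proj₁ (proj₂ (⟦ roundE ⟧ ((param , S₀) ∷ [])))) (proj₂ (proj₂ (⟦ roundE ⟧ ((param , S₀) ∷ []))))
          is-round = subst (λ r → IsRound (proj₁ (proj₂ r)) (proj₂ (proj₂ r))) (sym round-unfold) record
            { perm = subst (λ n → concat n ++ (concat (proj₁ (proj₂ final)) ++ proj₂ (proj₂ final)) ↭ S₀) no-nodes I.perm
            ; nonempty = I.ne₃
            ; sep = subst (λ n → AllPairs Sep (n ++ proj₁ (proj₂ final))) no-nodes I.sep
            ; tight = I.tight
            -- `pad-large` with denominator 1: `ℓ` itself bounds the root of the size.
            ; progress = λ ℓ root → subst₂ (λ a c → a ≤ 2 * c * ℓ) (ℕ.*-identityʳ (length S₀))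
                (trans (sym (trans (ℕ.+-identityʳ _) (ℕ.+-identityʳ _))) (trans R.same (cong (λ n → pads 0 n + length (concat (proj₁ (proj₂ final)))) no-nodes)))
                (pad-large (length S₀) S₀ pos doubled ℕ.≤-refl ℓ 1 (ℕ.≤-trans (ℕ.≤-reflexive (trans (cong (length S₀ *_) (ℕ.^-zeroˡ (suc p))) (ℕ.*-identityʳ _))) root)) }

          iters-round : iters roundE ((param , S₀) ∷ []) ≤ length S₀ + 3 * suc L * (length S₀ * levelRate L)
          iters-round = ℕ.≤-trans (ℕ.≤-reflexive round-cost) R.cost≤

    -- Bounding boxes of the cores and their emission.

    module Rounds (w : ℝ) (w≥0 : 0ℝ ≤ᵣ w) {p d : ℕ} {θ : List Fraction} (thresholds : Thresholds p (2 * d) θ) (r : ℝ) where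
      open Cuts 𝓡
      open Median 𝓡 using (above-false; atLeast)
      open RoundSpec w w≥0 thresholds public

      private
        maxstep : ℝ → ℝ → List ℝ → ℝ
        maxstep x s _ = if≤ x s s x

        maxstep-spec : ∀ xs s → s ≤ᵣ iter maxstep xs s × All (_≤ᵣ iter maxstep xs s) xs × (iter maxstep xs s ≡ s ⊎ Any (_≡ iter maxstep xs s) xs)
        maxstep-spec [] s = ≤ᵣ-refl , [] , inj₁ refl
        maxstep-spec (x ∷ xs) s with x ≤ᵣ? s
        ... | yes q with maxstep-spec xs s
        ...   | a , b , inj₁ c = a , ≤ᵣ-trans q a ∷ b , inj₁ c
        ...   | a , b , inj₂ c = a , ≤ᵣ-trans q a ∷ b , inj₂ (there c)
        maxstep-spec (x ∷ xs) s | no n with maxstep-spec xs x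
        ...   | a , b , inj₁ c = ≤ᵣ-trans (proj₁ (≰⇒>ᵣ n)) a , a ∷ b , inj₂ (here (sym c))
        ...   | a , b , inj₂ c = ≤ᵣ-trans (proj₁ (≰⇒>ᵣ n)) a , a ∷ b , inj₂ (there c)

      opaque
        unfolding maxE
        ⟦max⟧ : ∀ xs → 0 < length xs → All (_≤ᵣ ⟦ maxE ⟧ (xs ∷ [])) xs × Any (_≡ ⟦ maxE ⟧ (xs ∷ [])) xs
        ⟦max⟧ (x ∷ xs) _ with maxstep-spec xs x
        ... | a , b , inj₁ c = a ∷ b , here (sym c)
        ... | a , b , inj₂ c = a ∷ b , there c
        iters-max : ∀ xs → iters maxE (xs ∷ []) ≤ length xs
        iters-max [] = z≤n
        iters-max (x ∷ xs) = ℕ.≤-trans (iterCost-unit {f = maxstep} (λ y s _ → if≤-le y s z≤n z≤n) xs x) (ℕ.n≤1+n _)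

      mx : List Pt → ℕ → ℝ
      mx C e = ⟦ maxE ⟧ (⟦ keysE ⟧ (advs C e ∷ []) ∷ [])

      module _ {C : List Pt} (pos : 0 < length C) (e : ℕ) where
        private
          ks = ⟦ keysE ⟧ (advs C e ∷ [])
          spec = ⟦max⟧ ks (subst (0 <_) (sym (trans (length-keys (advs C e)) (length-advs C e))) pos)

          counts : ∀ q → # q ks ≡ # (λ x → q (coord e x)) C
          counts q = trans (#-keys {e} {advs C e} (advs-sync C e) q) (#-↭ _ (advs-full C e))

          -- The keys are known only through counts, so statements about all points are turned into
          -- vanishing counts and back.
          zero-count : ∀ {X : Set} (q : X → Bool) xs → # q xs ≡ 0 → All (λ x → q x ≡ false) xs
          zero-count q [] _ = []
          zero-count q (x ∷ xs) eq with q x in eq′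
          ... | false = eq′ ∷ zero-count q xs eq

          not-above : ∀ {t x} → above t x ≡ false → x ≤ᵣ t
          not-above {t} {x} eq with x ≤ᵣ? t
          ... | yes q = q

        below-mx : All (λ x → coord e x ≤ᵣ mx C e) C
        below-mx = All.map not-above (zero-count _ C (trans (sym (counts (above (mx C e)))) (#-none (above (mx C e)) (All.map above-false (proj₁ spec)))))

        mx-least : ∀ {t} → All (λ x → coord e x ≤ᵣ t) C → mx C e ≤ᵣ t
        mx-least {t} a = go (proj₂ spec) (zero-count (above t) ks (trans (counts (above t)) (#-none _ (All.map above-false a))))
          where
          go : ∀ {xs} → Any (_≡ mx C e) xs → All (λ x → above t x ≡ false) xs → mx C e ≤ᵣ t
          go (here eq) (q ∷ _) = subst (_≤ᵣ t) eq (not-above q)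
          go (there i) (_ ∷ qs) = go i qs

        mx-below : ∀ {t} → All (λ x → ¬ (t ≤ᵣ coord e x)) C → ¬ (t ≤ᵣ mx C e)
        mx-below {t} a le = go (proj₂ spec) (zero-count (atLeast t) ks (trans (counts (atLeast t)) (#-none _ (All.map (λ n → dec-false (t ≤ᵣ? _) n) a))))
          where
          go : ∀ {xs} → Any (_≡ mx C e) xs → ¬ All (λ x → atLeast t x ≡ false) xs
          go (here refl) (q ∷ _) = contradiction (trans (sym (dec-true (t ≤ᵣ? mx C e) le)) q) λ ()
          go (there i) (_ ∷ qs) = go i qs

      tops : List Pt → ℕ → List ℝ
      tops C zero = []
      tops C (suc n) = mx C n ∷ tops C n

      private
        bstep : ℝ → List Elem × List ℝ → List ℝ → List Elem × List ℝ
        bstep _ s _ = ⟦ advanceE ⟧ (proj₁ s ∷ []) , ⟦ maxE ⟧ (⟦ keysE ⟧ (proj₁ s ∷ []) ∷ []) ∷ proj₂ s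

        boxing : ∀ C fuel e → proj₂ (iter bstep fuel (advs C e , tops C e)) ≡ tops C (length fuel + e)
        boxing C [] e = refl
        boxing C (_ ∷ fuel) e = trans (boxing C fuel (suc e)) (cong (tops C) (ℕ.+-suc (length fuel) e))

        bcost : ℝ → List Elem × List ℝ → List ℝ → ℕ
        bcost _ s _ = iters advanceE (proj₁ s ∷ []) + (iters keysE (proj₁ s ∷ []) + iters maxE (⟦ keysE ⟧ (proj₁ s ∷ []) ∷ []) + 0)

        boxing-cost : ∀ C fuel e → iterCost bcost bstep fuel (advs C e , tops C e) ≤ length fuel * (1 + 3 * length C)
        boxing-cost C [] e = z≤n
        boxing-cost C (_ ∷ fuel) e = ℕ.+-mono-≤ (s≤s (ℕ.≤-trans (ℕ.+-mono-≤ (ℕ.≤-trans (iters-advance (advs C e)) len) (ℕ.+-monoˡ-≤ 0 (ℕ.+-mono-≤ (ℕ.≤-trans (iters-keys (advs C e)) len)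
            (ℕ.≤-trans (iters-max (⟦ keysE ⟧ (advs C e ∷ []))) (ℕ.≤-trans (ℕ.≤-reflexive (length-keys (advs C e))) len))))) (ℕ.≤-reflexive (arith (length C))))) (boxing-cost C fuel (suc e))
          where
          len : length (advs C e) ≤ length C
          len = ℕ.≤-reflexive (length-advs C e)
          arith : ∀ n → n + (n + n + 0) ≡ 3 * n
          arith = solve-∀

        dims : List Pt → List ℝ
        dims C = cases C [] λ x _ → x

        dims-length : ∀ C → 0 < length C → All Doubled C → length (dims C) ≡ 2 * d
        dims-length (x ∷ C) _ ((eq , _) ∷ _) = eq

        opaque
          unfolding boxE
          box-unfold : ∀ C → ⟦ boxE ⟧ (C ∷ []) ≡ proj₂ (iter bstep (dims C) (advs C 0 , tops C 0))
          box-unfold C = refl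
          box-cost : ∀ C → iters boxE (C ∷ []) ≤ 0 + (length C + iterCost bcost bstep (dims C) (advs C 0 , tops C 0))
          box-cost C = ℕ.+-mono-≤ {y = 0} (cases-le C z≤n λ _ _ → z≤n) (ℕ.+-monoˡ-≤ _ (ℕ.≤-trans (ℕ.≤-reflexive (ℕ.+-identityʳ _)) (iters-init C)))

      ⟦box⟧ : ∀ C → 0 < length C → All Doubled C → ⟦ boxE ⟧ (C ∷ []) ≡ tops C (2 * d)
      ⟦box⟧ C pos dbl = trans (box-unfold C) (trans (boxing C (dims C) 0) (cong (tops C) (trans (ℕ.+-identityʳ _) (dims-length C pos dbl))))

      -- The maximum of the negated coordinate is the negative of the minimum, hence the sign in
      -- `lo`; both ends are moved outwards by `r`.
      lo hi : List Pt → ℕ → ℝ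
      lo C i = -ᵣ (mx C (2 * i) +ᵣ r)
      hi C i = mx C (suc (2 * i)) +ᵣ r

      sides : List Pt → ℕ → List ℝ → List ℝ
      sides C zero fl = fl
      sides C (suc n) fl = sides C n (lo C n ∷ hi C n ∷ fl)

      private
        estep : ℝ → ℝ × List ℝ → List ℝ → ℝ × List ℝ
        estep x s _ = fromℕ 0 ⊖ proj₁ s , proj₁ s *ᵣ (x +ᵣ r) ∷ proj₂ s

        0-1 : fromℕ 0 ⊖ 1ℝ ≡ -ᵣ 1ℝ
        0-1 = +ᵣ-identityˡ _

        emitting : ∀ C n fl → proj₂ (iter estep (tops C (2 * n)) (1ℝ , fl)) ≡ sides C n fl
        emitting C zero fl = refl
        emitting C (suc n) fl = trans (cong (λ ts → proj₂ (iter estep ts (1ℝ , fl))) tops-suc)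
          (trans (cong₂ (λ s xs → proj₂ (iter estep (tops C (2 * n)) (s , xs))) sign (cong₂ _∷_ lower (cong (_∷ fl) (*ᵣ-identityˡ _)))) (emitting C n _))
          where
          tops-suc : tops C (2 * suc n) ≡ mx C (suc (2 * n)) ∷ mx C (2 * n) ∷ tops C (2 * n)
          tops-suc = cong (tops C) (arith n)
            where
            arith : ∀ n → 2 * suc n ≡ suc (suc (2 * n))
            arith = solve-∀
          sign : fromℕ 0 ⊖ (fromℕ 0 ⊖ 1ℝ) ≡ 1ℝ
          sign = trans (cong (fromℕ 0 ⊖_) 0-1) (trans (+ᵣ-identityˡ _) (-ᵣ-involutive 1ℝ))
          lower : (fromℕ 0 ⊖ 1ℝ) *ᵣ (mx C (2 * n) +ᵣ r) ≡ lo C n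
          lower = trans (cong (_*ᵣ (mx C (2 * n) +ᵣ r)) 0-1) (trans (sym (-ᵣ-distribˡ 1ℝ _)) (cong -ᵣ_ (*ᵣ-identityˡ _)))

        opaque
          unfolding emitE
          emit-unfold : ∀ C fl → ⟦ emitE ⟧ ((r , C , fl) ∷ []) ≡ proj₂ (iter estep (⟦ boxE ⟧ (C ∷ [])) (fromℕ 1 , fl))
          emit-unfold C fl = refl
          emit-cost : ∀ C fl → iters emitE ((r , C , fl) ∷ []) ≤ iters boxE (C ∷ []) + (0 + length (⟦ boxE ⟧ (C ∷ [])))
          emit-cost C fl = ℕ.+-monoʳ-≤ (iters boxE (C ∷ [])) (iterCost-unit {f = estep} (λ _ _ _ → z≤n) (⟦ boxE ⟧ (C ∷ [])) _)

      ⟦emit⟧ : ∀ C fl → 0 < length C → All Doubled C → ⟦ emitE ⟧ ((r , C , fl) ∷ []) ≡ sides C d fl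
      ⟦emit⟧ C fl pos dbl = trans (emit-unfold C fl) (trans (cong₂ (λ ts s → proj₂ (iter estep ts (s , fl))) (⟦box⟧ C pos dbl) fromℕ-1) (emitting C d fl))

      iters-emit : ∀ C fl → 0 < length C → All Doubled C → suc (iters emitE ((r , C , fl) ∷ [])) ≤ length C * (2 + 10 * d)
      iters-emit C fl pos dbl = begin
        suc (iters emitE ((r , C , fl) ∷ [])) ≤⟨ s≤s (ℕ.≤-trans (emit-cost C fl) (ℕ.+-mono-≤ (ℕ.≤-trans (box-cost C) (ℕ.+-monoʳ-≤ n (ℕ.≤-trans (boxing-cost C (dims C) 0)
            (ℕ.≤-reflexive (cong (_* (1 + 3 * n)) (dims-length C pos dbl)))))) (ℕ.≤-reflexive (trans (cong length (⟦box⟧ C pos dbl)) (length-tops (2 * d)))))) ⟩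
        1 + (n + 2 * d * (1 + 3 * n) + 2 * d) ≤⟨ ℕ.+-mono-≤ pos (ℕ.+-mono-≤ (ℕ.+-monoʳ-≤ n (ℕ.*-monoʳ-≤ (2 * d) (ℕ.+-monoˡ-≤ (3 * n) pos))) (ℕ.m≤m*n (2 * d) n {{ℕ.>-nonZero pos}})) ⟩
        n + (n + 2 * d * (n + 3 * n) + 2 * d * n) ≡⟨ arith n d ⟩
        n * (2 + 10 * d) ∎
        where
        open ℕ.≤-Reasoning
        n = length C
        arith : ∀ n d → n + (n + 2 * d * (n + 3 * n) + 2 * d * n) ≡ n * (2 + 10 * d)
        arith = solve-∀
        length-tops : ∀ k → length (tops C k) ≡ k
        length-tops zero = refl
        length-tops (suc k) = cong suc (length-tops k)

      flatten : List (List Pt) → List ℝ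
      flatten [] = []
      flatten (C ∷ Cs) = sides C d (flatten Cs)

      private
        emstep : List Pt → List ℝ × List ℝ → List (List Pt) → List ℝ × List ℝ
        emstep C s _ = r ∷ proj₁ s , ⟦ emitE ⟧ ((r , C , proj₂ s) ∷ [])

        emcost : List Pt → List ℝ × List ℝ → List (List Pt) → ℕ
        emcost C s _ = iters emitE ((r , C , proj₂ s) ∷ [])

        opaque
          unfolding emitsE
          emits-unfold : ∀ Cs s → ⟦ emitsE ⟧ ((r , Cs , s) ∷ []) ≡ iter emstep Cs s
          emits-unfold Cs s = refl
          emits-cost : ∀ Cs s → iters emitsE ((r , Cs , s) ∷ []) ≡ iterCost emcost emstep Cs s
          emits-cost Cs s = refl

        emits-go : ∀ Cs ms Ds → All (λ c → 0 < length c) Cs → All (All Doubled) Cs →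
          length (proj₁ (iter emstep Cs (ms , flatten Ds))) ≡ length Cs + length ms × proj₂ (iter emstep Cs (ms , flatten Ds)) ≡ flatten (Cs ʳ++ Ds)
        emits-go [] ms Ds _ _ = refl , refl
        emits-go (C ∷ Cs) ms Ds (p₀ ∷ ps) (q ∷ qs) rewrite ⟦emit⟧ C (flatten Ds) p₀ q =
          trans (proj₁ R) (ℕ.+-suc (length Cs) (length ms)) , proj₂ R
          where R = emits-go Cs (r ∷ ms) (C ∷ Ds) ps qs

        emits-cost-go : ∀ Cs s → All (λ c → 0 < length c) Cs → All (All Doubled) Cs → iterCost emcost emstep Cs s ≤ length (concat Cs) * (2 + 10 * d)
        emits-cost-go [] s _ _ = z≤n
        emits-cost-go (C ∷ Cs) s (p₀ ∷ ps) (q ∷ qs) = ℕ.≤-trans (ℕ.+-mono-≤ (iters-emit C (proj₂ s) p₀ q) (emits-cost-go Cs _ ps qs))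
          (ℕ.≤-reflexive (trans (sym (ℕ.*-distribʳ-+ (2 + 10 * d) (length C) _)) (cong (_* (2 + 10 * d)) (sym (length-++ C)))))

      ⟦emits⟧ : ∀ Cs ms Ds → All (λ c → 0 < length c) Cs → All (All Doubled) Cs → let s = ⟦ emitsE ⟧ ((r , Cs , ms , flatten Ds) ∷ []) in
        length (proj₁ s) ≡ length Cs + length ms × proj₂ s ≡ flatten (Cs ʳ++ Ds)
      ⟦emits⟧ Cs ms Ds ps qs rewrite emits-unfold Cs (ms , flatten Ds) = emits-go Cs ms Ds ps qs

      iters-emits : ∀ Cs s → All (λ c → 0 < length c) Cs → All (All Doubled) Cs → iters emitsE ((r , Cs , s) ∷ []) ≤ length (concat Cs) * (2 + 10 * d)
      iters-emits Cs s ps qs = ℕ.≤-trans (ℕ.≤-reflexive (emits-cost Cs s)) (emits-cost-go Cs s ps qs)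

    -- The sequence of rounds.

    module Main (w : ℝ) (w≥0 : 0ℝ ≤ᵣ w) {p d : ℕ} {θ : List Fraction} (thresholds : Thresholds p (2 * d) θ) (r : ℝ) where
      open Cuts 𝓡
      open Rounds w w≥0 {p} {d} {θ} thresholds r public

      GState : Set
      GState = List Pt × List ℝ × List ℝ

      private
        roundOf : List Pt → Level
        roundOf S = ⟦ roundE ⟧ ((param , S) ∷ [])

        gstep : ℝ → GState → List ℝ → GState
        gstep _ s _ = cases (proj₁ s) s λ _ _ → proj₂ (proj₂ (roundOf (proj₁ s))) , ⟦ emitsE ⟧ ((r , proj₁ (proj₂ (roundOf (proj₁ s))) , proj₂ s) ∷ [])

        gcost : ℝ → GState → List ℝ → ℕ
        gcost _ s _ = cases (proj₁ s) 0 λ _ _ → iters roundE ((param , proj₁ s) ∷ []) + iters emitsE ((r , proj₁ (proj₂ (roundOf (proj₁ s))) , proj₂ s) ∷ [])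

        opaque
          unfolding roundsE
          rounds-unfold : ∀ ns pts → ⟦ roundsE ⟧ ((param , r , ns , pts) ∷ []) ≡ proj₂ (iter gstep ns (pts , [] , []))
          rounds-unfold ns pts = refl
          rounds-cost : ∀ ns pts → iters roundsE ((param , r , ns , pts) ∷ []) ≡ iterCost gcost gstep ns (pts , [] , [])
          rounds-cost ns pts = refl

      roundRate : ℕ → ℕ
      roundRate L = 1 + 3 * suc L * levelRate L + (2 + 10 * d)

      module _ (X : List Pt) (doubled : All Doubled X) {L : ℕ} (X≤ : length X ≤ 2 ℕ.^ L) (ℓ : ℕ) (root : length X ≤ ℓ ℕ.^ suc p) where

        -- The groups are the sets of cores of the rounds.
        record Run (groups : List (List (List Pt))) (st : GState) : Set where
          field
            flat     : proj₂ (proj₂ st) ≡ flatten (concat groups)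
            markers  : length (proj₁ (proj₂ st)) ≡ length (concat groups)
            perm     : concat (concat groups) ++ proj₁ st ↭ X
            nonempty : All (λ c → 0 < length c) (concat groups)
            tight    : All Tight (concat groups)
            sep      : All (AllPairs Sep) groups

        private
          module Step {groups : List (List (List Pt))} {S : List Pt} {ms fl : List ℝ} (R : Run groups (S , ms , fl)) (pos : 0 < length S) where
            module R = Run R
            S-doubled : All Doubled S
            S-doubled = proj₂ (Allₚ.++⁻ (concat (concat groups)) (Permₚ.All-resp-↭ (↭-sym R.perm) doubled))
            S≤X : length S ≤ length X
            S≤X = ℕ.≤-trans (ℕ.m≤n+m _ _) (ℕ.≤-reflexive (trans (sym (length-++ (concat (concat groups)))) (Permₚ.↭-length R.perm)))
            S≤2^L = ℕ.≤-trans S≤X X≤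
            N = is-round S S-doubled {L} S≤2^L pos
            module N = IsRound N
            cores = proj₁ (proj₂ (roundOf S))
            rest = proj₂ (proj₂ (roundOf S))
            cores-doubled : All (All Doubled) cores
            cores-doubled = Allₚ.concat⁻ (proj₁ (Allₚ.++⁻ (concat cores) (Permₚ.All-resp-↭ (↭-sym N.perm) S-doubled)))
            gain : length (concat cores) + length rest ≡ length S
            gain = trans (sym (length-++ (concat cores))) (Permₚ.↭-length N.perm)
            progress : length S ≤ 2 * length (concat cores) * ℓ
            progress = N.progress ℓ (ℕ.≤-trans S≤X root)
            after-round : GState
            after-round = rest , ⟦ emitsE ⟧ ((r , cores , ms , fl) ∷ [])
            emitted : length (proj₁ (proj₂ after-round)) ≡ length cores + length ms × proj₂ (proj₂ after-round) ≡ flatten (cores ʳ++ concat groups)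
            emitted = subst (λ fl → let s = ⟦ emitsE ⟧ ((r , cores , ms , fl) ∷ []) in length (proj₁ s) ≡ length cores + length ms × proj₂ s ≡ flatten (cores ʳ++ concat groups))
              (sym R.flat) (⟦emits⟧ cores ms (concat groups) N.nonempty cores-doubled)
            All-rev : ∀ {Q : List Pt → Set} → All Q cores → All Q (concat groups) → All Q (reverse cores ++ concat groups)
            All-rev a b = Allₚ.++⁺ (Permₚ.All-resp-↭ (↭-sym (Permₚ.↭-reverse cores)) a) b
            run-after-round : Run (reverse cores ∷ groups) after-round
            run-after-round = record
              { flat = trans (proj₂ emitted) (cong flatten (ʳ++-defn cores))
              ; markers = trans (proj₁ emitted) (trans (cong (length cores +_) R.markers) (trans (cong (_+ length (concat groups)) (sym (Permₚ.↭-length (Permₚ.↭-reverse cores)))) (sym (length-++ (reverse cores)))))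
              ; perm = ↭-trans (Permₚ.++⁺ʳ rest (↭-trans (↭-reflexive (cong concat (sym (ʳ++-defn cores)))) (concat-ʳ++ cores)))
                  (↭-trans (reorder₃ (concat cores) (concat (concat groups)) rest) (↭-trans (Permₚ.++⁺ˡ (concat (concat groups)) N.perm) R.perm))
              ; nonempty = All-rev N.nonempty R.nonempty
              ; tight = All-rev N.tight R.tight
              ; sep = AllPairs-↭ sep-sym (↭-sym (Permₚ.↭-reverse cores)) N.sep ∷ R.sep }
              where
              reorder₃ : ∀ (a b c : List Pt) → (a ++ b) ++ c ↭ b ++ (a ++ c)
              reorder₃ a b c = ↭-trans (↭-reflexive (++-assoc a b c)) (Permₚ.shifts a b)
            -- The work of a round is proportional to the size of `S`, and `progress` charges it to
            -- the points that get into cores in this very round. Over all rounds, every point is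
            -- charged once.
            cost : suc (iters roundE ((param , S) ∷ []) + iters emitsE ((r , cores , ms , fl) ∷ [])) ≤ 1 + 2 * ℓ * length (concat cores) * roundRate L
            cost = s≤s (begin
              _ ≤⟨ ℕ.+-mono-≤ (iters-round S S-doubled {L} S≤2^L pos) (iters-emits cores (ms , fl) N.nonempty cores-doubled) ⟩
              m + 3 * suc L * (m * levelRate L) + a * (2 + 10 * d) ≤⟨ ℕ.+-monoʳ-≤ (m + 3 * suc L * (m * levelRate L)) (ℕ.*-monoˡ-≤ (2 + 10 * d) (ℕ.≤-trans (ℕ.m≤m+n a (length rest)) (ℕ.≤-reflexive gain))) ⟩
              m + 3 * suc L * (m * levelRate L) + m * (2 + 10 * d) ≡⟨ arith m (3 * suc L) (levelRate L) (2 + 10 * d) ⟩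
              m * roundRate L ≤⟨ ℕ.*-monoˡ-≤ (roundRate L) progress ⟩
              2 * a * ℓ * roundRate L ≡⟨ cong (_* roundRate L) (arith′ a ℓ) ⟩
              2 * ℓ * a * roundRate L ∎)
              where
              open ℕ.≤-Reasoning
              m = length S
              a = length (concat cores)
              arith : ∀ m t l e → m + t * (m * l) + m * e ≡ m * (1 + t * l + e)
              arith = solve-∀
              arith′ : ∀ a l → 2 * a * l ≡ 2 * l * a
              arith′ = solve-∀
            gains : 0 < length (concat cores)
            gains = positive (length (concat cores)) pos progress
              where
              positive : ∀ a {m} → 0 < m → m ≤ 2 * a * ℓ → 0 < a
              positive (suc a) _ _ = s≤s z≤n
              positive zero (s≤s _) ()

          record Runs (ns : List ℝ) (groups : List (List (List Pt))) (st : GState) : Set where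
            field
              {groups′} : List (List (List Pt))
              run   : Run groups′ (iter gstep ns st)
              -- A round puts at least m / 2 ℓ of the m remaining points into cores. While m ≥ 2 ^
              -- l, it thus lowers 2 ℓ m by at least 2 ^ l, and `j` counts the rounds until m < 2 ^
              -- l. Then `l` drops by one and `j` is reset to 2 ℓ.
              short : ∀ l j → 2 * ℓ * length (proj₁ st) < (2 * ℓ + j) * 2 ℕ.^ l → length groups′ ≤ length groups + (2 * ℓ * l + j)
              empty : length (proj₁ st) ≤ length ns → proj₁ (iter gstep ns st) ≡ []
              cost≤ : iterCost gcost gstep ns st ≤ length ns + 2 * ℓ * length (proj₁ st) * roundRate L

          idle-step : ∀ ns ms fl → iter gstep ns ([] , ms , fl) ≡ ([] , ms , fl)
          idle-step [] ms fl = refl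
          idle-step (_ ∷ ns) ms fl = idle-step ns ms fl

          idle-cost : ∀ ns ms fl → iterCost gcost gstep ns ([] , ms , fl) ≤ length ns
          idle-cost [] ms fl = z≤n
          idle-cost (_ ∷ ns) ms fl = s≤s (idle-cost ns ms fl)

          running : ∀ ns groups st → Run groups st → Runs ns groups st
          working : ∀ n ns groups S ms fl (R : Run groups (S , ms , fl)) (pos : 0 < length S) →
            gstep n (S , ms , fl) ns ≡ (proj₂ (proj₂ (roundOf S)) , ⟦ emitsE ⟧ ((r , proj₁ (proj₂ (roundOf S)) , ms , fl) ∷ [])) →
            gcost n (S , ms , fl) ns ≡ iters roundE ((param , S) ∷ []) + iters emitsE ((r , proj₁ (proj₂ (roundOf S)) , ms , fl) ∷ []) →
            Runs (n ∷ ns) groups (S , ms , fl)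
          running ns groups ([] , ms , fl) R = record
            { run = subst (Run groups) (sym (idle-step ns ms fl)) R ; short = λ _ _ _ → ℕ.m≤m+n _ _
            ; empty = λ _ → cong proj₁ (idle-step ns ms fl) ; cost≤ = ℕ.≤-trans (idle-cost ns ms fl) (ℕ.m≤m+n _ _) }
          running [] groups st@(x ∷ S , ms , fl) R = record
            { run = R ; short = λ _ _ _ → ℕ.m≤m+n _ _ ; empty = λ () ; cost≤ = z≤n }
          running (n ∷ ns) groups (S@(_ ∷ _) , ms , fl) R = working n ns groups S ms fl R (s≤s z≤n) refl refl

          -- The equations say that gstep is not idle.
          working n ns groups S ms fl R pos eq eq′ = record
            { run = subst (λ st → Run Q.groups′ (iter gstep ns st)) (sym eq) Q.run ; short = short
            ; empty = λ le → subst (λ st → proj₁ (iter gstep ns st) ≡ []) (sym eq) (Q.empty (ℕ.≤-pred (ℕ.≤-trans (ℕ.+-monoˡ-≤ (length rest) gains) (ℕ.≤-trans (ℕ.≤-reflexive gain) le))))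
            ; cost≤ = ℕ.≤-trans (ℕ.+-mono-≤ (ℕ.≤-trans (ℕ.≤-reflexive (cong suc eq′)) cost) (subst (λ st → iterCost gcost gstep ns st ≤ length ns + 2 * ℓ * length rest * roundRate L) (sym eq) Q.cost≤)) (ℕ.≤-reflexive (trans (arith (length ns) (2 * ℓ) (length (concat cores)) (length rest) (roundRate L))
                (cong (λ k → suc (length ns) + 2 * ℓ * k * roundRate L) gain))) }
            where
            open Step {groups} {S} {ms} {fl} R pos
            module Q = Runs (running ns (reverse cores ∷ groups) after-round run-after-round)
            m = length S
            a = length (concat cores)
            arith : ∀ n l a b r → (1 + l * a * r) + (n + l * b * r) ≡ suc n + l * (a + b) * r
            arith = solve-∀
            short : ∀ l j → 2 * ℓ * m < (2 * ℓ + j) * 2 ℕ.^ l → length Q.groups′ ≤ length groups + (2 * ℓ * l + j)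
            short l j lt with m ℕ.<? 2 ℕ.^ l
            short zero j lt | yes m< = contradiction (ℕ.≤-trans m< pos) (ℕ.<⇒≱ ℕ.≤-refl)
            short (suc l) j lt | yes m< = ℕ.≤-trans (short l (2 * ℓ) (ℕ.<-≤-trans (lower ℓ ℓ>0) (ℕ.≤-reflexive (arith₁ ℓ (2 ℕ.^ l)))))
              (ℕ.+-monoʳ-≤ (length groups) (ℕ.≤-trans (ℕ.≤-reflexive (arith₂ ℓ l)) (ℕ.m≤m+n (2 * ℓ * suc l) j)))
              where
              arith₁ : ∀ l x → 2 * l * (2 * x) ≡ (2 * l + 2 * l) * x
              arith₁ = solve-∀
              arith₂ : ∀ a l → 2 * a * l + 2 * a ≡ 2 * a * suc l
              arith₂ = solve-∀
              ℓ>0 : 0 < ℓ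
              ℓ>0 = go ℓ progress
                where
                go : ∀ ℓ → m ≤ 2 * a * ℓ → 0 < ℓ
                go (suc ℓ) _ = s≤s z≤n
                go zero le = contradiction (ℕ.≤-trans pos (ℕ.≤-trans le (ℕ.≤-reflexive (ℕ.*-zeroʳ (2 * a))))) λ ()
              lower : ∀ ℓ → 0 < ℓ → 2 * ℓ * m < 2 * ℓ * 2 ℕ.^ suc l
              lower (suc ℓ) _ = ℕ.*-monoʳ-< (2 * suc ℓ) m<
            short l zero lt | no m≮ = contradiction (ℕ.≤-trans (ℕ.≤-reflexive (cong (_* 2 ℕ.^ l) (ℕ.+-identityʳ (2 * ℓ)))) (ℕ.*-monoʳ-≤ (2 * ℓ) (ℕ.≮⇒≥ m≮))) (ℕ.<⇒≱ lt)
            short l (suc j) lt | no m≮ = ℕ.≤-trans (Q.short l j (ℕ.+-cancelʳ-< (2 ℕ.^ l) _ _ (begin-strict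
                2 * ℓ * length rest + 2 ℕ.^ l       ≤⟨ ℕ.+-monoʳ-≤ _ (ℕ.≤-trans (ℕ.≮⇒≥ m≮) (ℕ.≤-trans progress (ℕ.≤-reflexive (arith₁ a ℓ)))) ⟩
                2 * ℓ * length rest + 2 * ℓ * a     ≡⟨ arith₂ (2 * ℓ) (length rest) a ⟩
                2 * ℓ * (a + length rest)           ≡⟨ cong (2 * ℓ *_) gain ⟩
                2 * ℓ * m                           <⟨ lt ⟩
                (2 * ℓ + suc j) * 2 ℕ.^ l           ≡⟨ arith₃ (2 * ℓ) j (2 ℕ.^ l) ⟩
                (2 * ℓ + j) * 2 ℕ.^ l + 2 ℕ.^ l     ∎)))
                (ℕ.≤-reflexive (arith₄ (length groups) (2 * ℓ * l) j))
              where
              open ℕ.≤-Reasoning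
              arith₁ : ∀ a l → 2 * a * l ≡ 2 * l * a
              arith₁ = solve-∀
              arith₂ : ∀ l r a → l * r + l * a ≡ l * (a + r)
              arith₂ = solve-∀
              arith₃ : ∀ l j x → (l + suc j) * x ≡ (l + j) * x + x
              arith₃ = solve-∀
              arith₄ : ∀ g l j → suc g + (l + j) ≡ g + (l + suc j)
              arith₄ = solve-∀

        record Cover (out : List ℝ × List ℝ) (ns : List ℝ) : Set where
          field
            {groups} : List (List (List Pt))
            flat     : proj₂ out ≡ flatten (concat groups)
            markers  : length (proj₁ out) ≡ length (concat groups)
            perm     : concat (concat groups) ↭ X
            nonempty : All (λ c → 0 < length c) (concat groups)
            tight    : All Tight (concat groups)
            sep      : All (AllPairs Sep) groups
            short    : ∀ l → length X < 2 ℕ.^ l → length groups ≤ 2 * ℓ * l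
            cost     : iters roundsE ((param , r , ns , X) ∷ []) ≤ length ns + 2 * ℓ * length X * roundRate L

        cover : ∀ ns → 0 < ℓ → length X ≤ length ns → Cover (⟦ roundsE ⟧ ((param , r , ns , X) ∷ [])) ns
        cover ns ℓ>0 le = record
          { flat = trans (cong proj₂ (rounds-unfold ns X)) R.flat
          ; markers = trans (cong (λ o → length (proj₁ o)) (rounds-unfold ns X)) R.markers
          ; perm = ↭-trans (↭-reflexive (sym (trans (cong (concat (concat Q.groups′) ++_) (Q.empty le)) (++-identityʳ _)))) R.perm
          ; nonempty = R.nonempty ; tight = R.tight ; sep = R.sep
          ; short = λ l lt → ℕ.≤-trans (Q.short l 0 (subst (2 * ℓ * length X <_) (cong (_* 2 ℕ.^ l) (sym (ℕ.+-identityʳ (2 * ℓ)))) (scale ℓ ℓ>0 lt))) (ℕ.≤-reflexive (ℕ.+-identityʳ (2 * ℓ * l)))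
          ; cost = ℕ.≤-trans (ℕ.≤-reflexive (rounds-cost ns X)) Q.cost≤ }
          where
          start : Run [] (X , [] , [])
          start = record { flat = refl ; markers = refl ; perm = ↭-refl ; nonempty = [] ; tight = [] ; sep = [] }
          module Q = Runs (running ns [] (X , [] , []) start)
          module R = Run Q.run
          scale : ∀ ℓ {x y} → 0 < ℓ → x < y → 2 * ℓ * x < 2 * ℓ * y
          scale (suc ℓ) _ lt = ℕ.*-monoʳ-< (2 * suc ℓ) lt

  -- The thresholds, powers of 1 - 1 / (3 p).

  -- The number of squarings of 2 after which 6 d is reached.

  squarings : ℕ → ℕ → ℕ → ℕ
  squarings d zero j = j
  squarings d (suc f) j with 6 * d ℕ.≤? 2 ℕ.^ (2 ℕ.^ j)
  ... | yes _ = j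
  ... | no _ = squarings d f (suc j)

  squarings-large : ∀ d f j → 6 * d ≤ 2 ℕ.^ (2 ℕ.^ (f + j)) → 6 * d ≤ 2 ℕ.^ (2 ℕ.^ squarings d f j)
  squarings-large d zero j le = le
  squarings-large d (suc f) j le with 6 * d ℕ.≤? 2 ℕ.^ (2 ℕ.^ j)
  ... | yes q = q
  ... | no _ = squarings-large d f (suc j) (subst (λ n → 6 * d ≤ 2 ℕ.^ (2 ℕ.^ n)) (sym (ℕ.+-suc f j)) le)

  squarings-least : ∀ d f j K → j ≤ K → suc K ≤ squarings d f j → 2 ℕ.^ (2 ℕ.^ K) < 6 * d
  squarings-least d zero j K le lt = contradiction (ℕ.≤-trans lt le) (ℕ.<⇒≱ ℕ.≤-refl)
  squarings-least d (suc f) j K le lt with 6 * d ℕ.≤? 2 ℕ.^ (2 ℕ.^ j)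
  ... | yes _ = contradiction (ℕ.≤-trans lt le) (ℕ.<⇒≱ ℕ.≤-refl)
  ... | no n with ℕ.m≤n⇒m<n∨m≡n le
  ...   | inj₁ lt′ = squarings-least d f (suc j) K lt′ lt
  ...   | inj₂ refl = ℕ.≰⇒> n

  squarings≤ : ∀ d f j → squarings d f j ≤ f + j
  squarings≤ d zero j = ℕ.≤-refl
  squarings≤ d (suc f) j with 6 * d ℕ.≤? 2 ℕ.^ (2 ℕ.^ j)
  ... | yes _ = ℕ.m≤n+m j (suc f)
  ... | no _ = ℕ.≤-trans (squarings≤ d f (suc j)) (ℕ.≤-reflexive (ℕ.+-suc f j))

  squarings-stay : ∀ d f j → 6 * d ≤ 2 ℕ.^ (2 ℕ.^ j) → squarings d f j ≡ j
  squarings-stay d zero j le = refl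
  squarings-stay d (suc f) j le with 6 * d ℕ.≤? 2 ℕ.^ (2 ℕ.^ j)
  ... | yes _ = refl
  ... | no n = contradiction le n

  -- About log log d. With 3 + d attempts the search always succeeds, as 6 d ≤ 2 ^ (3 + d).
  K : ℕ → ℕ
  K d = squarings d (3 + d) 0

  6d≤2^2^K : ∀ d → 6 * d ≤ 2 ℕ.^ (2 ℕ.^ K d)
  6d≤2^2^K d = squarings-large d (3 + d) 0 (begin
      6 * d                             ≤⟨ ℕ.*-mono-≤ (ℕ.m≤m+n 6 2) (n≤2^n d) ⟩
      8 * 2 ℕ.^ d                       ≡⟨ ℕ.^-distribˡ-+-* 2 3 d ⟨
      2 ℕ.^ (3 + d)                     ≤⟨ ℕ.^-monoʳ-≤ 2 (ℕ.≤-trans (n≤2^n (3 + d)) (ℕ.≤-reflexive (cong (2 ℕ.^_) (sym (ℕ.+-identityʳ (3 + d)))))) ⟩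
      2 ℕ.^ (2 ℕ.^ (3 + d + 0))         ∎)
    where open ℕ.≤-Reasoning

  -- The exponents of the thresholds: in each block p equal steps, which double
  -- from block to block.

  block : ℕ → ℕ → ℕ → List ℕ
  block zero e s = []
  block (suc n) e s = e + s ∷ block n (e + s) s

  blocks : ℕ → ℕ → ℕ → ℕ → List ℕ
  blocks p zero e s = []
  blocks p (suc k) e s = block p e s ++ blocks p k (e + p * s) (s + s)

  length-block : ∀ n e s → length (block n e s) ≡ n
  length-block zero e s = refl
  length-block (suc n) e s = cong suc (length-block n (e + s) s)

  length-blocks : ∀ p k e s → length (blocks p k e s) ≡ k * p
  length-blocks p zero e s = refl
  length-blocks p (suc k) e s = trans (length-++ (block p e s)) (cong₂ _+_ (length-block p e s) (length-blocks p k _ _))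

  module Powers (p : ℕ) (p>0 : 0 < p) where

    -- All thresholds are powers of 1 - 1 / (3 p). By the two forms of Bernoulli's inequality, its
    -- p-th power is at least 2/3, as the first threshold has to be, and at most 3/4, so that
    -- doubling the exponent soon makes it small.
    base : ℕ
    base = 3 * p ∸ 1

    suc-base : suc base ≡ 3 * p
    suc-base = go p p>0
      where
      go : ∀ p → 0 < p → suc (3 * p ∸ 1) ≡ 3 * p
      go (suc p) _ = refl

    power : ℕ → Fraction
    power e = base ℕ.^ e , suc base ℕ.^ e

    -- (1 - 1 / A) ^ n ≥ 1 - n / A for A = a + 1, with denominators cleared.
    bernoulli : ∀ a n → suc a ℕ.^ n * suc a ≤ a ℕ.^ n * suc a + n * suc a ℕ.^ n
    bernoulli a zero = ℕ.≤-reflexive (sym (ℕ.+-identityʳ _))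
    bernoulli a (suc n) = begin
      A * A ℕ.^ n * A                                  ≡⟨ ℕ.*-assoc A (A ℕ.^ n) A ⟩
      A * (A ℕ.^ n * A)                                ≤⟨ ℕ.*-monoʳ-≤ A (bernoulli a n) ⟩
      A * (a ℕ.^ n * A + n * A ℕ.^ n)                  ≡⟨ arith a (a ℕ.^ n) n (A ℕ.^ n) ⟩
      a * a ℕ.^ n * A + (a ℕ.^ n * A + n * (A * A ℕ.^ n)) ≤⟨ ℕ.+-monoʳ-≤ (a * a ℕ.^ n * A) (ℕ.+-monoˡ-≤ _ (ℕ.≤-trans (ℕ.*-monoˡ-≤ A (ℕ.^-monoˡ-≤ n (ℕ.n≤1+n a))) (ℕ.≤-reflexive (ℕ.*-comm (A ℕ.^ n) A)))) ⟩
      a * a ℕ.^ n * A + suc n * (A * A ℕ.^ n)          ∎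
      where
      open ℕ.≤-Reasoning
      A = suc a
      arith : ∀ a x n y → suc a * (x * suc a + n * y) ≡ a * x * suc a + (x * suc a + n * (suc a * y))
      arith = solve-∀

    -- (1 + 1 / a) ^ n ≥ 1 + n / a, with denominators cleared.
    bernoulli′ : ∀ a n → a ℕ.^ n * (a + n) ≤ suc a ℕ.^ n * a
    bernoulli′ a zero = ℕ.≤-reflexive (cong (1 *_) (ℕ.+-identityʳ a))
    bernoulli′ a (suc n) = begin
      a * a ℕ.^ n * (a + suc n)                   ≡⟨ arith a (a ℕ.^ n) n ⟩
      a * (a ℕ.^ n * (a + n)) + a * a ℕ.^ n       ≤⟨ ℕ.+-mono-≤ (ℕ.*-monoʳ-≤ a (bernoulli′ a n)) (ℕ.≤-trans (ℕ.≤-reflexive (ℕ.*-comm a _)) (ℕ.≤-trans (ℕ.*-monoʳ-≤ (a ℕ.^ n) (ℕ.m≤m+n a n)) (bernoulli′ a n))) ⟩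
      a * (suc a ℕ.^ n * a) + suc a ℕ.^ n * a     ≡⟨ arith′ a (suc a ℕ.^ n) ⟩
      suc a * suc a ℕ.^ n * a                     ∎
      where
      open ℕ.≤-Reasoning
      arith : ∀ a x n → a * x * (a + suc n) ≡ a * (x * (a + n)) + a * x
      arith = solve-∀
      arith′ : ∀ a y → a * (y * a) + y * a ≡ suc a * y * a
      arith′ = solve-∀

    first-large : 2 * suc base ℕ.^ p ≤ 3 * base ℕ.^ p
    first-large = ℕ.*-cancelˡ-≤ p {{ℕ.>-nonZero p>0}} (ℕ.+-cancelʳ-≤ (p * A ℕ.^ p) _ _ (begin
      p * (2 * A ℕ.^ p) + p * A ℕ.^ p    ≡⟨ arith p (A ℕ.^ p) ⟩
      A ℕ.^ p * (3 * p)                  ≡⟨ cong (A ℕ.^ p *_) suc-base ⟨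
      A ℕ.^ p * A                        ≤⟨ bernoulli base p ⟩
      base ℕ.^ p * A + p * A ℕ.^ p       ≡⟨ cong (λ x → base ℕ.^ p * x + p * A ℕ.^ p) suc-base ⟩
      base ℕ.^ p * (3 * p) + p * A ℕ.^ p ≡⟨ cong (_+ p * A ℕ.^ p) (arith′ (base ℕ.^ p) p) ⟩
      p * (3 * base ℕ.^ p) + p * A ℕ.^ p ∎))
      where
      open ℕ.≤-Reasoning
      A = suc base
      arith : ∀ p x → p * (2 * x) + p * x ≡ x * (3 * p)
      arith = solve-∀
      arith′ : ∀ x p → x * (3 * p) ≡ p * (3 * x)
      arith′ = solve-∀

    base>0 : 0 < base
    base>0 = ℕ.≤-pred (ℕ.≤-trans (ℕ.≤-trans (ℕ.n≤1+n 2) (ℕ.*-monoʳ-≤ 3 p>0)) (ℕ.≤-reflexive (sym suc-base)))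

    first-small : 4 * base ℕ.^ p ≤ 3 * suc base ℕ.^ p
    first-small = ℕ.*-cancelʳ-≤ _ _ base {{ℕ.>-nonZero base>0}} (begin
      4 * base ℕ.^ p * base        ≡⟨ arith (base ℕ.^ p) base ⟩
      base ℕ.^ p * (3 * base + base) ≤⟨ ℕ.*-monoʳ-≤ (base ℕ.^ p) (ℕ.+-monoʳ-≤ (3 * base) (ℕ.≤-trans (ℕ.n≤1+n base) (ℕ.≤-reflexive suc-base))) ⟩
      base ℕ.^ p * (3 * base + 3 * p) ≡⟨ arith′ (base ℕ.^ p) base p ⟩
      3 * (base ℕ.^ p * (base + p)) ≤⟨ ℕ.*-monoʳ-≤ 3 (bernoulli′ base p) ⟩
      3 * (suc base ℕ.^ p * base)  ≡⟨ ℕ.*-assoc 3 (suc base ℕ.^ p) base ⟨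
      3 * suc base ℕ.^ p * base    ∎)
      where
      open ℕ.≤-Reasoning
      arith : ∀ x a → 4 * x * a ≡ x * (3 * a + a)
      arith = solve-∀
      arith′ : ∀ x a p → x * (3 * a + 3 * p) ≡ 3 * (x * (a + p))
      arith′ = solve-∀

    power>0 : ∀ e → 0 < proj₂ (power e)
    power>0 e = ℕ.m^n>0 (suc base) e

    power-antitone : ∀ {x y} → x ≤ y → base ℕ.^ y * suc base ℕ.^ x ≤ base ℕ.^ x * suc base ℕ.^ y
    power-antitone {x} {y} le = subst (λ y → base ℕ.^ y * suc base ℕ.^ x ≤ base ℕ.^ x * suc base ℕ.^ y) (ℕ.m+[n∸m]≡n le) (go (y ∸ x))
      where
      go : ∀ i → base ℕ.^ (x + i) * suc base ℕ.^ x ≤ base ℕ.^ x * suc base ℕ.^ (x + i)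
      go i rewrite ℕ.^-distribˡ-+-* base x i | ℕ.^-distribˡ-+-* (suc base) x i = begin
        base ℕ.^ x * base ℕ.^ i * suc base ℕ.^ x        ≤⟨ ℕ.*-monoˡ-≤ _ (ℕ.*-monoʳ-≤ (base ℕ.^ x) (ℕ.^-monoˡ-≤ i (ℕ.n≤1+n base))) ⟩
        base ℕ.^ x * suc base ℕ.^ i * suc base ℕ.^ x    ≡⟨ arith (base ℕ.^ x) (suc base ℕ.^ i) (suc base ℕ.^ x) ⟩
        base ℕ.^ x * (suc base ℕ.^ x * suc base ℕ.^ i)  ∎
        where
        open ℕ.≤-Reasoning
        arith : ∀ a b c → a * b * c ≡ a * (c * b)
        arith = solve-∀

    -- For powers of one fraction below 1, the condition of `Link` compares exponents: (e + s) p ≤ e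
    -- (p + 1), that is, p s ≤ e.
    link : ∀ {e s} → p * s ≤ e → Link p (power e) (power (e + s))
    link {e} {s} le = record { D>0 = power>0 e ; D′>0 = power>0 (e + s) ; slow = begin
        (base ℕ.^ e) ℕ.^ suc p * (suc base ℕ.^ (e + s)) ℕ.^ p ≡⟨ cong₂ _*_ (ℕ.^-*-assoc base e (suc p)) (ℕ.^-*-assoc (suc base) (e + s) p) ⟩
        base ℕ.^ (e * suc p) * suc base ℕ.^ ((e + s) * p)     ≤⟨ power-antitone exps ⟩
        base ℕ.^ ((e + s) * p) * suc base ℕ.^ (e * suc p)     ≡⟨ cong₂ _*_ (ℕ.^-*-assoc base (e + s) p) (ℕ.^-*-assoc (suc base) e (suc p)) ⟨
        (base ℕ.^ (e + s)) ℕ.^ p * (suc base ℕ.^ e) ℕ.^ suc p ∎ }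
      where
      open ℕ.≤-Reasoning
      arith : ∀ e s p → (e + s) * p ≡ e * p + p * s
      arith = solve-∀
      exps : (e + s) * p ≤ e * suc p
      exps = ℕ.≤-trans (ℕ.≤-reflexive (arith e s p)) (ℕ.≤-trans (ℕ.+-monoʳ-≤ (e * p) le) (ℕ.≤-reflexive (trans (ℕ.+-comm (e * p) e) (sym (ℕ.*-suc e p)))))

    block-ladder : ∀ n {e s θ z} → p * s ≤ e → Ladder p (power (e + n * s)) θ z → Ladder p (power e) (map power (block n e s) ++ θ) z
    block-ladder zero {e} {θ = θ} {z} le l = subst (λ e → Ladder p (power e) θ z) (ℕ.+-identityʳ e) l
    block-ladder (suc n) {e} {s} {θ} {z} le l = link le ∷ block-ladder n (ℕ.≤-trans le (ℕ.m≤m+n e s))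
      (subst (λ e → Ladder p (power e) θ z) (sym (ℕ.+-assoc e s (n * s))) l)

    -- A block starts at the exponent p s and makes p steps of size s. It ends at p (2 s), which is
    -- just what allows steps of size 2 s from there on.
    blocks-ladder : ∀ k s → Ladder p (power (p * s)) (map power (blocks p k (p * s) s)) (power (p * (2 ℕ.^ k * s)))
    blocks-ladder zero s = subst (λ e → Ladder p (power (p * s)) [] (power (p * e))) (sym (ℕ.+-identityʳ s)) (stop (power>0 (p * s)))
    blocks-ladder (suc k) s = subst (λ θ → Ladder p (power (p * s)) θ (power (p * (2 ℕ.^ suc k * s)))) (sym (map-++ power (block p (p * s) s) _))
      (block-ladder p ℕ.≤-refl (subst₂ (λ e f → Ladder p (power e) (map power (blocks p k e (s + s))) (power (p * f))) (ℕ.*-distribˡ-+ p s s) (arith (2 ℕ.^ k) s) (blocks-ladder k (s + s))))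
      where
      arith : ∀ x s → x * (s + s) ≡ (x + (x + 0)) * s
      arith = solve-∀

    -- The p-th power is at most 3/4, and (3/4) ^ 4 = 81 / 256 ≤ 1 / 2. As T = 4 U, the last
    -- threshold is at most 1 / 2 ^ U, where 2 ^ U ≥ 6 d. The factor 4 is the reason for the two
    -- blocks beyond `K d`.
    last-small : ∀ d → proj₁ (power (p * 2 ℕ.^ (2 + K d))) * (6 * d) ≤ proj₂ (power (p * 2 ℕ.^ (2 + K d)))
    last-small d = ℕ.*-cancelʳ-≤ _ _ (3 ℕ.^ T) {{ℕ.m^n≢0 3 T}} (begin
      base ℕ.^ (p * T) * (6 * d) * 3 ℕ.^ T           ≡⟨ ℕ.*-assoc (base ℕ.^ (p * T)) (6 * d) _ ⟩
      base ℕ.^ (p * T) * (6 * d * 3 ℕ.^ T)           ≤⟨ ℕ.*-monoʳ-≤ (base ℕ.^ (p * T)) (begin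
          6 * d * 3 ℕ.^ T                            ≤⟨ ℕ.*-monoˡ-≤ (3 ℕ.^ T) (6d≤2^2^K d) ⟩
          2 ℕ.^ U * 3 ℕ.^ T                          ≡⟨ cong (λ n → 2 ℕ.^ U * 3 ℕ.^ n) T≡ ⟩
          2 ℕ.^ U * 3 ℕ.^ (4 * U)                    ≡⟨ cong (2 ℕ.^ U *_) (sym (ℕ.^-*-assoc 3 4 U)) ⟩
          2 ℕ.^ U * 81 ℕ.^ U                         ≡⟨ ^-distribʳ-* U 2 81 ⟨
          162 ℕ.^ U                                  ≤⟨ ℕ.^-monoˡ-≤ U (ℕ.m≤m+n 162 94) ⟩
          256 ℕ.^ U                                  ≡⟨ ℕ.^-*-assoc 4 4 U ⟩
          4 ℕ.^ (4 * U)                              ≡⟨ cong (4 ℕ.^_) T≡ ⟨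
          4 ℕ.^ T                                    ∎) ⟩
      base ℕ.^ (p * T) * 4 ℕ.^ T                     ≡⟨ cong (_* 4 ℕ.^ T) (ℕ.^-*-assoc base p T) ⟨
      (base ℕ.^ p) ℕ.^ T * 4 ℕ.^ T                   ≡⟨ ^-distribʳ-* T (base ℕ.^ p) 4 ⟨
      (base ℕ.^ p * 4) ℕ.^ T                         ≤⟨ ℕ.^-monoˡ-≤ T (ℕ.≤-trans (ℕ.≤-reflexive (ℕ.*-comm (base ℕ.^ p) 4)) (ℕ.≤-trans first-small (ℕ.≤-reflexive (ℕ.*-comm 3 (suc base ℕ.^ p))))) ⟩
      (suc base ℕ.^ p * 3) ℕ.^ T                     ≡⟨ ^-distribʳ-* T (suc base ℕ.^ p) 3 ⟩
      (suc base ℕ.^ p) ℕ.^ T * 3 ℕ.^ T               ≡⟨ cong (_* 3 ℕ.^ T) (ℕ.^-*-assoc (suc base) p T) ⟩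
      suc base ℕ.^ (p * T) * 3 ℕ.^ T                 ∎)
      where
      open ℕ.≤-Reasoning
      U = 2 ℕ.^ K d
      T = 2 ℕ.^ (2 + K d)
      T≡ : T ≡ 4 * U
      T≡ = ℕ.^-distribˡ-+-* 2 2 (K d)

    exponents : ℕ → List ℕ
    exponents d = blocks p (2 + K d) p 1

    thresholds : ∀ d → 0 < d → Thresholds p (2 * d) (map power (exponents d))
    thresholds d d>0 = record
      { E>0 = ℕ.≤-trans d>0 (ℕ.m≤m+n d _)
      ; ladder = subst₂ (λ e f → Ladder p (power e) (map power (blocks p (2 + K d) e 1)) (power (p * f))) (ℕ.*-identityʳ p) (ℕ.*-identityʳ _) (blocks-ladder (2 + K d) 1)
      ; large = first-large
      ; small = ℕ.≤-trans (ℕ.≤-reflexive (cong (proj₁ (power (p * 2 ℕ.^ (2 + K d))) *_) (arith d))) (last-small d) }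
      where
      arith : ∀ d → 3 * (2 * d) ≡ 6 * d
      arith = solve-∀

  -- Computing p and the thresholds, and reading the points.

  module Parameters (𝓡 : RealNumbers) where
    open Basics 𝓡
    open Cuts 𝓡

    private
      module Blocks (ds : List ℝ) where
        d : ℕ
        d = length ds

        six : ℝ
        six = fromℕ 6 *ᵣ ⟦ lenE {num} ⟧ (ds ∷ [])

        six≡ : six ≡ fromℕ (6 * d)
        six≡ = trans (cong (fromℕ 6 *ᵣ_) (⟦len⟧ {num} ds)) (sym (fromℕ-* 6 d))

        step : ℝ → ℝ × List ℝ → List ℝ → ℝ × List ℝ
        step u s _ = if≤ six (proj₁ s) s (proj₁ s *ᵣ proj₁ s , u ∷ proj₂ s)

        go : ∀ fuel j l → length l ≡ j → length (proj₂ (iter step fuel (fromℕ (2 ℕ.^ (2 ℕ.^ j)) , l))) ≡ squarings d (length fuel) j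
        go [] j l eq = eq
        go (u ∷ fuel) j l eq with six ≤ᵣ? fromℕ (2 ℕ.^ (2 ℕ.^ j)) | 6 * d ℕ.≤? 2 ℕ.^ (2 ℕ.^ j)
        ... | yes _ | yes q = trans (go fuel j l eq) (squarings-stay d (length fuel) j q)
        ... | yes q | no n = contradiction (fromℕ-cancel {6 * d} {2 ℕ.^ (2 ℕ.^ j)} (subst (_≤ᵣ fromℕ (2 ℕ.^ (2 ℕ.^ j))) six≡ q)) n
        ... | no n | yes q = contradiction (subst (_≤ᵣ fromℕ (2 ℕ.^ (2 ℕ.^ j))) (sym six≡) (fromℕ-mono {6 * d} {2 ℕ.^ (2 ℕ.^ j)} q)) n
        ... | no _ | no _ = trans (cong (λ x → length (proj₂ (iter step fuel (x , u ∷ l)))) square) (go fuel (suc j) (u ∷ l) (cong suc eq))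
          where
          square : fromℕ (2 ℕ.^ (2 ℕ.^ j)) *ᵣ fromℕ (2 ℕ.^ (2 ℕ.^ j)) ≡ fromℕ (2 ℕ.^ (2 ℕ.^ suc j))
          square = trans (sym (fromℕ-* (2 ℕ.^ (2 ℕ.^ j)) (2 ℕ.^ (2 ℕ.^ j)))) (cong fromℕ (trans (sym (ℕ.^-distribˡ-+-* 2 (2 ℕ.^ j) (2 ℕ.^ j)))
            (cong (2 ℕ.^_) (cong (2 ℕ.^ j +_) (sym (ℕ.+-identityʳ (2 ℕ.^ j)))))))

    opaque
      unfolding blocksE
      length-blocksE : ∀ ds → length (⟦ blocksE ⟧ (ds ∷ [])) ≡ 2 + K (length ds)
      length-blocksE ds = cong (λ n → 2 + n) (Blocks.go ds (fromℕ 0 ∷ fromℕ 0 ∷ fromℕ 0 ∷ ds) 0 [] refl)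
      iters-blocks : ∀ ds → iters blocksE (ds ∷ []) ≤ 3 + 2 * length ds
      iters-blocks ds = ℕ.≤-trans (ℕ.+-mono-≤ (iters-len {num} ds) (ℕ.≤-trans (ℕ.≤-reflexive (ℕ.+-identityʳ _)) (iterCost-unit {f = Blocks.step ds}
        (λ _ s _ → if≤-le (Blocks.six ds) (proj₁ s) z≤n z≤n) (fromℕ 0 ∷ fromℕ 0 ∷ fromℕ 0 ∷ ds) _))) (ℕ.≤-reflexive (arith (length ds)))
        where
        arith : ∀ d → d + (3 + d) ≡ 3 + 2 * d
        arith = solve-∀

    -- The least number q with q ρ > 2, but at most f more than j.
    reach : ℝ → ℕ → ℕ → ℕ
    reach ρ zero j = j
    reach ρ (suc f) j with fromℕ j *ᵣ ρ ≤ᵣ? fromℕ 2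
    ... | yes _ = reach ρ f (suc j)
    ... | no _ = j

    reach-stay : ∀ ρ f j → ¬ (fromℕ j *ᵣ ρ ≤ᵣ fromℕ 2) → reach ρ f j ≡ j
    reach-stay ρ zero j n = refl
    reach-stay ρ (suc f) j n with fromℕ j *ᵣ ρ ≤ᵣ? fromℕ 2
    ... | yes q = contradiction q n
    ... | no _ = refl

    reach≤ : ∀ ρ f j → reach ρ f j ≤ f + j
    reach≤ ρ zero j = ℕ.≤-refl
    reach≤ ρ (suc f) j with fromℕ j *ᵣ ρ ≤ᵣ? fromℕ 2
    ... | yes _ = ℕ.≤-trans (reach≤ ρ f (suc j)) (ℕ.≤-reflexive (ℕ.+-suc f j))
    ... | no _ = ℕ.m≤n+m j (suc f)

    reach-below : ∀ ρ f j i → j ≤ i → i < reach ρ f j → fromℕ i *ᵣ ρ ≤ᵣ fromℕ 2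
    reach-below ρ zero j i le lt = contradiction lt (ℕ.≤⇒≯ le)
    reach-below ρ (suc f) j i le lt with fromℕ j *ᵣ ρ ≤ᵣ? fromℕ 2
    ... | no _ = contradiction lt (ℕ.≤⇒≯ le)
    ... | yes q with ℕ.m≤n⇒m<n∨m≡n le
    ...   | inj₁ lt′ = reach-below ρ f (suc j) i lt′ lt
    ...   | inj₂ refl = q

    reach-end : ∀ ρ f j → reach ρ f j ≡ f + j ⊎ ¬ (fromℕ (reach ρ f j) *ᵣ ρ ≤ᵣ fromℕ 2)
    reach-end ρ zero j = inj₁ refl
    reach-end ρ (suc f) j with fromℕ j *ᵣ ρ ≤ᵣ? fromℕ 2
    ... | no n = inj₂ n
    ... | yes _ with reach-end ρ f (suc j)
    ...   | inj₁ eq = inj₁ (trans eq (ℕ.+-suc f j))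
    ...   | inj₂ n = inj₂ n

    private
      module Qs (ρ : ℝ) where
        step : ℝ → ℝ × List ℝ → List ℝ → ℝ × List ℝ
        step u s _ = if≤ (proj₁ s) (fromℕ 2) (proj₁ s +ᵣ ρ , u ∷ proj₂ s) s

        go : ∀ fuel j x l → x ≡ fromℕ j *ᵣ ρ → length l ≡ j → length (proj₂ (iter step fuel (x , l))) ≡ reach ρ (length fuel) j
        go [] j x l _ eq = eq
        go (u ∷ fuel) j x l refl eq with fromℕ j *ᵣ ρ ≤ᵣ? fromℕ 2
        ... | yes _ = go fuel (suc j) _ (u ∷ l) (trans (+ᵣ-comm _ ρ) (trans (cong (_+ᵣ fromℕ j *ᵣ ρ) (sym (*ᵣ-identityˡ ρ))) (sym (*ᵣ-distribʳ ρ 1ℝ (fromℕ j))))) (cong suc eq)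
        ... | no n = trans (go fuel j _ l refl eq) (reach-stay ρ (length fuel) j n)

    opaque
      unfolding qsE
      length-qsE : ∀ ρ ns → length (⟦ qsE ⟧ ((ρ , ns) ∷ [])) ≡ reach ρ (2 + length ns) 0
      length-qsE ρ ns = Qs.go ρ (fromℕ 0 ∷ fromℕ 0 ∷ ns) 0 _ [] (sym (*ᵣ-zeroˡ ρ)) refl
      iters-qs : ∀ ρ ns → iters qsE ((ρ , ns) ∷ []) ≤ 2 + length ns
      iters-qs ρ ns = iterCost-unit {f = Qs.step ρ} (λ _ s _ → if≤-le (proj₁ s) (fromℕ 2) z≤n z≤n) (fromℕ 0 ∷ fromℕ 0 ∷ ns) _

    private
      module Ladders (ps : List ℝ) (p>0 : 0 < length ps) where
        p : ℕ
        p = length ps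
        open Powers p p>0

        LState : Set
        LState = (ℝ × ℝ) × (ℝ × ℝ) × List (ℝ × ℝ)

        A a : ℝ
        A = fromℕ 3 *ᵣ ⟦ lenE {num} ⟧ (ps ∷ [])
        a = A ⊖ fromℕ 1

        pow : ℕ → ℝ × ℝ
        pow e = fromℕ (base ℕ.^ e) , fromℕ (suc base ℕ.^ e)

        A≡ : A ≡ fromℕ (suc base)
        A≡ = trans (cong (fromℕ 3 *ᵣ_) (⟦len⟧ {num} ps)) (trans (sym (fromℕ-* 3 p)) (cong fromℕ (sym suc-base)))

        a≡ : a ≡ fromℕ base
        a≡ = trans (cong (_⊖ fromℕ 1) A≡) (fromℕ-pred base)

        pow-+ : ∀ e s → (proj₁ (pow e) *ᵣ proj₁ (pow s) , proj₂ (pow e) *ᵣ proj₂ (pow s)) ≡ pow (e + s)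
        pow-+ e s = cong₂ _,_ (trans (sym (fromℕ-* (base ℕ.^ e) (base ℕ.^ s))) (cong fromℕ (sym (ℕ.^-distribˡ-+-* base e s))))
          (trans (sym (fromℕ-* (suc base ℕ.^ e) (suc base ℕ.^ s))) (cong fromℕ (sym (ℕ.^-distribˡ-+-* (suc base) e s))))

        step₀ : ℝ → ℝ × ℝ → List ℝ → ℝ × ℝ
        step₀ _ s _ = a *ᵣ proj₁ s , A *ᵣ proj₂ s

        start : ∀ fuel e → iter step₀ fuel (pow e) ≡ pow (length fuel + e)
        start [] e = refl
        start (_ ∷ fuel) e = trans (cong (iter step₀ fuel) (cong₂ _,_ (trans (cong (_*ᵣ fromℕ (base ℕ.^ e)) a≡) (sym (fromℕ-* base (base ℕ.^ e))))
          (trans (cong (_*ᵣ fromℕ (suc base ℕ.^ e)) A≡) (sym (fromℕ-* (suc base) (suc base ℕ.^ e)))))) (trans (start fuel (suc e)) (cong pow (ℕ.+-suc (length fuel) e)))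

        step₁ : ℝ × ℝ → ℝ → (ℝ × ℝ) × List (ℝ × ℝ) → List ℝ → (ℝ × ℝ) × List (ℝ × ℝ)
        step₁ h _ s _ = let c = proj₁ (proj₁ s) *ᵣ proj₁ h , proj₂ (proj₁ s) *ᵣ proj₂ h in c , c ∷ proj₂ s

        inner : ∀ fuel e s acc → iter (step₁ (pow s)) fuel (pow e , acc) ≡ (pow (e + length fuel * s) , map pow (block (length fuel) e s) ʳ++ acc)
        inner [] e s acc = cong (λ n → pow n , acc) (sym (ℕ.+-identityʳ e))
        inner (_ ∷ fuel) e s acc = trans (cong (λ c → iter (step₁ (pow s)) fuel (c , c ∷ acc)) (pow-+ e s))
          (trans (inner fuel (e + s) s (pow (e + s) ∷ acc)) (cong (λ n → pow n , map pow (block (length fuel) (e + s) s) ʳ++ (pow (e + s) ∷ acc)) (ℕ.+-assoc e s _)))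

        step₂ : ℝ → LState → List ℝ → LState
        step₂ _ s _ = let u = iter (step₁ (proj₁ (proj₂ s))) ps (proj₁ s , proj₂ (proj₂ s)) in
          proj₁ u , (proj₁ (proj₁ (proj₂ s)) *ᵣ proj₁ (proj₁ (proj₂ s)) , proj₂ (proj₁ (proj₂ s)) *ᵣ proj₂ (proj₁ (proj₂ s))) , proj₂ u

        outer : ∀ bs e s acc → proj₂ (proj₂ (iter step₂ bs (pow e , pow s , acc))) ≡ map pow (blocks p (length bs) e s) ʳ++ acc
        outer [] e s acc = refl
        outer (_ ∷ bs) e s acc = trans (cong₂ (λ u h → proj₂ (proj₂ (iter step₂ bs (proj₁ u , h , proj₂ u)))) (inner ps e s acc) (pow-+ s s))
          (trans (outer bs (e + p * s) (s + s) _) (trans (sym (++-ʳ++ (map pow (block p e s)))) (cong (_ʳ++ acc) (sym (map-++ pow (block p e s) _)))))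

        initial : (iter step₀ ps (fromℕ 1 , fromℕ 1)) ≡ pow p
        initial = trans (start ps 0) (cong pow (ℕ.+-identityʳ p))

        result : ∀ bs → proj₂ (proj₂ (iter step₂ bs (iter step₀ ps (fromℕ 1 , fromℕ 1) , (a , A) , []))) ≡ map pow (blocks p (length bs) p 1) ʳ++ []
        result bs = trans (cong₂ (λ c h → proj₂ (proj₂ (iter step₂ bs (c , h , [])))) initial
          (cong₂ _,_ (trans a≡ (cong fromℕ (sym (ℕ.*-identityʳ base)))) (trans A≡ (cong fromℕ (sym (ℕ.*-identityʳ (suc base))))))) (outer bs p 1 [])

        opaque
          unfolding ladderE
          ladder-unfold : ∀ bs → ⟦ ladderE ⟧ ((bs , ps) ∷ []) ≡ ⟦ revAppE {num ⊗ num} ⟧ ((proj₂ (proj₂ (iter step₂ bs (iter step₀ ps (fromℕ 1 , fromℕ 1) , (a , A) , []))) , []) ∷ [])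
          ladder-unfold bs = refl
          ladder-cost : ∀ bs → iters ladderE ((bs , ps) ∷ []) ≤ p + (0 + (p + (length bs * suc p +
            length (proj₂ (proj₂ (iter step₂ bs (iter step₀ ps (fromℕ 1 , fromℕ 1) , (a , A) , [])))))))
          ladder-cost bs = ℕ.+-mono-≤ (iters-len {num} ps) (ℕ.+-mono-≤ (iterCost-unit {f = step₀} (λ _ _ _ → z≤n) ps _)
            (ℕ.+-mono-≤ (iterCost-const p {f = step₂} (λ _ s _ → ℕ.≤-trans (ℕ.≤-reflexive (ℕ.+-identityʳ _)) (iterCost-unit {f = step₁ (proj₁ (proj₂ s))} (λ _ _ _ → z≤n) ps _)) bs _)
              (iters-revApp {num ⊗ num} _ [])))

    module _ (ps : List ℝ) (p>0 : 0 < length ps) (bs : List ℝ) (d : ℕ) (bs≡ : length bs ≡ 2 + K d) (w : ℝ) where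
      private
        module L = Ladders ps p>0
        open Powers (length ps) p>0

      ⟦ladder⟧ : ⟦ ladderE ⟧ ((bs , ps) ∷ []) ≡ toΘ w (map power (exponents d))
      ⟦ladder⟧ = trans (L.ladder-unfold bs) (trans (⟦revApp⟧ {num ⊗ num} _ []) (trans (cong (_ʳ++ []) (L.result bs))
        (trans (ʳ++-ʳ++ (map L.pow (blocks (length ps) (length bs) (length ps) 1))) (trans (++-identityʳ _)
          (trans (cong (λ k → map L.pow (blocks (length ps) k (length ps) 1)) bs≡) (map-∘ (exponents d)))))))

      iters-ladder : iters ladderE ((bs , ps) ∷ []) ≤ 2 * length ps + (2 + K d) * (1 + 2 * length ps)
      iters-ladder = begin
        _ ≤⟨ L.ladder-cost bs ⟩
        _ ≡⟨ cong₂ (λ k l → p + (p + (k * suc p + l))) bs≡ (trans (cong length (L.result bs)) (trans (length-ʳ++ (map L.pow (blocks p (length bs) p 1))) (trans (ℕ.+-identityʳ _)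
               (trans (length-map L.pow (blocks p (length bs) p 1)) (trans (length-blocks p (length bs) p 1) (cong (_* p) bs≡)))))) ⟩
        p + (p + ((2 + K d) * suc p + (2 + K d) * p)) ≡⟨ arith p (2 + K d) ⟩
        2 * p + (2 + K d) * (1 + 2 * p) ∎
        where
        open ℕ.≤-Reasoning
        p = length ps
        arith : ∀ p k → p + (p + (k * suc p + k * p)) ≡ 2 * p + k * (1 + 2 * p)
        arith = solve-∀

    double : List ℝ → Pt
    double [] = []
    double (x ∷ xs) = fromℕ 0 ⊖ x ∷ x ∷ double xs

    length-double : ∀ xs → length (double xs) ≡ 2 * length xs
    length-double [] = refl
    length-double (x ∷ xs) = trans (cong (λ n → suc (suc n)) (length-double xs)) (sym (ℕ.*-suc 2 (length xs)))

    coord-double : ∀ xs i → i < length xs → coord (2 * i) (double xs) ≡ -ᵣ coord i xs × coord (suc (2 * i)) (double xs) ≡ coord i xs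
    coord-double (x ∷ xs) zero _ = +ᵣ-identityˡ _ , refl
    coord-double (x ∷ xs) (suc i) (s≤s lt) = trans (cong (λ e → coord e (double (x ∷ xs))) (arith i)) (proj₁ (coord-double xs i lt)) ,
      trans (cong (λ e → coord (suc e) (double (x ∷ xs))) (arith i)) (proj₂ (coord-double xs i lt))
      where
      arith : ∀ i → 2 * suc i ≡ suc (suc (2 * i))
      arith = solve-∀

    private
      qstep : ℝ → List ℝ × List ℝ → List ℝ → List ℝ × List ℝ
      qstep _ s _ = cases (proj₁ s) s λ x xs → xs , x ∷ (fromℕ 0 ⊖ x) ∷ proj₂ s

      pointing : ∀ ds xs rest acc → length xs ≡ length ds → iter qstep ds (xs ++ rest , acc) ≡ (rest , double xs ʳ++ acc)
      pointing [] [] rest acc _ = refl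
      pointing (_ ∷ ds) (x ∷ xs) rest acc eq = pointing ds xs rest _ (ℕ.suc-injective eq)

      opaque
        unfolding pointE
        point-unfold : ∀ ds cs → ⟦ pointE ⟧ ((ds , cs) ∷ []) ≡ let s = iter qstep ds (cs , []) in (proj₁ s , ⟦ revAppE {num} ⟧ ((proj₂ s , []) ∷ []))
        point-unfold ds cs = refl
        point-cost : ∀ ds cs → iters pointE ((ds , cs) ∷ []) ≤ length ds + length (proj₂ (iter qstep ds (cs , [])))
        point-cost ds cs = ℕ.+-mono-≤ (iterCost-unit {f = qstep} (λ _ s _ → cases-le (proj₁ s) z≤n λ _ _ → z≤n) ds _) (iters-revApp {num} _ [])

    ⟦point⟧ : ∀ ds xs rest → length xs ≡ length ds → ⟦ pointE ⟧ ((ds , xs ++ rest) ∷ []) ≡ (rest , double xs)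
    ⟦point⟧ ds xs rest eq = trans (point-unfold ds (xs ++ rest)) (trans (cong (λ s → proj₁ s , ⟦ revAppE {num} ⟧ ((proj₂ s , []) ∷ [])) (pointing ds xs rest [] eq))
      (cong (rest ,_) (trans (⟦revApp⟧ {num} _ []) (trans (ʳ++-ʳ++ (double xs)) (++-identityʳ _)))))

    iters-point : ∀ ds xs rest → length xs ≡ length ds → iters pointE ((ds , xs ++ rest) ∷ []) ≤ 3 * length ds
    iters-point ds xs rest eq = ℕ.≤-trans (point-cost ds (xs ++ rest)) (ℕ.+-monoʳ-≤ (length ds) (ℕ.≤-reflexive (trans (cong (λ s → length (proj₂ s)) (pointing ds xs rest [] eq))
      (trans (length-ʳ++ (double xs)) (trans (ℕ.+-identityʳ _) (trans (length-double xs) (cong (2 *_) eq)))))))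

    private
      tstep : List ℝ → ℝ → List ℝ × List Pt → List ℝ → List ℝ × List Pt
      tstep ds _ s _ = let o = ⟦ pointE ⟧ ((ds , proj₁ s) ∷ []) in proj₁ o , proj₂ o ∷ proj₂ s

      gathering : ∀ ds ns xss acc → length xss ≡ length ns → All (λ xs → length xs ≡ length ds) xss →
        proj₂ (iter (tstep ds) ns (concat xss , acc)) ≡ map double xss ʳ++ acc ×
        iterCost (λ _ s _ → iters pointE ((ds , proj₁ s) ∷ []) + 0) (tstep ds) ns (concat xss , acc) ≤ length ns * (1 + 3 * length ds)
      gathering ds [] [] acc _ _ = refl , z≤n
      gathering ds (_ ∷ ns) (xs ∷ xss) acc eq (e ∷ es) rewrite ⟦point⟧ ds xs (concat xss) e =
        proj₁ R , ℕ.+-mono-≤ (s≤s (ℕ.≤-trans (ℕ.≤-reflexive (ℕ.+-identityʳ _)) (iters-point ds xs (concat xss) e))) (proj₂ R)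
        where R = gathering ds ns xss (double xs ∷ acc) (ℕ.suc-injective eq) es

    opaque
      unfolding pointsE
      ⟦points⟧ : ∀ ds ns xss → length xss ≡ length ns → All (λ xs → length xs ≡ length ds) xss → ⟦ pointsE ⟧ ((ds , ns , concat xss) ∷ []) ≡ map double xss ʳ++ []
      ⟦points⟧ ds ns xss eq es = proj₁ (gathering ds ns xss [] eq es)
      iters-points : ∀ ds ns xss → length xss ≡ length ns → All (λ xs → length xs ≡ length ds) xss → iters pointsE ((ds , ns , concat xss) ∷ []) ≤ length ns * (1 + 3 * length ds)
      iters-points ds ns xss eq es = proj₂ (gathering ds ns xss [] eq es)

  -- The assembled algorithm.

  module Algorithms (𝓡 : RealNumbers) where
    open Basics 𝓡
    open Clustering 𝓡
    open Cuts 𝓡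
    open Parameters 𝓡

    module Algorithm (ds ns : List ℝ) (xss : List (List ℝ)) (ρ Δ : ℝ)
        (d>0 : 0 < length ds) (n>0 : 0 < length ns) (xss≡ : length xss ≡ length ns) (xs≡ : All (λ xs → length xs ≡ length ds) xss)
        (0<ρ : 0ℝ <ᵣ ρ) (ρ<1 : ρ <ᵣ 1ℝ) (0<Δ : 0ℝ <ᵣ Δ) where
      n d q p k : ℕ
      n = length ns
      d = length ds
      q = reach ρ (2 + n) 0
      p = ℕ.pred q
      k = (2 + K d) * p

      qs ps : List ℝ
      qs = ⟦ qsE ⟧ ((ρ , ns) ∷ [])
      ps = ⟦ tlE {num} ⟧ (qs ∷ [])

      length-ps : length ps ≡ p
      length-ps = trans (cong length (⟦tl⟧ {num} qs)) (trans (length-drop qs) (cong ℕ.pred (length-qsE ρ ns)))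
        where
        length-drop : ∀ (xs : List ℝ) → length (drop 1 xs) ≡ ℕ.pred (length xs)
        length-drop [] = refl
        length-drop (x ∷ xs) = refl

      -- The first three steps are always made since ρ < 1.
      q≥3 : 3 ≤ q
      q≥3 = ℕ.≮⇒≥ λ q<3 → late (reach-end ρ (2 + n) 0) q<3
        where
        late : reach ρ (2 + n) 0 ≡ 2 + n + 0 ⊎ ¬ (fromℕ (reach ρ (2 + n) 0) *ᵣ ρ ≤ᵣ fromℕ 2) → ¬ (q < 3)
        late (inj₁ eq) q<3 = ℕ.<⇒≱ (subst (_< 3) eq q<3) (ℕ.≤-trans (s≤s (s≤s n>0)) (ℕ.≤-reflexive (sym (ℕ.+-identityʳ (2 + n)))))
        late (inj₂ big) q<3 = big (≤ᵣ-trans (*ᵣ-mono (proj₁ 0<ρ) (0≤fromℕ 2) (fromℕ-mono {q} {2} (ℕ.≤-pred q<3)) (proj₁ ρ<1)) (≤ᵣ-reflexive (*ᵣ-identityʳ _)))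

      suc-p : suc p ≡ q
      suc-p = ℕ.suc-pred q {{ℕ.>-nonZero (ℕ.≤-trans (s≤s z≤n) q≥3)}}

      p>0 : 0 < p
      p>0 = ℕ.≤-pred (subst (2 ≤_) (sym suc-p) (ℕ.≤-trans (ℕ.n≤1+n 2) q≥3))

      -- The predecessor of q never exceeds 2 / ρ, whether the search succeeds or stops at the cap.
      pρ≤2 : fromℕ p *ᵣ ρ ≤ᵣ fromℕ 2
      pρ≤2 = reach-below ρ (2 + n) 0 p z≤n (ℕ.≤-reflexive suc-p)

      open Powers p p>0

      θ : List Fraction
      θ = map power (exponents d)

      length-θ : length θ ≡ k
      length-θ = trans (length-map power (exponents d)) (length-blocks p (2 + K d) p 1)

      Θ : List (ℝ × ℝ)
      Θ = ⟦ ladderE ⟧ ((⟦ blocksE ⟧ (ds ∷ []) , ps) ∷ [])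

      w r : ℝ
      w = Δ /ᵣ (fromℕ 2 *ᵣ ⟦ lenE {num ⊗ num} ⟧ (Θ ∷ []) +ᵣ fromℕ 1)
      r = w /ᵣ fromℕ 2

      Θ≡ : Θ ≡ toΘ w θ
      Θ≡ = trans (⟦ladder⟧ ps ps>0 (⟦ blocksE ⟧ (ds ∷ [])) d (length-blocksE ds) w) (cong (toΘ w) (exponents≡ length-ps ps>0 p>0))
        where
        ps>0 : 0 < length ps
        ps>0 = subst (0 <_) (sym length-ps) p>0
        exponents≡ : ∀ {p p′} → p ≡ p′ → (a : 0 < p) (b : 0 < p′) → map (Powers.power p a) (Powers.exponents p a d) ≡ map (Powers.power p′ b) (Powers.exponents p′ b d)
        exponents≡ refl a b = refl

      denominator : fromℕ 2 *ᵣ ⟦ lenE {num ⊗ num} ⟧ (Θ ∷ []) +ᵣ fromℕ 1 ≡ fromℕ (2 * k + 1)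
      denominator = trans (cong (λ x → fromℕ 2 *ᵣ x +ᵣ fromℕ 1) (trans (⟦len⟧ {num ⊗ num} Θ) (cong fromℕ (trans (cong length Θ≡) (trans (length-map _ θ) length-θ)))))
        (trans (cong (_+ᵣ fromℕ 1) (sym (fromℕ-* 2 k))) (sym (fromℕ-+ (2 * k) 1)))

      2k+1>0 : 0ℝ <ᵣ fromℕ (2 * k + 1)
      2k+1>0 = subst (λ m → 0ℝ <ᵣ fromℕ m) (ℕ.+-comm 1 (2 * k)) (0<fromℕ (2 * k))

      w-spec : w *ᵣ fromℕ (2 * k + 1) ≡ Δ
      w-spec = trans (cong (λ x → Δ /ᵣ x *ᵣ fromℕ (2 * k + 1)) denominator) (/-* 2k+1>0)

      w>0 : 0ℝ <ᵣ w
      w>0 = subst (λ x → 0ℝ <ᵣ Δ /ᵣ x) (sym denominator) (*-pos 0<Δ (⁻¹-pos 2k+1>0))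

      r-spec : r +ᵣ r ≡ w
      r-spec = trans (sym (cong₂ _+ᵣ_ (*ᵣ-identityʳ r) (*ᵣ-identityʳ r))) (trans (sym (*ᵣ-distribˡ r 1ℝ 1ℝ)) (trans (cong (λ x → r *ᵣ (1ℝ +ᵣ x)) (sym fromℕ-1)) (/-* (0<fromℕ 1))))

      r>0 : 0ℝ <ᵣ r
      r>0 = *-pos w>0 (⁻¹-pos (0<fromℕ 1))

      open Main w (proj₁ w>0) {p} {d} {θ} (thresholds d d>0) r public hiding (k)

      X : List Pt
      X = map double xss ʳ++ []

      length-X : length X ≡ n
      length-X = trans (length-ʳ++ (map double xss)) (trans (ℕ.+-identityʳ _) (trans (length-map double xss) xss≡))

      X↭ : X ↭ map double xss
      X↭ = ↭-trans (ʳ++-↭ (map double xss)) (↭-reflexive (++-identityʳ _))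

      X-doubled : All Doubled X
      X-doubled = Permₚ.All-resp-↭ (↭-sym X↭) (Allₚ.map⁺ (All.map doubled xs≡))
        where
        doubled : ∀ {xs} → length xs ≡ d → Doubled (double xs)
        doubled {xs} eq = trans (length-double xs) (cong (2 *_) eq) , λ i lt →
          let c = coord-double xs i (subst (i <_) (sym eq) (ℕ.*-cancelˡ-< 2 i d (ℕ.<-trans (ℕ.n<1+n _) lt))) in
          trans (proj₂ c) (trans (sym (-ᵣ-involutive _)) (cong -ᵣ_ (sym (proj₁ c))))

      out : List ℝ × List ℝ
      out = ⟦ mainE ⟧ (ds ∷ ns ∷ concat xss ∷ ρ ∷ Δ ∷ [])

      private
        opaque
          unfolding mainE
          main-unfold : out ≡ ⟦ roundsE ⟧ (((Θ , w) , r , ns , ⟦ pointsE ⟧ ((ds , ns , concat xss) ∷ [])) ∷ [])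
          main-unfold = refl
          main-cost : iters mainE (ds ∷ ns ∷ concat xss ∷ ρ ∷ Δ ∷ []) ≡
            (iters blocksE (ds ∷ []) + (iters qsE ((ρ , ns) ∷ []) + iters (tlE {num}) (qs ∷ [])) + iters ladderE ((⟦ blocksE ⟧ (ds ∷ []) , ps) ∷ [])) +
            ((iters (lenE {num ⊗ num}) (Θ ∷ []) + 0) + (iters pointsE ((ds , ns , concat xss) ∷ []) +
              iters roundsE (((Θ , w) , r , ns , ⟦ pointsE ⟧ ((ds , ns , concat xss) ∷ [])) ∷ [])))
          main-cost = refl

        points≡ : ⟦ pointsE ⟧ ((ds , ns , concat xss) ∷ []) ≡ X
        points≡ = ⟦points⟧ ds ns xss xss≡ xs≡

        arguments : List (ℝ × ℝ) → List Pt → ⟦ Param ⊗ (num ⊗ (list num ⊗ list P)) ⟧ᵗ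
        arguments t x = (t , w) , r , ns , x

        call : arguments Θ (⟦ pointsE ⟧ ((ds , ns , concat xss) ∷ [])) ≡ arguments (toΘ w θ) X
        call = cong₂ arguments Θ≡ points≡

      out≡ : out ≡ ⟦ roundsE ⟧ ((param , r , ns , X) ∷ [])
      out≡ = trans main-unfold (cong (λ c → ⟦ roundsE ⟧ (c ∷ [])) call)

      X≤ : ∀ {m} → n ≤ m → length X ≤ m
      X≤ le = ℕ.≤-trans (ℕ.≤-reflexive length-X) le

      covering : ∀ {L} (n≤ : n ≤ 2 ℕ.^ L) ℓ (root : n ≤ ℓ ℕ.^ suc p) → 0 < ℓ → Cover X X-doubled {L} (X≤ n≤) ℓ (X≤ root) out ns
      covering {L} n≤ ℓ root ℓ>0 = subst (λ o → Cover X X-doubled {L} (X≤ n≤) ℓ (X≤ root) o ns) (sym out≡)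
        (cover X X-doubled {L} (X≤ n≤) ℓ (X≤ root) ns ℓ>0 (ℕ.≤-reflexive length-X))

      iters-main : ∀ {c} → iters roundsE ((param , r , ns , X) ∷ []) ≤ c →
        iters mainE (ds ∷ ns ∷ concat xss ∷ ρ ∷ Δ ∷ []) ≤
          (3 + 2 * d + (2 + n) + (2 * p + (2 + K d) * (1 + 2 * p))) + (k + (n * (1 + 3 * d) + c))
      iters-main {c} le = ℕ.≤-trans (ℕ.≤-reflexive main-cost) (ℕ.+-mono-≤
        (ℕ.+-mono-≤ (ℕ.+-mono-≤ (iters-blocks ds) (ℕ.≤-trans (ℕ.+-mono-≤ (iters-qs ρ ns) (iters-tl {num} qs)) (ℕ.≤-reflexive (ℕ.+-identityʳ _))))
          (subst (λ m → iters ladderE ((⟦ blocksE ⟧ (ds ∷ []) , ps) ∷ []) ≤ 2 * m + (2 + K d) * (1 + 2 * m)) length-ps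
            (iters-ladder ps (subst (0 <_) (sym length-ps) p>0) (⟦ blocksE ⟧ (ds ∷ [])) d (length-blocksE ds) w)))
        (ℕ.+-mono-≤ (ℕ.≤-trans (ℕ.≤-reflexive (ℕ.+-identityʳ _)) (ℕ.≤-trans (iters-len {num ⊗ num} Θ) (ℕ.≤-reflexive (trans (cong length Θ≡) (trans (length-map _ θ) length-θ)))))
          (ℕ.+-mono-≤ (iters-points ds ns xss xss≡ xs≡) (subst (λ c′ → iters roundsE (c′ ∷ []) ≤ c) (sym call) le))))

  -- Integer roots and logarithms, and the count of fold steps.

  integer-root : ∀ q n → 0 < n → ∃[ l ] 0 < l × l ℕ.^ suc q ≤ n × n < suc l ℕ.^ suc q
  integer-root q n n>0 = search n (ℕ.≤-trans (ℕ.≤-reflexive (sym (ℕ.*-identityʳ (suc n)))) (ℕ.*-monoʳ-≤ (suc n) (ℕ.m^n>0 (suc n) q)))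
    where
    search : ∀ l → n < suc l ℕ.^ suc q → ∃[ l ] 0 < l × l ℕ.^ suc q ≤ n × n < suc l ℕ.^ suc q
    search zero lt = contradiction (ℕ.<-≤-trans lt (ℕ.≤-reflexive (ℕ.^-zeroˡ (suc q)))) (ℕ.≤⇒≯ n>0)
    search (suc l) lt with suc l ℕ.^ suc q ℕ.≤? n
    ... | yes le = suc l , s≤s z≤n , le , lt
    ... | no gt = search l (ℕ.≰⇒> gt)

  integer-log : ∀ n → 0 < n → ∃[ b ] 2 ℕ.^ b ≤ n × n < 2 ℕ.^ suc b
  integer-log n n>0 = search n (ℕ.<-trans (n<2^n n) (ℕ.^-monoʳ-< 2 ℕ.≤-refl (ℕ.n<1+n n)))
    where
    search : ∀ b → n < 2 ℕ.^ suc b → ∃[ b ] 2 ℕ.^ b ≤ n × n < 2 ℕ.^ suc b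
    search zero lt = zero , n>0 , lt
    search (suc b) lt with 2 ℕ.^ suc b ℕ.≤? n
    ... | yes le = suc b , le , lt
    ... | no gt = search b (ℕ.≰⇒> gt)

  -- A root l ^ q ≤ n loses a factor of log n ≤ b + 1 against the root y of n ^ 2.
  module Root (q : ℕ) (2≤q : 2 ≤ q) (l b n : ℕ) (l>0 : 0 < l) where
    instance
      q≢0 : NonZero q
      q≢0 = ℕ.>-nonZero (ℕ.≤-trans (s≤s z≤n) 2≤q)

    e y : ℕ
    e = b ℕ./ q
    y = l * 2 ℕ.^ e

    y^q≤n² : l ℕ.^ q ≤ n → 2 ℕ.^ b ≤ n → y ℕ.^ q ≤ n ℕ.^ 2
    y^q≤n² l≤ b≤ = begin
      y ℕ.^ q                      ≡⟨ ^-distribʳ-* q l (2 ℕ.^ e) ⟩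
      l ℕ.^ q * (2 ℕ.^ e) ℕ.^ q    ≡⟨ cong (l ℕ.^ q *_) (ℕ.^-*-assoc 2 e q) ⟩
      l ℕ.^ q * 2 ℕ.^ (e * q)      ≤⟨ ℕ.*-mono-≤ l≤ (ℕ.≤-trans (ℕ.^-monoʳ-≤ 2 (ℕ.m/n*n≤m b q)) b≤) ⟩
      n * n                        ≡⟨ cong (n *_) (ℕ.*-identityʳ n) ⟨
      n ℕ.^ 2                      ∎
      where open ℕ.≤-Reasoning

    l≤y : l ≤ y
    l≤y = ℕ.m≤m*n l (2 ℕ.^ e) {{ℕ.m^n≢0 2 e}}

    -- b < q (e + 1) ≤ q 2 ^ e: a logarithm is exchanged for a factor q and the second factor of
    -- `y`.
    lb≤qy : l * b ≤ q * y
    lb≤qy = begin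
      l * b                  ≤⟨ ℕ.*-monoʳ-≤ l (begin
          b                  ≡⟨ ℕ.m≡m%n+[m/n]*n b q ⟩
          b ℕ.% q + e * q    ≤⟨ ℕ.+-monoˡ-≤ (e * q) (ℕ.<⇒≤ (ℕ.m%n<n b q)) ⟩
          suc e * q          ≤⟨ ℕ.*-monoˡ-≤ q (n<2^n e) ⟩
          2 ℕ.^ e * q        ∎) ⟩
      l * (2 ℕ.^ e * q)      ≡⟨ arith l (2 ℕ.^ e) q ⟩
      q * y                  ∎
      where
      open ℕ.≤-Reasoning
      arith : ∀ l x q → l * (x * q) ≡ q * (l * x)
      arith = solve-∀

    rounds≤ : 2 * suc l * suc b ≤ 8 * (q * y)
    rounds≤ = begin
      2 * suc l * suc b            ≤⟨ ℕ.*-monoˡ-≤ (suc b) (ℕ.*-monoʳ-≤ 2 (ℕ.+-monoˡ-≤ l l>0)) ⟩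
      2 * (l + l) * suc b          ≡⟨ arith l b ⟩
      4 * (l + l * b)              ≤⟨ ℕ.*-monoʳ-≤ 4 (ℕ.+-mono-≤ (ℕ.≤-trans l≤y (ℕ.m≤n*m y q)) lb≤qy) ⟩
      4 * (q * y + q * y)          ≡⟨ arith′ (q * y) ⟩
      8 * (q * y)                  ∎
      where
      open ℕ.≤-Reasoning
      arith : ∀ l b → 2 * (l + l) * suc b ≡ 4 * (l + l * b)
      arith = solve-∀
      arith′ : ∀ x → 4 * (x + x) ≡ 8 * x
      arith′ = solve-∀

    work≤ : suc l * (2 + b + q) ≤ 6 * (q * y)
    work≤ = begin
      suc l * (2 + b + q)                  ≤⟨ ℕ.*-monoˡ-≤ (2 + b + q) (ℕ.+-monoˡ-≤ l l>0) ⟩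
      (l + l) * (2 + b + q)                ≡⟨ arith l b q ⟩
      2 * (2 * l + l * b + q * l)          ≤⟨ ℕ.*-monoʳ-≤ 2 (ℕ.+-mono-≤ (ℕ.+-mono-≤ (ℕ.*-mono-≤ 2≤q l≤y) lb≤qy) (ℕ.*-monoʳ-≤ q l≤y)) ⟩
      2 * (q * y + q * y + q * y)          ≡⟨ arith′ (q * y) ⟩
      6 * (q * y)                          ∎
      where
      open ℕ.≤-Reasoning
      arith : ∀ l b q → (l + l) * (2 + b + q) ≡ 2 * (2 * l + l * b + q * l)
      arith = solve-∀
      arith′ : ∀ x → 2 * (x + x + x) ≡ 6 * x
      arith′ = solve-∀

  -- Crude, as `K d` is about log log d, but sufficient for a running time quadratic in d.
  2+K≤6d : ∀ d → 0 < d → 2 + K d ≤ 6 * d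
  2+K≤6d d d>0 = begin
    2 + K d           ≤⟨ ℕ.+-monoʳ-≤ 2 (squarings≤ d (3 + d) 0) ⟩
    2 + (3 + d + 0)   ≡⟨ arith d ⟩
    5 * 1 + d         ≤⟨ ℕ.+-monoˡ-≤ d (ℕ.*-monoʳ-≤ 5 d>0) ⟩
    5 * d + d         ≡⟨ ℕ.+-comm (5 * d) d ⟩
    6 * d             ∎
    where
    open ℕ.≤-Reasoning
    arith : ∀ d → 2 + (3 + d + 0) ≡ 5 * 1 + d
    arith = solve-∀

  module Budget (n d q p l b κ : ℕ) (n>0 : 0 < n) (d>0 : 0 < d) (suc-p : suc p ≡ q) (l>0 : 0 < l) (κ≡ : κ ≡ (2 + K d) * p) where

    -- A logarithm for the number of levels in a round, times the sum of another one for sorting and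
    -- q for the scans.
    V : ℕ
    V = (2 + b) * (2 + b + q)

    V>0 : 0 < V
    V>0 = s≤s z≤n

    q≤V : q ≤ V
    q≤V = ℕ.≤-trans (ℕ.m≤n+m q (2 + b)) (ℕ.m≤n*m (2 + b + q) (2 + b))

    G : ℕ
    G = n * l * (d * d) * V

    κ≤ : κ ≤ 6 * (d * q)
    κ≤ = begin
      κ                ≡⟨ κ≡ ⟩
      (2 + K d) * p    ≤⟨ ℕ.*-mono-≤ (2+K≤6d d d>0) (ℕ.≤-trans (ℕ.n≤1+n p) (ℕ.≤-reflexive suc-p)) ⟩
      6 * d * q        ≡⟨ ℕ.*-assoc 6 d q ⟩
      6 * (d * q)      ∎
      where open ℕ.≤-Reasoning

    levelRate≤ : 4 + 2 * d * (12 + 5 * suc b + 2 * κ) + 2 ≤ 30 * (d * d) * (2 + b + q)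
    levelRate≤ = begin
      4 + 2 * d * (12 + 5 * suc b + 2 * κ) + 2           ≤⟨ ℕ.+-monoˡ-≤ 2 (ℕ.+-monoʳ-≤ 4 (ℕ.*-monoʳ-≤ (2 * d) (ℕ.+-monoʳ-≤ (12 + 5 * suc b) (ℕ.*-monoʳ-≤ 2 κ≤)))) ⟩
      4 + 2 * d * (12 + 5 * suc b + 2 * (6 * (d * q))) + 2 ≡⟨ arith₁ d b q ⟩
      6 * (1 * 1) + 34 * (d * 1) + 10 * (d * 1) * b + 24 * (d * d) * q ≤⟨ ℕ.+-monoˡ-≤ (24 * (d * d) * q) (ℕ.+-mono-≤ (ℕ.+-mono-≤ (ℕ.*-monoʳ-≤ 6 (ℕ.*-mono-≤ d>0 d>0)) (ℕ.*-monoʳ-≤ 34 (ℕ.*-monoʳ-≤ d d>0)))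
           (ℕ.*-monoˡ-≤ b (ℕ.*-monoʳ-≤ 10 (ℕ.*-monoʳ-≤ d d>0)))) ⟩
      6 * (d * d) + 34 * (d * d) + 10 * (d * d) * b + 24 * (d * d) * q ≤⟨ ℕ.m≤m+n _ (20 * (d * d) + 20 * (d * d) * b + 6 * (d * d) * q) ⟩
      6 * (d * d) + 34 * (d * d) + 10 * (d * d) * b + 24 * (d * d) * q + (20 * (d * d) + 20 * (d * d) * b + 6 * (d * d) * q) ≡⟨ arith₂ (d * d) b q ⟩
      30 * (d * d) * (2 + b + q)                         ∎
      where
      open ℕ.≤-Reasoning
      arith₁ : ∀ d b q → 4 + 2 * d * (12 + 5 * suc b + 2 * (6 * (d * q))) + 2 ≡ 6 * (1 * 1) + 34 * (d * 1) + 10 * (d * 1) * b + 24 * (d * d) * q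
      arith₁ = solve-∀
      arith₂ : ∀ D b q → 6 * D + 34 * D + 10 * D * b + 24 * D * q + (20 * D + 20 * D * b + 6 * D * q) ≡ 30 * D * (2 + b + q)
      arith₂ = solve-∀

    roundRate≤ : 1 + 3 * suc (suc b) * (4 + 2 * d * (12 + 5 * suc b + 2 * κ) + 2) + (2 + 10 * d) ≤ 103 * (d * d) * V
    roundRate≤ = begin
      1 + 3 * suc (suc b) * lr + (2 + 10 * d)                      ≤⟨ ℕ.+-monoˡ-≤ (2 + 10 * d) (ℕ.+-monoʳ-≤ 1 (ℕ.*-monoʳ-≤ (3 * suc (suc b)) levelRate≤)) ⟩
      1 + 3 * suc (suc b) * (30 * (d * d) * (2 + b + q)) + (2 + 10 * d) ≡⟨ arith₁ d (2 + b) (2 + b + q) ⟩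
      90 * (d * d) * V + (3 * (1 * 1) * 1 + 10 * (d * 1) * 1)      ≤⟨ ℕ.+-monoʳ-≤ (90 * (d * d) * V) (ℕ.+-mono-≤ (ℕ.*-mono-≤ (ℕ.*-monoʳ-≤ 3 (ℕ.*-mono-≤ d>0 d>0)) V>0) (ℕ.*-mono-≤ (ℕ.*-monoʳ-≤ 10 (ℕ.*-monoʳ-≤ d d>0)) V>0)) ⟩
      90 * (d * d) * V + (3 * (d * d) * V + 10 * (d * d) * V)      ≡⟨ arith₂ (d * d) V ⟩
      103 * (d * d) * V                                            ∎
      where
      open ℕ.≤-Reasoning
      lr = 4 + 2 * d * (12 + 5 * suc b + 2 * κ) + 2
      arith₁ : ∀ d v u → 1 + 3 * v * (30 * (d * d) * u) + (2 + 10 * d) ≡ 90 * (d * d) * (v * u) + (3 * (1 * 1) * 1 + 10 * (d * 1) * 1)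
      arith₁ = solve-∀
      arith₂ : ∀ D V → 90 * D * V + (3 * D * V + 10 * D * V) ≡ 103 * D * V
      arith₂ = solve-∀

    ≤G : ∀ {a c e f} → a ≤ n → c ≤ l → e ≤ d * d → f ≤ V → a * c * e * f ≤ G
    ≤G a c e f = ℕ.*-mono-≤ (ℕ.*-mono-≤ (ℕ.*-mono-≤ a c) e) f

    d≤dd : d ≤ d * d
    d≤dd = ℕ.m≤m*n d d {{ℕ.>-nonZero d>0}}

    1≤dd : 1 ≤ d * d
    1≤dd = ℕ.*-mono-≤ d>0 d>0

    1≤G : 1 ≤ G
    1≤G = ≤G n>0 l>0 1≤dd V>0

    n≤G : n ≤ G
    n≤G = ℕ.≤-trans (ℕ.≤-reflexive (arith n)) (≤G ℕ.≤-refl l>0 1≤dd V>0)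
      where
      arith : ∀ n → n ≡ n * 1 * 1 * 1
      arith = solve-∀

    nd≤G : n * d ≤ G
    nd≤G = ℕ.≤-trans (ℕ.≤-reflexive (arith n d)) (≤G ℕ.≤-refl l>0 d≤dd V>0)
      where
      arith : ∀ n d → n * d ≡ n * 1 * d * 1
      arith = solve-∀

    d≤G : d ≤ G
    d≤G = ℕ.≤-trans (ℕ.m≤n*m d n {{ℕ.>-nonZero n>0}}) nd≤G

    dq≤G : d * q ≤ G
    dq≤G = ℕ.≤-trans (ℕ.≤-reflexive (arith d q)) (≤G n>0 l>0 d≤dd q≤V)
      where
      arith : ∀ d q → d * q ≡ 1 * 1 * d * q
      arith = solve-∀

    q≤G : q ≤ G
    q≤G = ℕ.≤-trans (ℕ.m≤n*m q d {{ℕ.>-nonZero d>0}}) dq≤G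

    total≤ : (3 + 2 * d + (2 + n) + (2 * p + (2 + K d) * (1 + 2 * p))) + ((2 + K d) * p + (n * (1 + 3 * d) +
        (n + 2 * l * n * (1 + 3 * suc (suc b) * (4 + 2 * d * (12 + 5 * suc b + 2 * κ) + 2) + (2 + 10 * d))))) ≤ 245 * G
    total≤ = begin
      _ ≤⟨ ℕ.+-mono-≤ (ℕ.+-monoʳ-≤ (3 + 2 * d + (2 + n)) (ℕ.+-mono-≤ (ℕ.*-monoʳ-≤ 2 p≤q) (ℕ.*-mono-≤ (2+K≤6d d d>0) (ℕ.+-monoʳ-≤ 1 (ℕ.*-monoʳ-≤ 2 p≤q)))))
             (ℕ.+-mono-≤ (ℕ.*-mono-≤ (2+K≤6d d d>0) p≤q) (ℕ.+-monoʳ-≤ (n * (1 + 3 * d)) (ℕ.+-monoʳ-≤ n (ℕ.*-monoʳ-≤ (2 * l * n) roundRate≤)))) ⟩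
      (3 + 2 * d + (2 + n) + (2 * q + 6 * d * (1 + 2 * q))) + (6 * d * q + (n * (1 + 3 * d) + (n + 2 * l * n * (103 * (d * d) * V)))) ≡⟨ arith₁ d n q l V ⟩
      5 * 1 + 8 * d + 3 * n + 2 * q + 18 * (d * q) + 3 * (n * d) + 206 * G ≤⟨ ℕ.+-monoˡ-≤ (206 * G) (ℕ.+-mono-≤ (ℕ.+-mono-≤ (ℕ.+-mono-≤ (ℕ.+-mono-≤ (ℕ.+-mono-≤ (ℕ.*-monoʳ-≤ 5 1≤G) (ℕ.*-monoʳ-≤ 8 d≤G)) (ℕ.*-monoʳ-≤ 3 n≤G)) (ℕ.*-monoʳ-≤ 2 q≤G)) (ℕ.*-monoʳ-≤ 18 dq≤G)) (ℕ.*-monoʳ-≤ 3 nd≤G)) ⟩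
      5 * G + 8 * G + 3 * G + 2 * G + 18 * G + 3 * G + 206 * G             ≡⟨ arith₂ G ⟩
      245 * G                                                              ∎
      where
      open ℕ.≤-Reasoning
      p≤q : p ≤ q
      p≤q = ℕ.≤-trans (ℕ.n≤1+n p) (ℕ.≤-reflexive suc-p)
      arith₁ : ∀ d n q l V → (3 + 2 * d + (2 + n) + (2 * q + 6 * d * (1 + 2 * q))) + (6 * d * q + (n * (1 + 3 * d) + (n + 2 * l * n * (103 * (d * d) * V))))
        ≡ 5 * 1 + 8 * d + 3 * n + 2 * q + 18 * (d * q) + 3 * (n * d) + 206 * (n * l * (d * d) * V)
      arith₁ = solve-∀
      arith₂ : ∀ G → 5 * G + 8 * G + 3 * G + 2 * G + 18 * G + 3 * G + 206 * G ≡ 245 * G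
      arith₂ = solve-∀

  -- Real powers and logarithms.

  module Analysis (𝓡 : RealNumbers) where
    open OrderedField 𝓡
    open RealNumbers 𝓡 using (pow; log₂; lg; UpperBound; sup; sup-upper; sup-least)
    open Extrema (DecTotalOrder.totalOrder decTotalOrder) using (⊥≤max; xs≤max; max≤v⁺)
    open Parameters 𝓡

    1≤fromℕ : ∀ {n} → 0 < n → 1ℝ ≤ᵣ fromℕ n
    1≤fromℕ {n} lt = subst (_≤ᵣ fromℕ n) fromℕ-1 (fromℕ-mono {1} {n} lt)

    ^ᵣ-nonneg : ∀ k {x} → 0ℝ ≤ᵣ x → 0ℝ ≤ᵣ x ^ᵣ k
    ^ᵣ-nonneg zero x≥0 = 0≤1
    ^ᵣ-nonneg (suc k) x≥0 = *-nonNegative x≥0 (^ᵣ-nonneg k x≥0)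

    ^ᵣ-mono : ∀ k {x y} → 0ℝ ≤ᵣ x → x ≤ᵣ y → x ^ᵣ k ≤ᵣ y ^ᵣ k
    ^ᵣ-mono zero _ _ = ≤ᵣ-refl
    ^ᵣ-mono (suc k) x≥0 le = *ᵣ-mono (^ᵣ-nonneg k x≥0) (≤ᵣ-trans x≥0 le) le (^ᵣ-mono k x≥0 le)

    ^ᵣ-pos : ∀ k {x} → 0ℝ <ᵣ x → 0ℝ <ᵣ x ^ᵣ k
    ^ᵣ-pos zero _ = 0<1
    ^ᵣ-pos (suc k) x>0 = *-pos x>0 (^ᵣ-pos k x>0)

    ^ᵣ-cancel : ∀ k {x y} → NonZero k → 0ℝ ≤ᵣ y → x ^ᵣ k ≤ᵣ y ^ᵣ k → x ≤ᵣ y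
    ^ᵣ-cancel (suc k) {x} {y} _ y≥0 le with x ≤ᵣ? y
    ... | yes q = q
    ... | no n = *-cancel-pos (^ᵣ-pos k x>0) (≤ᵣ-trans le (subst₂ _≤ᵣ_ (*ᵣ-comm _ y) (*ᵣ-comm _ y) (*ᵣ-monoˡ y≥0 (^ᵣ-mono k y≥0 (proj₁ (≰⇒>ᵣ n))))))
      where
      x>0 : 0ℝ <ᵣ x
      x>0 = ≤ᵣ-<ᵣ-trans y≥0 (≰⇒>ᵣ n)

    private
      ratio : ∀ {a b c} → 0 < b → fromℕ a /ᵣ fromℕ b ≤ᵣ c → fromℕ a ≤ᵣ c *ᵣ fromℕ b
      ratio {a} {suc b} _ le = subst (_≤ᵣ _) (/-* (0<fromℕ b)) (*ᵣ-monoˡ (0≤fromℕ (suc b)) le)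

      ratio′ : ∀ {a b c} → 0 < b → fromℕ a ≤ᵣ c *ᵣ fromℕ b → fromℕ a /ᵣ fromℕ b ≤ᵣ c
      ratio′ {a} {suc b} _ = /≤ (0<fromℕ b)

    -- The exponent `p` / `q` makes `y` a member of the set. That set must also be shown to be
    -- bounded, for otherwise its `sup` is unspecified; as ρ ≤ 2, n ^ 2 is a bound.
    pow-lower : ∀ {n ρ} y p q → 0 < n → 0ℝ ≤ᵣ ρ → ρ ≤ᵣ fromℕ 2 → 0 < q → fromℕ p ≤ᵣ ρ *ᵣ fromℕ q → y ℕ.^ q ≤ n ℕ.^ p → fromℕ y ≤ᵣ pow (fromℕ n) ρ
    pow-lower {n} {ρ} y p q n>0 ρ≥0 ρ≤2 q>0 p≤ root = sup-upper S (fromℕ y , member) (fromℕ (n ℕ.^ 2) , bounded) (fromℕ y) member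
      where
      S : Pred ℝ 0ℓ
      S y = (0ℝ ≤ᵣ y) × (∃[ p ] ∃[ q ] NonZero q × (fromℕ p /ᵣ fromℕ q ≤ᵣ ρ) × (y ^ᵣ q ≤ᵣ fromℕ n ^ᵣ p))
      member : S (fromℕ y)
      member = 0≤fromℕ y , p , q , ℕ.>-nonZero q>0 , ratio′ {p} {q} q>0 p≤ , subst₂ _≤ᵣ_ (fromℕ-^ y q) (fromℕ-^ n p) (fromℕ-mono {y ℕ.^ q} {n ℕ.^ p} root)
      bounded : UpperBound S (fromℕ (n ℕ.^ 2))
      bounded x (x≥0 , a , b , b≢0 , le , x^b≤) = ^ᵣ-cancel b b≢0 (0≤fromℕ (n ℕ.^ 2)) (≤ᵣ-trans x^b≤ (subst₂ _≤ᵣ_ (fromℕ-^ n a) (fromℕ-^ (n ℕ.^ 2) b)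
          (fromℕ-mono {n ℕ.^ a} {(n ℕ.^ 2) ℕ.^ b} (ℕ.≤-trans (ℕ.^-monoʳ-≤ n {{ℕ.>-nonZero n>0}} a≤2b) (ℕ.≤-reflexive (sym (ℕ.^-*-assoc n 2 b)))))))
        where
        b>0 : 0 < b
        b>0 = ℕ.>-nonZero⁻¹ b {{b≢0}}
        a≤2b : a ≤ 2 * b
        a≤2b = fromℕ-cancel {a} {2 * b} (≤ᵣ-trans (ratio {a} {b} b>0 le) (≤ᵣ-trans (*ᵣ-monoˡ (0≤fromℕ b) ρ≤2) (≤ᵣ-reflexive (sym (fromℕ-* 2 b)))))

    -- `N` bounds the set whose supremum is the logarithm, which gives that supremum a meaning, and
    -- so bounds the logarithm itself.
    module _ {x : ℝ} (1≤x : 1ℝ ≤ᵣ x) (N : ℕ) (x≤ : x ≤ᵣ fromℕ (2 ℕ.^ N)) where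
      private
        S : Pred ℝ 0ℓ
        S y = ∃[ p ] ∃[ q ] NonZero q × (y ≡ fromℕ p /ᵣ fromℕ q) × (fromℕ 2 ^ᵣ p ≤ᵣ x ^ᵣ q)

        bounded : UpperBound S (fromℕ N)
        bounded _ (a , b , b≢0 , refl , le) = ratio′ {a} {b} b>0 (subst (fromℕ a ≤ᵣ_) (fromℕ-* N b) (fromℕ-mono {a} {N * b} (ℕ.≮⇒≥ λ lt →
            ℕ.<⇒≱ (ℕ.^-monoʳ-< 2 ℕ.≤-refl lt) (fromℕ-cancel {2 ℕ.^ a} {2 ℕ.^ (N * b)} (subst₂ _≤ᵣ_ (sym (fromℕ-^ 2 a)) (trans (sym (fromℕ-^ (2 ℕ.^ N) b)) (cong fromℕ (ℕ.^-*-assoc 2 N b)))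
              (≤ᵣ-trans le (^ᵣ-mono b (≤ᵣ-trans 0≤1 1≤x) x≤)))))))
          where
          b>0 : 0 < b
          b>0 = ℕ.>-nonZero⁻¹ b {{b≢0}}

        member : ∀ j → fromℕ (2 ℕ.^ j) ≤ᵣ x → S (fromℕ j)
        member j le = j , 1 , _ , sym (trans (sym (*ᵣ-identityʳ _)) (trans (cong (fromℕ j /ᵣ fromℕ 1 *ᵣ_) (sym fromℕ-1)) (/-* (0<fromℕ 0)))) ,
          subst₂ _≤ᵣ_ (fromℕ-^ 2 j) (sym (*ᵣ-identityʳ x)) le

        zero-member : S (fromℕ 0)
        zero-member = member 0 (subst (_≤ᵣ x) (sym fromℕ-1) 1≤x)

      lg-lower : ∀ j → fromℕ (2 ℕ.^ j) ≤ᵣ x → fromℕ j ≤ᵣ lg x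
      lg-lower j le = ≤ᵣ-trans (sup-upper S (fromℕ 0 , zero-member) (fromℕ N , bounded) (fromℕ j) (member j le)) (All.head (xs≤max 1ℝ (log₂ x ∷ [])))

      lg-upper : 0 < N → lg x ≤ᵣ fromℕ N
      lg-upper N>0 = max≤v⁺ (1≤fromℕ N>0) (sup-least S (fromℕ 0 , zero-member) (fromℕ N) bounded ∷ [])

    1≤lg : ∀ x → 1ℝ ≤ᵣ lg x
    1≤lg x = ⊥≤max 1ℝ (log₂ x ∷ [])

    lg-fromℕ : ∀ {n b} → 0 < n → 2 ℕ.^ b ≤ n → fromℕ b ≤ᵣ lg (fromℕ n)
    lg-fromℕ {n} {b} n>0 le = lg-lower (1≤fromℕ n>0) n (fromℕ-mono {n} {2 ℕ.^ n} (n≤2^n n)) b (fromℕ-mono {2 ℕ.^ b} {n} le)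

    lglg : ∀ {d} J → 0 < d → 2 ℕ.^ (2 ℕ.^ J) ≤ d → fromℕ J ≤ᵣ lg (lg (fromℕ d))
    lglg {d} J d>0 le = lg-lower (1≤lg (fromℕ d)) d (≤ᵣ-trans (lg-upper (1≤fromℕ d>0) d (fromℕ-mono {d} {2 ℕ.^ d} (n≤2^n d)) d>0) (fromℕ-mono {d} {2 ℕ.^ d} (n≤2^n d)))
      J (lg-fromℕ {d} {2 ℕ.^ J} d>0 le)

    private
      -- With x = 2 ^ (2 ^ J), the left-hand side is x ^ 4, and x ^ 4 ≥ 8 x since x ≥ 2.
      few-squarings : ∀ {d} J → 2 ℕ.^ (2 ℕ.^ (2 + J)) < 6 * d → 2 ℕ.^ (2 ℕ.^ J) ≤ d
      few-squarings {d} J lt = ℕ.≮⇒≥ λ d<x → ℕ.<⇒≱ lt (begin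
          6 * d                        ≤⟨ ℕ.*-monoʳ-≤ 6 (ℕ.<⇒≤ d<x) ⟩
          6 * x                        ≤⟨ ℕ.*-monoˡ-≤ x (ℕ.m≤m+n 6 2) ⟩
          8 * x                        ≡⟨ arith x ⟩
          2 * (2 * (2 * x))            ≤⟨ ℕ.*-mono-≤ x≥2 (ℕ.*-mono-≤ x≥2 (ℕ.*-monoˡ-≤ x x≥2)) ⟩
          x * (x * (x * x))            ≡⟨ cong (λ y → x * (x * (x * y))) (ℕ.*-identityʳ x) ⟨
          x ℕ.^ 4                      ≡⟨ ℕ.^-*-assoc 2 (2 ℕ.^ J) 4 ⟩
          2 ℕ.^ (2 ℕ.^ J * 4)          ≡⟨ cong (2 ℕ.^_) (trans (ℕ.*-comm (2 ℕ.^ J) 4) (sym (ℕ.^-distribˡ-+-* 2 2 J))) ⟩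
          2 ℕ.^ (2 ℕ.^ (2 + J))        ∎)
        where
        open ℕ.≤-Reasoning
        x = 2 ℕ.^ (2 ℕ.^ J)
        arith : ∀ x → 8 * x ≡ 2 * (2 * (2 * x))
        arith = solve-∀
        x≥2 : 2 ≤ x
        x≥2 = ℕ.≤-trans (ℕ.≤-reflexive (sym (ℕ.*-identityʳ 2))) (ℕ.^-monoʳ-≤ 2 (ℕ.m^n>0 2 J))

    -- If `K d` is J + 3, one squaring fewer did not reach 6 d, whence J ≤ log log d. The remaining
    -- 5 are paid by reading logarithmic factors as at least 1, and so are the small values.
    K-bound : ∀ d → 0 < d → fromℕ (2 + K d) ≤ᵣ fromℕ 6 *ᵣ lg (lg (fromℕ d))
    K-bound d d>0 = go (K d) refl
      where
      X = lg (lg (fromℕ d))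
      small : ∀ {m} → m ≤ 6 → fromℕ m ≤ᵣ fromℕ 6 *ᵣ X
      small {m} le = ≤ᵣ-trans (fromℕ-mono {m} {6} le) (subst (_≤ᵣ fromℕ 6 *ᵣ X) (*ᵣ-identityʳ _) (*ᵣ-mono 0≤1 (0≤fromℕ 6) ≤ᵣ-refl (1≤lg _)))
      go : ∀ k → K d ≡ k → fromℕ (2 + k) ≤ᵣ fromℕ 6 *ᵣ X
      go 0 _ = small (ℕ.m≤m+n 2 4)
      go 1 _ = small (ℕ.m≤m+n 3 3)
      go 2 _ = small (ℕ.m≤m+n 4 2)
      go (suc (suc (suc J))) eq = subst₂ _≤ᵣ_ (sym (fromℕ-+ 5 J)) (trans (sym (*ᵣ-distribʳ X (fromℕ 5) (fromℕ 1))) (cong (_*ᵣ X) (sym (fromℕ-+ 5 1))))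
        (+ᵣ-mono (subst (_≤ᵣ fromℕ 5 *ᵣ X) (*ᵣ-identityʳ _) (*ᵣ-mono 0≤1 (0≤fromℕ 5) ≤ᵣ-refl (1≤lg _)))
          (≤ᵣ-trans (lglg {d} J d>0 (few-squarings J (squarings-least d (3 + d) 0 (2 + J) z≤n (ℕ.≤-reflexive (sym eq)))))
            (≤ᵣ-reflexive (trans (sym (*ᵣ-identityˡ X)) (cong (_*ᵣ X) (sym fromℕ-1))))))

    -- The rounding of the exponent: either q ρ > 2, or q is so large that l = 1 and b < q.
    module Exponent {n : ℕ} (n>0 : 0 < n) {ρ : ℝ} (0<ρ : 0ℝ <ᵣ ρ) (ρ<1 : ρ <ᵣ 1ℝ) (2≤q : 2 ≤ reach ρ (2 + n) 0)
        {l b : ℕ} (l>0 : 0 < l) (l≤ : l ℕ.^ reach ρ (2 + n) 0 ≤ n) (b≤ : 2 ℕ.^ b ≤ n) where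
      q : ℕ
      q = reach ρ (2 + n) 0
      open Root q 2≤q l b n l>0 public

      private
        q>0 : 0 < q
        q>0 = ℕ.≤-trans (s≤s z≤n) 2≤q

        -- At the cap q exceeds n, and a root of at least 2 would give 2 ^ n ≤ n.
        l≡1 : q ≡ 2 + n + 0 → l ≡ 1
        l≡1 eq = go l l>0 refl
          where
          go : ∀ m → 0 < m → m ≡ l → l ≡ 1
          go (suc zero) _ eq = sym eq
          go (suc (suc m)) _ refl = contradiction (begin-strict
              n                    <⟨ n<2^n n ⟩
              2 ℕ.^ n              ≤⟨ ℕ.^-monoʳ-≤ 2 (ℕ.≤-trans (ℕ.m≤n+m n 2) (ℕ.≤-trans (ℕ.m≤m+n (2 + n) 0) (ℕ.≤-reflexive (sym eq)))) ⟩
              2 ℕ.^ q              ≤⟨ ℕ.^-monoˡ-≤ q (s≤s (s≤s z≤n)) ⟩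
              suc (suc m) ℕ.^ q    ≤⟨ l≤ ⟩
              n                    ∎) (ℕ.<-irrefl refl)
            where open ℕ.≤-Reasoning

        y≡1 : q ≡ 2 + n + 0 → y ≡ 1
        y≡1 eq = cong₂ (λ a c → a * 2 ℕ.^ c) (l≡1 eq) (ℕ.m<n⇒m/n≡0 (ℕ.<-≤-trans (n<2^n b) (ℕ.≤-trans b≤ (ℕ.≤-trans (ℕ.m≤n+m n 2) (ℕ.≤-trans (ℕ.m≤m+n (2 + n) 0) (ℕ.≤-reflexive (sym eq)))))))

        2≤ρq : ¬ (fromℕ q *ᵣ ρ ≤ᵣ fromℕ 2) → fromℕ 2 ≤ᵣ ρ *ᵣ fromℕ q
        2≤ρq big = subst (fromℕ 2 ≤ᵣ_) (*ᵣ-comm (fromℕ q) ρ) (proj₁ (≰⇒>ᵣ big))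

        ρ≥0 = proj₁ 0<ρ

        1≤2 : 1ℝ ≤ᵣ fromℕ 2
        1≤2 = 1≤fromℕ {2} (s≤s z≤n)

        1+ρ≥0 : 0ℝ ≤ᵣ 1ℝ +ᵣ ρ
        1+ρ≥0 = ≤ᵣ-trans ρ≥0 (subst (_≤ᵣ 1ℝ +ᵣ ρ) (+ᵣ-identityˡ ρ) (+ᵣ-mono 0≤1 ≤ᵣ-refl))

        1+ρ≤2 : 1ℝ +ᵣ ρ ≤ᵣ fromℕ 2
        1+ρ≤2 = +ᵣ-mono ≤ᵣ-refl (≤ᵣ-trans (proj₁ ρ<1) (≤ᵣ-reflexive (sym fromℕ-1)))

      -- At the cap `y` is 1 and the exponent 0 will do; otherwise q ρ > 2 makes 2 / q an admissible
      -- exponent.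
      y≤pow : fromℕ y ≤ᵣ pow (fromℕ n) ρ
      y≤pow with reach-end ρ (2 + n) 0
      ... | inj₁ eq = pow-lower y 0 1 n>0 ρ≥0 (≤ᵣ-trans (proj₁ ρ<1) 1≤2) (s≤s z≤n) (*-nonNegative ρ≥0 (0≤fromℕ 1)) (ℕ.≤-reflexive (cong (λ y → y * 1) (y≡1 eq)))
      ... | inj₂ big = pow-lower y 2 q n>0 ρ≥0 (≤ᵣ-trans (proj₁ ρ<1) 1≤2) q>0 (2≤ρq big) (y^q≤n² l≤ b≤)

      ny≤pow : fromℕ (n * y) ≤ᵣ pow (fromℕ n) (1ℝ +ᵣ ρ)
      ny≤pow with reach-end ρ (2 + n) 0
      ... | inj₁ eq = pow-lower (n * y) 1 1 n>0 1+ρ≥0 1+ρ≤2 (s≤s z≤n)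
        (subst (_≤ᵣ (1ℝ +ᵣ ρ) *ᵣ fromℕ 1) (trans (cong (1ℝ *ᵣ_) fromℕ-1) (trans (*ᵣ-identityˡ 1ℝ) (sym fromℕ-1))) (*ᵣ-monoˡ (0≤fromℕ 1) (subst (_≤ᵣ 1ℝ +ᵣ ρ) (+ᵣ-identityʳ 1ℝ) (+ᵣ-mono ≤ᵣ-refl ρ≥0))))
        (ℕ.≤-reflexive (cong (λ y → y * 1) (trans (cong (n *_) (y≡1 eq)) (ℕ.*-identityʳ n))))
      ... | inj₂ big = pow-lower (n * y) (q + 2) q n>0 1+ρ≥0 1+ρ≤2 q>0
        (subst₂ _≤ᵣ_ (sym (fromℕ-+ q 2)) (trans (cong (_+ᵣ ρ *ᵣ fromℕ q) (sym (*ᵣ-identityˡ (fromℕ q)))) (sym (*ᵣ-distribʳ (fromℕ q) 1ℝ ρ))) (+ᵣ-mono ≤ᵣ-refl (2≤ρq big)))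
        (ℕ.≤-trans (ℕ.≤-reflexive (^-distribʳ-* q n y)) (ℕ.≤-trans (ℕ.*-monoʳ-≤ (n ℕ.^ q) (y^q≤n² l≤ b≤)) (ℕ.≤-reflexive (sym (ℕ.^-distribˡ-+-* n q 2)))))

  -- The complete program.

  -- Cells 5 and 6 are counters, 7 and 8 point to Δ and ρ, and 9, 10, 11 hold the
  -- coordinates, n and d as lists.

  H₀ : ℕ
  H₀ = 20 + top mainE 12

  -- Naturals cannot be multiplied, so n d is built by repeated addition, in the heap pointer and in
  -- cell 6. `coordLoop` then runs cell 6 down through the addresses of the coordinates. As a real
  -- is represented by its address, the counter itself is the entry of the list.
  sizeLoop coordLoop : Program
  sizeLoop = while (leN (at 4) (at 5)) (⟪ opN add (at 2) (at 2) (at 1) ⟫ ⨾ ⟪ opN add (at 6) (at 6) (at 1) ⟫ ⨾ ⟪ opN monus (at 5) (at 5) (at 4) ⟫)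
  coordLoop = while (leN (at 5) (at 6)) (⟪ opN monus (at 6) (at 6) (at 4) ⟫ ⨾ newpair 9 6 9)

  -- The entries are copies of cell 7, the address of Δ; what counts is the length.
  unaryLoop : ℕ → Program
  unaryLoop k = while (leN (at 4) (at 5)) (⟪ opN monus (at 5) (at 5) (at 4) ⟫ ⨾ newpair k 7 k)

  -- The heap begins at H₀ + n d, above the input in the real bank.
  prelude : Program
  prelude = ⟪ setN (at 4) 1 ⟫ ⨾ ⟪ setN (at 8) 1 ⟫ ⨾ ⟪ setN (at 2) H₀ ⟫ ⨾ ⟪ setN (at 6) 2 ⟫ ⨾
    ⟪ opN add (at 5) (at 0) (at 3) ⟫ ⨾ sizeLoop ⨾
    ⟪ setN (at 5) 3 ⟫ ⨾ coordLoop ⨾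
    ⟪ setN (at 10) 0 ⟫ ⨾ ⟪ opN add (at 5) (at 0) (at 3) ⟫ ⨾ unaryLoop 10 ⨾
    ⟪ setN (at 11) 0 ⟫ ⨾ ⟪ opN add (at 5) (at 1) (at 3) ⟫ ⨾ unaryLoop 11

  -- All intervals are closed, so a 1 is written as the flag of every endpoint. Endpoints and flags
  -- get the same addresses in the two banks, so that cells 1 and 2 end with the same start address,
  -- the heap pointer.
  countLoop writeLoop : Program
  countLoop = while (leN (at 4) (at 5)) (⟪ opN add (at 0) (at 0) (at 4) ⟫ ⨾ ⟪ opN add (at 5) (at 5) (at 4) ⟫ ⨾ ⟪ opN add (at 5) (ind 5) (at 3) ⟫)
  writeLoop = while (leN (at 4) (at 6)) (⟪ opN add (at 8) (ind 6) (at 3) ⟫ ⨾ ⟪ setR (ind 7) 0 ⟫ ⨾ ⟪ opR add (ind 7) (ind 7) (ind 8) ⟫ ⨾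
    ⟪ setN (ind 7) 1 ⟫ ⨾ ⟪ opN add (at 7) (at 7) (at 4) ⟫ ⨾ ⟪ opN add (at 6) (at 6) (at 4) ⟫ ⨾ ⟪ opN add (at 6) (ind 6) (at 3) ⟫)

  postlude : Program
  postlude = ⟪ opN add (at 5) (ind 12) (at 3) ⟫ ⨾ ⟪ opN add (at 12) (at 12) (at 4) ⟫ ⨾ ⟪ opN add (at 6) (ind 12) (at 3) ⟫ ⨾
    ⟪ setN (at 0) 0 ⟫ ⨾ countLoop ⨾ ⟪ opN add (at 7) (at 2) (at 3) ⟫ ⨾ writeLoop ⨾ ⟪ opN add (at 1) (at 2) (at 3) ⟫

  mainRegs : Regs (list num ∷ list num ∷ list num ∷ num ∷ num ∷ [])
  mainRegs = 11 ∷ 10 ∷ 9 ∷ 8 ∷ 7 ∷ []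

  program : Program
  program = prelude ⨾ compile mainE mainRegs 12 ⨾ postlude

  -- Preparing the input.

  module Run (𝓡 : RealNumbers) where
    open Basics 𝓡
    open RealRAM 𝓡
    open Simulation H₀

    12<H₀ : 12 < H₀
    12<H₀ = ≤-trans (m≤m+n 13 7) (m≤m+n 20 (top mainE 12))

    <H₀ : ∀ {a} → a ≤ 12 → a < H₀
    <H₀ le = ≤-<-trans le 12<H₀

    record Sized (σ : Store) (c d : ℕ) : Set where
      field
        {τ}  : Store
        run₁ : ⟨ sizeLoop , σ ⟩⇓⟨ τ , 4 * c + 1 ⟩
        hp₁  : nat τ 2 ≡ nat σ 2 + c * d
        ptr₁ : nat τ 6 ≡ nat σ 6 + c * d
        same : ∀ a → a ≢ 2 → a ≢ 5 → a ≢ 6 → nat τ a ≡ nat σ a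
        real₁ : ∀ a → real τ a ≡ real σ a

    sized : ∀ c {d σ} → nat σ 5 ≡ c → nat σ 1 ≡ d → nat σ 4 ≡ 1 → Sized σ c d
    sized zero {σ = σ} eq₅ eq₁ eq₄ = record
      { run₁ = while-false λ le → 1+n≰n (subst₂ _≤_ eq₄ eq₅ le)
      ; hp₁ = sym (+-identityʳ _) ; ptr₁ = sym (+-identityʳ _) ; same = λ _ _ _ _ → refl ; real₁ = λ _ → refl }
    sized (suc c) {d} {σ} eq₅ eq₁ eq₄ = record
      { run₁ = subst (λ t → ⟨ sizeLoop , σ ⟩⇓⟨ R.τ , t ⟩) (steps c) (while-true (subst₂ _≤_ (sym eq₄) (sym eq₅) (s≤s z≤n)) (seq instr (seq instr instr)) R.run₁)
      ; hp₁ = trans R.hp₁ (trans (cong (λ x → nat σ 2 + x + c * d) eq₁) (+-assoc (nat σ 2) d (c * d)))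
      ; ptr₁ = trans R.ptr₁ (trans (cong (λ x → nat σ 6 + x + c * d) eq₁) (+-assoc (nat σ 6) d (c * d)))
      ; same = λ a a≢2 a≢5 a≢6 → trans (R.same a a≢2 a≢5 a≢6) (body a a≢2 a≢5 a≢6)
      ; real₁ = R.real₁ }
      where
      σ′ = exec (opN monus (at 5) (at 5) (at 4)) (exec (opN add (at 6) (at 6) (at 1)) (exec (opN add (at 2) (at 2) (at 1)) σ))
      body : ∀ a → a ≢ 2 → a ≢ 5 → a ≢ 6 → nat σ′ a ≡ nat σ a
      body a a≢2 a≢5 a≢6 = trans (upd-other (nat (exec (opN add (at 6) (at 6) (at 1)) (exec (opN add (at 2) (at 2) (at 1)) σ))) a≢5)
        (trans (upd-other (nat (exec (opN add (at 2) (at 2) (at 1)) σ)) a≢6) (upd-other (nat σ) a≢2))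
      module R = Sized (sized c {d} {σ′} (cong₂ _∸_ eq₅ eq₄) eq₁ eq₄)
      steps : ∀ c → suc (3 + (4 * c + 1)) ≡ 4 * suc c + 1
      steps = solve-∀

    -- The values start at 2, since the coordinates follow Δ and ρ in the real bank.
    range : (ℕ → ℝ) → ℕ → List ℝ → List ℝ
    range f zero xs = xs
    range f (suc c) xs = range f c (f (2 + c) ∷ xs)

    -- What a loop that builds a list in register k does, if it counts with register j.
    record Built (P : Program) (k j : ℕ) (σ : Store) (xs : List ℝ) (c : ℕ) : Set where
      field
        {τ}  : Store
        run₁ : ⟨ P , σ ⟩⇓⟨ τ , 7 * c + 1 ⟩
        ext₁ : Ext 0 σ τ
        same : ∀ a → a < k → a ≢ 2 → a ≢ j → nat τ a ≡ nat σ a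
        list₁ : rep τ (list num) xs (nat τ k)

    private
      steps : ∀ c → suc (6 + (7 * c + 1)) ≡ 7 * suc c + 1
      steps = solve-∀

      low-ext : ∀ {σ j v} → 5 ≤ j → j < H₀ → Good σ → Ext 0 σ (putN σ (at j) v)
      low-ext {σ} {j} {v} j≥ j< g = Ext-wk z≤n (ext-put j≥ j< {σ} {v} g)

      put-good : ∀ {σ j v} → 5 ≤ j → j < H₀ → Good σ → Good (putN σ (at j) v)
      put-good {σ} {j} {v} j≥ j< g = Ext-good j≥ (ext-put j≥ j< {σ} {v} g) g

    -- The step common to the three loops that build lists: a test, a decrement and the five
    -- instructions of `newpair`, hence the 7 in `Built`.
    building : ∀ (b : Test) (P : Program) (k j r : ℕ) (c : ℕ) {σ x xs ys} →
      5 ≤ j → j < k → k ≤ 12 → 5 ≤ r → r < k →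
      P ≡ while b (⟪ opN monus (at j) (at j) (at 4) ⟫ ⨾ newpair k r k) → Holds b σ →
      let σ′ = exec (opN monus (at j) (at j) (at 4)) σ in
      Good σ → rep σ (list num) xs (nat σ k) → rep σ′ num x (nat σ′ r) →
      (∀ {τ} → Ext 0 σ τ → (∀ a → a < k → a ≢ 2 → a ≢ j → nat τ a ≡ nat σ a) → nat τ j ≡ nat σ j ∸ 1 →
        rep τ (list num) (x ∷ xs) (nat τ k) → Built P k j τ ys c) →
      Built P k j σ ys (suc c)
    building b P k j r c {σ} {x} {xs} {ys} j≥ j<k k≤ r≥ r<k refl hold g rl rx rec = record
      { run₁ = subst (λ t → ⟨ P , σ ⟩⇓⟨ R.τ , t ⟩) (steps c)
          (subst (λ t → ⟨ P , σ ⟩⇓⟨ R.τ , suc (1 + t + (7 * c + 1)) ⟩) five (while-true hold (seq instr (run G)) R.run₁))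
      ; ext₁ = Ext-trans E₂ R.ext₁
      ; same = λ a a<k a≢2 a≢j → trans (R.same a a<k a≢2 a≢j) (kept a a<k a≢2 a≢j)
      ; list₁ = R.list₁ }
      where
      σ′ = exec (opN monus (at j) (at j) (at 4)) σ
      k<H = <H₀ k≤
      E₁ = low-ext {σ} {j} {nat σ j ∸ nat σ 4} j≥ (<-trans j<k k<H) g
      g₁ = put-good {σ} {j} {nat σ j ∸ nat σ 4} j≥ (<-trans j<k k<H) g
      k≥ = ≤-trans j≥ (<⇒≤ j<k)
      k-same : nat σ′ k ≡ nat σ k
      k-same = upd-other (nat σ) (λ e → <⇒≢ j<k (sym e))
      G₀ = newpair-gives k≥ k<H {A = num} {list num} {σ = σ′} {r = r} {s = k} {a = x} {b = xs} g₁ r≥ (<-trans r<k k<H) k≥ k<H rx (subst (repList σ′ num xs) (sym k-same) (rep-ext E₁ (list num) {xs} rl))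
      G : Gives k σ′ (newpair k r k) (list num) (x ∷ xs) 5
      G = gives (run G₀) (ext G₀) (result G₀) (time≤ G₀)
      five : time G ≡ 5
      five = refl
      E₂ = Ext-trans E₁ (Ext-wk z≤n (ext G))
      kept : ∀ a → a < k → a ≢ 2 → a ≢ j → nat (after G) a ≡ nat σ a
      kept a a<k a≢2 a≢j = trans (low (ext G) a a<k a≢2) (upd-other (nat σ) a≢j)
      module R = Built (rec E₂ kept (trans (low (ext G) j j<k (n≢2 j≥)) (trans (upd-same (nat σ) j) (cong (nat σ j ∸_) (one≡ g)))) (result G))

    coordinates : ∀ (f : ℕ → ℝ) c {σ xs} → nat σ 6 ≡ 2 + c → nat σ 5 ≡ 3 → Good σ → rep σ (list num) xs (nat σ 9) →
      (∀ a → a < 2 + c → a < nat σ 2 × real σ a ≡ f a) → Built coordLoop 9 6 σ (range f c xs) c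
    coordinates f zero {σ} eq₆ eq₅ g rl inp = record
      { run₁ = while-false λ le → 1+n≰n (subst₂ _≤_ eq₅ eq₆ le) ; ext₁ = Ext-refl ; same = λ _ _ _ _ → refl ; list₁ = rl }
    coordinates f (suc c) {σ} {xs} eq₆ eq₅ g rl inp = building (leN (at 5) (at 6)) coordLoop 9 6 6 c {σ} {f (2 + c)} {xs} {range f c (f (2 + c) ∷ xs)}
      (n≤1+n 5) (m≤m+n 7 2) (m≤m+n 9 3) (n≤1+n 5) (m≤m+n 7 2) refl (subst₂ _≤_ (sym eq₅) (sym eq₆) (s≤s (s≤s (s≤s z≤n)))) g rl
      (subst (λ p → p < nat σ 2 × real σ p ≡ f (2 + c)) (sym ptr) (inp (2 + c) (n<1+n _)))
      λ {τ} E kept ptr′ rl′ → coordinates f c {τ} {f (2 + c) ∷ xs} (trans ptr′ (cong (_∸ 1) eq₆)) (trans (kept 5 (m≤m+n 6 3) (λ ()) (λ ())) eq₅)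
        (good-after E (kept 3 (m≤m+n 4 5) (λ ()) (λ ())) (kept 4 (m≤m+n 5 4) (λ ()) (λ ())) g) rl′
        λ a a< → let p = inp a (<-trans a< (n<1+n _)) in <-≤-trans (proj₁ p) (hp≤ E) , trans (heapR E a (proj₁ p)) (proj₂ p)
      where
      good-after : ∀ {σ τ} → Ext 0 σ τ → nat τ 3 ≡ nat σ 3 → nat τ 4 ≡ nat σ 4 → Good σ → Good τ
      good-after E e₃ e₄ g = record { zero≡ = trans e₃ (zero≡ g) ; one≡ = trans e₄ (one≡ g) ; H≤hp = ≤-trans (H≤hp g) (hp≤ E) }
      ptr : nat (exec (opN monus (at 6) (at 6) (at 4)) σ) 6 ≡ 2 + c
      ptr = trans (upd-same (nat σ) 6) (cong₂ _∸_ eq₆ (one≡ g))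

    copies : ℝ → ℕ → List ℝ → List ℝ
    copies x zero xs = xs
    copies x (suc c) xs = copies x c (x ∷ xs)

    length-copies : ∀ x c {xs} → length (copies x c xs) ≡ c + length xs
    length-copies x zero = refl
    length-copies x (suc c) {xs} = trans (length-copies x c) (+-suc c (length xs))

    good-after : ∀ {σ τ} → Ext 0 σ τ → nat τ 3 ≡ nat σ 3 → nat τ 4 ≡ nat σ 4 → Good σ → Good τ
    good-after E e₃ e₄ g = record { zero≡ = trans e₃ (zero≡ g) ; one≡ = trans e₄ (one≡ g) ; H≤hp = ≤-trans (H≤hp g) (hp≤ E) }

    unary : ∀ k → 10 ≤ k → k ≤ 11 → ∀ c {σ x xs} → nat σ 5 ≡ c → Good σ → rep σ (list num) xs (nat σ k) → rep σ num x (nat σ 7) →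
      Built (unaryLoop k) k 5 σ (copies x c xs) c
    unary k k≥ k≤ zero {σ} eq₅ g rl rx = record
      { run₁ = while-false λ le → 1+n≰n (subst₂ _≤_ (one≡ g) eq₅ le) ; ext₁ = Ext-refl ; same = λ _ _ _ _ → refl ; list₁ = rl }
    unary k k≥ k≤ (suc c) {σ} {x} {xs} eq₅ g rl rx = building (leN (at 4) (at 5)) (unaryLoop k) k 5 7 c {σ} {x} {xs} {copies x c (x ∷ xs)}
      ≤-refl (≤-trans (m≤m+n 6 4) k≥) (≤-trans k≤ (n≤1+n 11)) (m≤m+n 5 2) 7<k refl (subst₂ _≤_ (sym (one≡ g)) (sym eq₅) (s≤s z≤n)) g rl
      (rep-ext {0} E₀ num {x} rx)
      λ {τ} E kept ptr rl′ → unary k k≥ k≤ c {τ} {x} {x ∷ xs} (trans ptr (cong (_∸ 1) eq₅))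
        (good-after E (kept 3 (≤-trans (m≤m+n 4 6) k≥) (λ ()) (λ ())) (kept 4 (≤-trans (m≤m+n 5 5) k≥) (λ ()) (λ ())) g) rl′
        (subst (rep τ num x) (sym (kept 7 7<k (λ ()) (λ ()))) (rep-ext {0} E num {x} rx))
      where
      7<k : 7 < k
      7<k = ≤-trans (m≤m+n 8 2) k≥
      E₀ = low-ext {σ} {5} {nat σ 5 ∸ nat σ 4} ≤-refl (<H₀ (m≤m+n 5 7)) g

    rep-put : ∀ {σ j v} A {x} r → 5 ≤ j → j < H₀ → Good σ → r ≢ j → rep σ A x (nat σ r) → rep (putN σ (at j) v) A x (nat (putN σ (at j) v) r)
    rep-put {σ} {j} {v} A {x} r j≥ j< g ne rx = subst (rep (putN σ (at j) v) A x) (sym (upd-other (nat σ) ne)) (rep-ext (low-ext {σ} {j} {v} j≥ j< g) A {x} rx)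

    built-rep : ∀ {P k j σ xs c} (B : Built P k j σ xs c) A {x} r → r < k → r ≢ 2 → r ≢ j → rep σ A x (nat σ r) → rep (Built.τ B) A x (nat (Built.τ B) r)
    built-rep B A {x} r r<k r≢2 r≢j rx = subst (rep (Built.τ B) A x) (sym (Built.same B r r<k r≢2 r≢j)) (rep-ext (Built.ext₁ B) A {x} rx)

    record Prepared (σ : Store) (f : ℕ → ℝ) (n d : ℕ) : Set where
      field
        {τ}  : Store
        {t}  : ℕ
        run₁ : ⟨ prelude , σ ⟩⇓⟨ τ , t ⟩
        t≡   : t ≡ 14 + 11 * n + 7 * (n * d) + 7 * d
        good : Good τ
        env  : RepEnv τ 12 mainRegs (copies (f 0) d [] ∷ copies (f 0) n [] ∷ range f (n * d) [] ∷ f 1 ∷ f 0 ∷ [])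

    -- Beyond n and d the natural bank is 0 at the start. So cells 3, 7 and 9 already hold what is
    -- wanted: the constant 0, the address of Δ and the empty list.
    module _ (σ : Store) (f : ℕ → ℝ) (n d : ℕ) (eq₀ : nat σ 0 ≡ n) (eq₁ : nat σ 1 ≡ d) (empty : ∀ a → 2 ≤ a → nat σ a ≡ 0) (real≡ : ∀ a → real σ a ≡ f a) where
      private
        <H₀′ : ∀ a {b} → a + b ≡ 12 → a < H₀
        <H₀′ a {b} eq = <H₀ (subst (a ≤_) eq (m≤m+n a b))

        s₅ : Store
        s₅ = exec (opN add (at 5) (at 0) (at 3)) (exec (setN (at 6) 2) (exec (setN (at 2) H₀) (exec (setN (at 8) 1) (exec (setN (at 4) 1) σ))))

        plus0 : ∀ {x y n} → x ≡ n → y ≡ 0 → x + y ≡ n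
        plus0 refl refl = +-identityʳ _

        module S = Sized (sized n {d} {s₅} (plus0 eq₀ (empty 3 (s≤s (s≤s z≤n)))) eq₁ refl)

        g₁ : Good S.τ
        g₁ = record { zero≡ = trans (S.same 3 (λ ()) (λ ()) (λ ())) (empty 3 (s≤s (s≤s z≤n))) ; one≡ = S.same 4 (λ ()) (λ ()) (λ ())
          ; H≤hp = ≤-trans (m≤m+n H₀ (n * d)) (≤-reflexive (sym S.hp₁)) }

        s₆ : Store
        s₆ = exec (setN (at 5) 3) S.τ

        g₂ : Good s₆
        g₂ = put-good {S.τ} {5} {3} ≤-refl (<H₀′ 5 refl) g₁

        input-rep : ∀ a → a < 2 + n * d → a < nat s₆ 2 × real s₆ a ≡ f a
        input-rep a a< = <-≤-trans a< (≤-trans (+-monoˡ-≤ (n * d) (m≤m+n 2 18)) (≤-trans (+-monoˡ-≤ (n * d) (m≤m+n 20 (top mainE 12))) (≤-reflexive (sym S.hp₁)))) ,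
          trans (S.real₁ a) (real≡ a)

        module C = Built (coordinates f (n * d) {s₆} {[]} S.ptr₁ refl g₂ (trans (S.same 9 (λ ()) (λ ()) (λ ())) (empty 9 (s≤s (s≤s z≤n)))) input-rep)

        g₃ : Good C.τ
        g₃ = good-after C.ext₁ (C.same 3 (m≤m+n 4 5) (λ ()) (λ ())) (C.same 4 (m≤m+n 5 4) (λ ()) (λ ())) g₂

        s₇ : Store
        s₇ = exec (opN add (at 5) (at 0) (at 3)) (exec (setN (at 10) 0) C.τ)

        g₄ : Good (exec (setN (at 10) 0) C.τ)
        g₄ = put-good {C.τ} {10} {0} (m≤m+n 5 5) (<H₀′ 10 refl) g₃

        g₅ : Good s₇
        g₅ = put-good {exec (setN (at 10) 0) C.τ} {5} {nat C.τ 0 + nat C.τ 3} ≤-refl (<H₀′ 5 refl) g₄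

        to-s₇ : ∀ A {x} r → r ≢ 5 → r ≢ 10 → rep C.τ A x (nat C.τ r) → rep s₇ A x (nat s₇ r)
        to-s₇ A {x} r ne₅ ne₁₀ rx = rep-put {exec (setN (at 10) 0) C.τ} {5} {nat C.τ 0 + nat C.τ 3} A {x} r ≤-refl (<H₀′ 5 refl) g₄ ne₅
          (rep-put {C.τ} {10} {0} A {x} r (m≤m+n 5 5) (<H₀′ 10 refl) g₃ ne₁₀ rx)

        Δ-rep : rep s₆ num (f 0) (nat s₆ 7)
        Δ-rep = subst (rep s₆ num (f 0)) (sym (trans (S.same 7 (λ ()) (λ ()) (λ ())) (empty 7 (s≤s (s≤s z≤n))))) (input-rep 0 (s≤s z≤n))

        ρ-rep : rep s₆ num (f 1) (nat s₆ 8)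
        ρ-rep = subst (rep s₆ num (f 1)) (sym (S.same 8 (λ ()) (λ ()) (λ ()))) (input-rep 1 (s≤s (s≤s z≤n)))

        C-built = coordinates f (n * d) {s₆} {[]} S.ptr₁ refl g₂ (trans (S.same 9 (λ ()) (λ ()) (λ ())) (empty 9 (s≤s (s≤s z≤n)))) input-rep

        Δ₇ : rep s₇ num (f 0) (nat s₇ 7)
        Δ₇ = to-s₇ num {f 0} 7 (λ ()) (λ ()) (built-rep C-built num {f 0} 7 (m≤m+n 8 1) (λ ()) (λ ()) Δ-rep)

        U-built : Built (unaryLoop 10) 10 5 s₇ (copies (f 0) n []) n
        U-built = unary 10 ≤-refl (n≤1+n 10) n {s₇} {f 0} {[]} (plus0 (trans (C.same 0 (s≤s z≤n) (λ ()) (λ ())) (trans (S.same 0 (λ ()) (λ ()) (λ ())) eq₀)) (zero≡ g₃)) g₅ refl Δ₇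
        module U = Built U-built

        g₆ : Good U.τ
        g₆ = good-after U.ext₁ (U.same 3 (m≤m+n 4 6) (λ ()) (λ ())) (U.same 4 (m≤m+n 5 5) (λ ()) (λ ())) g₅

        s₈ : Store
        s₈ = exec (opN add (at 5) (at 1) (at 3)) (exec (setN (at 11) 0) U.τ)

        g₇ : Good (exec (setN (at 11) 0) U.τ)
        g₇ = put-good {U.τ} {11} {0} (m≤m+n 5 6) (<H₀′ 11 refl) g₆

        g₈ : Good s₈
        g₈ = put-good {exec (setN (at 11) 0) U.τ} {5} {nat U.τ 1 + nat U.τ 3} ≤-refl (<H₀′ 5 refl) g₇

        to-s₈ : ∀ A {x} r → r ≢ 5 → r ≢ 11 → rep U.τ A x (nat U.τ r) → rep s₈ A x (nat s₈ r)
        to-s₈ A {x} r ne₅ ne₁₁ rx = rep-put {exec (setN (at 11) 0) U.τ} {5} {nat U.τ 1 + nat U.τ 3} A {x} r ≤-refl (<H₀′ 5 refl) g₇ ne₅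
          (rep-put {U.τ} {11} {0} A {x} r (m≤m+n 5 6) (<H₀′ 11 refl) g₆ ne₁₁ rx)

        Δ₈ : rep s₈ num (f 0) (nat s₈ 7)
        Δ₈ = to-s₈ num {f 0} 7 (λ ()) (λ ()) (built-rep U-built num {f 0} 7 (m≤m+n 8 2) (λ ()) (λ ()) Δ₇)

        V-built : Built (unaryLoop 11) 11 5 s₈ (copies (f 0) d []) d
        V-built = unary 11 (n≤1+n 10) ≤-refl d {s₈} {f 0} {[]} (plus0 (trans (U.same 1 (s≤s (s≤s z≤n)) (λ ()) (λ ()))
          (trans (C.same 1 (s≤s (s≤s z≤n)) (λ ()) (λ ())) (trans (S.same 1 (λ ()) (λ ()) (λ ())) eq₁))) (zero≡ g₆)) g₈ refl Δ₈
        module V = Built V-built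

        carry : ∀ A {x} r → r < 9 ⊎ r ≡ 9 → r ≢ 2 → r ≢ 5 → rep C.τ A x (nat C.τ r) → rep V.τ A x (nat V.τ r)
        carry A {x} r le ne₂ ne₅ rx = built-rep V-built A {x} r (<-trans r<10 (n<1+n 10)) ne₂ ne₅ (to-s₈ A {x} r ne₅ (<⇒≢ (<-trans r<10 (n<1+n 10)))
            (built-rep U-built A {x} r r<10 ne₂ ne₅ (to-s₇ A {x} r ne₅ (<⇒≢ r<10) rx)))
          where
          small : ∀ {r} → r < 9 ⊎ r ≡ 9 → r < 10
          small (inj₁ lt) = <-trans lt (n<1+n 9)
          small (inj₂ refl) = ≤-refl
          r<10 : r < 10
          r<10 = small le

      prepared : Prepared σ f n d
      prepared = record
        { run₁ = seq instr (seq instr (seq instr (seq instr (seq instr (seq S.run₁ (seq instr (seq C.run₁ (seq instr (seq instr (seq U.run₁ (seq instr (seq instr V.run₁))))))))))))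
        ; t≡ = steps₁ n d (n * d)
        ; good = good-after V.ext₁ (V.same 3 (m≤m+n 4 7) (λ ()) (λ ())) (V.same 4 (m≤m+n 5 6) (λ ()) (λ ())) g₈
        ; env = (m≤m+n 5 6 , ≤-refl , V.list₁)
              , (m≤m+n 5 5 , m≤m+n 11 1 , built-rep V-built (list num) {copies (f 0) n []} 10 ≤-refl (λ ()) (λ ()) (to-s₈ (list num) {copies (f 0) n []} 10 (λ ()) (λ ()) U.list₁))
              , (m≤m+n 5 4 , m≤m+n 10 2 , carry (list num) {range f (n * d) []} 9 (inj₂ refl) (λ ()) (λ ()) C.list₁)
              , (m≤m+n 5 3 , m≤m+n 9 3 , carry num {f 1} 8 (inj₁ ≤-refl) (λ ()) (λ ()) (built-rep C-built num {f 1} 8 ≤-refl (λ ()) (λ ()) ρ-rep))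
              , (m≤m+n 5 2 , m≤m+n 8 4 , carry num {f 0} 7 (inj₁ (m≤m+n 8 1)) (λ ()) (λ ()) (built-rep C-built num {f 0} 7 (m≤m+n 8 1) (λ ()) (λ ()) Δ-rep))
              , tt }
        where
        steps₁ : ∀ n d e → 1 + (1 + (1 + (1 + (1 + (4 * n + 1 + (1 + (7 * e + 1 + (1 + (1 + (7 * n + 1 + (1 + (1 + (7 * d + 1))))))))))))) ≡ 14 + 11 * n + 7 * e + 7 * d
        steps₁ = solve-∀

  -- Writing the output.

  module Finish (𝓡 : RealNumbers) where
    open Basics 𝓡
    open RealRAM 𝓡
    open Simulation H₀
    open Run 𝓡

    record Counted (σ : Store) (c : ℕ) : Set where
      field
        {τ}   : Store
        run₁  : ⟨ countLoop , σ ⟩⇓⟨ τ , 4 * c + 1 ⟩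
        ext₁  : Ext 0 σ τ
        count : nat τ 0 ≡ nat σ 0 + c
        same  : ∀ a → a ≢ 0 → a ≢ 5 → nat τ a ≡ nat σ a

    counted : ∀ (xs : List ℝ) {σ} → Good σ → repList σ num xs (nat σ 5) → Counted σ (length xs)
    counted [] {σ} g eq = record { run₁ = while-false λ le → 1+n≰n (subst₂ _≤_ (one≡ g) eq le) ; ext₁ = Ext-refl ; count = sym (+-identityʳ _) ; same = λ _ _ _ → refl }
    counted (x ∷ xs) {σ} g (H≤p , p< , _ , rxs) = record
      { run₁ = subst (λ t → ⟨ countLoop , σ ⟩⇓⟨ R.τ , t ⟩) (steps₂ (length xs))
          (while-true (subst (_≤ nat σ 5) (sym (one≡ g)) (≤-trans (s≤s z≤n) (≤-trans (<H₀ z≤n) H≤p))) (seq instr (seq instr instr)) R.run₁)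
      ; ext₁ = Ext-trans E R.ext₁
      ; count = trans R.count (trans (cong (λ n → nat σ 0 + n + length xs) (one≡ g)) (+-assoc (nat σ 0) 1 (length xs)))
      ; same = λ a ≢0 ≢5 → trans (R.same a ≢0 ≢5) (body a ≢0 ≢5) }
      where
      p = nat σ 5
      σ₁ = exec (opN add (at 0) (at 0) (at 4)) σ
      σ₂ = exec (opN add (at 5) (at 5) (at 4)) σ₁
      σ₃ = exec (opN add (at 5) (ind 5) (at 3)) σ₂
      body : ∀ a → a ≢ 0 → a ≢ 5 → nat σ₃ a ≡ nat σ a
      body a ≢0 ≢5 = trans (upd-other (nat σ₂) ≢5) (trans (upd-other (nat σ₁) ≢5) (upd-other (nat σ) ≢0))
      E : Ext 0 σ σ₃
      E = record
        { low = λ _ () ; heapN = λ a H≤a _ → body a (λ { refl → <⇒≱ (<H₀ z≤n) H≤a }) (λ { refl → <⇒≱ (<H₀ (m≤m+n 5 7)) H≤a })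
        ; heapR = λ _ _ → refl ; hp≤ = ≤-refl }
      ptr : nat σ₃ 5 ≡ nat σ (suc p)
      ptr = trans (cong₂ _+_ (trans (cong (nat σ₂) (trans (cong (p +_) (one≡ g)) (+-comm p 1)))
          (upd-other (nat σ₁) (λ e → <⇒≱ (<H₀ (m≤m+n 5 7)) (subst (H₀ ≤_) e (m≤n⇒m≤1+n H≤p))))) (zero≡ g)) (+-identityʳ _)
      g₃ : Good σ₃
      g₃ = good-after E refl refl g
      module R = Counted (counted xs {σ₃} g₃ (subst (repList σ₃ num xs) (sym ptr) (repList-ext E num xs rxs)))
      steps₂ : ∀ c → suc (3 + (4 * c + 1)) ≡ 4 * suc c + 1
      steps₂ = solve-∀

    -- The output starts at or above the heap pointer, so nothing represented is overwritten, in
    -- particular not the endpoints still to be read.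
    record Written (σ : Store) (xs : List ℝ) : Set where
      field
        {τ}   : Store
        run₁  : ⟨ writeLoop , σ ⟩⇓⟨ τ , 8 * length xs + 1 ⟩
        sameN : ∀ a → a < nat σ 7 → a ≢ 6 → a ≢ 7 → a ≢ 8 → nat τ a ≡ nat σ a
        sameR : ∀ a → a < nat σ 7 → real τ a ≡ real σ a
        value : ∀ i → real τ (nat σ 7 + toℕ i) ≡ lookup xs i × nat τ (nat σ 7 + toℕ i) ≡ 1

    written : ∀ (xs : List ℝ) {σ} → Good σ → repList σ num xs (nat σ 6) → nat σ 2 ≤ nat σ 7 → Written σ xs
    written [] {σ} g eq _ = record { run₁ = while-false λ le → 1+n≰n (subst₂ _≤_ (one≡ g) eq le) ; sameN = λ _ _ _ _ _ → refl ; sameR = λ _ _ → refl ; value = λ () }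
    written (x ∷ xs) {σ} g (H≤p , p< , (h< , hx) , rxs) hp≤b = record
      { run₁ = subst (λ t → ⟨ writeLoop , σ ⟩⇓⟨ R.τ , t ⟩) (steps₃ (length xs))
          (while-true (subst (_≤ nat σ 6) (sym (one≡ g)) (≤-trans (s≤s z≤n) (≤-trans (<H₀ z≤n) H≤p))) (seq instr (seq instr (seq instr (seq instr (seq instr (seq instr instr)))))) R.run₁)
      ; sameN = λ a a<b ≢6 ≢7 ≢8 → trans (R.sameN a (<-trans a<b b<b′) ≢6 ≢7 ≢8) (body a (<⇒≢ a<b) ≢6 ≢7 ≢8)
      ; sameR = λ a a<b → trans (R.sameR a (<-trans a<b b<b′)) (realOther a (<⇒≢ a<b))
      ; value = value }
      where
      b = nat σ 7
      p = nat σ 6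
      H≤b : H₀ ≤ b
      H≤b = ≤-trans (H≤hp g) hp≤b
      w₁ = exec (opN add (at 8) (ind 6) (at 3)) σ
      w₂ = exec (setR (ind 7) 0) w₁
      w₃ = exec (opR add (ind 7) (ind 7) (ind 8)) w₂
      w₄ = exec (setN (ind 7) 1) w₃
      w₅ = exec (opN add (at 7) (at 7) (at 4)) w₄
      w₆ = exec (opN add (at 6) (at 6) (at 4)) w₅
      w₇ = exec (opN add (at 6) (ind 6) (at 3)) w₆
      reg≢ : ∀ a {c} → a + c ≡ 12 → a ≢ b
      reg≢ a eq e = <⇒≱ (<H₀ (subst (a ≤_) eq (m≤m+n a _))) (subst (H₀ ≤_) (sym e) H≤b)
      low≢ : ∀ a {c} {x} → a + c ≡ 12 → H₀ ≤ x → x ≢ a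
      low≢ a eq H≤x e = <⇒≱ (<H₀ (subst (a ≤_) eq (m≤m+n a _))) (subst (H₀ ≤_) e H≤x)
      body : ∀ a → a ≢ b → a ≢ 6 → a ≢ 7 → a ≢ 8 → nat w₇ a ≡ nat σ a
      body a ≢b ≢6 ≢7 ≢8 = trans (upd-other (nat w₆) ≢6) (trans (upd-other (nat w₅) ≢6) (trans (upd-other (nat w₄) ≢7) (trans (upd-other (nat w₃) ≢b) (upd-other (nat σ) ≢8))))
      b′≡ : nat w₇ 7 ≡ suc b
      b′≡ = trans (cong₂ _+_ (upd-other (nat w₃) (reg≢ 7 refl)) (trans (upd-other (nat w₃) (reg≢ 4 refl)) (one≡ g))) (+-comm b 1)
      b<b′ : b < nat w₇ 7
      b<b′ = ≤-reflexive (sym b′≡)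
      realOther : ∀ a → a ≢ b → real w₇ a ≡ real σ a
      realOther a ne = trans (upd-other (real w₂) ne) (upd-other (real w₁) ne)
      h≡ : nat w₂ 8 ≡ nat σ p
      h≡ = trans (cong (nat σ p +_) (zero≡ g)) (+-identityʳ _)
      written-value : real w₇ b ≡ x
      written-value = trans (upd-same (real w₂) b) (trans (cong₂ _+ᵣ_ (upd-same (real w₁) b) (trans (cong (real w₂) h≡) (trans (upd-other (real w₁) (<⇒≢ (<-≤-trans h< hp≤b))) hx))) (+ᵣ-identityˡ x))
      p′≡ : nat w₆ 6 ≡ suc p
      p′≡ = trans (cong₂ _+_ (upd-other (nat w₃) (reg≢ 6 refl)) (trans (upd-other (nat w₃) (reg≢ 4 refl)) (one≡ g))) (+-comm p 1)
      ptr : nat w₇ 6 ≡ nat σ (suc p)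
      ptr = trans (cong₂ _+_ (trans (cong (nat w₆) p′≡) (trans (upd-other (nat w₅) (low≢ 6 refl H≤p′)) (trans (upd-other (nat w₄) (low≢ 7 refl H≤p′))
          (trans (upd-other (nat w₃) (<⇒≢ (<-≤-trans p< hp≤b))) (upd-other (nat σ) (low≢ 8 refl H≤p′)))))) (trans (upd-other (nat w₃) (reg≢ 3 refl)) (zero≡ g))) (+-identityʳ _)
        where
        H≤p′ = m≤n⇒m≤1+n H≤p
      hp≡ : nat w₇ 2 ≡ nat σ 2
      hp≡ = body 2 (reg≢ 2 refl) (λ ()) (λ ()) (λ ())
      E : Ext 0 σ w₇
      E = record
        { low = λ _ () ; heapN = λ a H≤a a<hp → body a (<⇒≢ (<-≤-trans a<hp hp≤b)) (low≢ 6 refl H≤a) (low≢ 7 refl H≤a) (low≢ 8 refl H≤a)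
        ; heapR = λ a a<hp → realOther a (<⇒≢ (<-≤-trans a<hp hp≤b)) ; hp≤ = ≤-reflexive (sym hp≡) }
      g₇ : Good w₇
      g₇ = good-after E (body 3 (reg≢ 3 refl) (λ ()) (λ ()) (λ ())) (body 4 (reg≢ 4 refl) (λ ()) (λ ()) (λ ())) g
      module R = Written (written xs {w₇} g₇ (subst (repList w₇ num xs) (sym ptr) (repList-ext E num xs rxs)) (≤-trans (≤-reflexive hp≡) (≤-trans hp≤b (<⇒≤ b<b′))))
      value : ∀ i → real R.τ (b + toℕ i) ≡ lookup (x ∷ xs) i × nat R.τ (b + toℕ i) ≡ 1
      value Fin.zero = trans (cong (real R.τ) (+-identityʳ b)) (trans (R.sameR b b<b′) written-value) ,
        trans (cong (nat R.τ) (+-identityʳ b)) (trans (R.sameN b b<b′ (λ e → reg≢ 6 refl (sym e)) (λ e → reg≢ 7 refl (sym e)) (λ e → reg≢ 8 refl (sym e))) one-at)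
        where
        one-at : nat w₇ b ≡ 1
        one-at = trans (upd-other (nat w₆) (λ e → reg≢ 6 refl (sym e))) (trans (upd-other (nat w₅) (λ e → reg≢ 6 refl (sym e)))
          (trans (upd-other (nat w₄) (λ e → reg≢ 7 refl (sym e))) (upd-same (nat w₃) b)))
      value (Fin.suc i) = subst (λ c → real R.τ c ≡ lookup xs i × nat R.τ c ≡ 1) (trans (cong (_+ toℕ i) b′≡) (sym (+-suc b (toℕ i)))) (R.value i)
      steps₃ : ∀ c → suc (7 + (8 * c + 1)) ≡ 8 * suc c + 1
      steps₃ = solve-∀

    record Stored (σ : Store) (ms fl : List ℝ) : Set where
      field
        {τ}   : Store
        {t}   : ℕ
        run₁  : ⟨ postlude , σ ⟩⇓⟨ τ , t ⟩
        t≡    : t ≡ 8 + 4 * length ms + 8 * length fl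
        count : nat τ 0 ≡ length ms
        bases : nat τ 1 ≡ nat τ 2
        value : ∀ i → real τ (nat τ 2 + toℕ i) ≡ lookup fl i × nat τ (nat τ 2 + toℕ i) ≡ 1

    stored : ∀ σ ms fl → Good σ → rep σ (list num ⊗ list num) (ms , fl) (nat σ 12) → Stored σ ms fl
    stored σ ms fl g (H≤p , p< , rms , rfl) = record
      { run₁ = seq instr (seq instr (seq instr (seq instr (seq C.run₁ (seq instr (seq W.run₁ instr))))))
      ; t≡ = steps₄ (length ms) (length fl)
      ; count = trans (W.sameN 0 (<-≤-trans (<H₀ z≤n) (≤-trans (H≤hp g₆) (≤-reflexive (sym b≡)))) (λ ()) (λ ()) (λ ())) C.count
      ; bases = trans (cong (nat W.τ 2 +_) zero₇) (+-identityʳ _)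
      ; value = λ i → subst (λ b → real W.τ (b + toℕ i) ≡ lookup fl i × nat τ (b + toℕ i) ≡ 1) (trans b≡ (sym hp₇))
          (proj₁ (W.value i) , trans (upd-other (nat W.τ) {1} (λ e → <⇒≱ (<H₀ (s≤s z≤n)) (subst (H₀ ≤_) e (≤-trans (≤-trans (H≤hp g₆) (≤-reflexive (sym b≡))) (m≤m+n _ (toℕ i)))))) (proj₂ (W.value i))) }
      where
      p = nat σ 12
      s₁ = exec (opN add (at 5) (ind 12) (at 3)) σ
      s₂ = exec (opN add (at 12) (at 12) (at 4)) s₁
      s₃ = exec (opN add (at 6) (ind 12) (at 3)) s₂
      s₄ = exec (setN (at 0) 0) s₃
      reg< : ∀ a {c} → a + c ≡ 12 → a < H₀
      reg< a eq = <H₀ (subst (a ≤_) eq (m≤m+n a _))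
      low≢ : ∀ a {c} {x} → a + c ≡ 12 → H₀ ≤ x → x ≢ a
      low≢ a eq H≤x e = <⇒≱ (reg< a eq) (subst (H₀ ≤_) e H≤x)
      E₃ : Ext 0 σ s₄
      E₃ = record
        { low = λ _ () ; heapN = λ a H≤a _ → trans (upd-other (nat s₃) (low≢ 0 refl H≤a)) (trans (upd-other (nat s₂) (low≢ 6 refl H≤a)) (trans (upd-other (nat s₁) (low≢ 12 refl H≤a)) (upd-other (nat σ) (low≢ 5 refl H≤a))))
        ; heapR = λ _ _ → refl ; hp≤ = ≤-refl }
      g₄ : Good s₄
      g₄ = good-after E₃ refl refl g
      ptr₅ : nat s₄ 5 ≡ nat σ p
      ptr₅ = trans (cong (nat σ p +_) (zero≡ g)) (+-identityʳ _)
      ptr₆ : nat s₄ 6 ≡ nat σ (suc p)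
      ptr₆ = trans (cong₂ _+_ (trans (cong (nat s₂) (trans (cong (p +_) (one≡ g)) (+-comm p 1))) (trans (upd-other (nat s₁) (low≢ 12 refl (m≤n⇒m≤1+n H≤p))) (upd-other (nat σ) (low≢ 5 refl (m≤n⇒m≤1+n H≤p))))) (zero≡ g)) (+-identityʳ _)
      module C = Counted (counted ms {s₄} g₄ (subst (repList s₄ num ms) (sym ptr₅) (repList-ext E₃ num ms rms)))
      g₅ : Good C.τ
      g₅ = good-after C.ext₁ (C.same 3 (λ ()) (λ ())) (C.same 4 (λ ()) (λ ())) g₄
      s₆ = exec (opN add (at 7) (at 2) (at 3)) C.τ
      E₆ : Ext 0 C.τ s₆
      E₆ = Ext-wk z≤n (ext-put (m≤m+n 5 2) (reg< 7 refl) {C.τ} {nat C.τ 2 + nat C.τ 3} g₅)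
      g₆ : Good s₆
      g₆ = good-after E₆ refl refl g₅
      b≡ : nat s₆ 7 ≡ nat s₆ 2
      b≡ = trans (cong (nat C.τ 2 +_) (zero≡ g₅)) (+-identityʳ _)
      rfl₆ : repList s₆ num fl (nat s₆ 6)
      rfl₆ = subst (repList s₆ num fl) (sym (trans (C.same 6 (λ ()) (λ ())) ptr₆)) (repList-ext E₆ num fl (repList-ext C.ext₁ num fl (repList-ext E₃ num fl rfl)))
      module W = Written (written fl {s₆} g₆ rfl₆ (≤-reflexive (sym b≡)))
      b≥ : H₀ ≤ nat s₆ 7
      b≥ = ≤-trans (H≤hp g₆) (≤-reflexive (sym b≡))
      zero₇ : nat W.τ 3 ≡ 0
      zero₇ = trans (W.sameN 3 (<-≤-trans (reg< 3 refl) b≥) (λ ()) (λ ()) (λ ())) (zero≡ g₆)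
      hp₇ : nat W.τ 2 ≡ nat s₆ 2
      hp₇ = W.sameN 2 (<-≤-trans (reg< 2 refl) b≥) (λ ()) (λ ()) (λ ())
      τ = exec (opN add (at 1) (at 2) (at 3)) W.τ
      steps₄ : ∀ c e → 1 + (1 + (1 + (1 + (4 * c + 1 + (1 + (8 * e + 1 + 1)))))) ≡ 8 + 4 * c + 8 * e
      steps₄ = solve-∀

    module _ (σ : Store) (f : ℕ → ℝ) (n d : ℕ) (eq₀ : nat σ 0 ≡ n) (eq₁ : nat σ 1 ≡ d) (empty : ∀ a → 2 ≤ a → nat σ a ≡ 0) (real≡ : ∀ a → real σ a ≡ f a) where

      env : Env (list num ∷ list num ∷ list num ∷ num ∷ num ∷ [])
      env = copies (f 0) d [] ∷ copies (f 0) n [] ∷ range f (n * d) [] ∷ f 1 ∷ f 0 ∷ []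

      record Finished : Set where
        field
          {τ}   : Store
          {t}   : ℕ
          run₁  : ⟨ program , σ ⟩⇓⟨ τ , t ⟩
          t≤    : t ≤ 22 + 11 * n + 7 * (n * d) + 7 * d + weight mainE * suc (iters mainE env) + (4 * length (proj₁ (⟦ mainE ⟧ env)) + 8 * length (proj₂ (⟦ mainE ⟧ env)))
          count : nat τ 0 ≡ length (proj₁ (⟦ mainE ⟧ env))
          bases : nat τ 1 ≡ nat τ 2
          value : ∀ i → real τ (nat τ 2 + toℕ i) ≡ lookup (proj₂ (⟦ mainE ⟧ env)) i × nat τ (nat τ 2 + toℕ i) ≡ 1

      finished : Finished
      finished = record
        { run₁ = seq A.run₁ (seq (run G) B.run₁)
        ; t≤ = ≤-trans (+-mono-≤ (≤-reflexive A.t≡) (+-mono-≤ (time≤ G) (≤-reflexive B.t≡)))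
            (≤-reflexive (arith n (n * d) d (weight mainE * suc (iters mainE env)) (length (proj₁ (⟦ mainE ⟧ env))) (length (proj₂ (⟦ mainE ⟧ env)))))
        ; count = B.count ; bases = B.bases ; value = B.value }
        where
        module A = Prepared (prepared σ f n d eq₀ eq₁ empty real≡)
        G = simulation mainE mainRegs {env} {12} {A.τ} (m≤m+n 5 7) (m≤n+m (top mainE 12) 20) A.good A.env
        module B = Stored (stored (after G) (proj₁ (⟦ mainE ⟧ env)) (proj₂ (⟦ mainE ⟧ env)) (Ext-good (m≤m+n 5 7) (ext G) A.good) (result G))
        arith : ∀ n e d w a b → 14 + 11 * n + 7 * e + 7 * d + (w + (8 + 4 * a + 8 * b)) ≡ 22 + 11 * n + 7 * e + 7 * d + w + (4 * a + 8 * b)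
        arith = solve-∀

  filter-map-≤ : {A B : Set} (f : A → B) {P : Pred B 0ℓ} {Q : Pred A 0ℓ} (P? : Decidable P) (Q? : Decidable Q) → (∀ {x} → P (f x) → Q x) →
    ∀ xs → length (filter P? (map f xs)) ≤ length (filter Q? xs)
  filter-map-≤ f P? Q? imp [] = z≤n
  filter-map-≤ f P? Q? imp (x ∷ xs) with P? (f x) | Q? x
  ... | yes _ | yes _ = s≤s (filter-map-≤ f P? Q? imp xs)
  ... | yes p | no n = contradiction (imp p) n
  ... | no _ | yes _ = ℕ.m≤n⇒m≤1+n (filter-map-≤ f P? Q? imp xs)
  ... | no _ | no _ = filter-map-≤ f P? Q? imp xs

  -- Distances, intervals and clusters.

  module Geometry (𝓡 : RealNumbers) where
    open OrderedField 𝓡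
    open ℓ∞ 𝓡
    open Extrema (DecTotalOrder.totalOrder decTotalOrder) using (⊥≤max; xs≤max; max≤v⁺)

    abs≤ : ∀ {x y} → x ≤ᵣ y → -ᵣ x ≤ᵣ y → abs x ≤ᵣ y
    abs≤ p q = max≤v⁺ p (q ∷ [])

    dist≤ : ∀ {d} {x y : Point d} {r} → 0ℝ ≤ᵣ r → (∀ i → x i ⊖ y i ≤ᵣ r) → (∀ i → y i ⊖ x i ≤ᵣ r) → dist x y ≤ᵣ r
    dist≤ {d} {x} {y} r≥0 f g = max≤v⁺ r≥0 (Allₚ.tabulate⁺ λ i → abs≤ (f i) (subst (_≤ᵣ _) (negated (x i) (y i)) (g i)))
      where
      negated : ∀ a b → b ⊖ a ≡ -ᵣ (a ⊖ b)
      negated a b = trans (sym (+ᵣ-identityˡ _)) (trans (cong (_+ᵣ (b ⊖ a)) (sym (-ᵣ-inverseˡ (a ⊖ b)))) (trans (+ᵣ-assoc _ (a ⊖ b) (b ⊖ a))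
        (trans (cong (-ᵣ (a ⊖ b) +ᵣ_) (trans (sym (+ᵣ-assoc (a ⊖ b) b (-ᵣ a))) (trans (cong (_+ᵣ -ᵣ a) (sub-add a b)) (-ᵣ-inverseʳ a)))) (+ᵣ-identityʳ _))))

    coordinate≤dist : ∀ {d} (x y : Point d) i → abs (x i ⊖ y i) ≤ᵣ dist x y
    coordinate≤dist x y i = Allₚ.tabulate⁻ (xs≤max 0ℝ (tabulate λ i → abs (x i ⊖ y i))) i

    dist-upper : ∀ {d} (x y : Point d) i → x i ≤ᵣ y i +ᵣ dist x y
    dist-upper x y i = x≤y+z (≤ᵣ-trans (⊥≤max (x i ⊖ y i) (-ᵣ (x i ⊖ y i) ∷ [])) (coordinate≤dist x y i))

    dist-lower : ∀ {d} (x y : Point d) i → y i ≤ᵣ x i +ᵣ dist x y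
    dist-lower x y i = subst (_≤ᵣ x i +ᵣ dist x y) (trans (cong (x i +ᵣ_) refl) (back (x i) (y i))) (+ᵣ-mono ≤ᵣ-refl
        (≤ᵣ-trans (All.head (xs≤max (x i ⊖ y i) (-ᵣ (x i ⊖ y i) ∷ []))) (coordinate≤dist x y i)))
      where
      back : ∀ a b → a +ᵣ -ᵣ (a ⊖ b) ≡ b
      back a b = trans (cong (_+ᵣ -ᵣ (a ⊖ b)) (trans (sym (sub-add a b)) refl)) (add-sub (a ⊖ b) b)

    -- The closed interval from a to b, if it is not empty.
    closed : ℝ → ℝ → Interval
    closed a b with a ≤ᵣ? b
    ... | yes p = record { lower = a ; upper = b ; lower≤upper = p ; lowerClosed = true ; upperClosed = true }
    ... | no _ = record { lower = 0ℝ ; upper = 0ℝ ; lower≤upper = ≤ᵣ-refl ; lowerClosed = true ; upperClosed = true }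

    closed-flags : ∀ a b → lowerClosed (closed a b) ≡ true × upperClosed (closed a b) ≡ true
    closed-flags a b with a ≤ᵣ? b
    ... | yes _ = refl , refl
    ... | no _ = refl , refl

    closed-ends : ∀ {a b} → a ≤ᵣ b → lower (closed a b) ≡ a × upper (closed a b) ≡ b
    closed-ends {a} {b} le with a ≤ᵣ? b
    ... | yes _ = refl , refl
    ... | no n = contradiction le n

    closed-∈ : ∀ {a b x} → a ≤ᵣ x → x ≤ᵣ b → x ∈I closed a b
    closed-∈ {a} {b} p q with a ≤ᵣ? b
    ... | yes _ = p , q
    ... | no n = contradiction (≤ᵣ-trans p q) n

    weaken : ∀ {x y} c → x ≤[ c ] y → x ≤ᵣ y
    weaken true p = p
    weaken false (p , _) = p

    ∈-bounds : ∀ {x I} → x ∈I I → lower I ≤ᵣ x × x ≤ᵣ upper I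
    ∈-bounds {I = I} (p , q) = weaken (lowerClosed I) p , weaken (upperClosed I) q

    width≤ : ∀ {d} {R : Rectangle d} {Δ} → 0ℝ ≤ᵣ Δ → (∀ i → len (R i) ≤ᵣ Δ) → width R ≤ᵣ Δ
    width≤ Δ≥0 f = max≤v⁺ Δ≥0 (Allₚ.tabulate⁺ f)

    ∈⟦⟧⁺ : ∀ {n} {Q : Pred (Fin n) 0ℓ} (Q? : Decidable Q) {j} → Q j → j Subset.∈ ⟦ Q? ⟧
    ∈⟦⟧⁺ Q? {j} q = Vecₚ.lookup⇒[]= j _ (trans (Vecₚ.lookup∘tabulate _ j) (dec-true (Q? j) q))

    ∈⟦⟧⁻ : ∀ {n} {Q : Pred (Fin n) 0ℓ} (Q? : Decidable Q) {j} → j Subset.∈ ⟦ Q? ⟧ → Q j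
    ∈⟦⟧⁻ Q? {j} m with Q? j | trans (sym (Vecₚ.lookup∘tabulate (λ j → does (Q? j)) j)) (Vecₚ.[]=⇒lookup m)
    ... | yes q | _ = q
    ... | no _ | ()

    module _ {n d : ℕ} (X : Dataset n d) {Δ : ℝ} (Δ≥0 : 0ℝ ≤ᵣ Δ) where

      ∈∩⁻ : ∀ {R j} → j Subset.∈ (X ∩ R) → point X j ∈R R
      ∈∩⁻ {R} = ∈⟦⟧⁻ (λ j → point X j ∈R? R)

      cluster-diameter : ∀ (R : Rectangle d) → (∀ i → len (R i) ≤ᵣ Δ) → diameter X (X ∩ R) ≤ᵣ Δ
      cluster-diameter R lens = max≤v⁺ Δ≥0 (Allₚ.cartesianProductWith⁺ (setoid (Fin n)) (setoid (Fin n)) (λ i j → dist (point X i) (point X j)) is is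
          λ {i} {j} i∈ j∈ → dist≤ Δ≥0 (λ k → within (R k) (inside i∈ k) (inside j∈ k) (lens k)) (λ k → within (R k) (inside j∈ k) (inside i∈ k) (lens k)))
        where
        is = filter (_∈? (X ∩ R)) (allFin n)
        inside : ∀ {i} → i ∈ is → ∀ k → point X i k ∈I R k
        inside i∈ = ∈∩⁻ {R} (proj₂ (∈ₚ.∈-filter⁻ (_∈? (X ∩ R)) {xs = allFin n} i∈))
        within : ∀ I {x y} → x ∈I I → y ∈I I → len I ≤ᵣ Δ → x ⊖ y ≤ᵣ Δ
        within I p q le = ≤ᵣ-trans (+ᵣ-mono (proj₂ (∈-bounds {I = I} p)) (neg-mono (proj₁ (∈-bounds {I = I} q)))) le

      cluster-count : ∀ i (ℛ : List (Rectangle d)) → length (filter (i ∈?_) (clusters X ℛ)) ≤ length (filter (point X i ∈R?_) ℛ)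
      cluster-count i = filter-map-≤ (X ∩_) (i ∈?_) (point X i ∈R?_) (λ {R} → ∈∩⁻ {R})

      neighborhood-cover : ∀ {β s} (ℛ : List (Rectangle d)) → All (λ R → ∀ i → len (R i) ≤ᵣ Δ) ℛ →
        (∀ i → Any (λ R → ∀ {z} → B∞ (point X i) (Δ /ᵣ β) z → z ∈R R) ℛ) →
        (∀ i → fromℕ (length (filter (point X i ∈R?_) ℛ)) ≤ᵣ s) → IsNeighborhoodCover X β s Δ (clusters X ℛ)
      neighborhood-cover {β} ℛ lens covered sparse = record
        { diameter≤Δ = Allₚ.map⁺ (All.map (λ {R} → cluster-diameter R) lens)
        ; covering = λ i → Anyₚ.map⁺ (Any.map (λ {R} f {j} j∈ → ∈⟦⟧⁺ (λ j → point X j ∈R? R) (f (∈⟦⟧⁻ (λ j → dist (point X i) (point X j) ≤ᵣ? Δ /ᵣ β) j∈))) (covered i))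
        ; sparsity = λ i → ≤ᵣ-trans (fromℕ-mono {length (filter (i ∈?_) (clusters X ℛ))} {length (filter (point X i ∈R?_) ℛ)} (cluster-count i ℛ)) (sparse i) }

  -- Positions are plain numbers here, for the index arithmetic of the output arrays.
  At : {A : Set} → List A → ℕ → A → Set
  At xs i x = Σ[ j ∈ Fin (length xs) ] toℕ j ≡ i × lookup xs j ≡ x

  At-suc : ∀ {A : Set} {y : A} {xs i x} → At xs i x → At (y ∷ xs) (suc i) x
  At-suc (j , eq , eq′) = Fin.suc j , cong suc eq , eq′

  parity : ∀ e → (∃[ i ] e ≡ 2 * i) ⊎ (∃[ i ] e ≡ suc (2 * i))
  parity zero = inj₁ (0 , refl)
  parity (suc e) with parity e
  ... | inj₁ (i , refl) = inj₂ (i , refl)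
  ... | inj₂ (i , refl) = inj₁ (suc i , sym (ℕ.*-suc 2 i))

  AllPairs-with : {X : Set} {G : X → Set} {R S : X → X → Set} → (∀ {x y} → G x → G y → R x y → S x y) →
    ∀ {xs} → All G xs → AllPairs R xs → AllPairs S xs
  AllPairs-with f [] [] = []
  AllPairs-with f (g ∷ gs) (r ∷ rs) = All.zipWith (λ (h , r) → f g h r) (gs , r) ∷ AllPairs-with f gs rs

  filter-exclusive : {X : Set} {P : Pred X 0ℓ} (P? : Decidable P) → ∀ {xs} → AllPairs (λ x y → P x → ¬ P y) xs → length (filter P? xs) ≤ 1
  filter-exclusive P? [] = z≤n
  filter-exclusive P? {x ∷ xs} (ex ∷ a) with P? x
  ... | yes p = s≤s (ℕ.≤-reflexive (cong length (filter-none P? (All.map (λ f → f p) ex))))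
  ... | no _ = filter-exclusive P? a

  filter-groups : {X : Set} {P : Pred X 0ℓ} (P? : Decidable P) → ∀ {xss} → All (AllPairs (λ x y → P x → ¬ P y)) xss → length (filter P? (concat xss)) ≤ length xss
  filter-groups P? [] = z≤n
  filter-groups P? {xs ∷ xss} (a ∷ as) = ℕ.≤-trans (ℕ.≤-reflexive (trans (cong length (filter-++ P? xs (concat xss))) (length-++ (filter P? xs))))
    (ℕ.+-mono-≤ (filter-exclusive P? a) (filter-groups P? as))

  -- The rectangles: width, covering, disjointness and their place in memory.

  module Rectangles (𝓡 : RealNumbers) where
    open Basics 𝓡
    open ℓ∞ 𝓡 hiding (⟦_⟧)
    open RealRAM 𝓡
    open Clustering 𝓡
    open Cuts 𝓡
    open Geometry 𝓡
    open Parameters 𝓡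

    module Boxes (w : ℝ) (w≥0 : 0ℝ ≤ᵣ w) {p d : ℕ} {θ : List Fraction}
        (thresholds : Thresholds p (2 * d) θ) (r : ℝ) (r≥0 : 0ℝ ≤ᵣ r) (r-spec : r +ᵣ r ≡ w)
        {Δ : ℝ} (Δ-spec : fromℕ (2 * length θ) *ᵣ w +ᵣ w ≡ Δ) where
      private module A = Main w w≥0 {p} {d} {θ} thresholds r
      open A using (Cover; mx; lo; hi; Doubled; Tight; Sep; sides; flatten)

      rect : List Pt → Rectangle d
      rect C i = closed (lo C (toℕ i)) (hi C (toℕ i))

      record Good (C : List Pt) : Set where
        field
          pos     : 0 < length C
          doubled : All Doubled C
          tight   : Tight C

      some : ∀ {C} {Q : Pt → Set} → 0 < length C → All Q C → ∃[ x ] Q x × x ∈ C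
      some {x ∷ C} _ (q ∷ _) = x , q , here refl

      odd<  : ∀ {i} → i < d → suc (2 * i) < 2 * d
      odd< {i} lt = ℕ.≤-trans (ℕ.≤-reflexive (sym (ℕ.*-suc 2 i))) (ℕ.*-monoʳ-≤ 2 lt)

      module _ {C : List Pt} (G : Good C) where
        private module G = Good G

        lo≤hi : ∀ {i} → i < d → lo C i ≤ᵣ hi C i
        lo≤hi {i} lt with some G.pos G.doubled
        ... | x , (_ , dbl) , x∈ = ≤ᵣ-trans (neg-mono (≤ᵣ-trans (All.lookup (A.below-mx G.pos (2 * i)) x∈) (t≤t+r (mx C (2 * i)))))
            (≤ᵣ-trans (≤ᵣ-reflexive (sym (dbl i (odd< lt)))) (≤ᵣ-trans (All.lookup (A.below-mx G.pos (suc (2 * i))) x∈) (t≤t+r (mx C (suc (2 * i))))))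
          where
          t≤t+r : ∀ t → t ≤ᵣ t +ᵣ r
          t≤t+r t = subst (_≤ᵣ t +ᵣ r) (+ᵣ-identityʳ t) (+ᵣ-mono ≤ᵣ-refl r≥0)

        -- `mx-least` is used twice, once for each of the two points in `Tight`.
        diameter-C : ∀ {i} → i < d → mx C (suc (2 * i)) +ᵣ mx C (2 * i) ≤ᵣ A.W
        diameter-C {i} lt = subst (_≤ᵣ A.W) (+ᵣ-comm _ _) (toSum (A.mx-least G.pos (2 * i) (All.tabulate λ {y} y∈ → toDiff (subst (_≤ᵣ A.W) (+ᵣ-comm _ _)
            (toSum (A.mx-least G.pos (suc (2 * i)) (All.map (λ a → toDiff (All.lookup a y∈)) (G.tight i (odd< lt)))))))))
          where
          toDiff : ∀ {a b c} → a +ᵣ b ≤ᵣ c → a ≤ᵣ c ⊖ b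
          toDiff {a} {b} {c} p = +ᵣ-cancelʳ b (subst (a +ᵣ b ≤ᵣ_) (sym (sub-add c b)) p)
          toSum : ∀ {a b c} → a ≤ᵣ c ⊖ b → a +ᵣ b ≤ᵣ c
          toSum {a} {b} {c} p = subst (a +ᵣ b ≤ᵣ_) (sub-add c b) (+ᵣ-monoˡ-≤ b p)

        -- The core spans at most 2 k w, and the enlargement by `r` at both ends adds w.
        rect-len : ∀ i → len (rect C i) ≤ᵣ Δ
        rect-len i = subst (_≤ᵣ Δ) (sym (cong₂ _⊖_ (proj₂ ends) (proj₁ ends))) (≤ᵣ-trans (≤ᵣ-reflexive (trans (cong (hi C (toℕ i) +ᵣ_) (-ᵣ-involutive _)) (arith (mx C (suc (2 * toℕ i))) (mx C (2 * toℕ i)) r)))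
            (≤ᵣ-trans (+ᵣ-mono (diameter-C (toℕ<n i)) (≤ᵣ-reflexive r-spec)) (≤ᵣ-reflexive Δ-spec)))
          where
          ends = closed-ends (lo≤hi (toℕ<n i))
          arith : ∀ a b c → (a +ᵣ c) +ᵣ (b +ᵣ c) ≡ (a +ᵣ b) +ᵣ (c +ᵣ c)
          arith = RealSolver.solve 3 (λ a b c → (a :+ c) :+ (b :+ c) := (a :+ b) :+ (c :+ c)) refl
            where open RealSolver using (_:+_; _:=_)

        covers : ∀ {x : Point d} {q : Pt} → (∀ j → coord (2 * toℕ j) q ≡ -ᵣ x j × coord (suc (2 * toℕ j)) q ≡ x j) → q ∈ C →
          ∀ {z δ} → δ ≤ᵣ r → B∞ x δ z → z ∈R rect C
        covers {x} {q} coords q∈ {z} {δ} δ≤r ball j = closed-∈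
            (≤ᵣ-trans (neg-mono (+ᵣ-mono (≤ᵣ-trans (≤ᵣ-reflexive (sym (proj₁ (coords j)))) (All.lookup (A.below-mx G.pos (2 * toℕ j)) q∈)) ≤ᵣ-refl))
              (≤ᵣ-trans (≤ᵣ-reflexive (negate (x j) r)) (x-y≤z (subst (x j ≤ᵣ_) (+ᵣ-comm _ _) (≤ᵣ-trans (dist-upper x z j) (+ᵣ-mono ≤ᵣ-refl near))))))
            (≤ᵣ-trans (dist-lower x z j) (+ᵣ-mono (≤ᵣ-trans (≤ᵣ-reflexive (sym (proj₂ (coords j)))) (All.lookup (A.below-mx G.pos (suc (2 * toℕ j))) q∈)) near))
          where
          near : dist x z ≤ᵣ r
          near = ≤ᵣ-trans ball δ≤r
          negate : ∀ a b → -ᵣ (-ᵣ a +ᵣ b) ≡ a ⊖ b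
          negate a b = trans (sym (-ᵣ-+-comm (-ᵣ a) b)) (cong (_+ᵣ -ᵣ b) (-ᵣ-involutive a))

        rect-bounds : ∀ {z} → z ∈R rect C → ∀ i → -ᵣ z i ≤ᵣ mx C (2 * toℕ i) +ᵣ r × z i ≤ᵣ mx C (suc (2 * toℕ i)) +ᵣ r
        rect-bounds {z} z∈ i = subst (-ᵣ z i ≤ᵣ_) (-ᵣ-involutive _) (neg-mono (subst (_≤ᵣ z i) (proj₁ ends) (proj₁ bounds))) , subst (z i ≤ᵣ_) (proj₂ ends) (proj₂ bounds)
          where
          ends = closed-ends (lo≤hi (toℕ<n i))
          bounds = ∈-bounds {I = rect C i} (z∈ i)

      -- Here u is a coordinate, up to the sign, of a common point of the boxes of C and D.
      clash : ∀ {t a b u} → a ≤ᵣ t → ¬ (-ᵣ (t +ᵣ w) ≤ᵣ b) → u ≤ᵣ a +ᵣ r → ¬ (-ᵣ u ≤ᵣ b +ᵣ r)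
      clash {t} {a} {b} {u} a≤t above u≤ -u≤ = above (subst₂ _≤ᵣ_ (+ᵣ-identityˡ _) (trans (cong (_⊖ (t +ᵣ w)) (+ᵣ-comm b (t +ᵣ w))) (add-sub (t +ᵣ w) b)) (+ᵣ-monoˡ-≤ (-ᵣ (t +ᵣ w)) positive))
        where
        arith : ∀ a b r → (a +ᵣ r) +ᵣ (b +ᵣ r) ≡ b +ᵣ (a +ᵣ (r +ᵣ r))
        arith = RealSolver.solve 3 (λ a b r → (a :+ r) :+ (b :+ r) := b :+ (a :+ (r :+ r))) refl
          where open RealSolver using (_:+_; _:=_)
        positive : 0ℝ ≤ᵣ b +ᵣ (t +ᵣ w)
        positive = ≤ᵣ-trans (subst₂ _≤ᵣ_ (-ᵣ-inverseʳ u) (trans (arith a b r) (cong (λ x → b +ᵣ (a +ᵣ x)) r-spec)) (+ᵣ-mono u≤ -u≤)) (+ᵣ-mono ≤ᵣ-refl (+ᵣ-mono a≤t ≤ᵣ-refl))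

      -- Beyond the last coordinate all points have the default value 0, so that no separation can
      -- occur there.
      coord-beyond : ∀ e (x : Pt) → length x ≤ e → coord e x ≡ 0ℝ
      coord-beyond zero [] _ = refl
      coord-beyond (suc e) [] _ = refl
      coord-beyond (suc e) (_ ∷ x) (s≤s le) = coord-beyond e x le

      module _ {C D : List Pt} (G : Good C) (H : Good D) {z : Point d} (z∈C : z ∈R rect C) (z∈D : z ∈R rect D) where
        private
          module G = Good G
          module H = Good H

          opposite : ∀ {e e′ t} → All (λ y → coord e′ y ≡ -ᵣ coord e y) D → A.High e t D → ¬ (-ᵣ (t +ᵣ w) ≤ᵣ mx D e′)
          opposite {e} {e′} {t} eqs high = A.mx-below H.pos e′ (All.zipWith (λ {y} (eq , h) le → h (subst₂ _≤ᵣ_ (-ᵣ-involutive _) (-ᵣ-involutive _) (neg-mono (subst (-ᵣ (t +ᵣ w) ≤ᵣ_) eq le)))) (eqs , high))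

          beyond : ∀ {e t} → 2 * d ≤ e → A.Low e t C → ¬ A.High e t D
          beyond {e} {t} le low high with some {C} {λ x → Doubled x × coord e x ≤ᵣ t} G.pos (All.zip (G.doubled , low)) | some {D} {λ y → Doubled y × ¬ (coord e y ≤ᵣ t +ᵣ w)} H.pos (All.zip (H.doubled , high))
          ... | x , ((eq , _) , l) , _ | y , ((eq′ , _) , h) , _ = h (≤ᵣ-trans (≤ᵣ-reflexive (trans (coord-beyond e y (ℕ.≤-trans (ℕ.≤-reflexive eq′) le)) (sym (coord-beyond e x (ℕ.≤-trans (ℕ.≤-reflexive eq) le)))))
            (≤ᵣ-trans l (t≤t+w w w≥0 t)))

        -- A common point would have signed coordinate u ≤ t + r because of `C`, and u > t + w - r
        -- because of `D`, although w = 2 r. The parity of `e` tells which sign of which original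
        -- coordinate is meant.
        half-apart : ∀ {e t} → A.Low e t C → ¬ A.High e t D
        half-apart {e} {t} low high with parity e
        ... | inj₁ (i , refl) with i ℕ.<? d
        ...   | no n = beyond (ℕ.*-monoʳ-≤ 2 (ℕ.≮⇒≥ n)) low high
        ...   | yes lt = clash {t} (A.mx-least G.pos (2 * i) low) (opposite {2 * i} {suc (2 * i)} (All.map (λ dbl → proj₂ dbl i (odd< lt)) H.doubled) high)
                  (subst (λ i → -ᵣ z j ≤ᵣ mx C (2 * i) +ᵣ r) eq (proj₁ (rect-bounds G z∈C j)))
                  (subst₂ (λ i x → x ≤ᵣ mx D (suc (2 * i)) +ᵣ r) eq (sym (-ᵣ-involutive _)) (proj₂ (rect-bounds H z∈D j)))
          where
          j = Fin.fromℕ< lt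
          eq = toℕ-fromℕ< lt
        half-apart {e} {t} low high | inj₂ (i , refl) with i ℕ.<? d
        ...   | no n = beyond (ℕ.≤-trans (ℕ.*-monoʳ-≤ 2 (ℕ.≮⇒≥ n)) (ℕ.n≤1+n _)) low high
        ...   | yes lt = clash {t} (A.mx-least G.pos (suc (2 * i)) low) (opposite {suc (2 * i)} {2 * i} (All.map (λ dbl → trans (sym (-ᵣ-involutive _)) (cong -ᵣ_ (sym (proj₂ dbl i (odd< lt))))) H.doubled) high)
                  (subst (λ i → z j ≤ᵣ mx C (suc (2 * i)) +ᵣ r) eq (proj₂ (rect-bounds G z∈C j)))
                  (subst (λ i → -ᵣ z j ≤ᵣ mx D (2 * i) +ᵣ r) eq (proj₁ (rect-bounds H z∈D j)))
          where
          j = Fin.fromℕ< lt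
          eq = toℕ-fromℕ< lt

      disjoint : ∀ {C D z} → Good C → Good D → Sep C D → z ∈R rect C → ¬ (z ∈R rect D)
      disjoint G H (e , t , inj₁ (low , high)) z∈C z∈D = half-apart G H z∈C z∈D {e} {t} low high
      disjoint G H (e , t , inj₂ (low , high)) z∈C z∈D = half-apart H G z∈D z∈C {e} {t} low high

      At-sides : ∀ C n fl → (∀ i → i < n → At (sides C n fl) (2 * i) (lo C i) × At (sides C n fl) (suc (2 * i)) (hi C i)) ×
        (∀ {i x} → At fl i x → At (sides C n fl) (2 * n + i) x)
      At-sides C zero fl = (λ _ ()) , λ a → a
      At-sides C (suc n) fl = ends , λ {i} {x} a → subst (λ j → At (sides C (suc n) fl) j x) (arith n i) (proj₂ R (At-suc (At-suc a)))
        where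
        R = At-sides C n (lo C n ∷ hi C n ∷ fl)
        arith : ∀ n i → 2 * n + suc (suc i) ≡ 2 * suc n + i
        arith = solve-∀
        ends : ∀ i → i < suc n → At (sides C (suc n) fl) (2 * i) (lo C i) × At (sides C (suc n) fl) (suc (2 * i)) (hi C i)
        ends i (s≤s le) with ℕ.m≤n⇒m<n∨m≡n le
        ... | inj₁ lt = proj₁ R i lt
        ... | inj₂ refl = subst (λ j → At (sides C (suc n) fl) j (lo C n)) (ℕ.+-identityʳ _) (proj₂ R (Fin.zero , refl , refl)) ,
          subst (λ j → At (sides C (suc n) fl) j (hi C n)) (ℕ.+-comm (2 * n) 1) (proj₂ R (Fin.suc Fin.zero , refl , refl))

      length-sides : ∀ C n fl → length (sides C n fl) ≡ 2 * n + length fl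
      length-sides C zero fl = refl
      length-sides C (suc n) fl = trans (length-sides C n _) (arith n (length fl))
        where
        arith : ∀ n l → 2 * n + suc (suc l) ≡ 2 * suc n + l
        arith = solve-∀

      length-flatten : ∀ Cs → length (flatten Cs) ≡ length Cs * (2 * d)
      length-flatten [] = refl
      length-flatten (C ∷ Cs) = trans (length-sides C d _) (cong (2 * d +_) (length-flatten Cs))

      At-flatten : ∀ {Cs} → All Good Cs → (t : Fin (length (map rect Cs))) → ∃[ C ] Good C × lookup (map rect Cs) t ≡ rect C ×
        (∀ i → i < d → At (flatten Cs) (toℕ t * (2 * d) + 2 * i) (lo C i) × At (flatten Cs) (toℕ t * (2 * d) + suc (2 * i)) (hi C i))
      At-flatten {C ∷ Cs} (g ∷ gs) Fin.zero = C , g , refl , proj₁ (At-sides C d (flatten Cs))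
      At-flatten {C ∷ Cs} (g ∷ gs) (Fin.suc t) with At-flatten gs t
      ... | D , h , eq , f = D , h , eq , λ i lt → shift (2 * i) (proj₁ (f i lt)) , shift (suc (2 * i)) (proj₂ (f i lt))
        where
        shift : ∀ k {x} → At (flatten Cs) (toℕ t * (2 * d) + k) x → At (sides C d (flatten Cs)) (2 * d + toℕ t * (2 * d) + k) x
        shift k {x} a = subst (λ j → At (sides C d (flatten Cs)) j x) (sym (ℕ.+-assoc (2 * d) _ k)) (proj₂ (At-sides C d (flatten Cs)) a)

      module Covering {n : ℕ} (𝒳 : Dataset n d) {X : List Pt} (X↭ : X ↭ map double (toList λ i → toList (point 𝒳 i)))
          {X-doubled : All Doubled X} {L : ℕ} {X≤ : length X ≤ 2 ℕ.^ L} {ℓ : ℕ} {root : length X ≤ ℓ ℕ.^ suc p} {out : List ℝ × List ℝ} {ns : List ℝ}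
          (cover : Cover X X-doubled {L} X≤ ℓ root out ns) where
        private module C = Cover cover

        cores : List (List Pt)
        cores = concat C.groups

        good : All Good cores
        good = All.zipWith (λ (a , b , c) → record { pos = a ; doubled = b ; tight = c })
          (C.nonempty , All.zip (Allₚ.concat⁻ (Permₚ.All-resp-↭ (↭-sym C.perm) X-doubled) , C.tight))

        ℛ : List (Rectangle d)
        ℛ = map rect cores

        lens : All (λ R → ∀ i → len (R i) ≤ᵣ Δ) ℛ
        lens = Allₚ.map⁺ (All.map (λ G → rect-len G) good)

        coord-tabulate : ∀ {m} (x : Point m) j → coord (toℕ j) (tabulate x) ≡ x j
        coord-tabulate x Fin.zero = refl
        coord-tabulate x (Fin.suc j) = coord-tabulate (λ i → x (Fin.suc i)) j

        coords : ∀ (x : Point d) j → coord (2 * toℕ j) (double (tabulate x)) ≡ -ᵣ x j × coord (suc (2 * toℕ j)) (double (tabulate x)) ≡ x j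
        coords x j with coord-double (tabulate x) (toℕ j) (subst (toℕ j <_) (sym (length-tabulate x)) (toℕ<n j))
        ... | eq , eq′ = trans eq (cong -ᵣ_ (coord-tabulate x j)) , trans eq′ (coord-tabulate x j)

        -- The cores of all rounds together are a permutation of the data, so every point lies in
        -- some core.
        covered : ∀ {δ} → δ ≤ᵣ r → ∀ i → Any (λ R → ∀ {z} → B∞ (point 𝒳 i) δ z → z ∈R R) ℛ
        covered δ≤r i with ∈ₚ.∈-concat⁻′ cores (Permₚ.∈-resp-↭ (↭-sym (↭-trans C.perm X↭)) (∈ₚ.∈-map⁺ double (∈ₚ.∈-tabulate⁺ {f = λ i → toList (point 𝒳 i)} i)))
        ... | C , q∈ , C∈ = lose (∈ₚ.∈-map⁺ rect C∈) λ {z} → covers (All.lookup good C∈) (coords (point 𝒳 i)) q∈ δ≤r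

        -- Each round contributes at most one rectangle around `z`, as the boxes of a round are
        -- disjoint.
        sparse : ∀ z → length (filter (z ∈R?_) ℛ) ≤ length C.groups
        sparse z = ℕ.≤-trans (filter-map-≤ rect (z ∈R?_) (λ C → z ∈R? rect C) (λ m → m) cores)
          (filter-groups (λ C → z ∈R? rect C) (All.zipWith (λ (gs , sep) → AllPairs-with (λ G H s → disjoint G H s) gs sep) (Allₚ.concat⁻ good , C.sep)))

        markers≡ : length ℛ ≡ length (proj₁ out)
        markers≡ = trans (length-map rect cores) (sym C.markers)

        length-X : length X ≡ n
        length-X = trans (Permₚ.↭-length X↭) (trans (length-map double (toList λ i → toList (point 𝒳 i))) (length-tabulate λ i → toList (point 𝒳 i)))

        markers≤ : length (proj₁ out) ≤ n
        markers≤ = ℕ.≤-trans (ℕ.≤-reflexive C.markers) (ℕ.≤-trans (length≤concat cores C.nonempty) (ℕ.≤-reflexive (trans (Permₚ.↭-length C.perm) length-X)))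

        ends≡ : length (proj₂ out) ≡ length (proj₁ out) * (2 * d)
        ends≡ = trans (cong length C.flat) (trans (length-flatten cores) (cong (_* (2 * d)) (sym C.markers)))

        module _ {τ : Store} (count : nat τ 0 ≡ length (proj₁ out)) (bases : nat τ 1 ≡ nat τ 2)
            (value : ∀ i → real τ (nat τ 2 + toℕ i) ≡ lookup (proj₂ out) i × nat τ (nat τ 2 + toℕ i) ≡ 1) where
          private
            stored : ∀ {k x} → At (flatten cores) k x → real τ (nat τ 2 + k) ≡ x × nat τ (nat τ 2 + k) ≡ 1
            stored {k} {x} a with subst (λ fl → At fl k x) (sym C.flat) a
            ... | j , refl , refl = value j

            side : ∀ t i → (real τ (nat τ 2 + 2 * (toℕ t * d + toℕ i)) ≡ lower (lookup ℛ t i) × nat τ (nat τ 2 + 2 * (toℕ t * d + toℕ i)) ≡ bit (lowerClosed (lookup ℛ t i))) ×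
              (real τ (nat τ 2 + suc (2 * (toℕ t * d + toℕ i))) ≡ upper (lookup ℛ t i) × nat τ (nat τ 2 + suc (2 * (toℕ t * d + toℕ i))) ≡ bit (upperClosed (lookup ℛ t i)))
            side t i with At-flatten good t
            ... | C , G , eq , ats = (trans (proj₁ lo-stored) (trans (sym (proj₁ ends)) (cong (λ R → lower (R i)) (sym eq))) , trans (proj₂ lo-stored) (trans (cong bit (sym (proj₁ flags))) (cong (λ R → bit (lowerClosed (R i))) (sym eq)))) ,
                (trans (proj₁ hi-stored) (trans (sym (proj₂ ends)) (cong (λ R → upper (R i)) (sym eq))) , trans (proj₂ hi-stored) (trans (cong bit (sym (proj₂ flags))) (cong (λ R → bit (upperClosed (R i))) (sym eq))))
              where
              ends = closed-ends (lo≤hi G (toℕ<n i))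
              flags = closed-flags (lo C (toℕ i)) (hi C (toℕ i))
              arith : ∀ t d i → t * (2 * d) + 2 * i ≡ 2 * (t * d + i)
              arith = solve-∀
              lo-stored = stored (subst (λ k → At (flatten cores) k (lo C (toℕ i))) (arith (toℕ t) d (toℕ i)) (proj₁ (ats (toℕ i) (toℕ<n i))))
              hi-stored = stored (subst (λ k → At (flatten cores) k (hi C (toℕ i))) (trans (ℕ.+-suc (toℕ t * (2 * d)) (2 * toℕ i)) (cong suc (arith (toℕ t) d (toℕ i)))) (proj₂ (ats (toℕ i) (toℕ<n i))))

          outputs : Outputs τ ℛ
          outputs = record
            { count = trans count (sym markers≡)
            ; lowers = λ t i → trans (cong (λ b → real τ (b + 2 * (toℕ t * d + toℕ i))) bases) (proj₁ (proj₁ (side t i)))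
            ; uppers = λ t i → trans (cong (λ b → real τ (b + suc (2 * (toℕ t * d + toℕ i)))) bases) (proj₁ (proj₂ (side t i)))
            ; lowerCs = λ t i → proj₂ (proj₁ (side t i))
            ; upperCs = λ t i → proj₂ (proj₂ (side t i)) }

  -- The outcome for one instance, with bounds in natural numbers.

  module Solving (𝓡 : RealNumbers) where
    open Basics 𝓡
    open ℓ∞ 𝓡 hiding (⟦_⟧)
    open Parameters 𝓡
    open RealRAM 𝓡
    open Clustering 𝓡
    open Algorithms 𝓡
    open Rectangles 𝓡

    rows : ∀ {n d} → Dataset n d → List (List ℝ)
    rows 𝒳 = toList λ i → toList (point 𝒳 i)

    -- The root and the logarithm of n enter only through their integral parts `l` and `b`; real
    -- powers are left to the analysis.
    record Solved {n d : ℕ} (𝒳 : Dataset n d) (ρ Δ : ℝ) (env : Env (list num ∷ list num ∷ list num ∷ num ∷ num ∷ [])) : Set where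
      q : ℕ
      q = reach ρ (2 + n) 0
      p : ℕ
      p = ℕ.pred q
      field
        ℛ       : List (Rectangle d)
        l b     : ℕ
        l>0     : 0 < l
        l≤      : l ℕ.^ q ≤ n
        b≤      : 2 ℕ.^ b ≤ n
        q≥3     : 3 ≤ q
        pρ≤2    : fromℕ p *ᵣ ρ ≤ᵣ fromℕ 2
        lens    : All (λ R → ∀ i → len (R i) ≤ᵣ Δ) ℛ
        -- The factor 2 (2 k + 1) is the ratio of Δ to `r`.
        covered : ∀ {δ} → δ *ᵣ fromℕ (2 * (2 * ((2 + K d) * p) + 1)) ≤ᵣ Δ → ∀ i → Any (λ R → ∀ {z} → B∞ (point 𝒳 i) δ z → z ∈R R) ℛ
        sparse  : ∀ z → length (filter (z ∈R?_) ℛ) ≤ 2 * suc l * suc b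
        cost    : iters mainE env ≤ 245 * (n * suc l * (d * d) * ((2 + b) * (2 + b + q)))
        markers≤ : length (proj₁ (⟦ mainE ⟧ env)) ≤ n
        ends≡   : length (proj₂ (⟦ mainE ⟧ env)) ≡ length (proj₁ (⟦ mainE ⟧ env)) * (2 * d)
        outputs : ∀ {τ} → nat τ 0 ≡ length (proj₁ (⟦ mainE ⟧ env)) → nat τ 1 ≡ nat τ 2 →
          (∀ i → real τ (nat τ 2 + toℕ i) ≡ lookup (proj₂ (⟦ mainE ⟧ env)) i × nat τ (nat τ 2 + toℕ i) ≡ 1) → Outputs τ ℛ

    solve : ∀ {n d} (𝒳 : Dataset n d) {ρ Δ} ds ns cs → length ns ≡ n → length ds ≡ d → cs ≡ concat (rows 𝒳) → 0 < n → 0 < d →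
      0ℝ <ᵣ ρ → ρ <ᵣ 1ℝ → 0ℝ <ᵣ Δ → Solved 𝒳 ρ Δ (ds ∷ ns ∷ cs ∷ ρ ∷ Δ ∷ [])
    solve 𝒳 {ρ} {Δ} ds ns _ refl refl refl n>0 d>0 0<ρ ρ<1 0<Δ = record
      { ℛ = R.ℛ ; l = l ; b = b ; l>0 = l>0 ; l≤ = subst (λ q → l ℕ.^ q ≤ A.n) A.suc-p l≤ ; b≤ = b≤ ; q≥3 = A.q≥3 ; pρ≤2 = A.pρ≤2
      ; lens = R.lens
      ; covered = λ {δ} le → R.covered (*-cancel-pos (0<fromℕ (suc (4 * A.k))) (subst₂ (λ m x → δ *ᵣ fromℕ m ≤ᵣ x) even (sym (trans (cong (λ m → A.r *ᵣ fromℕ m) (sym even)) radius)) le))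
      ; sparse = λ z → ℕ.≤-trans (R.sparse z) (Main.Cover.short C (suc b) (ℕ.≤-<-trans (ℕ.≤-reflexive A.length-X) <b))
      ; cost = ℕ.≤-trans (A.iters-main (subst (λ m → iters roundsE ((A.param , A.r , ns , A.X) ∷ []) ≤ A.n + 2 * suc l * m * A.roundRate (suc b)) A.length-X (Main.Cover.cost C)))
          (Budget.total≤ A.n A.d A.q A.p (suc l) b (length A.θ) n>0 d>0 A.suc-p (s≤s z≤n) A.length-θ)
      ; markers≤ = R.markers≤ ; ends≡ = R.ends≡ ; outputs = R.outputs }
      where
      module A = Algorithm ds ns (rows 𝒳) ρ Δ d>0 n>0 (length-tabulate λ i → toList (point 𝒳 i)) (Allₚ.tabulate⁺ λ i → length-tabulate (point 𝒳 i)) 0<ρ ρ<1 0<Δ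
      root = integer-root A.p A.n n>0
      l = proj₁ root
      l>0 = proj₁ (proj₂ root)
      l≤ = proj₁ (proj₂ (proj₂ root))
      log = integer-log A.n n>0
      b = proj₁ log
      b≤ = proj₁ (proj₂ log)
      <b = proj₂ (proj₂ log)
      -- Root and logarithm were rounded down, but the rounds need upper bounds, hence the two
      -- successors.
      C = A.covering {suc b} (ℕ.<⇒≤ <b) (suc l) (ℕ.<⇒≤ (proj₂ (proj₂ (proj₂ root)))) (s≤s z≤n)
      Δ-spec : fromℕ (2 * length A.θ) *ᵣ A.w +ᵣ A.w ≡ Δ
      Δ-spec = trans (cong (λ k → fromℕ (2 * k) *ᵣ A.w +ᵣ A.w) A.length-θ) (trans (arith (fromℕ (2 * A.k)) A.w (fromℕ 1) fromℕ-1)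
          (trans (cong (A.w *ᵣ_) (sym (fromℕ-+ (2 * A.k) 1))) A.w-spec))
        where
        arith : ∀ a w o → o ≡ 1ℝ → a *ᵣ w +ᵣ w ≡ w *ᵣ (a +ᵣ o)
        arith a w _ refl = trans (cong₂ _+ᵣ_ (*ᵣ-comm a w) (sym (*ᵣ-identityʳ w))) (sym (*ᵣ-distribˡ w a 1ℝ))
      module B = Boxes A.w (proj₁ A.w>0) {A.p} {A.d} {A.θ} (Powers.thresholds A.p A.p>0 A.d d>0) A.r (proj₁ A.r>0) A.r-spec Δ-spec
      module R = B.Covering 𝒳 A.X↭ C
      even : 2 * (2 * A.k + 1) ≡ suc (suc (4 * A.k))
      even = arith A.k
        where
        arith : ∀ k → 2 * (2 * k + 1) ≡ suc (suc (4 * k))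
        arith = solve-∀
      radius : A.r *ᵣ fromℕ (2 * (2 * A.k + 1)) ≡ Δ
      radius = trans (cong (A.r *ᵣ_) (fromℕ-* 2 (2 * A.k + 1))) (trans (sym (*ᵣ-assoc A.r _ _)) (trans (cong (_*ᵣ fromℕ (2 * A.k + 1)) (/-* (0<fromℕ 1))) A.w-spec))

  -- The bounds on time, sparsity and β.

  module Bounds (𝓡 : RealNumbers) where
    open Basics 𝓡
    open RealNumbers 𝓡 using (pow; lg)
    open ℓ∞ 𝓡 hiding (⟦_⟧)
    open RealRAM 𝓡
    open Parameters 𝓡
    open Analysis 𝓡
    open Geometry 𝓡
    open Solving 𝓡
    open Run 𝓡
    open Finish 𝓡

    nth : List ℝ → ℕ → ℝ
    nth L a = fromMaybe 0ℝ (List.head (drop a L))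

    take-suc : ∀ c L xs → c < length L → take (suc c) L ++ xs ≡ take c L ++ (nth L c ∷ xs)
    take-suc zero (x ∷ L) xs _ = refl
    take-suc (suc c) (x ∷ L) xs (s≤s lt) = cong (x ∷_) (take-suc c L xs lt)

    range-take : ∀ {f} L → (∀ a → f (2 + a) ≡ nth L a) → ∀ c xs → c ≤ length L → range f c xs ≡ take c L ++ xs
    range-take L f≡ zero xs _ = refl
    range-take L f≡ (suc c) xs lt = trans (range-take L f≡ c _ (ℕ.<⇒≤ lt)) (trans (cong (λ x → take c L ++ (x ∷ xs)) (f≡ c)) (sym (take-suc c L xs lt)))

    range-all : ∀ {f} L {m} → (∀ a → f (2 + a) ≡ nth L a) → length L ≡ m → range f m [] ≡ L
    range-all L f≡ refl = trans (range-take L f≡ (length L) [] ℕ.≤-refl) (trans (++-identityʳ _) (take-length L))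
      where
      take-length : ∀ (L : List ℝ) → take (length L) L ≡ L
      take-length [] = refl
      take-length (x ∷ L) = cong (x ∷_) (take-length L)

    length-concat : ∀ {d} {xss : List (List ℝ)} → All (λ xs → length xs ≡ d) xss → length (concat xss) ≡ length xss * d
    length-concat [] = refl
    length-concat {xss = xs ∷ _} (refl ∷ a) = trans (length-++ xs) (cong (length xs +_) (length-concat a))

    length-rows : ∀ {n d} (𝒳 : Dataset n d) → length (concat (rows 𝒳)) ≡ n * d
    length-rows {n} {d} 𝒳 = trans (length-concat (Allₚ.tabulate⁺ λ i → length-tabulate (point 𝒳 i))) (cong (_* d) (length-tabulate λ i → toList (point 𝒳 i)))

    nothing-beyond : ∀ (n d a : ℕ) → 2 ≤ a → fromMaybe 0 (List.head (drop a (n ∷ d ∷ []))) ≡ 0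
    nothing-beyond n d (suc (suc zero)) _ = refl
    nothing-beyond n d (suc (suc (suc a))) _ = refl
    nothing-beyond n d (suc zero) (s≤s ())

    scale : ∀ {a b x y} → fromℕ a ≤ᵣ x → fromℕ b ≤ᵣ y → fromℕ (a * b) ≤ᵣ x *ᵣ y
    scale {a} {b} p q = subst (_≤ᵣ _) (sym (fromℕ-* a b)) (*ᵣ-mono (0≤fromℕ b) (≤ᵣ-trans (0≤fromℕ a) p) p q)

    -- 67 collects the prelude and the postlude, and 246 = 1 + 245 the fold steps, each charged with
    -- the weight `W`. 54 = 6 · 3 · 3 comes from absorbing a logarithm, from q ≤ 3 / ρ and from b +
    -- 2 ≤ 3 lg n. The value is large enough for sparsity and β as well.
    constant : ℕ → ℕ
    constant W = (67 + 246 * W) * 54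

    72≤constant : ∀ W → 72 ≤ constant W
    72≤constant W = ℕ.≤-trans (ℕ.m≤m+n 72 3546) (ℕ.*-monoˡ-≤ 54 (ℕ.m≤m+n 67 (246 * W)))

    -- This is β. It has to depend on d and ρ alone, whereas p depends on n through the cap; so p is
    -- replaced by a bound in ρ, using 2 (2 k + 1) ≤ 4 (2 + K d) q and q ≤ 3 / ρ.
    factor : ℕ → ℝ → ℝ
    factor d ρ = fromℕ (12 * (2 + K d)) *ᵣ ρ ⁻¹

    factor>0 : ∀ d {ρ} → 0ℝ <ᵣ ρ → 0ℝ <ᵣ factor d ρ
    factor>0 d 0<ρ = *-pos (0<fromℕ (ℕ.pred (12 * (2 + K d)))) (⁻¹-pos 0<ρ)

    factor≤ : ∀ d {ρ} W → 0 < d → 0ℝ <ᵣ ρ → factor d ρ ≤ᵣ fromℕ (constant W) *ᵣ (ρ ⁻¹ *ᵣ lg (lg (fromℕ d)))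
    factor≤ d {ρ} W d>0 0<ρ = ≤ᵣ-trans (*ᵣ-monoˡ i≥0 (scale {12} {2 + K d} ≤ᵣ-refl (K-bound d d>0)))
        (≤ᵣ-trans (≤ᵣ-reflexive (trans (arith (fromℕ 12) (fromℕ 6) Y (ρ ⁻¹)) (cong (_*ᵣ (ρ ⁻¹ *ᵣ Y)) (sym (fromℕ-* 12 6)))))
          (*ᵣ-monoˡ (*-nonNegative i≥0 (≤ᵣ-trans 0≤1 (1≤lg _))) (fromℕ-mono {72} {constant W} (72≤constant W))))
      where
      Y = lg (lg (fromℕ d))
      i≥0 = proj₁ (⁻¹-pos 0<ρ)
      arith : ∀ a b y i → a *ᵣ (b *ᵣ y) *ᵣ i ≡ (a *ᵣ b) *ᵣ (i *ᵣ y)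
      arith = RealSolver.solve 4 (λ a b y i → a :* (b :* y) :* i := (a :* b) :* (i :* y)) refl
        where open RealSolver using (_:*_; _:=_)

    module _ {n d : ℕ} {𝒳 : Dataset n d} {ρ Δ : ℝ} {env : Env (list num ∷ list num ∷ list num ∷ num ∷ num ∷ [])} (n>0 : 0 < n) (d>0 : 0 < d) (0<ρ : 0ℝ <ᵣ ρ) (ρ<1 : ρ <ᵣ 1ℝ) (0<Δ : 0ℝ <ᵣ Δ) (S : Solved 𝒳 ρ Δ env) where
      private
        module S = Solved S
        2≤q : 2 ≤ S.q
        2≤q = ℕ.≤-trans (ℕ.n≤1+n 2) S.q≥3
        module E = Exponent n>0 0<ρ ρ<1 2≤q {S.l} {S.b} S.l>0 S.l≤ S.b≤
        i = ρ ⁻¹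
        Λ = lg (fromℕ n)
        i≥0 : 0ℝ ≤ᵣ i
        i≥0 = proj₁ (⁻¹-pos 0<ρ)
        Λ≥0 : 0ℝ ≤ᵣ Λ
        Λ≥0 = ≤ᵣ-trans 0≤1 (1≤lg _)
        suc-p : suc S.p ≡ S.q
        suc-p = ℕ.suc-pred S.q {{ℕ.>-nonZero (ℕ.≤-trans (s≤s z≤n) S.q≥3)}}

        -- q ρ = p ρ + ρ ≤ 2 + 1.
        q≤ : fromℕ S.q ≤ᵣ fromℕ 3 *ᵣ i
        q≤ = *-cancel-pos 0<ρ (subst₂ _≤ᵣ_ (cong (λ q → fromℕ q *ᵣ ρ) suc-p) (sym (trans (*ᵣ-assoc _ i ρ) (trans (cong (fromℕ 3 *ᵣ_) (⁻¹-inverseˡ 0<ρ)) (*ᵣ-identityʳ _))))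
          (subst (_≤ᵣ fromℕ 3) (sym (*ᵣ-distribʳ ρ 1ℝ (fromℕ S.p))) (+ᵣ-mono (≤ᵣ-trans (≤ᵣ-reflexive (*ᵣ-identityˡ ρ)) (proj₁ ρ<1)) S.pρ≤2)))

        b≤ : fromℕ (2 + S.b) ≤ᵣ fromℕ 3 *ᵣ Λ
        b≤ = subst₂ _≤ᵣ_ (sym (fromℕ-+ 2 S.b)) (trans (sym (*ᵣ-distribʳ Λ (fromℕ 2) (fromℕ 1))) (cong (_*ᵣ Λ) (sym (fromℕ-+ 2 1))))
          (+ᵣ-mono (subst (_≤ᵣ fromℕ 2 *ᵣ Λ) (*ᵣ-identityʳ _) (*ᵣ-mono 0≤1 (0≤fromℕ 2) ≤ᵣ-refl (1≤lg _)))
            (≤ᵣ-trans (lg-fromℕ {n} {S.b} n>0 S.b≤) (≤ᵣ-reflexive (trans (sym (*ᵣ-identityˡ Λ)) (cong (_*ᵣ Λ) (sym fromℕ-1))))))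

      covered≤ : ∀ j → Any (λ R → ∀ {z} → B∞ (point 𝒳 j) (Δ /ᵣ factor d ρ) z → z ∈R R) S.ℛ
      covered≤ = S.covered (≤ᵣ-trans (subst₂ _≤ᵣ_ (*ᵣ-comm _ δ) (*ᵣ-comm _ δ) (*ᵣ-monoˡ (proj₁ δ>0) (≤ᵣ-trans (fromℕ-mono {2 * (2 * ((2 + K d) * S.p) + 1)} {4 * (2 + K d) * S.q} small)
          (≤ᵣ-trans (scale {4 * (2 + K d)} {S.q} ≤ᵣ-refl q≤) (≤ᵣ-reflexive triple))))) (≤ᵣ-reflexive (/-* (factor>0 d 0<ρ))))
        where
        δ = Δ /ᵣ factor d ρ
        δ>0 : 0ℝ <ᵣ δ
        δ>0 = *-pos 0<Δ (⁻¹-pos (factor>0 d 0<ρ))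
        triple : fromℕ (4 * (2 + K d)) *ᵣ (fromℕ 3 *ᵣ i) ≡ factor d ρ
        triple = trans (sym (*ᵣ-assoc _ (fromℕ 3) i)) (cong (_*ᵣ i) (trans (sym (fromℕ-* (4 * (2 + K d)) 3)) (cong fromℕ (arith (2 + K d)))))
          where
          arith : ∀ k → 4 * k * 3 ≡ 12 * k
          arith = solve-∀
        small : 2 * (2 * ((2 + K d) * S.p) + 1) ≤ 4 * (2 + K d) * S.q
        small = ℕ.≤-trans (ℕ.m≤m+n _ (6 + 4 * K d)) (ℕ.≤-reflexive (trans (arith (K d) S.p) (cong (4 * (2 + K d) *_) suc-p)))
          where
          arith : ∀ k p → 2 * (2 * ((2 + k) * p) + 1) + (6 + 4 * k) ≡ 4 * (2 + k) * suc p
          arith = solve-∀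

      -- At most 8 q y rounds take place, where q ≤ 3 / ρ and y ≤ n ^ ρ.
      sparse≤ : ∀ W z → fromℕ (length (filter (z ∈R?_) S.ℛ)) ≤ᵣ fromℕ (constant W) *ᵣ (pow (fromℕ n) ρ *ᵣ i *ᵣ Λ)
      sparse≤ W z = ≤ᵣ-trans (fromℕ-mono {length (filter (z ∈R?_) S.ℛ)} {8 * (S.q * E.y) * 1} (ℕ.≤-trans (S.sparse z) (ℕ.≤-trans E.rounds≤ (ℕ.≤-reflexive (sym (ℕ.*-identityʳ _))))))
          (≤ᵣ-trans (scale {8 * (S.q * E.y)} {1} (scale {8} {S.q * E.y} ≤ᵣ-refl (scale {S.q} {E.y} q≤ E.y≤pow)) (subst (_≤ᵣ Λ) (sym fromℕ-1) (1≤lg _)))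
          (≤ᵣ-trans (≤ᵣ-reflexive (trans (arith (fromℕ 8) (fromℕ 3) i (pow (fromℕ n) ρ) Λ) (cong (_*ᵣ (pow (fromℕ n) ρ *ᵣ i *ᵣ Λ)) (sym (fromℕ-* 8 3)))))
            (*ᵣ-monoˡ (*-nonNegative (*-nonNegative (≤ᵣ-trans (0≤fromℕ E.y) E.y≤pow) i≥0) Λ≥0) (fromℕ-mono {24} {constant W} (ℕ.≤-trans (ℕ.m≤m+n 24 48) (72≤constant W))))))
        where
        arith : ∀ a b i P l → a *ᵣ (b *ᵣ i *ᵣ P) *ᵣ l ≡ (a *ᵣ b) *ᵣ (P *ᵣ i *ᵣ l)
        arith = RealSolver.solve 5 (λ a b i P l → a :* (b :* i :* P) :* l := (a :* b) :* (P :* i :* l)) refl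
          where open RealSolver using (_:*_; _:=_)

      time≤ : ∀ W {t m e} → t ≤ 22 + 11 * n + 7 * (n * d) + 7 * d + W * suc (iters mainE env) + (4 * m + 8 * e) → m ≤ n → e ≡ m * (2 * d) →
        fromℕ t ≤ᵣ fromℕ (constant W) *ᵣ (pow (fromℕ n) (1ℝ +ᵣ ρ) *ᵣ i *ᵣ fromℕ d ^ᵣ 2 *ᵣ Λ)
      time≤ W {t} {m} {e} t≤ m≤ refl = ≤ᵣ-trans (fromℕ-mono {t} {c * (6 * (n * E.y * S.q * (d * d) * (2 + S.b)))} total)
          (≤ᵣ-trans (scale {c} {6 * (n * E.y * S.q * (d * d) * (2 + S.b))} ≤ᵣ-refl (scale {6} {n * E.y * S.q * (d * d) * (2 + S.b)} ≤ᵣ-refl (scale {n * E.y * S.q * (d * d)} {2 + S.b} (scale {n * E.y * S.q} {d * d} (scale {n * E.y} {S.q} E.ny≤pow q≤) square) b≤)))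
          (≤ᵣ-reflexive (trans (arith (fromℕ c) (fromℕ 6) (fromℕ 3) (pow (fromℕ n) (1ℝ +ᵣ ρ)) i (fromℕ d ^ᵣ 2) Λ) (cong (_*ᵣ (pow (fromℕ n) (1ℝ +ᵣ ρ) *ᵣ i *ᵣ fromℕ d ^ᵣ 2 *ᵣ Λ))
            (sym (trans (fromℕ-* c 54) (cong (fromℕ c *ᵣ_) (trans (fromℕ-* 6 9) (cong (fromℕ 6 *ᵣ_) (fromℕ-* 3 3))))))))))
        where
        c = 67 + 246 * W
        open Budget n d S.q S.p (suc S.l) S.b ((2 + K d) * S.p) n>0 d>0 suc-p (s≤s z≤n) refl
        square : fromℕ (d * d) ≤ᵣ fromℕ d ^ᵣ 2
        square = ≤ᵣ-reflexive (trans (fromℕ-* d d) (cong (fromℕ d *ᵣ_) (sym (*ᵣ-identityʳ _))))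
        arith : ∀ c s t P i D l → c *ᵣ (s *ᵣ (P *ᵣ (t *ᵣ i) *ᵣ D *ᵣ (t *ᵣ l))) ≡ (c *ᵣ (s *ᵣ (t *ᵣ t))) *ᵣ (P *ᵣ i *ᵣ D *ᵣ l)
        arith = RealSolver.solve 7 (λ c s t P i D l → c :* (s :* (P :* (t :* i) :* D :* (t :* l))) := (c :* (s :* (t :* t))) :* (P :* i :* D :* l)) refl
          where open RealSolver using (_:*_; _:=_)
        -- Of the two factors in `V`, the sum 2 + b + q is absorbed together with the root into q y,
        -- and 2 + b remains as the logarithm of the bound.
        G≤ : G ≤ 6 * (n * E.y * S.q * (d * d) * (2 + S.b))
        G≤ = ℕ.≤-trans (ℕ.≤-reflexive (arith₁ n (suc S.l) (d * d) (2 + S.b) (2 + S.b + S.q))) (ℕ.≤-trans (ℕ.*-monoʳ-≤ (n * (d * d) * (2 + S.b)) E.work≤) (ℕ.≤-reflexive (arith₂ n (d * d) (2 + S.b) S.q E.y)))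
          where
          arith₁ : ∀ n l D v u → n * l * D * (v * u) ≡ n * D * v * (l * u)
          arith₁ = solve-∀
          arith₂ : ∀ n D v q y → n * D * v * (6 * (q * y)) ≡ 6 * (n * y * q * D * v)
          arith₂ = solve-∀
        total : t ≤ c * (6 * (n * E.y * S.q * (d * d) * (2 + S.b)))
        total = begin
          t ≤⟨ t≤ ⟩
          22 + 11 * n + 7 * (n * d) + 7 * d + W * suc (iters mainE env) + (4 * m + 8 * (m * (2 * d)))
            ≤⟨ ℕ.+-mono-≤ (ℕ.+-mono-≤ (ℕ.+-mono-≤ (ℕ.+-mono-≤ (ℕ.+-mono-≤ (ℕ.*-monoʳ-≤ 22 1≤G) (ℕ.*-monoʳ-≤ 11 n≤G)) (ℕ.*-monoʳ-≤ 7 nd≤G)) (ℕ.*-monoʳ-≤ 7 d≤G)) (ℕ.*-monoʳ-≤ W (ℕ.+-mono-≤ 1≤G S.cost)))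
                 (ℕ.+-mono-≤ (ℕ.*-monoʳ-≤ 4 (ℕ.≤-trans m≤ n≤G)) (ℕ.≤-trans (ℕ.*-monoʳ-≤ 8 (ℕ.*-monoˡ-≤ (2 * d) m≤)) (ℕ.≤-trans (ℕ.≤-reflexive (arith₃ n d)) (ℕ.*-monoʳ-≤ 16 nd≤G)))) ⟩
          22 * G + 11 * G + 7 * G + 7 * G + W * (G + 245 * G) + (4 * G + 16 * G) ≡⟨ arith₄ G W ⟩
          c * G ≤⟨ ℕ.*-monoʳ-≤ c G≤ ⟩
          c * (6 * (n * E.y * S.q * (d * d) * (2 + S.b))) ∎
          where
          open ℕ.≤-Reasoning
          arith₃ : ∀ n d → 8 * (n * (2 * d)) ≡ 16 * (n * d)
          arith₃ = solve-∀
          arith₄ : ∀ G W → 22 * G + 11 * G + 7 * G + 7 * G + W * (G + 245 * G) + (4 * G + 16 * G) ≡ (67 + 246 * W) * G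
          arith₄ = solve-∀

open Construction using (mainE; weight; program; module OrderedField; module Geometry; module Solving; module Run; module Finish; module Bounds)

theorem2p3 : (𝓡 : RealNumbers) → let open RealNumbers 𝓡 in let open RealRAM 𝓡 in let open ℓ∞ 𝓡 in
    Σ[ algorithm ∈ Program ] Σ[ K ∈ ℝ ] Σ[ s ∈ (ℕ → ℝ → ℝ) ] Σ[ β ∈ (ℕ → ℝ → ℝ) ]
      (∀ n d .{{_ : NonZero n}} .{{_ : NonZero d}} (ρ : ℝ) → 0ℝ < ρ → ρ < 1ℝ →
        (s n ρ ≤ K * (pow (fromℕ n) ρ * ρ ⁻¹ * lg (fromℕ n))) ×
        (0ℝ < β d ρ) × (β d ρ ≤ K * (ρ ⁻¹ * lg (lg (fromℕ d)))) ×
        ((X : Dataset n d) (Δ : ℝ) → 0ℝ < Δ →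
          ∃[ σ ] ∃[ t ] Σ[ ℛ ∈ List (Rectangle d) ]
            ⟨ algorithm , input X Δ ρ ⟩⇓⟨ σ , t ⟩ ×
            (fromℕ t ≤ K * (pow (fromℕ n) (1ℝ + ρ) * ρ ⁻¹ * fromℕ d ^ 2 * lg (fromℕ n))) ×
            Outputs σ ℛ ×
            All (λ R → width R ≤ Δ) ℛ ×
            (∀ i → Any (λ R → B∞ (point X i) (Δ / β d ρ) ⊆ (_∈R R)) ℛ) ×
            (∀ i → fromℕ (length (filter (point X i ∈R?_) ℛ)) ≤ s n ρ) ×
            IsNeighborhoodCover X (β d ρ) (s n ρ) Δ (clusters X ℛ)))
theorem2p3 𝓡 = program , fromℕ (constant W) , (λ n ρ → fromℕ (constant W) * (pow (fromℕ n) ρ * ρ ⁻¹ * lg (fromℕ n))) , factor ,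
    λ n d ρ 0<ρ ρ<1 → ≤ᵣ-refl , factor>0 d 0<ρ , factor≤ d W (>-nonZero⁻¹ d) 0<ρ , cover n d 0<ρ ρ<1 (>-nonZero⁻¹ n) (>-nonZero⁻¹ d)
  where
  open RealNumbers 𝓡
  open RealRAM 𝓡
  open ℓ∞ 𝓡
  open OrderedField 𝓡 using (≤ᵣ-refl)
  open Geometry 𝓡
  open Solving 𝓡
  open Run 𝓡 using (length-copies)
  open Finish 𝓡
  open Bounds 𝓡

  W : ℕ
  W = weight mainE

  cover : ∀ n d {ρ} → 0ℝ < ρ → ρ < 1ℝ → 0 ℕ.< n → 0 ℕ.< d → (X : Dataset n d) (Δ : ℝ) → 0ℝ < Δ → ∃[ σ ] ∃[ t ] Σ[ ℛ ∈ List (Rectangle d) ]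
    ⟨ program , input X Δ ρ ⟩⇓⟨ σ , t ⟩ × (fromℕ t ≤ fromℕ (constant W) * (pow (fromℕ n) (1ℝ + ρ) * ρ ⁻¹ * fromℕ d ^ 2 * lg (fromℕ n))) ×
    Outputs σ ℛ × All (λ R → width R ≤ Δ) ℛ × (∀ i → Any (λ R → B∞ (point X i) (Δ / factor d ρ) ⊆ (_∈R R)) ℛ) ×
    (∀ i → fromℕ (length (filter (point X i ∈R?_) ℛ)) ≤ fromℕ (constant W) * (pow (fromℕ n) ρ * ρ ⁻¹ * lg (fromℕ n))) ×
    IsNeighborhoodCover X (factor d ρ) (fromℕ (constant W) * (pow (fromℕ n) ρ * ρ ⁻¹ * lg (fromℕ n))) Δ (clusters X ℛ)
  cover n d {ρ} 0<ρ ρ<1 n>0 d>0 X Δ 0<Δ = F.τ , F.t , S.ℛ , F.run₁ , time≤ n>0 d>0 0<ρ ρ<1 0<Δ solved W F.t≤ S.markers≤ S.ends≡ ,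
      S.outputs F.count F.bases F.value , All.map (λ {R} → width≤ {R = R} (proj₁ 0<Δ)) S.lens , covered ,
      sparse , neighborhood-cover X (proj₁ 0<Δ) S.ℛ S.lens covered sparse
    where
    σ = input X Δ ρ
    module F = Finished (finished σ (real σ) n d refl refl (nothing-beyond n d) (λ _ → refl))
    -- Both unary lists are filled with Δ, the first real of the input; the third list holds all
    -- coordinates, point after point.
    solved = solve X _ _ _ (trans (length-copies Δ n) (+-identityʳ n)) (trans (length-copies Δ d) (+-identityʳ d))
      (range-all (concat (rows X)) (λ _ → refl) (length-rows X)) n>0 d>0 0<ρ ρ<1 0<Δ
    module S = Solved solved
    covered = covered≤ n>0 d>0 0<ρ ρ<1 0<Δ solved
    sparse = λ i → sparse≤ n>0 d>0 0<ρ ρ<1 0<Δ solved W (point X i)
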